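{- Let $p=5m+3$ be a prime with $m\ge\max\{5T(1/5),21\}$, let $n\ge1$, and let $(k,\ell)=(4,1)$ or $(3,2)$. If $A\subset\mathbb F_p^n$ is a nontrivial $(k,\ell)$-sum-free set with $|A|\ge mp^{n-1}$, then $A$ is either normal or of type 3 or of type 4.
   Context: Here $k+\ell=5$ and $p=(k+\ell)m+2+\lambda$ with $\lambda=1$. For a set $X$ in an abelian group and $h\ge1$, $hX=\{x_1+\dots+x_h:x_i\in X\}$. A nonempty $A\subseteq\mathbb F_p^n$ is $(k,\ell)$-sum-free if $kA\cap\ell A=\emptyset$. Subsets of $\mathbb F_p^n$ are isomorphic if an automorphism of the additive group $\mathbb F_p^n$ maps one onto the other. For $a,b\in\mathbb F_p$, $[a,b]=\{a,a+1,\dots,b\}\subseteq\mathbb F_p$ (cyclic interval). With $\lambda=1$, the only extremal cuboid is $A_{k,\ell,p,0}=[a_0,a_0+m]\times\mathbb F_p^{n-1}$, $a_0=-(km+1)(k-\ell)^{ -1}\in\mathbb F_p$; a $(k,\ell)$-sum-free set is trivial if it is isomorphic to a subset of $A_{k,\ell,p,0}$, nontrivial otherwise. Types (for $A\subseteq\mathbb F_p^n$ with $|A|=mp^{n-1}$): type 1: $A$ is isomorphic to $[a,a+m-1]\times\mathbb F_p^{n-1}$ for some $a\in\mathbb F_p$ with $\ell a-k(a+m-1)\in[1,\ell]$ or $\in[\lambda+\ell+2,k]$ (latter only when $\lambda+\ell+2\le k$). Type 2: $\ell=1$, $n\ge2$, and $A$ is isomorphic to $(\{a\}\times(\mathbb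 F_p^{n-1}\setminus V))\sqcup([a+1,a+m-1]\times\mathbb F_p^{n-1})\sqcup(\{a+m\}\times V)$ with $a=mk(\ell-k)^{ -1}$ and $V$ a proper subspace of $\mathbb F_p^{n-1}$. Normal means type 1 or type 2. Type 3: with $a=(\ell m+k-1)(k-\ell)^{ -1}\in\mathbb F_p$, $A$ is isomorphic to $([a-1,a+m]\setminus\{a,a+m-1\})\times\mathbb F_p^{n-1}$. Type 4: $n\ge2$ and there is a proper subspace $V\subset\mathbb F_p^{n-1}$ such that $A$ is isomorphic to $(\{2m+1,3m+2\}\times V)\sqcup(\{2m+2,3m+1\}\times(\mathbb F_p^{n-1}\setminus V))\sqcup([2m+3,3m]\times\mathbb F_p^{n-1})$. The function $T$: a finite $X\subseteq\mathbb F_p$ has the covering property if it is contained in an arithmetic progression of length $|X+X|-|X|+1$. For $c\in(0,1)$, $\tau\in(0,1]$ is feasible for $c$ if (for every prime $p$) every $X\subseteq\mathbb F_p$ with $|X|\le cp$ and $|X+X|\le(2+\tau)|X|-3$ has the covering property; $\tau(c)$ is the supremum of feasible $\tau$ and $T(c)=1/\tau(c)$. -}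

module Defs where

open import Data.Nat using (ℕ; zero; suc; _+_; _*_; _∸_; _≤_; _<_; _≤ᵇ_; NonZero; _%_)
open import Data.Nat.DivMod using (m%n<n)
open import Data.Bool using (Bool; true; false; _∧_; _∨_; not; if_then_else_)
open import Data.Fin using (Fin; toℕ; fromℕ<; _≟_)
open import Data.Vec using (Vec; []; _∷_; zipWith; map; replicate)
open import Data.Vec.Relation.Unary.All using (All)
open import Data.Bool.ListAction using (any)
open import Data.List using (List; concatMap; allFin) renaming ([] to []ˡ; _∷_ to _∷ˡ_; map to mapˡ)
open import Data.Product using (Σ; ∃; _×_; _,_)
open import Data.Sum using (_⊎_)
open import Relation.Nullary using (¬_; does)
open import Relation.Binary.PropositionalEquality using (_≡_)

count : {A : Set} → (A → Bool) → List A → ℕ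
count P []ˡ = 0
count P (x ∷ˡ xs) = if P x then suc (count P xs) else count P xs

module _ (p : ℕ) .{{_ : NonZero p}} where

  Fp : Set
  Fp = Fin p

  ⟦_⟧ : ℕ → Fp
  ⟦ x ⟧ = fromℕ< (m%n<n x p)

  _+ₚ_ : Fp → Fp → Fp
  x +ₚ y = ⟦ toℕ x + toℕ y ⟧

  _*ₚ_ : Fp → Fp → Fp
  x *ₚ y = ⟦ toℕ x * toℕ y ⟧

  negₚ : Fp → Fp
  negₚ x = ⟦ p ∸ toℕ x ⟧

  _-ₚ_ : Fp → Fp → Fp
  x -ₚ y = x +ₚ negₚ y

  powₚ : Fp → ℕ → Fp
  powₚ x zero = ⟦ 1 ⟧
  powₚ x (suc e) = x *ₚ powₚ x e

  -- multiplicative inverse x^(p-2) (Fermat); the inverse of x ≠ 0 when p is prime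
  invₚ : Fp → Fp
  invₚ x = powₚ x (p ∸ 2)

  _==_ : Fp → Fp → Bool
  x == y = does (x ≟ y)

  -- cyclic interval [a,b] = {a, a+1, ..., b} ⊆ F_p, as a Boolean predicate
  interval : Fp → Fp → Fp → Bool
  interval a b x = toℕ (x -ₚ a) ≤ᵇ toℕ (b -ₚ a)

  Vp : ℕ → Set
  Vp n = Vec Fp n

  _⊕_ : ∀ {n} → Vp n → Vp n → Vp n
  _⊕_ = zipWith _+ₚ_

  _·_ : ∀ {n} → Fp → Vp n → Vp n
  c · v = map (c *ₚ_) v

  0v : ∀ {n} → Vp n
  0v = replicate _ ⟦ 0 ⟧

  allVecs : ∀ n → List (Vp n)
  allVecs zero = [] ∷ˡ []ˡ
  allVecs (suc n) = concatMap (λ x → mapˡ (x ∷_) (allVecs n)) (allFin p)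

  Subset : ℕ → Set
  Subset n = Vp n → Bool

  card : ∀ {n} → Subset n → ℕ
  card {n} A = count A (allVecs n)

  full : ∀ {n} → Subset n
  full _ = true

  vsum : ∀ {n h} → Vec (Vp n) h → Vp n
  vsum [] = 0v
  vsum (x ∷ xs) = x ⊕ vsum xs

  SumFree : ∀ {n} → ℕ → ℕ → Subset n → Set
  SumFree {n} k ℓ A =
    (∃ λ x → A x ≡ true) ×
    ¬ (Σ (Vec (Vp n) k) λ xs → Σ (Vec (Vp n) ℓ) λ ys →
         All (λ x → A x ≡ true) xs × All (λ y → A y ≡ true) ys × vsum xs ≡ vsum ys)

  record Aut (n : ℕ) : Set where
    field
      f : Vp n → Vp n
      g : Vp n → Vp n
      f-hom : ∀ x y → f (x ⊕ y) ≡ f x ⊕ f y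
      gf : ∀ x → g (f x) ≡ x
      fg : ∀ y → f (g y) ≡ y

  Iso : ∀ {n} → Subset n → Subset n → Set
  Iso {n} A B = Σ (Aut n) λ φ → ∀ x → A x ≡ B (Aut.f φ x)

  _⊆_ : ∀ {n} → Subset n → Subset n → Set
  A ⊆ B = ∀ x → A x ≡ true → B x ≡ true

  _⊠_ : ∀ {d} → (Fp → Bool) → Subset d → Subset (suc d)
  (S ⊠ W) (x ∷ xs) = S x ∧ W xs

  ProperSubspace : ∀ {d} → Subset d → Set
  ProperSubspace V =
    (V 0v ≡ true) ×
    (∀ x y → V x ≡ true → V y ≡ true → V (x ⊕ y) ≡ true) ×
    (∀ c x → V x ≡ true → V (c · x) ≡ true) ×
    (∃ λ x → V x ≡ false)

  -- The parameters: λ = 1, k, ℓ, m;  all n = suc d ≥ 1.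

  a₀ : ℕ → ℕ → ℕ → Fp
  a₀ k ℓ m = negₚ ⟦ k * m + 1 ⟧ *ₚ invₚ (⟦ k ⟧ -ₚ ⟦ ℓ ⟧)

  A₀ : ∀ {d} → ℕ → ℕ → ℕ → Subset (suc d)
  A₀ k ℓ m = interval (a₀ k ℓ m) (a₀ k ℓ m +ₚ ⟦ m ⟧) ⊠ full

  Trivial : ∀ {d} → ℕ → ℕ → ℕ → Subset (suc d) → Set
  Trivial {d} k ℓ m A = Σ (Subset (suc d)) λ B → (B ⊆ A₀ k ℓ m) × Iso A B

  Type1 : ∀ {d} → ℕ → ℕ → ℕ → Subset (suc d) → Set
  Type1 {d} k ℓ m A = Σ Fp λ a →
    let e = (⟦ ℓ ⟧ *ₚ a) -ₚ (⟦ k ⟧ *ₚ (a +ₚ ⟦ m ∸ 1 ⟧)) in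
    ((interval ⟦ 1 ⟧ ⟦ ℓ ⟧ e ≡ true) ⊎
     ((1 + ℓ + 2 ≤ k) × (interval ⟦ 1 + ℓ + 2 ⟧ ⟦ k ⟧ e ≡ true))) ×
    Iso A (interval a (a +ₚ ⟦ m ∸ 1 ⟧) ⊠ full)

  type2Set : ∀ {d} → Fp → ℕ → Subset d → Subset (suc d)
  type2Set a m V (x ∷ xs) =
    ((x == a) ∧ not (V xs)) ∨
    interval (a +ₚ ⟦ 1 ⟧) (a +ₚ ⟦ m ∸ 1 ⟧) x ∨
    ((x == (a +ₚ ⟦ m ⟧)) ∧ V xs)

  Type2 : ∀ {d} → ℕ → ℕ → ℕ → Subset (suc d) → Set
  Type2 {d} k ℓ m A =
    (ℓ ≡ 1) × (1 ≤ d) ×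
    Σ (Subset d) λ V → ProperSubspace V ×
      Iso A (type2Set (⟦ m * k ⟧ *ₚ invₚ (⟦ ℓ ⟧ -ₚ ⟦ k ⟧)) m V)

  Normal : ∀ {d} → ℕ → ℕ → ℕ → Subset (suc d) → Set
  Normal k ℓ m A = Type1 k ℓ m A ⊎ Type2 k ℓ m A

  type3Set : ∀ {d} → Fp → ℕ → Subset (suc d)
  type3Set a m =
    (λ x → interval (a -ₚ ⟦ 1 ⟧) (a +ₚ ⟦ m ⟧) x ∧ not (x == a) ∧ not (x == (a +ₚ ⟦ m ∸ 1 ⟧)))
    ⊠ full

  Type3 : ∀ {d} → ℕ → ℕ → ℕ → Subset (suc d) → Set
  Type3 k ℓ m A =
    Iso A (type3Set (⟦ ℓ * m + k ∸ 1 ⟧ *ₚ invₚ (⟦ k ⟧ -ₚ ⟦ ℓ ⟧)) m)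

  type4Set : ∀ {d} → ℕ → Subset d → Subset (suc d)
  type4Set m V (x ∷ xs) =
    (((x == ⟦ 2 * m + 1 ⟧) ∨ (x == ⟦ 3 * m + 2 ⟧)) ∧ V xs) ∨
    (((x == ⟦ 2 * m + 2 ⟧) ∨ (x == ⟦ 3 * m + 1 ⟧)) ∧ not (V xs)) ∨
    interval ⟦ 2 * m + 3 ⟧ ⟦ 3 * m ⟧ x

  Type4 : ∀ {d} → ℕ → Subset (suc d) → Set
  Type4 {d} m A =
    (1 ≤ d) × Σ (Subset d) λ V → ProperSubspace V × Iso A (type4Set m V)

-- The function T, via feasibility (c = cn/cd, τ = tn/td rational)

module _ (q : ℕ) .{{_ : NonZero q}} where

  cardF : (Fin q → Bool) → ℕ
  cardF X = count X (allFin q)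

  sumsetF : (Fin q → Bool) → (Fin q → Bool)
  sumsetF X z = any (λ x → X x ∧ X (_-ₚ_ q z x)) (allFin q)

  Covering : (Fin q → Bool) → Set
  Covering X = Σ (Fin q) λ a → Σ (Fin q) λ δ → ∀ x → X x ≡ true →
    ∃ λ i → (i < cardF (sumsetF X) ∸ cardF X + 1) × (x ≡ _+ₚ_ q a (_*ₚ_ q (⟦_⟧ q i) δ))

open import Data.Nat.Primality using (Prime)

-- τ = tn/td is feasible for c = cn/cd
Feasible : ℕ → ℕ → ℕ → ℕ → Set
Feasible cn cd tn td =
  (0 < tn) × (tn ≤ td) ×
  (∀ q .{{_ : NonZero q}} → Prime q → (X : Fin q → Bool) →
     cd * cardF q X ≤ cn * q →
     td * cardF q (sumsetF q X) + 3 * td ≤ (2 * td + tn) * cardF q X →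
     Covering q X)

-- m ≥ 5 T(1/5)  ⇔  5/m ≤ τ(1/5)  ⇔  every rational τ ∈ (0,1] with τ < 5/m is feasible for 1/5
MBoundT : ℕ → Set
MBoundT m = ∀ tn td → 0 < tn → tn ≤ td → tn * m < 5 * td → Feasible 1 5 tn td

{-# OPTIONS --safe #-}

-- Both notions of sum-freeness read x + σ(a + b) ≠ c + d with a sign σ. By averaging, some line
-- through 0 contains at least m points of A; Cauchy–Davenport, Vosper's theorem and the bound on
-- T place m of them among m + 2 consecutive multiples of a vector, which an automorphism turns
-- into the first basis vector. Each slice of A in this direction then lies in m + 3 consecutive
-- points, and the slices of 2A contain arcs of length 2m − 1. By sum-freeness these arcs avoid
-- each other, so their positions form a homomorphism up to a bounded error, hence are close to
-- a true homomorphism; shearing by it confines A to m + 6 consecutive parallel hyperplanes.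
-- With N = pⁿ⁻¹, sum-freeness bounds the sizes of two fibres over suitable hyperplanes by N in
-- total. As |A| ≥ mN, this leaves at most m + 2 hyperplanes in a few possible positions, with all
-- fibres full except for at most two complementary pairs at the ends, which are cosets of one
-- subspace and their complements.

module Submission where

open import Data.Nat using (ℕ; NonZero)
import Data.Nat as ℕ
open import Data.Nat.Primality using (Prime)
open import Relation.Binary.PropositionalEquality using (_≡_)


-- For m points X on a line, X + σ2X misses 2X. As p = 5m + 3, |2X| ≥ 2m + 2 leaves no slack in
-- Cauchy-Davenport and Vosper applies; otherwise |2X| ≤ 2m + 1 = (2 + 4/m)m - 3, and 4/m < 5/m is
-- feasible for 1/5. Disjoint arcs of length 2m - 1 start between 2m - 1 and 3m + 4 apart. A slice
-- of n points narrows this freedom to m + 6 - n, and two slices with 2m points in total leave an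
-- additive error of at most 12. Since m ≥ 21 gives p ≥ 108, such errors lift to ℤ without
-- ambiguity. Let M + 1 = m + e be the number of hyperplanes. Placing three of the five summands on
-- the two end hyperplanes gives translations γ + tM, 0 ≤ t ≤ 3, along which fibres compete for
-- room. None of them can have size at most M - e, which leaves 7 - 3e values of γ. So e ≤ 2;
-- outside the extremal cuboid, e = 0 gives m full hyperplanes, e = 1 one complementary pair, e = 2
-- two. Negation reverses the list of values of γ and so saves cases.

-- A verified decision procedure for linear inequalities over ℤ and ℕ.

module LinearArithmetic where

  open import Data.Bool using (Bool; true; false; _∧_; _∨_; if_then_else_)
  open import Data.Empty using (⊥)
  open import Data.Fin using (Fin; zero; suc)
  open import Data.Integer as ℤ using (ℤ; +_; -[1+_]; +[1+_]; 0ℤ; 1ℤ)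
  import Data.Integer.Properties as ℤP
  open import Data.Integer.Tactic.RingSolver using (solve-∀)
  open import Data.List as List using (List; []; _∷_; _++_)
  open import Data.List.Relation.Unary.All as All using (All; []; _∷_)
  open import Data.List.Relation.Unary.All.Properties using (++⁺)
  open import Data.Maybe using (Maybe; just; nothing)
  open import Data.Nat as ℕ using (ℕ; zero; suc)
  open import Data.Product using (_×_; _,_)
  open import Data.Vec as Vec using (Vec; []; _∷_; lookup)
  open import Relation.Binary.PropositionalEquality

  -- Linear integer arithmetic by reflection: Fourier–Motzkin elimination, run by the type checker.

  infixr 5 _∙_
  infixl 6 _:+_ _:-_
  infixr 7 _:*_
  infix 4 _:≤_ _:<_ _:≡_
  infixr 2 _⇒_
  infix 3 ⊢_

  -- `con` is allowed at every length: it stands for zero coefficients in all remaining variables,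
  -- so constants need no padding.
  data Lin : ℕ → Set where
    con : ∀ {n} → ℤ → Lin n
    _∙_ : ∀ {n} → ℤ → Lin n → Lin (suc n)

  ⟦_⟧ˡ : ∀ {n} → Lin n → Vec ℤ n → ℤ
  ⟦ con c ⟧ˡ ρ = c
  ⟦ c ∙ l ⟧ˡ (x ∷ ρ) = c ℤ.* x ℤ.+ ⟦ l ⟧ˡ ρ

  addˡ : ∀ {n} → Lin n → Lin n → Lin n
  addˡ (con a) (con b) = con (a ℤ.+ b)
  addˡ (con a) (c ∙ l) = c ∙ addˡ (con a) l
  addˡ (c ∙ l) (con b) = c ∙ addˡ l (con b)
  addˡ (c ∙ l) (d ∙ k) = (c ℤ.+ d) ∙ addˡ l k

  scaleˡ : ∀ {n} → ℤ → Lin n → Lin n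
  scaleˡ a (con c) = con (a ℤ.* c)
  scaleˡ a (c ∙ l) = (a ℤ.* c) ∙ scaleˡ a l

  addˡ-correct : ∀ {n} (l k : Lin n) ρ → ⟦ addˡ l k ⟧ˡ ρ ≡ ⟦ l ⟧ˡ ρ ℤ.+ ⟦ k ⟧ˡ ρ
  addˡ-correct (con a) (con b) ρ = refl
  addˡ-correct (con a) (c ∙ l) (x ∷ ρ) =
    trans (cong (λ z → c ℤ.* x ℤ.+ z) (addˡ-correct (con a) l ρ)) (lemma a (c ℤ.* x) (⟦ l ⟧ˡ ρ))
    where
    lemma : ∀ a y z → y ℤ.+ (a ℤ.+ z) ≡ a ℤ.+ (y ℤ.+ z)
    lemma = solve-∀
  addˡ-correct (c ∙ l) (con b) (x ∷ ρ) =
    trans (cong (λ z → c ℤ.* x ℤ.+ z) (addˡ-correct l (con b) ρ)) (sym (ℤP.+-assoc (c ℤ.* x) _ _))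
  addˡ-correct (c ∙ l) (d ∙ k) (x ∷ ρ) =
    trans (cong (λ z → (c ℤ.+ d) ℤ.* x ℤ.+ z) (addˡ-correct l k ρ)) (lemma c d x _ _)
    where
    lemma : ∀ c d x y z → (c ℤ.+ d) ℤ.* x ℤ.+ (y ℤ.+ z) ≡ c ℤ.* x ℤ.+ y ℤ.+ (d ℤ.* x ℤ.+ z)
    lemma = solve-∀

  scaleˡ-correct : ∀ {n} a (l : Lin n) ρ → ⟦ scaleˡ a l ⟧ˡ ρ ≡ a ℤ.* ⟦ l ⟧ˡ ρ
  scaleˡ-correct a (con c) ρ = refl
  scaleˡ-correct a (c ∙ l) (x ∷ ρ) =
    trans (cong (λ z → a ℤ.* c ℤ.* x ℤ.+ z) (scaleˡ-correct a l ρ)) (lemma a c x _)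
    where
    lemma : ∀ a c x y → a ℤ.* c ℤ.* x ℤ.+ a ℤ.* y ≡ a ℤ.* (c ℤ.* x ℤ.+ y)
    lemma = solve-∀

  varˡ : ∀ {n} → Fin n → Lin n
  varˡ zero = 1ℤ ∙ con 0ℤ
  varˡ (suc i) = 0ℤ ∙ varˡ i

  varˡ-correct : ∀ {n} (i : Fin n) ρ → ⟦ varˡ i ⟧ˡ ρ ≡ lookup ρ i
  varˡ-correct zero (x ∷ ρ) = trans (ℤP.+-identityʳ _) (ℤP.*-identityˡ x)
  varˡ-correct (suc i) (x ∷ ρ) =
    trans (cong (ℤ._+ ⟦ varˡ i ⟧ˡ ρ) (ℤP.*-zeroˡ x)) (trans (ℤP.+-identityˡ _) (varˡ-correct i ρ))

  NonNeg : ∀ {n} → Vec ℤ n → Lin n → Set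
  NonNeg ρ l = 0ℤ ℤ.≤ ⟦ l ⟧ˡ ρ

  nonneg-+ : ∀ {a b} → 0ℤ ℤ.≤ a → 0ℤ ℤ.≤ b → 0ℤ ℤ.≤ a ℤ.+ b
  nonneg-+ = ℤP.+-mono-≤

  nonneg-* : ∀ i {a} → 0ℤ ℤ.≤ a → 0ℤ ℤ.≤ +[1+ i ] ℤ.* a
  nonneg-* i {a} h = subst (ℤ._≤ +[1+ i ] ℤ.* a) (ℤP.*-zeroʳ +[1+ i ]) (ℤP.*-monoˡ-≤-nonNeg +[1+ i ] h)

  record Split (n : ℕ) : Set where
    constructor splitting
    field
      free : List (Lin n)
      pos neg : List (ℕ × Lin n)

  classify : ∀ {n} → List (Lin (suc n)) → Split n
  classify [] = splitting [] [] []
  classify (con c ∷ cs) = let splitting f p q = classify cs in splitting (con c ∷ f) p q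
  classify ((+ 0 ∙ l) ∷ cs) = let splitting f p q = classify cs in splitting (l ∷ f) p q
  classify ((+[1+ a ] ∙ l) ∷ cs) = let splitting f p q = classify cs in splitting f ((a , l) ∷ p) q
  classify ((-[1+ b ] ∙ l) ∷ cs) = let splitting f p q = classify cs in splitting f p ((b , l) ∷ q)

  PosOK NegOK : ∀ {n} → ℤ → Vec ℤ n → ℕ × Lin n → Set
  PosOK x ρ (a , l) = 0ℤ ℤ.≤ +[1+ a ] ℤ.* x ℤ.+ ⟦ l ⟧ˡ ρ
  NegOK x ρ (b , l) = 0ℤ ℤ.≤ -[1+ b ] ℤ.* x ℤ.+ ⟦ l ⟧ˡ ρ

  classify-sound : ∀ {n} x (ρ : Vec ℤ n) cs → All (NonNeg (x ∷ ρ)) cs →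
    All (NonNeg ρ) (Split.free (classify cs)) ×
    All (PosOK x ρ) (Split.pos (classify cs)) × All (NegOK x ρ) (Split.neg (classify cs))
  classify-sound x ρ [] [] = [] , [] , []
  classify-sound x ρ (con c ∷ cs) (h ∷ hs) =
    let f , p , q = classify-sound x ρ cs hs in h ∷ f , p , q
  classify-sound x ρ ((+ 0 ∙ l) ∷ cs) (h ∷ hs) =
    let f , p , q = classify-sound x ρ cs hs in
    subst (0ℤ ℤ.≤_) (trans (cong (ℤ._+ ⟦ l ⟧ˡ ρ) (ℤP.*-zeroˡ x)) (ℤP.+-identityˡ _)) h ∷ f , p , q
  classify-sound x ρ ((+[1+ a ] ∙ l) ∷ cs) (h ∷ hs) =
    let f , p , q = classify-sound x ρ cs hs in f , h ∷ p , q
  classify-sound x ρ ((-[1+ b ] ∙ l) ∷ cs) (h ∷ hs) =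
    let f , p , q = classify-sound x ρ cs hs in f , p , h ∷ q

  -- Coefficients of the eliminated variable are stored as predecessors of their absolute values,
  -- hence positive; cross-multiplying by them cancels the variable and keeps the sign.
  combine : ∀ {n} → ℕ × Lin n → ℕ × Lin n → Lin n
  combine (a , l) (b , k) = addˡ (scaleˡ +[1+ b ] l) (scaleˡ +[1+ a ] k)

  combine-sound : ∀ {n} x (ρ : Vec ℤ n) u v → PosOK x ρ u → NegOK x ρ v → NonNeg ρ (combine u v)
  combine-sound x ρ (a , l) (b , k) h h′ =
    subst (0ℤ ℤ.≤_)
      (trans (lemma +[1+ a ] +[1+ b ] x (⟦ l ⟧ˡ ρ) (⟦ k ⟧ˡ ρ))
        (sym (trans (addˡ-correct (scaleˡ +[1+ b ] l) (scaleˡ +[1+ a ] k) ρ)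
          (cong₂ ℤ._+_ (scaleˡ-correct +[1+ b ] l ρ) (scaleˡ-correct +[1+ a ] k ρ)))))
      (nonneg-+ (nonneg-* b h) (nonneg-* a h′))
    where
    lemma : ∀ A B x y z → B ℤ.* (A ℤ.* x ℤ.+ y) ℤ.+ A ℤ.* (ℤ.- B ℤ.* x ℤ.+ z) ≡ B ℤ.* y ℤ.+ A ℤ.* z
    lemma = solve-∀

  combineAll : ∀ {n} → List (ℕ × Lin n) → List (ℕ × Lin n) → List (Lin n) → List (Lin n)
  combineAll [] q r = r
  combineAll (u ∷ p) q r = List.map (combine u) q ++ combineAll p q r

  map-sound : ∀ {n} x (ρ : Vec ℤ n) u q → PosOK x ρ u → All (NegOK x ρ) q →
    All (NonNeg ρ) (List.map (combine u) q)
  map-sound x ρ u [] h [] = []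
  map-sound x ρ u (v ∷ q) h (k ∷ ks) = combine-sound x ρ u v h k ∷ map-sound x ρ u q h ks

  combineAll-sound : ∀ {n} x (ρ : Vec ℤ n) p q r → All (PosOK x ρ) p → All (NegOK x ρ) q →
    All (NonNeg ρ) r → All (NonNeg ρ) (combineAll p q r)
  combineAll-sound x ρ [] q r [] hq hr = hr
  combineAll-sound x ρ (u ∷ p) q r (h ∷ hp) hq hr =
    ++⁺ (map-sound x ρ u q h hq) (combineAll-sound x ρ p q r hp hq hr)

  isZero : ∀ {n} → Lin n → Bool
  isZero (con (+ 0)) = true
  isZero (+ 0 ∙ l) = isZero l
  isZero _ = false

  opposite : ∀ {n} → ℕ × Lin n → List (ℕ × Lin n) → Maybe (ℕ × Lin n)
  opposite u [] = nothing
  opposite u (v ∷ q) = if isZero (combine u v) then just v else opposite u q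

  findEquation : ∀ {n} → List (ℕ × Lin n) → List (ℕ × Lin n) → Maybe ((ℕ × Lin n) × (ℕ × Lin n))
  findEquation [] q = nothing
  findEquation (u ∷ p) q with opposite u q
  ... | just v = just (u , v)
  ... | nothing = findEquation p q

  opposite-sound : ∀ {n} {Q : ℕ × Lin n → Set} u q {v} → opposite u q ≡ just v → All Q q → Q v
  opposite-sound u (w ∷ q) e (h ∷ hs) with isZero (combine u w)
  opposite-sound u (w ∷ q) refl (h ∷ hs) | true = h
  ... | false = opposite-sound u q e hs

  findEquation-sound : ∀ {n} {Q R : ℕ × Lin n → Set} p q {u v} → findEquation p q ≡ just (u , v) →
    All Q p → All R q → Q u × R v
  findEquation-sound (u ∷ p) q e (h ∷ hs) ks with opposite u q in eq
  findEquation-sound (u ∷ p) q refl (h ∷ hs) ks | just v = h , opposite-sound u q eq ks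
  ... | nothing = findEquation-sound p q e hs ks

  -- A pair of opposite constraints is an equation: combining everything with it alone is enough.
  eliminate : ∀ {n} → List (Lin (suc n)) → List (Lin n)
  eliminate cs with classify cs
  ... | splitting f p q with findEquation p q
  ...   | just (u , v) = combineAll (u ∷ []) q (combineAll p (v ∷ []) f)
  ...   | nothing = combineAll p q f

  eliminate-sound : ∀ {n} x (ρ : Vec ℤ n) cs → All (NonNeg (x ∷ ρ)) cs → All (NonNeg ρ) (eliminate cs)
  eliminate-sound x ρ cs hs with classify cs | classify-sound x ρ cs hs
  ... | splitting f p q | hf , hp , hq with findEquation p q in eq
  ...   | just (u , v) = let hu , hv = findEquation-sound p q eq hp hq in
          combineAll-sound x ρ _ _ _ (hu ∷ []) hq (combineAll-sound x ρ _ _ _ hp (hv ∷ []) hf)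
  ...   | nothing = combineAll-sound x ρ _ _ _ hp hq hf

  isNeg : Lin 0 → Bool
  isNeg (con -[1+ _ ]) = true
  isNeg (con (+ _)) = false

  anyNeg : List (Lin 0) → Bool
  anyNeg [] = false
  anyNeg (c ∷ cs) = isNeg c ∨ anyNeg cs

  refutes : ∀ {n} → List (Lin n) → Bool
  refutes {zero} cs = anyNeg cs
  refutes {suc n} cs = refutes (eliminate cs)

  anyNeg-sound : ∀ cs → anyNeg cs ≡ true → All (NonNeg []) cs → ⊥
  anyNeg-sound (con (+ _) ∷ cs) e (_ ∷ hs) = anyNeg-sound cs e hs
  anyNeg-sound (con -[1+ _ ] ∷ cs) e (() ∷ hs)

  refutes-sound : ∀ {n} (cs : List (Lin n)) ρ → refutes cs ≡ true → All (NonNeg ρ) cs → ⊥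
  refutes-sound cs [] e hs = anyNeg-sound cs e hs
  refutes-sound cs (x ∷ ρ) e hs = refutes-sound (eliminate cs) ρ e (eliminate-sound x ρ cs hs)

  data Ex (n : ℕ) : Set where
    var : Fin n → Ex n
    lit : ℤ → Ex n
    _:+_ _:-_ : Ex n → Ex n → Ex n
    _:*_ : ℕ → Ex n → Ex n

  -- Multiples are unfolded to sums so that ⟦ 5 :* x ⟧ at + m is + (5 ℕ.* m) by computation.
  infixr 7 _times_
  _times_ : ℕ → ℤ → ℤ
  zero times x = 0ℤ
  suc k times x = x ℤ.+ k times x

  ⟦_⟧ᵉ : ∀ {n} → Ex n → Vec ℤ n → ℤ
  ⟦ var i ⟧ᵉ ρ = lookup ρ i
  ⟦ lit c ⟧ᵉ ρ = c
  ⟦ a :+ b ⟧ᵉ ρ = ⟦ a ⟧ᵉ ρ ℤ.+ ⟦ b ⟧ᵉ ρ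
  ⟦ a :- b ⟧ᵉ ρ = ⟦ a ⟧ᵉ ρ ℤ.- ⟦ b ⟧ᵉ ρ
  ⟦ k :* a ⟧ᵉ ρ = k times ⟦ a ⟧ᵉ ρ

  times-* : ∀ k x → + k ℤ.* x ≡ k times x
  times-* zero x = ℤP.*-zeroˡ x
  times-* (suc k) x = trans (ℤP.suc-* (+ k) x) (cong (λ z → x ℤ.+ z) (times-* k x))

  subˡ : ∀ {n} → Lin n → Lin n → Lin n
  subˡ a b = addˡ a (scaleˡ -[1+ 0 ] b)

  subˡ-correct : ∀ {n} (a b : Lin n) ρ → ⟦ subˡ a b ⟧ˡ ρ ≡ ⟦ a ⟧ˡ ρ ℤ.- ⟦ b ⟧ˡ ρ
  subˡ-correct a b ρ = trans (addˡ-correct a (scaleˡ -[1+ 0 ] b) ρ)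
    (cong (λ z → ⟦ a ⟧ˡ ρ ℤ.+ z) (trans (scaleˡ-correct -[1+ 0 ] b ρ) (ℤP.-1*i≡-i _)))

  norm : ∀ {n} → Ex n → Lin n
  norm (var i) = varˡ i
  norm (lit c) = con c
  norm (a :+ b) = addˡ (norm a) (norm b)
  norm (a :- b) = subˡ (norm a) (norm b)
  norm (k :* a) = scaleˡ (+ k) (norm a)

  norm-correct : ∀ {n} (e : Ex n) ρ → ⟦ norm e ⟧ˡ ρ ≡ ⟦ e ⟧ᵉ ρ
  norm-correct (var i) ρ = varˡ-correct i ρ
  norm-correct (lit c) ρ = refl
  norm-correct (a :+ b) ρ =
    trans (addˡ-correct (norm a) (norm b) ρ) (cong₂ ℤ._+_ (norm-correct a ρ) (norm-correct b ρ))
  norm-correct (a :- b) ρ =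
    trans (subˡ-correct (norm a) (norm b) ρ) (cong₂ ℤ._-_ (norm-correct a ρ) (norm-correct b ρ))
  norm-correct (k :* a) ρ =
    trans (scaleˡ-correct (+ k) (norm a) ρ)
      (trans (cong (+ k ℤ.*_) (norm-correct a ρ)) (times-* k _))

  data Rel (n : ℕ) : Set where
    _:≤_ _:<_ _:≡_ : Ex n → Ex n → Rel n

  ⟦_⟧ʳ : ∀ {n} → Rel n → Vec ℤ n → Set
  ⟦ a :≤ b ⟧ʳ ρ = ⟦ a ⟧ᵉ ρ ℤ.≤ ⟦ b ⟧ᵉ ρ
  ⟦ a :< b ⟧ʳ ρ = ⟦ a ⟧ᵉ ρ ℤ.< ⟦ b ⟧ᵉ ρ
  ⟦ a :≡ b ⟧ʳ ρ = ⟦ a ⟧ᵉ ρ ≡ ⟦ b ⟧ᵉ ρ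

  data Problem (n : ℕ) : Set where
    ⊢_ : Rel n → Problem n
    ⊢⊥ : Problem n
    _⇒_ : Rel n → Problem n → Problem n

  ⟦_⟧ᵖ : ∀ {n} → Problem n → Vec ℤ n → Set
  ⟦ ⊢ r ⟧ᵖ ρ = ⟦ r ⟧ʳ ρ
  ⟦ ⊢⊥ ⟧ᵖ ρ = ⊥
  ⟦ r ⇒ P ⟧ᵖ ρ = ⟦ r ⟧ʳ ρ → ⟦ P ⟧ᵖ ρ

  -- Tightening a strict inequality by 1 is where integrality enters; the elimination itself is the
  -- rational one.
  leˡ ltˡ : ∀ {n} → Ex n → Ex n → Lin n
  leˡ a b = norm (b :- a)
  ltˡ a b = norm (b :- a :- lit 1ℤ)

  leˡ-sound : ∀ {n} (a b : Ex n) ρ → ⟦ a ⟧ᵉ ρ ℤ.≤ ⟦ b ⟧ᵉ ρ → NonNeg ρ (leˡ a b)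
  leˡ-sound a b ρ h = subst (0ℤ ℤ.≤_) (sym (norm-correct (b :- a) ρ)) (ℤP.i≤j⇒0≤j-i h)

  ltˡ-sound : ∀ {n} (a b : Ex n) ρ → ⟦ a ⟧ᵉ ρ ℤ.< ⟦ b ⟧ᵉ ρ → NonNeg ρ (ltˡ a b)
  ltˡ-sound a b ρ h = subst (0ℤ ℤ.≤_)
    (trans (lemma (⟦ a ⟧ᵉ ρ) (⟦ b ⟧ᵉ ρ)) (sym (norm-correct (b :- a :- lit 1ℤ) ρ)))
    (ℤP.i≤j⇒0≤j-i (ℤP.i<j⇒suc[i]≤j h))
    where
    lemma : ∀ x y → y ℤ.- (1ℤ ℤ.+ x) ≡ y ℤ.- x ℤ.- 1ℤ
    lemma = solve-∀

  assume : ∀ {n} → Rel n → List (Lin n) → List (Lin n)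
  assume (a :≤ b) cs = leˡ a b ∷ cs
  assume (a :< b) cs = ltˡ a b ∷ cs
  assume (a :≡ b) cs = leˡ a b ∷ leˡ b a ∷ cs

  assume-sound : ∀ {n} (r : Rel n) cs ρ → ⟦ r ⟧ʳ ρ → All (NonNeg ρ) cs → All (NonNeg ρ) (assume r cs)
  assume-sound (a :≤ b) cs ρ h hs = leˡ-sound a b ρ h ∷ hs
  assume-sound (a :< b) cs ρ h hs = ltˡ-sound a b ρ h ∷ hs
  assume-sound (a :≡ b) cs ρ h hs =
    leˡ-sound a b ρ (ℤP.≤-reflexive h) ∷ leˡ-sound b a ρ (ℤP.≤-reflexive (sym h)) ∷ hs

  provesRel : ∀ {n} → Rel n → List (Lin n) → Bool
  provesRel (a :≤ b) cs = refutes (ltˡ b a ∷ cs)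
  provesRel (a :< b) cs = refutes (leˡ b a ∷ cs)
  provesRel (a :≡ b) cs = refutes (ltˡ b a ∷ cs) ∧ refutes (ltˡ a b ∷ cs)

  refutes-≤ : ∀ {n} (a b : Ex n) cs ρ → refutes (ltˡ b a ∷ cs) ≡ true → All (NonNeg ρ) cs →
    ⟦ a ⟧ᵉ ρ ℤ.≤ ⟦ b ⟧ᵉ ρ
  refutes-≤ a b cs ρ e hs =
    ℤP.≮⇒≥ λ h → refutes-sound (ltˡ b a ∷ cs) ρ e (ltˡ-sound b a ρ h ∷ hs)

  ∧-split : ∀ {a b} → a ∧ b ≡ true → a ≡ true × b ≡ true
  ∧-split {true} {true} _ = refl , refl

  provesRel-sound : ∀ {n} (r : Rel n) cs ρ → provesRel r cs ≡ true → All (NonNeg ρ) cs → ⟦ r ⟧ʳ ρ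
  provesRel-sound (a :≤ b) cs ρ e hs = refutes-≤ a b cs ρ e hs
  provesRel-sound (a :< b) cs ρ e hs =
    ℤP.≰⇒> λ h → refutes-sound (leˡ b a ∷ cs) ρ e (leˡ-sound b a ρ h ∷ hs)
  provesRel-sound (a :≡ b) cs ρ e hs = let e₁ , e₂ = ∧-split e in
    ℤP.≤-antisym (refutes-≤ a b cs ρ e₁ hs) (refutes-≤ b a cs ρ e₂ hs)

  proves : ∀ {n} → Problem n → List (Lin n) → Bool
  proves (⊢ r) cs = provesRel r cs
  proves ⊢⊥ cs = refutes cs
  proves (r ⇒ P) cs = proves P (assume r cs)

  proves-sound : ∀ {n} (P : Problem n) cs ρ → proves P cs ≡ true → All (NonNeg ρ) cs → ⟦ P ⟧ᵖ ρ
  proves-sound (⊢ r) cs ρ e hs = provesRel-sound r cs ρ e hs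
  proves-sound ⊢⊥ cs ρ e hs = refutes-sound cs ρ e hs
  proves-sound (r ⇒ P) cs ρ e hs h = proves-sound P _ ρ e (assume-sound r cs ρ h hs)

  Fun : ℕ → Set → Set → Set
  Fun zero A B = B
  Fun (suc n) A B = A → Fun n A B

  apply : ∀ {A B} n → Fun n A B → Vec A n → B
  apply zero f [] = f
  apply (suc n) f (x ∷ xs) = apply n (f x) xs

  close : ∀ {B : Set} n → Fun n (Ex n) B → B
  close n f = apply n f (Vec.map var (Vec.allFin n))

  Π : ∀ {A : Set} n → (Vec A n → Set) → Set
  Π zero P = P []
  Π (suc n) P = ∀ x → Π n (λ ρ → P (x ∷ ρ))

  curryΠ : ∀ {A : Set} n {P : Vec A n → Set} → (∀ ρ → P ρ) → Π n P
  curryΠ zero h = h []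
  curryΠ (suc n) h x = curryΠ n (λ ρ → h (x ∷ ρ))

  -- The problem is written as a function of its variables and closed by feeding in the variables
  -- themselves; running the procedure turns the second argument into `refl`.
  linarith : ∀ n (f : Fun n (Ex n) (Problem n)) → proves (close n f) [] ≡ true → Π n ⟦ close n f ⟧ᵖ
  linarith n f e = curryΠ n (λ ρ → proves-sound (close n f) [] ρ e [])

  -- The same for natural number variables, whose nonnegativity is assumed implicitly.

  data Exⁿ (n : ℕ) : Set where
    var : Fin n → Exⁿ n
    lit : ℕ → Exⁿ n
    _:+_ : Exⁿ n → Exⁿ n → Exⁿ n
    _:*_ : ℕ → Exⁿ n → Exⁿ n

  ⟦_⟧ᵉⁿ : ∀ {n} → Exⁿ n → Vec ℕ n → ℕ
  ⟦ var i ⟧ᵉⁿ ρ = lookup ρ i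
  ⟦ lit c ⟧ᵉⁿ ρ = c
  ⟦ a :+ b ⟧ᵉⁿ ρ = ⟦ a ⟧ᵉⁿ ρ ℕ.+ ⟦ b ⟧ᵉⁿ ρ
  ⟦ k :* a ⟧ᵉⁿ ρ = k ℕ.* ⟦ a ⟧ᵉⁿ ρ

  toEx : ∀ {n} → Exⁿ n → Ex n
  toEx (var i) = var i
  toEx (lit c) = lit (+ c)
  toEx (a :+ b) = toEx a :+ toEx b
  toEx (k :* a) = k :* toEx a

  lookup-map-+ : ∀ {n} (i : Fin n) (ρ : Vec ℕ n) → lookup (Vec.map +_ ρ) i ≡ + lookup ρ i
  lookup-map-+ zero (x ∷ ρ) = refl
  lookup-map-+ (suc i) (x ∷ ρ) = lookup-map-+ i ρ

  times-+ : ∀ k x → k times (+ x) ≡ + (k ℕ.* x)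
  times-+ zero x = refl
  times-+ (suc k) x = cong (λ z → + x ℤ.+ z) (times-+ k x)

  toEx-correct : ∀ {n} (e : Exⁿ n) ρ → ⟦ toEx e ⟧ᵉ (Vec.map +_ ρ) ≡ + ⟦ e ⟧ᵉⁿ ρ
  toEx-correct (var i) ρ = lookup-map-+ i ρ
  toEx-correct (lit c) ρ = refl
  toEx-correct (a :+ b) ρ = cong₂ ℤ._+_ (toEx-correct a ρ) (toEx-correct b ρ)
  toEx-correct (k :* a) ρ = trans (cong (k times_) (toEx-correct a ρ)) (times-+ k _)

  data Relⁿ (n : ℕ) : Set where
    _:≤_ _:<_ _:≡_ : Exⁿ n → Exⁿ n → Relⁿ n

  ⟦_⟧ʳⁿ : ∀ {n} → Relⁿ n → Vec ℕ n → Set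
  ⟦ a :≤ b ⟧ʳⁿ ρ = ⟦ a ⟧ᵉⁿ ρ ℕ.≤ ⟦ b ⟧ᵉⁿ ρ
  ⟦ a :< b ⟧ʳⁿ ρ = ⟦ a ⟧ᵉⁿ ρ ℕ.< ⟦ b ⟧ᵉⁿ ρ
  ⟦ a :≡ b ⟧ʳⁿ ρ = ⟦ a ⟧ᵉⁿ ρ ≡ ⟦ b ⟧ᵉⁿ ρ

  toRel : ∀ {n} → Relⁿ n → Rel n
  toRel (a :≤ b) = toEx a :≤ toEx b
  toRel (a :< b) = toEx a :< toEx b
  toRel (a :≡ b) = toEx a :≡ toEx b

  toRel⁺ : ∀ {n} (r : Relⁿ n) ρ → ⟦ r ⟧ʳⁿ ρ → ⟦ toRel r ⟧ʳ (Vec.map +_ ρ)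
  toRel⁺ (a :≤ b) ρ h = subst₂ ℤ._≤_ (sym (toEx-correct a ρ)) (sym (toEx-correct b ρ)) (ℤ.+≤+ h)
  toRel⁺ (a :< b) ρ h = subst₂ ℤ._<_ (sym (toEx-correct a ρ)) (sym (toEx-correct b ρ)) (ℤ.+<+ h)
  toRel⁺ (a :≡ b) ρ h = trans (toEx-correct a ρ) (trans (cong +_ h) (sym (toEx-correct b ρ)))

  toRel⁻ : ∀ {n} (r : Relⁿ n) ρ → ⟦ toRel r ⟧ʳ (Vec.map +_ ρ) → ⟦ r ⟧ʳⁿ ρ
  toRel⁻ (a :≤ b) ρ h = ℤP.drop‿+≤+ (subst₂ ℤ._≤_ (toEx-correct a ρ) (toEx-correct b ρ) h)
  toRel⁻ (a :< b) ρ h = ℤP.drop‿+<+ (subst₂ ℤ._<_ (toEx-correct a ρ) (toEx-correct b ρ) h)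
  toRel⁻ (a :≡ b) ρ h = ℤP.+-injective (trans (sym (toEx-correct a ρ)) (trans h (toEx-correct b ρ)))

  data Problemⁿ (n : ℕ) : Set where
    ⊢_ : Relⁿ n → Problemⁿ n
    ⊢⊥ : Problemⁿ n
    _⇒_ : Relⁿ n → Problemⁿ n → Problemⁿ n

  ⟦_⟧ᵖⁿ : ∀ {n} → Problemⁿ n → Vec ℕ n → Set
  ⟦ ⊢ r ⟧ᵖⁿ ρ = ⟦ r ⟧ʳⁿ ρ
  ⟦ ⊢⊥ ⟧ᵖⁿ ρ = ⊥
  ⟦ r ⇒ P ⟧ᵖⁿ ρ = ⟦ r ⟧ʳⁿ ρ → ⟦ P ⟧ᵖⁿ ρ

  toProblem : ∀ {n} → Problemⁿ n → Problem n
  toProblem (⊢ r) = ⊢ toRel r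
  toProblem ⊢⊥ = ⊢⊥
  toProblem (r ⇒ P) = toRel r ⇒ toProblem P

  toProblem⁻ : ∀ {n} (P : Problemⁿ n) ρ → ⟦ toProblem P ⟧ᵖ (Vec.map +_ ρ) → ⟦ P ⟧ᵖⁿ ρ
  toProblem⁻ (⊢ r) ρ h = toRel⁻ r ρ h
  toProblem⁻ ⊢⊥ ρ h = h
  toProblem⁻ (r ⇒ P) ρ h k = toProblem⁻ P ρ (h (toRel⁺ r ρ k))

  signs : ∀ n → List (Lin n)
  signs zero = []
  signs (suc n) = varˡ zero ∷ List.map (0ℤ ∙_) (signs n)

  signs-sound : ∀ {n} (ρ : Vec ℕ n) → All (NonNeg (Vec.map +_ ρ)) (signs n)
  signs-sound [] = []
  signs-sound (x ∷ ρ) = subst (0ℤ ℤ.≤_) (sym (varˡ-correct zero (+ x ∷ Vec.map +_ ρ))) (ℤ.+≤+ ℕ.z≤n) ∷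
    weaken (signs _) (signs-sound ρ)
    where
    weaken : ∀ ls → All (NonNeg (Vec.map +_ ρ)) ls →
      All (NonNeg (+ x ∷ Vec.map +_ ρ)) (List.map (0ℤ ∙_) ls)
    weaken [] [] = []
    weaken (l ∷ ls) (h ∷ hs) =
      subst (0ℤ ℤ.≤_) (sym (trans (cong (ℤ._+ ⟦ l ⟧ˡ (Vec.map +_ ρ)) (ℤP.*-zeroˡ (+ x))) (ℤP.+-identityˡ _))) h ∷
      weaken ls hs

  closeⁿ : ∀ {B : Set} n → Fun n (Exⁿ n) B → B
  closeⁿ n f = apply n f (Vec.map var (Vec.allFin n))

  linarithⁿ : ∀ n (f : Fun n (Exⁿ n) (Problemⁿ n)) → proves (toProblem (closeⁿ n f)) (signs n) ≡ true →
    Π n ⟦ closeⁿ n f ⟧ᵖⁿ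
  linarithⁿ n f e = curryΠ n (λ ρ →
    toProblem⁻ (closeⁿ n f) ρ (proves-sound (toProblem (closeⁿ n f)) (signs n) (Vec.map +_ ρ) e (signs-sound ρ)))

-- Finite sums, cardinalities and double counting.

module Sums where

  open import Defs using (count)
  open import Data.Bool using (Bool; true; false; not; _∧_; _∨_)
  open import Data.Empty using (⊥; ⊥-elim)
  open import Data.Fin using (Fin; zero; suc; toℕ)
  import Data.Fin.Properties as FinP
  open import Data.List as List using (List; []; _∷_; _++_; allFin; concatMap; tabulate)
  open import Data.Nat as ℕ using (ℕ; zero; suc; _+_; _*_; _^_; _≤_; _<_; z≤n; s≤s⁻¹)
  open import Data.Nat.Properties
  open import Data.Nat.Tactic.RingSolver using (solve-∀)
  open import Data.Product using (∃; _,_)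
  open import Data.Sum using (_⊎_; inj₁; inj₂)
  open import Data.Vec as Vec using (Vec; []; _∷_)
  import Data.Vec.Properties as VecP
  open import Function using (_∘_; id)
  open import Relation.Binary.PropositionalEquality
  open import Relation.Binary using (DecidableEquality)
  open import Relation.Nullary using (¬_; Dec; does; yes; no; contradiction)

  𝟙 : Bool → ℕ
  𝟙 false = 0
  𝟙 true = 1

  𝟙≤1 : ∀ b → 𝟙 b ≤ 1
  𝟙≤1 false = z≤n
  𝟙≤1 true = ≤-refl

  sumOver : {A : Set} → List A → (A → ℕ) → ℕ
  sumOver [] f = 0
  sumOver (x ∷ xs) f = f x + sumOver xs f

  module _ {A : Set} where
    sumOver-cong : ∀ (xs : List A) {f g} → (∀ x → f x ≡ g x) → sumOver xs f ≡ sumOver xs g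
    sumOver-cong [] h = refl
    sumOver-cong (x ∷ xs) h = cong₂ _+_ (h x) (sumOver-cong xs h)

    sumOver-mono : ∀ (xs : List A) {f g} → (∀ x → f x ≤ g x) → sumOver xs f ≤ sumOver xs g
    sumOver-mono [] h = z≤n
    sumOver-mono (x ∷ xs) h = +-mono-≤ (h x) (sumOver-mono xs h)

    sumOver-+ : ∀ (xs : List A) f g → sumOver xs (λ x → f x + g x) ≡ sumOver xs f + sumOver xs g
    sumOver-+ [] f g = refl
    sumOver-+ (x ∷ xs) f g = trans (cong (f x + g x +_) (sumOver-+ xs f g)) (lemma (f x) (g x) _ _)
      where
      lemma : ∀ a b c d → a + b + (c + d) ≡ a + c + (b + d)
      lemma = solve-∀

    sumOver-*ʳ : ∀ (xs : List A) f c → sumOver xs (λ x → f x * c) ≡ sumOver xs f * c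
    sumOver-*ʳ [] f c = refl
    sumOver-*ʳ (x ∷ xs) f c = trans (cong (f x * c +_) (sumOver-*ʳ xs f c)) (sym (*-distribʳ-+ c (f x) _))

    sumOver-zero : ∀ (xs : List A) → sumOver xs (λ _ → 0) ≡ 0
    sumOver-zero [] = refl
    sumOver-zero (x ∷ xs) = sumOver-zero xs

    sumOver-++ : ∀ (xs ys : List A) f → sumOver (xs ++ ys) f ≡ sumOver xs f + sumOver ys f
    sumOver-++ [] ys f = refl
    sumOver-++ (x ∷ xs) ys f = trans (cong (f x +_) (sumOver-++ xs ys f)) (sym (+-assoc (f x) _ _))

    count≡sumOver : ∀ (P : A → Bool) xs → count P xs ≡ sumOver xs (λ x → 𝟙 (P x))
    count≡sumOver P [] = refl
    count≡sumOver P (x ∷ xs) with P x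
    ... | true = cong suc (count≡sumOver P xs)
    ... | false = count≡sumOver P xs

  sumOver-swap : ∀ {A B : Set} (xs : List A) (ys : List B) (f : A → B → ℕ) →
    sumOver xs (λ x → sumOver ys (f x)) ≡ sumOver ys (λ y → sumOver xs (λ x → f x y))
  sumOver-swap [] ys f = sym (sumOver-zero ys)
  sumOver-swap (x ∷ xs) ys f =
    trans (cong (sumOver ys (f x) +_) (sumOver-swap xs ys f)) (sym (sumOver-+ ys (f x) _))

  sumOver-map : ∀ {A B : Set} (g : A → B) xs f → sumOver (List.map g xs) f ≡ sumOver xs (f ∘ g)
  sumOver-map g [] f = refl
  sumOver-map g (x ∷ xs) f = cong (f (g x) +_) (sumOver-map g xs f)

  sumOver-concatMap : ∀ {A B : Set} (g : A → List B) xs f →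
    sumOver (concatMap g xs) f ≡ sumOver xs (λ x → sumOver (g x) f)
  sumOver-concatMap g [] f = refl
  sumOver-concatMap g (x ∷ xs) f =
    trans (sumOver-++ (g x) _ f) (cong (sumOver (g x) f +_) (sumOver-concatMap g xs f))

  𝟙-does : ∀ {P Q : Set} (P? : Dec P) (Q? : Dec Q) → (P → Q) → (Q → P) → 𝟙 (does P?) ≡ 𝟙 (does Q?)
  𝟙-does (yes _) (yes _) _ _ = refl
  𝟙-does (no _) (no _) _ _ = refl
  𝟙-does (yes p) (no ¬q) f _ = contradiction (f p) ¬q
  𝟙-does (no ¬p) (yes q) _ g = contradiction (g q) ¬p

  does-true : ∀ {P : Set} (P? : Dec P) → does P? ≡ true → P
  does-true (yes p) _ = p

  does-false : ∀ {P : Set} (P? : Dec P) → does P? ≡ false → ¬ P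
  does-false (no ¬p) _ = ¬p

  does-intro : ∀ {P : Set} (P? : Dec P) → P → does P? ≡ true
  does-intro (yes _) _ = refl
  does-intro (no ¬p) p = contradiction p ¬p

  -- `once` expresses multiplicity one as a sum of indicators, which is the form that double
  -- counting consumes.
  record Finite (A : Set) : Set where
    field
      elems : List A
      _≟ᶠ_ : DecidableEquality A
      once : ∀ a → sumOver elems (λ x → 𝟙 (does (x ≟ᶠ a))) ≡ 1

    at : A → A → ℕ
    at x y = 𝟙 (does (x ≟ᶠ y))

  open Finite {{...}} public using (at; _≟ᶠ_)

  opaque
    ∑ : {A : Set} {{_ : Finite A}} → (A → ℕ) → ℕ
    ∑ {{F}} = sumOver (Finite.elems F)

    ∑≡sumOver : {A : Set} {{F : Finite A}} (f : A → ℕ) → ∑ f ≡ sumOver (Finite.elems F) f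
    ∑≡sumOver f = refl

    ∑-cong : {A : Set} {{_ : Finite A}} {f g : A → ℕ} → (∀ x → f x ≡ g x) → ∑ f ≡ ∑ g
    ∑-cong {{F}} = sumOver-cong (Finite.elems F)

    ∑-mono : {A : Set} {{_ : Finite A}} {f g : A → ℕ} → (∀ x → f x ≤ g x) → ∑ f ≤ ∑ g
    ∑-mono {{F}} = sumOver-mono (Finite.elems F)

    ∑-+ : {A : Set} {{_ : Finite A}} (f g : A → ℕ) → ∑ (λ x → f x + g x) ≡ ∑ f + ∑ g
    ∑-+ {{F}} = sumOver-+ (Finite.elems F)

    ∑-*ʳ : {A : Set} {{_ : Finite A}} (f : A → ℕ) (c : ℕ) → ∑ (λ x → f x * c) ≡ ∑ f * c
    ∑-*ʳ {{F}} = sumOver-*ʳ (Finite.elems F)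

    ∑-zero : {A : Set} {{_ : Finite A}} {f : A → ℕ} → (∀ x → f x ≡ 0) → ∑ f ≡ 0
    ∑-zero {{F}} h = trans (sumOver-cong (Finite.elems F) h) (sumOver-zero (Finite.elems F))

    ∑-once : {A : Set} {{_ : Finite A}} (a : A) → ∑ (λ x → at x a) ≡ 1
    ∑-once {{F}} = Finite.once F

    ∑-swap : ∀ {A B : Set} {{_ : Finite A}} {{_ : Finite B}} (f : A → B → ℕ) →
      ∑ (λ x → ∑ (f x)) ≡ ∑ (λ y → ∑ (λ x → f x y))
    ∑-swap {{F}} {{G}} f = sumOver-swap (Finite.elems F) (Finite.elems G) f

  size : (A : Set) {{_ : Finite A}} → ℕ
  size A = ∑ {A} (λ _ → 1)

  ∣_∣ : {A : Set} {{_ : Finite A}} → (A → Bool) → ℕ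
  ∣ X ∣ = ∑ (λ x → 𝟙 (X x))

  module _ {A : Set} {{F : Finite A}} where
    ∑-const : ∀ c → ∑ {A} (λ _ → c) ≡ size A * c
    ∑-const c = trans (∑-cong {f = λ _ → c} {g = λ _ → 1 * c} (λ _ → sym (*-identityˡ c))) (∑-*ʳ (λ _ → 1) c)

    ∑-at : ∀ (f : A → ℕ) a → ∑ (λ x → at x a * f x) ≡ f a
    ∑-at f a = trans (∑-cong here) (trans (∑-*ʳ (λ x → at x a) (f a))
      (trans (cong (_* f a) (∑-once a)) (*-identityˡ (f a))))
      where
      here : ∀ x → at x a * f x ≡ at x a * f a
      here x with x ≟ᶠ a
      ... | yes refl = refl
      ... | no _ = refl

    term≤∑ : ∀ (f : A → ℕ) a → f a ≤ ∑ f
    term≤∑ f a = subst (_≤ ∑ f) (∑-at f a) (∑-mono bound)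
      where
      bound : ∀ x → at x a * f x ≤ f x
      bound x = subst (at x a * f x ≤_) (*-identityˡ (f x)) (*-monoˡ-≤ (f x) (𝟙≤1 (does (x ≟ᶠ a))))

    two-terms≤∑ : ∀ (f : A → ℕ) a b → a ≢ b → f a + f b ≤ ∑ f
    two-terms≤∑ f a b a≢b =
      subst (_≤ ∑ f) (trans (∑-+ _ _) (cong₂ _+_ (∑-at f a) (∑-at f b))) (∑-mono bound)
      where
      bound : ∀ x → at x a * f x + at x b * f x ≤ f x
      bound x with x ≟ᶠ a | x ≟ᶠ b
      ... | yes refl | yes refl = contradiction refl a≢b
      ... | yes _ | no _ = ≤-reflexive (trans (+-identityʳ _) (*-identityˡ _))
      ... | no _ | yes _ = ≤-reflexive (*-identityˡ _)
      ... | no _ | no _ = z≤n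

    ∣∣≤size : (X : A → Bool) → ∣ X ∣ ≤ size A
    ∣∣≤size X = ∑-mono (λ x → 𝟙≤1 (X x))

    member⇒1≤ : (X : A → Bool) → ∀ {a} → X a ≡ true → 1 ≤ ∣ X ∣
    member⇒1≤ X {a} h = subst (λ b → 𝟙 b ≤ ∣ X ∣) h (term≤∑ (λ x → 𝟙 (X x)) a)

    search : (X : A → Bool) → (∃ λ x → X x ≡ true) ⊎ (∀ x → X x ≡ false)
    search X = go (Finite.elems F) (sym (∑≡sumOver (λ x → 𝟙 (X x))))
      where
      go : ∀ xs → sumOver xs (λ x → 𝟙 (X x)) ≡ ∣ X ∣ → (∃ λ x → X x ≡ true) ⊎ (∀ x → X x ≡ false)
      go [] e = inj₂ none
        where
        none : ∀ x → X x ≡ false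
        none x with X x in eq
        ... | false = refl
        ... | true = contradiction (member⇒1≤ X eq) (λ h → <-irrefl e h)
      go (x ∷ xs) e with X x in eq
      ... | true = inj₁ (x , eq)
      ... | false = go xs e

    1≤⇒member : (X : A → Bool) → 1 ≤ ∣ X ∣ → ∃ λ x → X x ≡ true
    1≤⇒member X h with search X
    ... | inj₁ r = r
    ... | inj₂ none = contradiction (subst (1 ≤_) (∑-zero (λ x → cong 𝟙 (none x))) h) λ ()

    -- Averaging: if `f x + 1 ≤ g x` held everywhere, the given inhabitant would make `∑ f` strictly
    -- smaller than `∑ g`.
    ∑-≤⇒∃ : A → (f g : A → ℕ) → ∑ g ≤ ∑ f → ∃ λ x → g x ≤ f x
    ∑-≤⇒∃ a f g h with search (λ x → does (g x ≤? f x))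
    ... | inj₁ (x , e) = x , does-true (g x ≤? f x) e
    ... | inj₂ none = ⊥-elim (<-irrefl refl (<-≤-trans strict h))
      where
      lt : ∀ x → f x + 1 ≤ g x
      lt x = subst (_≤ g x) (+-comm 1 (f x)) (≰⇒> (does-false (g x ≤? f x) (none x)))
      strict : ∑ f < ∑ g
      strict = <-≤-trans (subst (∑ f <_) (sym (∑-+ f (λ _ → 1)))
        (m<m+n (∑ f) (term≤∑ (λ _ → 1) a))) (∑-mono lt)

  -- Both sides count the graph of `g`, read once as y = g x and once as x = h y, so no permutation
  -- of lists is involved.
  ∑-bijection : ∀ {A B : Set} {{_ : Finite A}} {{_ : Finite B}} (g : A → B) (h : B → A) →
    (∀ x → h (g x) ≡ x) → (∀ y → g (h y) ≡ y) → (f : B → ℕ) → ∑ (λ x → f (g x)) ≡ ∑ f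
  ∑-bijection g h hg gh f = begin
    ∑ (λ x → f (g x))                       ≡⟨ ∑-cong (λ x → ∑-at f (g x)) ⟨
    ∑ (λ x → ∑ (λ y → at y (g x) * f y))    ≡⟨ ∑-swap (λ x y → at y (g x) * f y) ⟩
    ∑ (λ y → ∑ (λ x → at y (g x) * f y))    ≡⟨ ∑-cong (λ y → ∑-cong (λ x → cong (_* f y)
                                                 (𝟙-does (y ≟ᶠ g x) (x ≟ᶠ h y)
                                                   (λ { refl → sym (hg x) }) (λ { refl → sym (gh y) })))) ⟩
    ∑ (λ y → ∑ (λ x → at x (h y) * f y))    ≡⟨ ∑-cong (λ y → ∑-at (λ _ → f y) (h y)) ⟩
    ∑ f                                     ∎
    where open ≡-Reasoning

  ∣∣-bijection : ∀ {A B : Set} {{_ : Finite A}} {{_ : Finite B}} (g : A → B) (h : B → A) →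
    (∀ x → h (g x) ≡ x) → (∀ y → g (h y) ≡ y) → (X : B → Bool) → ∣ (λ x → X (g x)) ∣ ≡ ∣ X ∣
  ∣∣-bijection g h hg gh X = ∑-bijection g h hg gh (λ y → 𝟙 (X y))

  module _ {A : Set} {{F : Finite A}} where
    ∣∣-mono : (X Y : A → Bool) → (∀ x → X x ≡ true → Y x ≡ true) → ∣ X ∣ ≤ ∣ Y ∣
    ∣∣-mono X Y h = ∑-mono λ x → step (X x) (Y x) (h x)
      where
      step : ∀ a b → (a ≡ true → b ≡ true) → 𝟙 a ≤ 𝟙 b
      step false b _ = z≤n
      step true b k = ≤-reflexive (cong 𝟙 (sym (k refl)))

    ∣∣-modular : (X Y : A → Bool) → ∣ (λ x → X x ∨ Y x) ∣ + ∣ (λ x → X x ∧ Y x) ∣ ≡ ∣ X ∣ + ∣ Y ∣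
    ∣∣-modular X Y = trans (sym (∑-+ _ _)) (trans (∑-cong λ x → step (X x) (Y x)) (∑-+ _ _))
      where
      step : ∀ a b → 𝟙 (a ∨ b) + 𝟙 (a ∧ b) ≡ 𝟙 a + 𝟙 b
      step false false = refl
      step false true = refl
      step true false = refl
      step true true = refl

    ∣∣-complement : (X : A → Bool) → ∣ X ∣ + ∣ (λ x → not (X x)) ∣ ≡ size A
    ∣∣-complement X = trans (sym (∑-+ _ _)) (∑-cong λ x → step (X x))
      where
      step : ∀ a → 𝟙 a + 𝟙 (not a) ≡ 1
      step false = refl
      step true = refl

    Disjoint : (X Y : A → Bool) → Set
    Disjoint X Y = ∀ x → X x ≡ true → Y x ≡ true → ⊥

    disjoint⇒≤ : (X Y Z : A → Bool) → Disjoint X Y → (∀ x → X x ≡ true → Z x ≡ true) →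
      (∀ x → Y x ≡ true → Z x ≡ true) → ∣ X ∣ + ∣ Y ∣ ≤ ∣ Z ∣
    disjoint⇒≤ X Y Z dis hX hY = subst (_≤ ∣ Z ∣) (∑-+ _ _)
      (∑-mono λ x → step (X x) (Y x) (Z x) (dis x) (hX x) (hY x))
      where
      step : ∀ a b c → (a ≡ true → b ≡ true → ⊥) → (a ≡ true → c ≡ true) → (b ≡ true → c ≡ true) →
        𝟙 a + 𝟙 b ≤ 𝟙 c
      step false false c _ _ _ = z≤n
      step false true c _ _ h = ≤-reflexive (cong 𝟙 (sym (h refl)))
      step true false c _ h _ = ≤-reflexive (cong 𝟙 (sym (h refl)))
      step true true c d _ _ = ⊥-elim (d refl refl)

    disjoint⇒≤size : (X Y : A → Bool) → Disjoint X Y → ∣ X ∣ + ∣ Y ∣ ≤ size A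
    disjoint⇒≤size X Y dis = disjoint⇒≤ X Y (λ _ → true) dis (λ _ _ → refl) (λ _ _ → refl)

    -- An element of Y outside X would make X together with that singleton a disjoint pair inside Y,
    -- one element too large.
    ⊆∧≥⇒⊇ : (X Y : A → Bool) → (∀ x → X x ≡ true → Y x ≡ true) → ∣ Y ∣ ≤ ∣ X ∣ →
      ∀ x → Y x ≡ true → X x ≡ true
    ⊆∧≥⇒⊇ X Y sub le x y with X x in eq
    ... | true = refl
    ... | false = ⊥-elim (<-irrefl refl (<-≤-trans
        (subst (∣ X ∣ <_) (+-comm 1 ∣ X ∣) ≤-refl)
        (≤-trans (subst (λ z → ∣ X ∣ + z ≤ ∣ Y ∣) (∑-once x)
          (disjoint⇒≤ X (λ z → does (z ≟ᶠ x)) Y dis sub inY)) le)))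
      where
      dis : Disjoint X (λ z → does (z ≟ᶠ x))
      dis z a b with z ≟ᶠ x
      dis z a b | yes refl with () ← trans (sym a) eq
      dis z a () | no _
      inY : ∀ z → does (z ≟ᶠ x) ≡ true → Y z ≡ true
      inY z e with z ≟ᶠ x
      inY z e | yes refl = y
      inY z () | no _

    -- The equality case of `disjoint⇒≤size`; it converts tight fibre counts into exact descriptions
    -- of fibres.
    complementary : (X Y : A → Bool) → Disjoint X Y → size A ≤ ∣ X ∣ + ∣ Y ∣ → ∀ x → Y x ≡ not (X x)
    complementary X Y dis le x with X x in eqX
    ... | true with Y x in eqY
    ...   | true = ⊥-elim (dis x eqX eqY)
    ...   | false = refl
    complementary X Y dis le x | false =
      ⊆∧≥⇒⊇ Y (λ z → not (X z)) sub
        (+-cancelˡ-≤ ∣ X ∣ _ _ (subst (_≤ ∣ X ∣ + ∣ Y ∣) (sym (∣∣-complement X)) le)) x (cong not eqX)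
      where
      sub : ∀ z → Y z ≡ true → not (X z) ≡ true
      sub z e with X z in e′
      ... | true = ⊥-elim (dis z e′ e)
      ... | false = refl

  ∑< : ℕ → (ℕ → ℕ) → ℕ
  ∑< zero f = 0
  ∑< (suc n) f = ∑< n f + f n

  ∑<-cong : ∀ n {f g} → (∀ i → i < n → f i ≡ g i) → ∑< n f ≡ ∑< n g
  ∑<-cong zero h = refl
  ∑<-cong (suc n) h = cong₂ _+_ (∑<-cong n (λ i l → h i (m<n⇒m<1+n l))) (h n ≤-refl)

  ∑<-mono : ∀ n {f g} → (∀ i → i < n → f i ≤ g i) → ∑< n f ≤ ∑< n g
  ∑<-mono zero h = z≤n
  ∑<-mono (suc n) h = +-mono-≤ (∑<-mono n (λ i l → h i (m<n⇒m<1+n l))) (h n ≤-refl)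

  ∑<-+ : ∀ n f g → ∑< n (λ i → f i + g i) ≡ ∑< n f + ∑< n g
  ∑<-+ zero f g = refl
  ∑<-+ (suc n) f g = trans (cong (_+ (f n + g n)) (∑<-+ n f g)) (lemma (∑< n f) (∑< n g) (f n) (g n))
    where
    lemma : ∀ a b c d → a + b + (c + d) ≡ a + c + (b + d)
    lemma = solve-∀

  ∑<-const : ∀ n c → ∑< n (λ _ → c) ≡ n * c
  ∑<-const zero c = refl
  ∑<-const (suc n) c = trans (cong (_+ c) (∑<-const n c)) (+-comm (n * c) c)

  ∑<-split : ∀ a b f → ∑< (a + b) f ≡ ∑< a f + ∑< b (λ i → f (a + i))
  ∑<-split a zero f = trans (cong (λ n → ∑< n f) (+-identityʳ a)) (sym (+-identityʳ _))
  ∑<-split a (suc b) f = trans (cong (λ n → ∑< n f) (+-suc a b))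
    (trans (cong (_+ f (a + b)) (∑<-split a b f)) (+-assoc (∑< a f) _ _))

  ∑<-cons : ∀ n f → ∑< (suc n) f ≡ f 0 + ∑< n (λ i → f (suc i))
  ∑<-cons n f = ∑<-split 1 n f

  ∑<-reverse : ∀ n f → ∑< (suc n) f ≡ ∑< (suc n) (λ i → f (n ℕ.∸ i))
  ∑<-reverse zero f = refl
  ∑<-reverse (suc n) f = trans (cong (_+ f (suc n)) (∑<-reverse n f))
    (trans (+-comm _ (f (suc n))) (sym (∑<-cons (suc n) (λ i → f (suc n ℕ.∸ i)))))

  sumOver-tabulate : ∀ {A : Set} n (h : Fin n → A) (f : A → ℕ) (g : ℕ → ℕ) →
    (∀ i → f (h i) ≡ g (toℕ i)) → sumOver (tabulate h) f ≡ ∑< n g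
  sumOver-tabulate zero h f g e = refl
  sumOver-tabulate (suc n) h f g e =
    trans (cong₂ _+_ (e zero) (sumOver-tabulate n (h ∘ suc) f (g ∘ suc) (λ i → e (suc i)))) (sym (∑<-cons n g))

  𝟙-yes : ∀ {P : Set} (P? : Dec P) → P → 𝟙 (does P?) ≡ 1
  𝟙-yes (yes _) p = refl
  𝟙-yes (no ¬p) p = contradiction p ¬p

  𝟙-no : ∀ {P : Set} (P? : Dec P) → ¬ P → 𝟙 (does P?) ≡ 0
  𝟙-no (yes p) ¬p = contradiction p ¬p
  𝟙-no (no _) ¬p = refl

  ∑<-zero : ∀ n {f} → (∀ i → i < n → f i ≡ 0) → ∑< n f ≡ 0
  ∑<-zero n h = trans (∑<-cong n h) (trans (∑<-const n 0) (*-zeroʳ n))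

  ∑<-single : ∀ n k → k < n → ∑< n (λ i → 𝟙 (does (i ≟ k))) ≡ 1
  ∑<-single (suc n) k k<sn with n ≟ k
  ... | yes refl = cong₂ _+_
    (∑<-zero n (λ i i<n → 𝟙-no (i ≟ n) (λ { refl → contradiction i<n (<-irrefl refl) }))) (𝟙-yes (n ≟ n) refl)
  ... | no n≢k = trans (cong₂ _+_ (∑<-single n k (≤∧≢⇒< (s≤s⁻¹ k<sn) (λ e → n≢k (sym e)))) (𝟙-no (n ≟ k) n≢k)) refl

  instance
    finFinite : ∀ {n} → Finite (Fin n)
    finFinite {n} = record
      { elems = allFin n
      ; _≟ᶠ_ = Data.Fin._≟_
      ; once = λ a → trans
          (sumOver-tabulate n id _ (λ i → 𝟙 (does (i ≟ toℕ a)))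
            (λ i → 𝟙-does (i Data.Fin.≟ a) (toℕ i ≟ toℕ a) (cong toℕ) FinP.toℕ-injective))
          (∑<-single n (toℕ a) (FinP.toℕ<n a))
      }

  vectors : ∀ {A : Set} → List A → ∀ n → List (Vec A n)
  vectors xs zero = [] ∷ []
  vectors xs (suc n) = concatMap (λ x → List.map (x ∷_) (vectors xs n)) xs

  sumOver-vectors : ∀ {A : Set} (xs : List A) n f →
    sumOver (vectors xs (suc n)) f ≡ sumOver xs (λ x → sumOver (vectors xs n) (λ v → f (x ∷ v)))
  sumOver-vectors xs n f = trans (sumOver-concatMap _ xs f) (sumOver-cong xs (λ x → sumOver-map (x ∷_) (vectors xs n) f))

  module _ {A : Set} {{F : Finite A}} where
    private xs = Finite.elems F

    at-∷ : ∀ {n} (x a : A) (v w : Vec A n) →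
      𝟙 (does (VecP.≡-dec (Finite._≟ᶠ_ F) (x ∷ v) (a ∷ w))) ≡ 𝟙 (does (VecP.≡-dec (Finite._≟ᶠ_ F) v w)) * at x a
    at-∷ x a v w with x ≟ᶠ a | VecP.≡-dec (Finite._≟ᶠ_ F) v w
    ... | yes _ | yes _ = refl
    ... | yes _ | no _ = refl
    ... | no _ | yes _ = refl
    ... | no _ | no _ = refl

    once-vectors : ∀ n (a : Vec A n) → sumOver (vectors xs n) (λ v → 𝟙 (does (VecP.≡-dec (Finite._≟ᶠ_ F) v a))) ≡ 1
    once-vectors zero [] = refl
    once-vectors (suc n) (a ∷ w) = trans (sumOver-vectors xs n _)
      (trans (sumOver-cong xs λ x → trans (sumOver-cong (vectors xs n) (λ v → at-∷ x a v w))
          (trans (sumOver-*ʳ (vectors xs n) _ (at x a))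
            (trans (cong (_* at x a) (once-vectors n w)) (*-identityˡ _))))
        (Finite.once F a))

    instance
      vecFinite : ∀ {n} → Finite (Vec A n)
      vecFinite {n} = record { elems = vectors xs n ; _≟ᶠ_ = VecP.≡-dec (Finite._≟ᶠ_ F) ; once = once-vectors n }

    ∑-∷ : ∀ n (f : Vec A (suc n) → ℕ) → ∑ f ≡ ∑ (λ x → ∑ (λ v → f (x ∷ v)))
    ∑-∷ n f = trans (∑≡sumOver f) (trans (sumOver-vectors xs n f)
      (sym (trans (∑≡sumOver _) (sumOver-cong xs (λ x → ∑≡sumOver (λ v → f (x ∷ v)))))))

    size-Vec : ∀ n → size (Vec A n) ≡ size A ^ n
    size-Vec zero = ∑≡sumOver {Vec A zero} (λ _ → 1)
    size-Vec (suc n) = trans (∑-∷ n (λ _ → 1)) (trans (∑-const {A} (size (Vec A n))) (cong (size A *_) (size-Vec n)))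

  ∑-Fin : ∀ n (g : ℕ → ℕ) → ∑ {Fin n} (λ i → g (toℕ i)) ≡ ∑< n g
  ∑-Fin n g = trans (∑≡sumOver _) (sumOver-tabulate n id _ g (λ _ → refl))

  size-Fin : ∀ n → size (Fin n) ≡ n
  size-Fin n = trans (∑-Fin n (λ _ → 1)) (trans (∑<-const n 1) (*-identityʳ n))

-- Residues modulo p through integer representatives, and vectors over them.

module Residues (p : ℕ) .{{_ : NonZero p}} where

  open LinearArithmetic
  open Sums
  open import Defs using (⟦_⟧; _+ₚ_; _*ₚ_; negₚ; _⊕_; _·_; 0v)
  open import Algebra using (CommutativeRing; RawRing)
  import Algebra.Solver.Ring as RingSolver
  open import Algebra.Solver.Ring.AlmostCommutativeRing using (fromCommutativeRing; _-Raw-AlmostCommutative⟶_)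
  open import Data.Empty using (⊥-elim)
  open import Data.Fin using (Fin; toℕ; fromℕ<)
  import Data.Fin.Properties as FinP
  open import Data.Integer hiding (NonZero; ∣_∣; suc)
  open import Data.Integer.DivMod using (n%ℕd<d; a≡a%ℕn+[a/ℕn]*n)
  open import Data.Integer.Properties
  open import Data.Integer.Tactic.RingSolver using (solve-∀)
  open import Data.Maybe using (Maybe; just; nothing)
  import Data.Nat as ℕ
  import Data.Nat.DivMod as ℕ
  import Data.Nat.Properties as ℕ
  open import Data.Product using (_,_)
  open import Data.Vec as Vec using (Vec; []; _∷_; zipWith; replicate)
  import Data.Vec.Properties as VecP
  open import Level using (0ℓ)
  open import Relation.Binary.PropositionalEquality hiding ([_])
  open import Relation.Nullary using (yes; no)

  F : Set
  F = Fin p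

  P : ℤ
  P = + p

  infix 4 _≈_
  -- Positions are computed in ℤ, where they can be compared by size, and reach `F` only through
  -- `[_]`; the explicit quotient later becomes the slope correction of a sequence.
  record _≈_ (x y : ℤ) : Set where
    constructor mod
    field
      quotient : ℤ
      equation : x ≡ y + quotient * P

  ≡⇒≈ : ∀ {x y} → x ≡ y → x ≈ y
  ≡⇒≈ {x} refl = mod 0ℤ (lemma x P)
    where
    lemma : ∀ x P → x ≡ x + 0ℤ * P
    lemma = solve-∀

  ≈-refl : ∀ {x} → x ≈ x
  ≈-refl = ≡⇒≈ refl

  ≈-sym : ∀ {x y} → x ≈ y → y ≈ x
  ≈-sym {x} {y} (mod q refl) = mod (- q) (lemma y q P)
    where
    lemma : ∀ y q P → y ≡ y + q * P + - q * P
    lemma = solve-∀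

  ≈-trans : ∀ {x y z} → x ≈ y → y ≈ z → x ≈ z
  ≈-trans {z = z} (mod q refl) (mod r refl) = mod (q + r) (lemma z q r P)
    where
    lemma : ∀ z q r P → z + r * P + q * P ≡ z + (q + r) * P
    lemma = solve-∀

  ≈-+ : ∀ {x y z w} → x ≈ y → z ≈ w → x + z ≈ y + w
  ≈-+ {y = y} {w = w} (mod q refl) (mod r refl) = mod (q + r) (lemma y w q r P)
    where
    lemma : ∀ y w q r P → y + q * P + (w + r * P) ≡ y + w + (q + r) * P
    lemma = solve-∀

  ≈-neg : ∀ {x y} → x ≈ y → - x ≈ - y
  ≈-neg {y = y} (mod q refl) = mod (- q) (lemma y q P)
    where
    lemma : ∀ y q P → - (y + q * P) ≡ - y + - q * P
    lemma = solve-∀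

  ≈-- : ∀ {x y z w} → x ≈ y → z ≈ w → x - z ≈ y - w
  ≈-- h k = ≈-+ h (≈-neg k)

  ≈-* : ∀ {x y z w} → x ≈ y → z ≈ w → x * z ≈ y * w
  ≈-* {y = y} {w = w} (mod q refl) (mod r refl) = mod (y * r + q * w + q * r * P) (lemma y w q r P)
    where
    lemma : ∀ y w q r P → (y + q * P) * (w + r * P) ≡ y * w + (y * r + q * w + q * r * P) * P
    lemma = solve-∀

  -- A nonzero quotient would separate x and y by at least p. This is the step that turns
  -- congruences between bounded errors into equations.
  ≈-small : ∀ {x y} → x ≈ y → x < y + P → y < x + P → x ≡ y
  ≈-small {x} {y} (mod (+ 0) e) _ _ = trans e (lemma y P)
    where
    lemma : ∀ y P → y + 0ℤ * P ≡ y
    lemma = solve-∀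
  ≈-small {x} {y} (mod +[1+ n ] e) lt _ = ⊥-elim
    (linarith 4 (λ x y P k → x :≡ y :+ (P :+ k) ⇒ lit 0ℤ :≤ k ⇒ x :< y :+ P ⇒ ⊢⊥) refl
      x y P (+ (n ℕ.* p)) (trans e (cong (λ z → y + z) (sym (pos-* (ℕ.suc n) p)))) (+≤+ ℕ.z≤n) lt)
  ≈-small {x} {y} (mod -[1+ n ] e) _ lt = ⊥-elim
    (linarith 4 (λ x y P k → x :≡ y :- (P :+ k) ⇒ lit 0ℤ :≤ k ⇒ y :< x :+ P ⇒ ⊢⊥) refl
      x y P (+ (n ℕ.* p))
      (trans e (cong (λ z → y + z) (trans (sym (neg-distribˡ-* +[1+ n ] P)) (cong -_ (sym (pos-* (ℕ.suc n) p))))))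
      (+≤+ ℕ.z≤n) lt)

  rem : ℤ → ℕ
  rem z = z %ℕ p

  rem≈ : ∀ z → + rem z ≈ z
  rem≈ z = ≈-sym (mod (z /ℕ p) (a≡a%ℕn+[a/ℕn]*n z p))

  rem<p : ∀ z → rem z ℕ.< p
  rem<p z = n%ℕd<d z p

  opaque
    [_] : ℤ → F
    [ z ] = fromℕ< (rem<p z)

    toℕ-[] : ∀ z → toℕ [ z ] ≡ rem z
    toℕ-[] z = FinP.toℕ-fromℕ< (rem<p z)

  ι : F → ℤ
  ι a = + toℕ a

  <p⇒≡ : ∀ {a b} → a ℕ.< p → b ℕ.< p → + a ≈ + b → a ≡ b
  <p⇒≡ {a} {b} a<p b<p h = +-injective (≈-small h
    (<-≤-trans (+<+ a<p) (i≤j+i P (+ b))) (<-≤-trans (+<+ b<p) (i≤j+i P (+ a))))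

  []-cong : ∀ {x y} → x ≈ y → [ x ] ≡ [ y ]
  []-cong {x} {y} h = FinP.toℕ-injective (trans (toℕ-[] x) (trans
    (<p⇒≡ (rem<p x) (rem<p y) (≈-trans (rem≈ x) (≈-trans h (≈-sym (rem≈ y))))) (sym (toℕ-[] y))))

  ι-[] : ∀ z → ι [ z ] ≈ z
  ι-[] z = ≈-trans (≡⇒≈ (cong +_ (toℕ-[] z))) (rem≈ z)

  []-injective : ∀ {x y} → [ x ] ≡ [ y ] → x ≈ y
  []-injective {x} {y} e = ≈-trans (≈-sym (ι-[] x)) (≈-trans (≡⇒≈ (cong ι e)) (ι-[] y))

  []-ι : ∀ a → [ ι a ] ≡ a
  []-ι a = FinP.toℕ-injective (trans (toℕ-[] (ι a))
    (<p⇒≡ (rem<p (ι a)) (FinP.toℕ<n a) (rem≈ (ι a))))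

  ⟦⟧≡[] : ∀ n → ⟦_⟧ p n ≡ [ + n ]
  ⟦⟧≡[] n = FinP.toℕ-injective (trans (FinP.toℕ-fromℕ< (ℕ.m%n<n n p)) (sym (toℕ-[] (+ n))))

  infixl 6 _+ᶠ_
  infixl 7 _*ᶠ_
  infix 8 -ᶠ_
  opaque
    _+ᶠ_ _*ᶠ_ : F → F → F
    _+ᶠ_ = _+ₚ_ p
    _*ᶠ_ = _*ₚ_ p

    -ᶠ_ : F → F
    -ᶠ_ = negₚ p

    +ᶠ≡+ₚ : ∀ a b → a +ᶠ b ≡ _+ₚ_ p a b
    +ᶠ≡+ₚ a b = refl

    *ᶠ≡*ₚ : ∀ a b → a *ᶠ b ≡ _*ₚ_ p a b
    *ᶠ≡*ₚ a b = refl

    -ᶠ≡negₚ : ∀ a → -ᶠ a ≡ negₚ p a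
    -ᶠ≡negₚ a = refl

  []-+ : ∀ x y → [ x ] +ᶠ [ y ] ≡ [ x + y ]
  []-+ x y = trans (+ᶠ≡+ₚ _ _) (trans (⟦⟧≡[] _) ([]-cong (≈-+ (ι-[] x) (ι-[] y))))

  []-* : ∀ x y → [ x ] *ᶠ [ y ] ≡ [ x * y ]
  []-* x y = trans (*ᶠ≡*ₚ _ _) (trans (⟦⟧≡[] _) (trans (cong [_] (pos-* (toℕ [ x ]) (toℕ [ y ]))) ([]-cong (≈-* (ι-[] x) (ι-[] y)))))

  []-neg : ∀ x → -ᶠ [ x ] ≡ [ - x ]
  []-neg x = trans (-ᶠ≡negₚ _) (trans (⟦⟧≡[] _) ([]-cong (≈-trans
    (mod 1ℤ (trans (cong +_ refl) (trans (sym (⊖-≥ (ℕ.<⇒≤ (FinP.toℕ<n [ x ]))))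
      (trans (sym (m-n≡m⊖n p (toℕ [ x ]))) (lemma P (ι [ x ]))))))
    (≈-neg (ι-[] x)))))
    where
    lemma : ∀ P x → P - x ≡ - x + 1ℤ * P
    lemma = solve-∀

  -- Every residue has an integer representative, so the ring laws of `F` are inherited from ℤ.
  by-integers : (Q : F → Set) → (∀ z → Q [ z ]) → ∀ a → Q a
  by-integers Q h a = subst Q ([]-ι a) (h (ι a))

  0ᶠ 1ᶠ : F
  0ᶠ = [ 0ℤ ]
  1ᶠ = [ 1ℤ ]

  private
    law₁ : ∀ {f g : F → F} → (∀ x → f [ x ] ≡ g [ x ]) → ∀ a → f a ≡ g a
    law₁ h = by-integers _ h

    law₂ : ∀ {f g : F → F → F} → (∀ x y → f [ x ] [ y ] ≡ g [ x ] [ y ]) → ∀ a b → f a b ≡ g a b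
    law₂ h = by-integers _ λ x → by-integers _ λ y → h x y

    law₃ : ∀ {f g : F → F → F → F} → (∀ x y z → f [ x ] [ y ] [ z ] ≡ g [ x ] [ y ] [ z ]) →
      ∀ a b c → f a b c ≡ g a b c
    law₃ h = by-integers _ λ x → by-integers _ λ y → by-integers _ λ z → h x y z

  +ᶠ-assoc : ∀ a b c → a +ᶠ b +ᶠ c ≡ a +ᶠ (b +ᶠ c)
  +ᶠ-assoc = law₃ λ x y z → trans (cong (_+ᶠ [ z ]) ([]-+ x y)) (trans ([]-+ (x + y) z)
    (trans (cong [_] (+-assoc x y z)) (sym (trans (cong ([ x ] +ᶠ_) ([]-+ y z)) ([]-+ x (y + z))))))

  +ᶠ-comm : ∀ a b → a +ᶠ b ≡ b +ᶠ a
  +ᶠ-comm = law₂ λ x y → trans ([]-+ x y) (trans (cong [_] (+-comm x y)) (sym ([]-+ y x)))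

  +ᶠ-identityˡ : ∀ a → 0ᶠ +ᶠ a ≡ a
  +ᶠ-identityˡ = law₁ λ x → trans ([]-+ 0ℤ x) (cong [_] (+-identityˡ x))

  +ᶠ-inverseˡ : ∀ a → -ᶠ a +ᶠ a ≡ 0ᶠ
  +ᶠ-inverseˡ = law₁ λ x → trans (cong (_+ᶠ [ x ]) ([]-neg x)) (trans ([]-+ (- x) x) (cong [_] (+-inverseˡ x)))

  *ᶠ-assoc : ∀ a b c → a *ᶠ b *ᶠ c ≡ a *ᶠ (b *ᶠ c)
  *ᶠ-assoc = law₃ λ x y z → trans (cong (_*ᶠ [ z ]) ([]-* x y)) (trans ([]-* (x * y) z)
    (trans (cong [_] (*-assoc x y z)) (sym (trans (cong ([ x ] *ᶠ_) ([]-* y z)) ([]-* x (y * z))))))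

  *ᶠ-comm : ∀ a b → a *ᶠ b ≡ b *ᶠ a
  *ᶠ-comm = law₂ λ x y → trans ([]-* x y) (trans (cong [_] (*-comm x y)) (sym ([]-* y x)))

  *ᶠ-identityˡ : ∀ a → 1ᶠ *ᶠ a ≡ a
  *ᶠ-identityˡ = law₁ λ x → trans ([]-* 1ℤ x) (cong [_] (*-identityˡ x))

  *ᶠ-distribˡ : ∀ a b c → a *ᶠ (b +ᶠ c) ≡ a *ᶠ b +ᶠ a *ᶠ c
  *ᶠ-distribˡ = law₃ λ x y z → trans (cong ([ x ] *ᶠ_) ([]-+ y z)) (trans ([]-* x (y + z))
    (trans (cong [_] (*-distribˡ-+ x y z)) (sym (trans (cong₂ _+ᶠ_ ([]-* x y) ([]-* x z)) ([]-+ (x * y) (x * z))))))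

  *ᶠ-distribʳ : ∀ a b c → (b +ᶠ c) *ᶠ a ≡ b *ᶠ a +ᶠ c *ᶠ a
  *ᶠ-distribʳ a b c = trans (*ᶠ-comm (b +ᶠ c) a) (trans (*ᶠ-distribˡ a b c) (cong₂ _+ᶠ_ (*ᶠ-comm a b) (*ᶠ-comm a c)))

  module _ {A : Set} (_+′_ _*′_ : A → A → A) (-′_ : A → A) (0′ 1′ : A)
    (+a : ∀ a b c → (a +′ b) +′ c ≡ a +′ (b +′ c)) (+c : ∀ a b → a +′ b ≡ b +′ a)
    (+i : ∀ a → 0′ +′ a ≡ a) (+n : ∀ a → (-′ a) +′ a ≡ 0′)
    (*a : ∀ a b c → (a *′ b) *′ c ≡ a *′ (b *′ c)) (*c : ∀ a b → a *′ b ≡ b *′ a)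
    (*i : ∀ a → 1′ *′ a ≡ a) (*d : ∀ a b c → a *′ (b +′ c) ≡ (a *′ b) +′ (a *′ c)) where

    mkRing : CommutativeRing 0ℓ 0ℓ
    mkRing = record
      { Carrier = A ; _≈_ = _≡_ ; _+_ = _+′_ ; _*_ = _*′_ ; -_ = -′_ ; 0# = 0′ ; 1# = 1′
      ; isCommutativeRing = record
        { isRing = record
          { +-isAbelianGroup = record
            { isGroup = record
              { isMonoid = record
                { isSemigroup = record
                  { isMagma = record { isEquivalence = isEquivalence ; ∙-cong = cong₂ _+′_ } ; assoc = +a }
                ; identity = +i , λ a → trans (+c a 0′) (+i a) }
              ; inverse = +n , (λ a → trans (+c a (-′ a)) (+n a))
              ; ⁻¹-cong = cong -′_ }
            ; comm = +c }
          ; *-cong = cong₂ _*′_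
          ; *-assoc = *a
          ; *-identity = *i , (λ a → trans (*c a 1′) (*i a))
          ; distrib = *d , λ a b c → trans (*c (b +′ c) a) (trans (*d a b c) (cong₂ _+′_ (*c a b) (*c a c))) }
        ; *-comm = *c } }

  Fring : CommutativeRing 0ℓ 0ℓ
  Fring = mkRing _+ᶠ_ _*ᶠ_ -ᶠ_ 0ᶠ 1ᶠ +ᶠ-assoc +ᶠ-comm +ᶠ-identityˡ +ᶠ-inverseˡ *ᶠ-assoc *ᶠ-comm *ᶠ-identityˡ *ᶠ-distribˡ

  ℤraw : RawRing 0ℓ 0ℓ
  ℤraw = CommutativeRing.rawRing +-*-commutativeRing

  weakly : ∀ {A : Set} (h : ℤ → A) (x y : ℤ) → Maybe (h x ≡ h y)
  weakly h x y with x ≟ y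
  ... | yes e = just (cong h e)
  ... | no _ = nothing

  Fmorphism : ℤraw -Raw-AlmostCommutative⟶ fromCommutativeRing Fring
  Fmorphism = record
    { ⟦_⟧ = [_] ; +-homo = λ x y → sym ([]-+ x y) ; *-homo = λ x y → sym ([]-* x y)
    ; -‿homo = λ x → sym ([]-neg x) ; 0-homo = refl ; 1-homo = refl }

  module FSolver = RingSolver ℤraw (fromCommutativeRing Fring) Fmorphism (weakly [_])

  V : ℕ → Set
  V n = Vec F n

  infixl 6 _⊞_ _⊟_
  _⊞_ _⊠_ _⊟_ : ∀ {n} → V n → V n → V n
  _⊞_ = zipWith _+ᶠ_
  _⊠_ = zipWith _*ᶠ_

  ⊝_ : ∀ {n} → V n → V n
  ⊝_ = Vec.map -ᶠ_

  a ⊟ b = a ⊞ (⊝ b)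

  constᵛ : ∀ {n} → ℤ → V n
  constᵛ z = replicate _ [ z ]

  constᵛ-+ : ∀ {n} x y → constᵛ {n} x ⊞ constᵛ y ≡ constᵛ (x + y)
  constᵛ-+ {ℕ.zero} x y = refl
  constᵛ-+ {ℕ.suc n} x y = cong₂ _∷_ ([]-+ x y) (constᵛ-+ x y)

  constᵛ-* : ∀ {n} x y → constᵛ {n} x ⊠ constᵛ y ≡ constᵛ (x * y)
  constᵛ-* {ℕ.zero} x y = refl
  constᵛ-* {ℕ.suc n} x y = cong₂ _∷_ ([]-* x y) (constᵛ-* x y)

  constᵛ-neg : ∀ {n} x → ⊝ constᵛ {n} x ≡ constᵛ (- x)
  constᵛ-neg {ℕ.zero} x = refl
  constᵛ-neg {ℕ.suc n} x = cong₂ _∷_ ([]-neg x) (constᵛ-neg x)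

  -- The componentwise product makes Fⁿ a commutative ring with integers as constant vectors, so the
  -- ring solver also proves vector identities with integer multiples.
  Vring : ∀ n → CommutativeRing 0ℓ 0ℓ
  Vring n = mkRing {V n} _⊞_ _⊠_ ⊝_ (constᵛ 0ℤ) (constᵛ 1ℤ)
    (VecP.zipWith-assoc +ᶠ-assoc) (VecP.zipWith-comm +ᶠ-comm)
    (VecP.zipWith-identityˡ +ᶠ-identityˡ) (VecP.zipWith-inverseˡ +ᶠ-inverseˡ)
    (VecP.zipWith-assoc *ᶠ-assoc) (VecP.zipWith-comm *ᶠ-comm)
    (VecP.zipWith-identityˡ *ᶠ-identityˡ) (VecP.zipWith-distribˡ *ᶠ-distribˡ)

  Vmorphism : ∀ n → ℤraw -Raw-AlmostCommutative⟶ fromCommutativeRing (Vring n)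
  Vmorphism n = record
    { ⟦_⟧ = constᵛ ; +-homo = λ x y → sym (constᵛ-+ x y) ; *-homo = λ x y → sym (constᵛ-* x y)
    ; -‿homo = λ x → sym (constᵛ-neg x) ; 0-homo = refl ; 1-homo = refl }

  module VSolver {n} = RingSolver ℤraw (fromCommutativeRing (Vring n)) (Vmorphism n) (weakly (constᵛ {n}))

  0v≡ : ∀ {n} → 0v p {n} ≡ constᵛ 0ℤ
  0v≡ {n} = cong (replicate n) (⟦⟧≡[] 0)

  ⊞≡⊕ : ∀ {n} (v w : V n) → v ⊞ w ≡ _⊕_ p v w
  ⊞≡⊕ [] [] = refl
  ⊞≡⊕ (x ∷ v) (y ∷ w) = cong₂ _∷_ (+ᶠ≡+ₚ x y) (⊞≡⊕ v w)

  scalar : ∀ {n} → F → V n → V n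
  scalar c = Vec.map (c *ᶠ_)

  scalar≡· : ∀ {n} c (v : V n) → scalar c v ≡ _·_ p c v
  scalar≡· c v = VecP.map-cong (*ᶠ≡*ₚ c) v

  ·≡⊠ : ∀ {n} c (v : V n) → scalar c v ≡ replicate n c ⊠ v
  ·≡⊠ c [] = refl
  ·≡⊠ c (x ∷ v) = cong (c *ᶠ x ∷_) (·≡⊠ c v)

  []-·-+ : ∀ {n} x y (v : V n) → scalar [ x + y ] v ≡ scalar [ x ] v ⊞ scalar [ y ] v
  []-·-+ x y [] = refl
  []-·-+ x y (a ∷ v) = cong₂ _∷_ (trans (cong (_*ᶠ a) (sym ([]-+ x y))) (*ᶠ-distribʳ a [ x ] [ y ])) ([]-·-+ x y v)

  1·v : ∀ {n} (v : V n) → scalar 1ᶠ v ≡ v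
  1·v [] = refl
  1·v (a ∷ v) = cong₂ _∷_ (*ᶠ-identityˡ a) (1·v v)

  0·v : ∀ {n} (v : V n) → scalar 0ᶠ v ≡ constᵛ 0ℤ
  0·v [] = refl
  0·v (a ∷ v) = cong₂ _∷_ (FSolver.solve 1 (λ a → FSolver.con 0ℤ FSolver.:* a FSolver.:= FSolver.con 0ℤ) refl a) (0·v v)

  ·-· : ∀ {n} a b (v : V n) → scalar a (scalar b v) ≡ scalar (a *ᶠ b) v
  ·-· a b [] = refl
  ·-· a b (x ∷ v) = cong₂ _∷_ (sym (*ᶠ-assoc a b x)) (·-· a b v)

  ·-⊞ : ∀ {n} a (v w : V n) → scalar a (v ⊞ w) ≡ scalar a v ⊞ scalar a w
  ·-⊞ a [] [] = refl
  ·-⊞ a (x ∷ v) (y ∷ w) = cong₂ _∷_ (*ᶠ-distribˡ a x y) (·-⊞ a v w)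

  ∑-shift : ∀ c (f : F → ℕ) → ∑< p (λ i → f [ c + + i ]) ≡ ∑ f
  ∑-shift c f = begin
    ∑< p (λ i → f [ c + + i ])         ≡⟨ ∑-Fin p (λ i → f [ c + + i ]) ⟨
    ∑ {F} (λ a → f [ c + ι a ])        ≡⟨ ∑-bijection (λ a → [ c + ι a ]) (λ a → [ - c + ι a ])
                                           (λ a → inv (- c) c a (lemma c)) (λ a → inv c (- c) a (+-inverseˡ c)) f ⟩
    ∑ f                                ∎
    where
    open ≡-Reasoning
    lemma : ∀ c → c + - c ≡ 0ℤ
    lemma = solve-∀
    inv : ∀ b c a → c + b ≡ 0ℤ → [ b + ι [ c + ι a ] ] ≡ a
    inv b c a e = trans ([]-cong (≈-trans (≈-+ (≈-refl {b}) (ι-[] (c + ι a)))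
      (≡⇒≈ (trans (assoc′ b c (ι a)) (trans (cong (_+ ι a) e) (+-identityˡ (ι a))))))) ([]-ι a)
      where
      assoc′ : ∀ b c x → b + (c + x) ≡ c + b + x
      assoc′ = solve-∀

-- Inverses modulo a prime, and Fermat's theorem.

module PrimeField (p : ℕ) .{{_ : NonZero p}} (prime : Prime p) where

  open Residues p
  open import Defs using (invₚ; powₚ)
  open import Algebra using (CommutativeRing)
  import Algebra.Properties.CommutativeMonoid.Sum as MonoidSum
  open import Data.Fin using (Fin; toℕ)
  import Data.Fin as Fin
  import Data.Fin.Properties as FinP
  open import Data.Fin.Permutation using (permutation)
  open import Data.Integer hiding (NonZero; ∣_∣; suc)
  open import Data.Integer.Properties
  open import Data.Integer.Tactic.RingSolver using (solve-∀)
  import Data.Nat as ℕ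
  import Data.Nat.Properties as ℕ
  open import Data.Nat.Coprimality using (prime⇒coprime; coprime-Bézout)
  open import Data.Nat.GCD using (module Bézout)
  open import Data.Nat.Primality using (prime⇒nonTrivial)
  open import Data.Product using (∃; _,_)
  open import Relation.Binary.PropositionalEquality hiding ([_])
  open import Relation.Nullary using (¬_; yes; no; contradiction)

  2≤p : 2 ℕ.≤ p
  2≤p = ℕ.nonTrivial⇒n>1 p {{prime⇒nonTrivial prime}}

  []≡0 : ∀ {a} → toℕ a ≡ 0 → a ≡ 0ᶠ
  []≡0 {a} e = trans (sym ([]-ι a)) (cong (λ n → [ + n ]) e)

  inverse : ∀ a → a ≢ 0ᶠ → ∃ λ b → a *ᶠ b ≡ 1ᶠ
  inverse a a≢0 = by-Bézout (coprime-Bézout (prime⇒coprime prime (FinP.toℕ<n a)))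
    where
    n = toℕ a
    instance
      0<a : ℕ.NonZero n
      0<a = ℕ.≢-nonZero (λ e → a≢0 ([]≡0 e))
    finish : ∀ z → ι a * z ≈ 1ℤ → a *ᶠ [ z ] ≡ 1ᶠ
    finish z h = trans (cong (_*ᶠ [ z ]) (sym ([]-ι a))) (trans ([]-* (ι a) z) ([]-cong h))
    by-Bézout : Bézout.Identity 1 p n → ∃ λ b → a *ᶠ b ≡ 1ᶠ
    by-Bézout (Bézout.+- x y e) = [ - + y ] , finish (- + y) (mod (- + x)
      (trans (lemma₁ (ι a) (+ y)) (trans (cong (λ z → 1ℤ - z) e′) (lemma₂ (+ x) P))))
      where
      e′ : 1ℤ + + y * ι a ≡ + x * P
      e′ = trans (cong (λ z → 1ℤ + z) (sym (pos-* y n))) (trans (cong +_ e) (pos-* x p))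
      lemma₁ : ∀ a y → a * - y ≡ 1ℤ - (1ℤ + y * a)
      lemma₁ = solve-∀
      lemma₂ : ∀ x P → 1ℤ - x * P ≡ 1ℤ + - x * P
      lemma₂ = solve-∀
    by-Bézout (Bézout.-+ x y e) = [ + y ] , finish (+ y) (mod (+ x)
      (trans (*-comm (ι a) (+ y)) (trans (sym (pos-* y n)) (trans (cong +_ (sym e)) (cong (λ z → 1ℤ + z) (pos-* x p))))))

  *ᶠ-cancelˡ : ∀ a {b c} → a ≢ 0ᶠ → a *ᶠ b ≡ a *ᶠ c → b ≡ c
  *ᶠ-cancelˡ a {b} {c} a≢0 e = let a⁻¹ , h = inverse a a≢0 in begin
    b                  ≡⟨ *ᶠ-identityˡ b ⟨
    1ᶠ *ᶠ b            ≡⟨ cong (_*ᶠ b) (trans (*ᶠ-comm a⁻¹ a) h) ⟨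
    a⁻¹ *ᶠ a *ᶠ b      ≡⟨ *ᶠ-assoc a⁻¹ a b ⟩
    a⁻¹ *ᶠ (a *ᶠ b)    ≡⟨ cong (a⁻¹ *ᶠ_) e ⟩
    a⁻¹ *ᶠ (a *ᶠ c)    ≡⟨ *ᶠ-assoc a⁻¹ a c ⟨
    a⁻¹ *ᶠ a *ᶠ c      ≡⟨ cong (_*ᶠ c) (trans (*ᶠ-comm a⁻¹ a) h) ⟩
    1ᶠ *ᶠ c            ≡⟨ *ᶠ-identityˡ c ⟩
    c                  ∎
    where open ≡-Reasoning

  *ᶠ-zeroʳ : ∀ a → a *ᶠ 0ᶠ ≡ 0ᶠ
  *ᶠ-zeroʳ a = CommutativeRing.zeroʳ Fring a

  *ᶠ-nonzero : ∀ {a b} → a ≢ 0ᶠ → b ≢ 0ᶠ → a *ᶠ b ≢ 0ᶠ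
  *ᶠ-nonzero {a} a≢0 b≢0 e = b≢0 (*ᶠ-cancelˡ a a≢0 (trans e (sym (*ᶠ-zeroʳ a))))

  1≢0 : 1ᶠ ≢ 0ᶠ
  1≢0 e with () ← <p⇒≡ 2≤p (ℕ.<-trans (ℕ.s≤s ℕ.z≤n) 2≤p) ([]-injective e)

  private
    module Prod = MonoidSum (CommutativeRing.*-commutativeMonoid Fring)

    -- Replacing 0 by 1 lets the product of the nonzero residues run over all of `F`, where a
    -- permutation can be applied to it.
    unit : F → F
    unit a with a Fin.≟ 0ᶠ
    ... | yes _ = 1ᶠ
    ... | no _ = a

    factor : F → F → F
    factor x a with a Fin.≟ 0ᶠ
    ... | yes _ = 1ᶠ
    ... | no _ = x

    unit≢0 : ∀ a → unit a ≢ 0ᶠ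
    unit≢0 a with a Fin.≟ 0ᶠ
    ... | yes _ = 1≢0
    ... | no h = h

    unit-* : ∀ x → x ≢ 0ᶠ → ∀ a → unit (x *ᶠ a) ≡ factor x a *ᶠ unit a
    unit-* x x≢0 a with a Fin.≟ 0ᶠ | x *ᶠ a Fin.≟ 0ᶠ
    ... | yes _ | yes _ = sym (*ᶠ-identityˡ 1ᶠ)
    ... | yes refl | no h = contradiction (*ᶠ-zeroʳ x) h
    ... | no h | yes e = contradiction e (*ᶠ-nonzero x≢0 h)
    ... | no _ | no _ = refl

    product≢0 : ∀ n (f : Fin n → F) → (∀ i → f i ≢ 0ᶠ) → Prod.sum f ≢ 0ᶠ
    product≢0 ℕ.zero f h = 1≢0
    product≢0 (ℕ.suc n) f h = *ᶠ-nonzero (h Fin.zero) (product≢0 n (λ i → f (Fin.suc i)) (λ i → h (Fin.suc i)))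

    product-factor : ∀ n x (g : Fin n → F) → (∀ i → g i ≡ x) → Prod.sum g ≡ powₚ p x n
    product-factor ℕ.zero x g h = sym (⟦⟧≡[] 1)
    product-factor (ℕ.suc n) x g h = trans (cong₂ _*ᶠ_ (h Fin.zero) (product-factor n x _ (λ i → h (Fin.suc i)))) (*ᶠ≡*ₚ _ _)

    -- Multiplication by x permutes the nonzero residues, so their product absorbs a factor x^(p-1).
    fermat′ : ∀ k → p ≡ ℕ.suc k → ∀ x → x ≢ 0ᶠ → powₚ p x k ≡ 1ᶠ
    fermat′ k eq x x≢0 with inverse x x≢0
    ... | x⁻¹ , h = sym (*ᶠ-cancelˡ (Prod.sum unit) (product≢0 p unit unit≢0) (begin
      Prod.sum unit *ᶠ 1ᶠ                       ≡⟨ trans (*ᶠ-comm _ 1ᶠ) (*ᶠ-identityˡ _) ⟩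
      Prod.sum unit                             ≡⟨ Prod.sum-permute unit (permutation (x *ᶠ_) (x⁻¹ *ᶠ_) left right) ⟩
      Prod.sum (λ a → unit (x *ᶠ a))            ≡⟨ Prod.sum-cong-≗ (unit-* x x≢0) ⟩
      Prod.sum (λ a → factor x a *ᶠ unit a)     ≡⟨ Prod.∑-distrib-+ (factor x) unit ⟩
      Prod.sum (factor x) *ᶠ Prod.sum unit      ≡⟨ cong (_*ᶠ Prod.sum unit) (factors k eq) ⟩
      powₚ p x k *ᶠ Prod.sum unit               ≡⟨ *ᶠ-comm _ (Prod.sum unit) ⟩
      Prod.sum unit *ᶠ powₚ p x k               ∎))
      where
      open ≡-Reasoning
      left : ∀ a → x *ᶠ (x⁻¹ *ᶠ a) ≡ a
      left a = trans (sym (*ᶠ-assoc x x⁻¹ a)) (trans (cong (_*ᶠ a) h) (*ᶠ-identityˡ a))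
      right : ∀ a → x⁻¹ *ᶠ (x *ᶠ a) ≡ a
      right a = trans (sym (*ᶠ-assoc x⁻¹ x a)) (trans (cong (_*ᶠ a) (trans (*ᶠ-comm x⁻¹ x) h)) (*ᶠ-identityˡ a))
      factors : ∀ k → p ≡ ℕ.suc k → Prod.sum (factor x) ≡ powₚ p x k
      factors k eq = go p eq (factor x) (λ i e → zero-case i e) (λ i e → other-case i e)
        where
        zero-case : ∀ i → toℕ i ≡ 0 → factor x i ≡ 1ᶠ
        zero-case i e with i Fin.≟ 0ᶠ
        ... | yes _ = refl
        ... | no h = contradiction ([]≡0 e) h
        other-case : ∀ i → toℕ i ≢ 0 → factor x i ≡ x
        other-case i e with i Fin.≟ 0ᶠ
        ... | yes refl = contradiction (trans (toℕ-[] 0ℤ) (<p⇒≡ (rem<p 0ℤ) (ℕ.<-trans (ℕ.s≤s ℕ.z≤n) 2≤p) (rem≈ 0ℤ))) e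
        ... | no _ = refl
        go : ∀ n → n ≡ ℕ.suc k → (g : Fin n → F) → (∀ i → toℕ i ≡ 0 → g i ≡ 1ᶠ) → (∀ i → toℕ i ≢ 0 → g i ≡ x) →
          Prod.sum g ≡ powₚ p x k
        go .(ℕ.suc k) refl g h₀ h₁ = trans (cong₂ _*ᶠ_ (h₀ Fin.zero refl)
          (product-factor k x (λ i → g (Fin.suc i)) (λ i → h₁ (Fin.suc i) λ ()))) (*ᶠ-identityˡ _)

  -- `invₚ` is the power x^(p-2), so this is Fermat's theorem; it gives access to the quotients
  -- occurring in the types of the statement.
  inv-inverse : ∀ x → x ≢ 0ᶠ → x *ᶠ invₚ p x ≡ 1ᶠ
  inv-inverse x x≢0 = go (p ℕ.∸ 2) (sym (ℕ.m+[n∸m]≡n 2≤p))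
    where
    go : ∀ k → p ≡ 2 ℕ.+ k → x *ᶠ powₚ p x k ≡ 1ᶠ
    go k eq = trans (*ᶠ≡*ₚ _ _) (fermat′ (ℕ.suc k) eq x x≢0)

  -- A nonzero residue generates the whole group, so it cannot have all its multiples near 0; a
  -- homomorphism defect will be killed this way.
  multiples : ∀ z t → ¬ (z ≈ 0ℤ) → ∃ λ k → + k * z ≈ t
  multiples z t z≉0 = let b , h = inverse [ z ] (λ e → z≉0 ([]-injective e)) in
    toℕ (b *ᶠ [ t ]) , []-injective (begin
      [ ι (b *ᶠ [ t ]) * z ]             ≡⟨ []-* (ι (b *ᶠ [ t ])) z ⟨
      [ ι (b *ᶠ [ t ]) ] *ᶠ [ z ]        ≡⟨ cong (_*ᶠ [ z ]) ([]-ι _) ⟩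
      b *ᶠ [ t ] *ᶠ [ z ]                ≡⟨ FSolver.solve 3 (λ b t z → b FSolver.:* t FSolver.:* z FSolver.:= z FSolver.:* b FSolver.:* t) refl b [ t ] [ z ] ⟩
      [ z ] *ᶠ b *ᶠ [ t ]                ≡⟨ cong (_*ᶠ [ t ]) h ⟩
      1ᶠ *ᶠ [ t ]                        ≡⟨ *ᶠ-identityˡ [ t ] ⟩
      [ t ]                              ∎)
    where open ≡-Reasoning

-- The theorems of Cauchy-Davenport and Vosper.

module Vosper (p : ℕ) .{{_ : NonZero p}} (prime : Prime p) where

  open LinearArithmetic
  open Sums
  open Residues p
  open PrimeField p prime
  open import Data.Bool using (Bool; true; false; not; _∧_; _∨_)
  open import Data.Bool.Properties using (not-involutive; ∧-comm)
  open import Data.Empty using (⊥; ⊥-elim)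
  open import Data.Fin using (Fin; toℕ)
  import Data.Fin as Fin
  open import Data.Integer as ℤ using (ℤ; 0ℤ; 1ℤ)
  open import Data.Nat using (zero; suc; _+_; _≤_; _<_; z≤n; s≤s)
  open import Data.Nat.Properties
  open import Data.Product using (∃; _×_; _,_; proj₁; proj₂)
  open import Data.Sum using (_⊎_; inj₁; inj₂)
  open import Relation.Binary.PropositionalEquality hiding ([_])
  open import Relation.Nullary using (¬_; Dec; does; yes; no; contradiction)
  open FSolver using (solve; _:=_; con) renaming (_:+_ to _⊕_; _:-_ to _⊖_; _:*_ to _⊗_; :-_ to ⊖_)

  Sub : Set
  Sub = F → Bool

  ∧-intro : ∀ {a b} → a ≡ true → b ≡ true → a ∧ b ≡ true
  ∧-intro refl refl = refl

  ∨-introˡ : ∀ {a b} → a ≡ true → a ∨ b ≡ true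
  ∨-introˡ refl = refl

  ∨-introʳ : ∀ {a b} → b ≡ true → a ∨ b ≡ true
  ∨-introʳ {false} refl = refl
  ∨-introʳ {true} refl = refl

  ∨-elim : ∀ {a b} → a ∨ b ≡ true → a ≡ true ⊎ b ≡ true
  ∨-elim {true} _ = inj₁ refl
  ∨-elim {false} e = inj₂ e

  not-elim : ∀ {a} → not a ≡ true → a ≢ true
  not-elim {true} ()
  not-elim {false} _ ()

  not-intro : ∀ {a} → a ≢ true → not a ≡ true
  not-intro {true} h = contradiction refl h
  not-intro {false} h = refl

  infix 4 _==_
  _==_ : F → F → Bool
  a == b = does (a Fin.≟ b)

  ==-refl : ∀ a → (a == a) ≡ true
  ==-refl a with a Fin.≟ a
  ... | yes _ = refl
  ... | no h = contradiction refl h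

  ==-sound : ∀ {a b} → (a == b) ≡ true → a ≡ b
  ==-sound {a} {b} = does-true (a Fin.≟ b)

  infixl 6 _-ᶠ_
  _-ᶠ_ : F → F → F
  a -ᶠ b = a +ᶠ -ᶠ b

  module _ {A : Set} {{_ : Finite A}} where
    ∣∣≤1⇒unique : (X : A → Bool) → ∣ X ∣ ≤ 1 → ∀ {a b} → X a ≡ true → X b ≡ true → a ≡ b
    ∣∣≤1⇒unique X le {a} {b} ha hb with a ≟ᶠ b
    ... | yes e = e
    ... | no a≢b = contradiction
      (≤-trans (subst₂ (λ u v → 𝟙 u + 𝟙 v ≤ ∣ X ∣) ha hb (two-terms≤∑ (λ x → 𝟙 (X x)) a b a≢b)) le) λ { (s≤s ()) }

    remove : (A → Bool) → A → A → Bool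
    remove X a x = X x ∧ not (does (x ≟ᶠ a))

    ∣remove∣ : (X : A → Bool) (a : A) → X a ≡ true → suc ∣ remove X a ∣ ≡ ∣ X ∣
    ∣remove∣ X a h = trans (+-comm 1 _) (trans (cong (∣ remove X a ∣ +_) (sym (∑-once a)))
      (trans (sym (∑-+ _ _)) (∑-cong step)))
      where
      step : ∀ x → 𝟙 (remove X a x) + at x a ≡ 𝟙 (X x)
      step x with x ≟ᶠ a
      ... | yes refl rewrite h = refl
      ... | no _ with X x
      ...   | true = refl
      ...   | false = refl

    unique⇒∣∣≤1 : (X : A → Bool) → (∀ a b → X a ≡ true → X b ≡ true → a ≡ b) → ∣ X ∣ ≤ 1
    unique⇒∣∣≤1 X u with search X
    ... | inj₂ none = ≤-trans (≤-reflexive (∑-zero (λ x → cong 𝟙 (none x)))) z≤n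
    ... | inj₁ (a , ha) = subst (∣ X ∣ ≤_) (∑-once a) (∑-mono bound)
      where
      bound : ∀ x → 𝟙 (X x) ≤ at x a
      bound x with X x in e
      ... | false = z≤n
      ... | true = ≤-reflexive (sym (𝟙-yes (x ≟ᶠ a) (u x a e ha)))

    ∣∣-congruence : {X Y : A → Bool} → (∀ x → X x ≡ Y x) → ∣ X ∣ ≡ ∣ Y ∣
    ∣∣-congruence h = ∑-cong (λ x → cong 𝟙 (h x))

  ∣∣-translate : ∀ (X : Sub) t → ∣ (λ z → X (z +ᶠ t)) ∣ ≡ ∣ X ∣
  ∣∣-translate X t = ∣∣-bijection (_+ᶠ t) (_-ᶠ t)
    (λ x → solve 2 (λ x t → x ⊕ t ⊕ ⊖ t := x) refl x t) (λ x → solve 2 (λ x t → x ⊕ ⊖ t ⊕ t := x) refl x t) X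

  -- A nonzero δ generates the group, so every z is reached from x₀ after (z - x₀)/δ steps.
  shift-closed : ∀ (X : Sub) δ → δ ≢ 0ᶠ → (∀ x → X x ≡ true → X (x +ᶠ δ) ≡ true) →
    ∀ {x₀} → X x₀ ≡ true → ∀ z → X z ≡ true
  shift-closed X δ δ≢0 cl {x₀} h z = let b , e = inverse δ δ≢0 in
    subst (λ w → X w ≡ true) (begin
      x₀ +ᶠ [ ι (b *ᶠ (z -ᶠ x₀)) ] *ᶠ δ    ≡⟨ cong (λ w → x₀ +ᶠ w *ᶠ δ) ([]-ι _) ⟩
      x₀ +ᶠ b *ᶠ (z -ᶠ x₀) *ᶠ δ            ≡⟨ solve 4 (λ x b w δ → x ⊕ b ⊗ w ⊗ δ := x ⊕ (δ ⊗ b) ⊗ w) refl x₀ b (z -ᶠ x₀) δ ⟩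
      x₀ +ᶠ δ *ᶠ b *ᶠ (z -ᶠ x₀)            ≡⟨ cong (λ w → x₀ +ᶠ w *ᶠ (z -ᶠ x₀)) e ⟩
      x₀ +ᶠ 1ᶠ *ᶠ (z -ᶠ x₀)                ≡⟨ solve 2 (λ x z → x ⊕ con 1ℤ ⊗ (z ⊕ ⊖ x) := z) refl x₀ z ⟩
      z                                    ∎) (go (toℕ (b *ᶠ (z -ᶠ x₀))))
    where
    open ≡-Reasoning
    go : ∀ k → X (x₀ +ᶠ [ ℤ.+ k ] *ᶠ δ) ≡ true
    go zero = subst (λ w → X w ≡ true) (solve 2 (λ x δ → x := x ⊕ con 0ℤ ⊗ δ) refl x₀ δ) h
    go (suc k) = subst (λ w → X w ≡ true)
      (trans (solve 3 (λ x k δ → x ⊕ k ⊗ δ ⊕ δ := x ⊕ (con 1ℤ ⊕ k) ⊗ δ) refl x₀ [ ℤ.+ k ] δ)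
        (cong (λ w → x₀ +ᶠ w *ᶠ δ) ([]-+ 1ℤ (ℤ.+ k)))) (cl _ (go k))

  SumsIn : Sub → Sub → Sub → Set
  SumsIn X Y S = ∀ x y → X x ≡ true → Y y ≡ true → S (x +ᶠ y) ≡ true

  -- The Dyson transform of (X, Y) at e.
  module Transform (X Y S : Sub) (sums : SumsIn X Y S) (e : F) where
    X′ Y′ : Sub
    X′ z = X z ∨ Y (z -ᶠ e)
    Y′ z = Y z ∧ X (z +ᶠ e)

    card-sum : ∣ X′ ∣ + ∣ Y′ ∣ ≡ ∣ X ∣ + ∣ Y ∣
    card-sum = trans (cong (∣ X′ ∣ +_) eq) (trans (∣∣-modular X (λ z → Y (z -ᶠ e))) (cong (∣ X ∣ +_) (∣∣-translate Y (-ᶠ e))))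
      where
      eq : ∣ Y′ ∣ ≡ ∣ (λ z → X z ∧ Y (z -ᶠ e)) ∣
      eq = trans (∣∣-congruence λ z → trans (∧-comm (Y z) _) (cong (λ w → X (z +ᶠ e) ∧ Y w)
        (solve 2 (λ z e → z := z ⊕ e ⊕ ⊖ e) refl z e))) (∣∣-translate (λ z → X z ∧ Y (z -ᶠ e)) e)

    sums′ : SumsIn X′ Y′ S
    sums′ x y hx hy with ∧-split hy | ∨-elim hx
    ... | Yy , Xye | inj₁ Xx = sums x y Xx Yy
    ... | Yy , Xye | inj₂ Yxe = subst (λ w → S w ≡ true)
      (solve 3 (λ x y e → y ⊕ e ⊕ (x ⊕ ⊖ e) := x ⊕ y) refl x y e) (sums (y +ᶠ e) (x -ᶠ e) Xye Yxe)

    Y′⊆Y : ∀ z → Y′ z ≡ true → Y z ≡ true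
    Y′⊆Y z h = proj₁ (∧-split h)

    X⊆X′ : ∀ z → X z ≡ true → X′ z ≡ true
    X⊆X′ z h = ∨-introˡ h

  ∣∣<⇐missing : ∀ {A : Set} {{_ : Finite A}} (X Y : A → Bool) → (∀ x → X x ≡ true → Y x ≡ true) →
    ∀ {a} → Y a ≡ true → X a ≢ true → ∣ X ∣ < ∣ Y ∣
  ∣∣<⇐missing X Y sub ha ¬ha = ≰⇒> λ le → ¬ha (⊆∧≥⇒⊇ X Y sub le _ ha)

  translate-≤ : ∀ (X Y S : Sub) → SumsIn X Y S → ∀ {y} → Y y ≡ true → ∣ X ∣ ≤ ∣ S ∣
  translate-≤ X Y S sums {y} hy = subst (∣ X ∣ ≤_) (∣∣-translate S y)
    (∣∣-mono X (λ z → S (z +ᶠ y)) (λ x hx → sums x y hx hy))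

  difference≢0 : ∀ {a b} → a ≢ b → b -ᶠ a ≢ 0ᶠ
  difference≢0 {a} {b} h e = h (trans (solve 1 (λ a → a := con 0ℤ ⊕ a) refl a)
    (trans (cong (_+ᶠ a) (sym e)) (solve 2 (λ a b → b ⊕ ⊖ a ⊕ a := b) refl a b)))

  -- Induction on |Y|. For distinct y₁, y₂ in Y, either X is closed under y₂ - y₁ and hence
  -- everything, or some x in X has x + y₂ - y₁ outside X, and a Dyson transform shrinks Y while
  -- keeping |X| + |Y| and S.
  cauchy-davenport′ : ∀ n X Y S → ∣ Y ∣ ≤ n → ∀ {x₀ y₁} → X x₀ ≡ true → Y y₁ ≡ true → SumsIn X Y S →
    p ≤ ∣ S ∣ ⊎ ∣ X ∣ + ∣ Y ∣ ≤ ∣ S ∣ + 1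
  cauchy-davenport′ zero X Y S le hx hy sums = contradiction (≤-trans (member⇒1≤ Y hy) le) λ ()
  cauchy-davenport′ (suc n) X Y S le {x₀} {y₁} hx hy sums with search (remove Y y₁)
  ... | inj₂ none = inj₂ (+-mono-≤ (translate-≤ X Y S sums hy)
    (unique⇒∣∣≤1 Y λ a b ha hb → trans (only a ha) (sym (only b hb))))
    where
    only : ∀ a → Y a ≡ true → a ≡ y₁
    only a ha with a Fin.≟ y₁
    ... | yes e = e
    ... | no h with () ← trans (sym (none a)) (∧-intro ha (not-intro (λ e → h (==-sound e))))
  ... | inj₁ (y₂ , h₂) with search (λ x → X x ∧ not (X (x +ᶠ (y₂ -ᶠ y₁))))
  ...   | inj₂ none = inj₁ (subst (_≤ ∣ S ∣) (size-Fin p)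
      (≤-trans (∑-mono {f = λ _ → 1} (λ z → ≤-reflexive (cong 𝟙 (sym (all z))))) (translate-≤ X Y S sums hy)))
    where
    all : ∀ z → X z ≡ true
    all = shift-closed X (y₂ -ᶠ y₁) (difference≢0 λ e → not-elim (proj₂ (∧-split {Y y₂} h₂)) (trans (cong (_== y₁) (sym e)) (==-refl y₁))) step hx
      where
      step : ∀ x → X x ≡ true → X (x +ᶠ (y₂ -ᶠ y₁)) ≡ true
      step x h with X (x +ᶠ (y₂ -ᶠ y₁)) in e
      ... | true = refl
      ... | false with () ← trans (sym (none x)) (∧-intro h (cong not e))
  ...   | inj₁ (x , h) = conclude (cauchy-davenport′ n X′ Y′ S
      (≤-pred (≤-trans (∣∣<⇐missing Y′ Y Y′⊆Y (proj₁ (∧-split h₂)) missing) le)) (X⊆X′ x₀ hx) present sums′)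
    where
    -- At e = x - y₁ the transform keeps y₁, because y₁ + e = x lies in X, and loses y₂, because y₂
    -- + e does not.
    open Transform X Y S sums (x -ᶠ y₁)
    present : Y′ y₁ ≡ true
    present = ∧-intro hy (trans (cong X (solve 2 (λ x y → y ⊕ (x ⊕ ⊖ y) := x) refl x y₁)) (proj₁ (∧-split h)))
    missing : Y′ y₂ ≢ true
    missing e = not-elim (proj₂ (∧-split h)) (trans (cong X (solve 3 (λ x y z → x ⊕ (z ⊕ ⊖ y) := z ⊕ (x ⊕ ⊖ y)) refl x y₁ y₂)) (proj₂ (∧-split {Y y₂} e)))
    conclude : p ≤ ∣ S ∣ ⊎ ∣ X′ ∣ + ∣ Y′ ∣ ≤ ∣ S ∣ + 1 → p ≤ ∣ S ∣ ⊎ ∣ X ∣ + ∣ Y ∣ ≤ ∣ S ∣ + 1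
    conclude (inj₁ r) = inj₁ r
    conclude (inj₂ r) = inj₂ (subst (_≤ ∣ S ∣ + 1) card-sum r)

  cauchy-davenport : ∀ X Y S {x y} → X x ≡ true → Y y ≡ true → SumsIn X Y S → ∣ S ∣ < p →
    ∣ X ∣ + ∣ Y ∣ ≤ ∣ S ∣ + 1
  cauchy-davenport X Y S hx hy sums lt with cauchy-davenport′ ∣ Y ∣ X Y S ≤-refl hx hy sums
  ... | inj₁ r = contradiction r (<⇒≱ lt)
  ... | inj₂ r = r

  End : F → Sub → Sub
  End δ X x = X x ∧ not (X (x +ᶠ δ))

  -- X is a progression with difference δ when at most one of its elements has no successor in X.
  Progression : F → Sub → Set
  Progression δ X = ∣ End δ X ∣ ≤ 1

  complement : Sub → Sub
  complement X x = not (X x)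

  -- Along the cycle of steps δ, X is left as often as it is entered: both numbers are |X| minus the
  -- number of x with x and x + δ in X.
  ∣End∣-complement : ∀ δ X → ∣ End δ (complement X) ∣ ≡ ∣ End δ X ∣
  ∣End∣-complement δ X = +-cancelˡ-≡ ∣ both ∣ _ _ (trans first (sym second))
    where
    both : Sub
    both x = X x ∧ X (x +ᶠ δ)
    second : ∣ both ∣ + ∣ End δ X ∣ ≡ ∣ X ∣
    second = trans (sym (∑-+ _ _)) (∑-cong λ x → step (X x) (X (x +ᶠ δ)))
      where
      step : ∀ a b → 𝟙 (a ∧ b) + 𝟙 (a ∧ not b) ≡ 𝟙 a
      step false _ = refl
      step true false = refl
      step true true = refl
    first : ∣ both ∣ + ∣ End δ (complement X) ∣ ≡ ∣ X ∣
    first = trans (sym (∑-+ _ _)) (trans (∑-cong λ x → step (X x) (X (x +ᶠ δ))) (∣∣-translate X δ))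
      where
      step : ∀ a b → 𝟙 (a ∧ b) + 𝟙 (not a ∧ not (not b)) ≡ 𝟙 b
      step false false = refl
      step false true = refl
      step true false = refl
      step true true = refl

  opaque
    sumset : Sub → Sub → Sub
    sumset X Y z = does (1 ≤? ∣ (λ x → X x ∧ Y (z -ᶠ x)) ∣)

    sumset-intro : ∀ X Y → SumsIn X Y (sumset X Y)
    sumset-intro X Y x y hx hy = does-intro (1 ≤? ∣ (λ u → X u ∧ Y (x +ᶠ y -ᶠ u)) ∣)
      (member⇒1≤ (λ u → X u ∧ Y (x +ᶠ y -ᶠ u)) (∧-intro hx
        (trans (cong Y (solve 2 (λ x y → x ⊕ y ⊕ ⊖ x := y) refl x y)) hy)))

    sumset-elim : ∀ X Y z → sumset X Y z ≡ true → ∃ λ x → ∃ λ y → X x ≡ true × Y y ≡ true × z ≡ x +ᶠ y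
    sumset-elim X Y z e with 1≤⇒member (λ x → X x ∧ Y (z -ᶠ x)) (does-true (1 ≤? ∣ (λ x → X x ∧ Y (z -ᶠ x)) ∣) e)
    ... | x , h = x , (z -ᶠ x) , proj₁ (∧-split h) , proj₂ (∧-split {X x} h) , solve 2 (λ x z → z := x ⊕ (z ⊕ ⊖ x)) refl x z

  sumset-⊆ : ∀ X Y S → SumsIn X Y S → ∀ z → sumset X Y z ≡ true → S z ≡ true
  sumset-⊆ X Y S sums z e = let x , y , hx , hy , eq = sumset-elim X Y z e in
    trans (cong S eq) (sums x y hx hy)

  negated : Sub → Sub
  negated Y y = Y (-ᶠ y)

  ∣negated∣ : ∀ Y → ∣ negated Y ∣ ≡ ∣ Y ∣
  ∣negated∣ Y = ∣∣-bijection -ᶠ_ -ᶠ_ neg-neg neg-neg Y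
    where
    neg-neg : ∀ x → -ᶠ (-ᶠ x) ≡ x
    neg-neg x = solve 1 (λ x → ⊖ (⊖ x) := x) refl x

  -- If S is a progression, so is X: the complement of X contains D − Y for D the complement of S,
  -- and D is the union of D′ and D′ + δ with D′ smaller by at most one.
  progression-summand : ∀ δ X Y S {y₀} → Y y₀ ≡ true → SumsIn X Y S → Progression δ S →
    ∣ S ∣ + 2 ≤ p → ∣ S ∣ + 1 ≤ ∣ X ∣ + ∣ Y ∣ → Progression δ X
  progression-summand δ X Y S {y₀} hy₀ sums pS S≤ X+Y≥ =
    subst (_≤ 1) (∣End∣-complement δ X) (unique⇒∣∣≤1 (End δ (complement X)) unique)
    where
    D D′ Z rest : Sub
    D = complement S
    D′ z = D z ∧ D (z +ᶠ δ)
    Z = sumset D′ (negated Y)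
    rest z = not (X z) ∧ not (Z z)

    D-split : ∣ D′ ∣ + ∣ End δ D ∣ ≡ ∣ D ∣
    D-split = trans (sym (∑-+ _ _)) (∑-cong λ x → step (D x) (D (x +ᶠ δ)))
      where
      step : ∀ a b → 𝟙 (a ∧ b) + 𝟙 (a ∧ not b) ≡ 𝟙 a
      step false _ = refl
      step true false = refl
      step true true = refl

    D-card : ∣ S ∣ + ∣ D ∣ ≡ p
    D-card = trans (∣∣-complement S) (size-Fin p)

    X-card : ∣ X ∣ + ∣ complement X ∣ ≡ p
    X-card = trans (∣∣-complement X) (size-Fin p)

    End-D : ∣ End δ D ∣ ≤ 1
    End-D = subst (_≤ 1) (sym (∣End∣-complement δ S)) pS

    D′-nonempty : 1 ≤ ∣ D′ ∣
    D′-nonempty = linarithⁿ 5 (λ d e D s p → d :+ e :≡ D ⇒ e :≤ lit 1 ⇒ s :+ D :≡ p ⇒ s :+ lit 2 :≤ p ⇒ ⊢ (lit 1 :≤ d)) refl _ _ _ _ _ D-split End-D D-card S≤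

    avoid : ∀ d y → D d ≡ true → Y y ≡ true → X (d -ᶠ y) ≢ true
    avoid d y hd hy hx = not-elim hd (trans (cong S (solve 2 (λ d y → d := d ⊕ ⊖ y ⊕ y) refl d y)) (sums (d -ᶠ y) y hx hy))

    -- Such a z is d - y with both d and d + δ outside S, so neither z nor z + δ can be in X. In
    -- particular z is not an end of the complement of X.
    Z-out : ∀ z → Z z ≡ true → X z ≢ true × X (z +ᶠ δ) ≢ true
    Z-out z hz = let d , y , hd , hy , eq = sumset-elim D′ (negated Y) z hz in
      (λ h → avoid d (-ᶠ y) (proj₁ (∧-split hd)) hy
        (trans (cong X (trans (solve 2 (λ d y → d ⊕ ⊖ (⊖ y) := d ⊕ y) refl d y) (sym eq))) h)) ,
      (λ h → avoid (d +ᶠ δ) (-ᶠ y) (proj₂ (∧-split {D d} hd)) hy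
        (trans (cong X (trans (solve 3 (λ d y δ → d ⊕ δ ⊕ ⊖ (⊖ y) := d ⊕ y ⊕ δ) refl d y δ) (cong (_+ᶠ δ) (sym eq)))) h))

    -- The hypothesis on the cardinalities gives |complement X| ≤ |D| + |Y| - 1, and
    -- Cauchy-Davenport for D′ - Y falls short of this by at most the one element of D missing from
    -- D′.
    Z-card : ∣ complement X ∣ ≤ ∣ Z ∣ + 1
    Z-card = let d , hd = 1≤⇒member D′ D′-nonempty in
      conclude (cauchy-davenport′ ∣ negated Y ∣ D′ (negated Y) Z ≤-refl hd
        (trans (cong Y (solve 1 (λ y → ⊖ (⊖ y) := y) refl y₀)) hy₀) (sumset-intro D′ (negated Y)))
      where
      count : ∀ x x′ y d′ e D s p z → x + x′ ≡ p → s + 1 ≤ x + y → d′ + e ≡ D → e ≤ 1 → s + D ≡ p →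
        d′ + y ≤ z + 1 → x′ ≤ z + 1
      count = linarithⁿ 9 (λ x x′ y d′ e D s p z → x :+ x′ :≡ p ⇒ s :+ lit 1 :≤ x :+ y ⇒ d′ :+ e :≡ D ⇒
        e :≤ lit 1 ⇒ s :+ D :≡ p ⇒ d′ :+ y :≤ z :+ lit 1 ⇒ ⊢ (x′ :≤ z :+ lit 1)) refl
      conclude : p ≤ ∣ Z ∣ ⊎ ∣ D′ ∣ + ∣ negated Y ∣ ≤ ∣ Z ∣ + 1 → ∣ complement X ∣ ≤ ∣ Z ∣ + 1
      conclude (inj₁ r) = ≤-trans (≤-trans (m≤n+m _ ∣ X ∣) (≤-reflexive X-card)) (≤-trans r (m≤m+n _ 1))
      conclude (inj₂ r) = count _ _ _ _ _ _ _ _ _ X-card X+Y≥ D-split End-D D-card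
        (subst (λ w → ∣ D′ ∣ + w ≤ ∣ Z ∣ + 1) (∣negated∣ Y) r)

    rest≤1 : ∣ rest ∣ ≤ 1
    rest≤1 = +-cancelˡ-≤ ∣ Z ∣ _ _ (≤-trans (disjoint⇒≤ Z rest (complement X)
        (λ z hz hr → not-elim (proj₂ (∧-split {not (X z)} hr)) hz)
        (λ z hz → not-intro (proj₁ (Z-out z hz))) (λ z hr → proj₁ (∧-split hr))) Z-card)

    unique : ∀ a b → End δ (complement X) a ≡ true → End δ (complement X) b ≡ true → a ≡ b
    unique a b ha hb = ∣∣≤1⇒unique rest rest≤1 (inRest a ha) (inRest b hb)
      where
      inRest : ∀ a → End δ (complement X) a ≡ true → rest a ≡ true
      inRest a ha = let u , v = ∧-split {not (X a)} ha in
        ∧-intro u (not-intro λ hz → proj₂ (Z-out a hz) (trans (sym (not-involutive _)) v))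

  -- If x + y is an end of S, both x and y are ends: a successor of either would put x + y + δ into
  -- S. Unique ends therefore add up to a unique end.
  progression-sum : ∀ δ X Y S → SumsIn X Y S → (∀ z → S z ≡ true → sumset X Y z ≡ true) →
    Progression δ X → Progression δ Y → Progression δ S
  progression-sum δ X Y S sums gen pX pY = unique⇒∣∣≤1 (End δ S) unique
    where
    split′ : ∀ z → End δ S z ≡ true → ∃ λ x → ∃ λ y → End δ X x ≡ true × End δ Y y ≡ true × z ≡ x +ᶠ y
    split′ z hz = let Sz , end = ∧-split {S z} hz
                      x , y , hx , hy , eq = sumset-elim X Y z (gen z Sz) in x , y ,
      ∧-intro hx (not-intro λ h → not-elim end (trans (cong S (trans (cong (_+ᶠ δ) eq)
        (solve 3 (λ x y δ → x ⊕ y ⊕ δ := x ⊕ δ ⊕ y) refl x y δ))) (sums _ _ h hy))) ,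
      ∧-intro hy (not-intro λ h → not-elim end (trans (cong S (trans (cong (_+ᶠ δ) eq)
        (solve 3 (λ x y δ → x ⊕ y ⊕ δ := x ⊕ (y ⊕ δ)) refl x y δ))) (sums _ _ hx h))) , eq
    unique : ∀ a b → End δ S a ≡ true → End δ S b ≡ true → a ≡ b
    unique a b ha hb = let x , y , hx , hy , e = split′ a ha
                           x′ , y′ , hx′ , hy′ , e′ = split′ b hb in
      trans e (trans (cong₂ _+ᶠ_ (∣∣≤1⇒unique (End δ X) pX hx hx′) (∣∣≤1⇒unique (End δ Y) pY hy hy′)) (sym e′))

  -- S contains X + y₁, and X + y₂ adds to it one new element for each end of X with respect to y₂ -
  -- y₁. As |S| ≤ |X| + 1, there is at most one end.
  vosper-pair : ∀ X Y S {y₁ y₂} → Y y₁ ≡ true → Y y₂ ≡ true → y₁ ≢ y₂ → ∣ Y ∣ ≤ 2 → SumsIn X Y S →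
    ∣ S ∣ + 1 ≤ ∣ X ∣ + ∣ Y ∣ → Progression (y₂ -ᶠ y₁) X × Progression (y₂ -ᶠ y₁) Y
  vosper-pair X Y S {y₁} {y₂} h₁ h₂ y₁≢y₂ Y≤2 sums X+Y≥ = pX , pY
    where
    δ = y₂ -ᶠ y₁
    new : Sub
    new z = X (z -ᶠ δ) ∧ not (X z)
    new-card : ∣ new ∣ ≡ ∣ End δ X ∣
    new-card = sym (trans (∣∣-congruence λ z → cong (λ w → X w ∧ not (X (z +ᶠ δ)))
      (solve 2 (λ z δ → z := z ⊕ δ ⊕ ⊖ δ) refl z δ)) (∣∣-translate new δ))
    grow : ∣ X ∣ + ∣ new ∣ ≤ ∣ S ∣
    grow = subst (∣ X ∣ + ∣ new ∣ ≤_) (∣∣-translate S y₁) (disjoint⇒≤ X new (λ z → S (z +ᶠ y₁))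
      (λ z hz hn → not-elim (proj₂ (∧-split {X (z -ᶠ δ)} hn)) hz)
      (λ z hz → sums z y₁ hz h₁)
      (λ z hn → trans (cong S (solve 3 (λ z a b → z ⊕ a := z ⊕ ⊖ (b ⊕ ⊖ a) ⊕ b) refl z y₁ y₂))
        (sums (z -ᶠ δ) y₂ (proj₁ (∧-split hn)) h₂)))
    pX : Progression δ X
    pX = linarithⁿ 5 (λ e n x s y → n :≡ e ⇒ x :+ n :≤ s ⇒ s :+ lit 1 :≤ x :+ y ⇒ y :≤ lit 2 ⇒ ⊢ (e :≤ lit 1)) refl _ _ _ _ _ new-card grow X+Y≥ Y≤2
    pY : Progression δ Y
    pY = ≤-trans (∣∣-mono (End δ Y) (remove Y y₁) λ y hy → ∧-intro (proj₁ (∧-split hy))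
        (not-intro λ e → not-elim (proj₂ (∧-split {Y y} hy))
          (trans (cong Y (trans (cong (_+ᶠ δ) (==-sound e)) (solve 2 (λ a b → a ⊕ (b ⊕ ⊖ a) := b) refl y₁ y₂))) h₂)))
      (≤-pred (subst (_≤ 2) (sym (∣remove∣ Y y₁ h₁)) Y≤2))

  -- When no transform at x − y₀ shrinks Y to a set of at least two elements, the translates of
  -- Y ∖ {y₀} at all x with |Y′| = 1 coincide, which is absurd.
  vosper-stuck : ∀ X Y S {y₀} → Y y₀ ≡ true → 2 ≤ ∣ X ∣ → 3 ≤ ∣ Y ∣ → SumsIn X Y S →
    ∣ S ∣ + 2 ≤ p → ∣ S ∣ + 1 ≤ ∣ X ∣ + ∣ Y ∣ →
    (∀ x → X x ≡ true → ∣ (λ z → Y z ∧ X (z +ᶠ (x -ᶠ y₀))) ∣ ≤ 1 ⊎ ∣ Y ∣ ≤ ∣ (λ z → Y z ∧ X (z +ᶠ (x -ᶠ y₀))) ∣) → ⊥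
  vosper-stuck X Y S {y₀} hy₀ 2≤X 3≤Y sums S≤ X+Y≥ dichotomy =
    let x , hx = 1≤⇒member X₂ (≤-trans (s≤s z≤n) X₂-card)
        x′ , hx′ = 1≤⇒member (remove X₂ x) (≤-pred (subst (2 ≤_) (sym (∣remove∣ X₂ x hx)) X₂-card))
        hx′₂ , x′≢x = ∧-split {X₂ x′} hx′
        y , hy = 1≤⇒member Y₁ (≤-trans (s≤s z≤n) Y₁≥2)
        all = shift-closed Y₁ (x -ᶠ x′) (difference≢0 λ e → not-elim x′≢x (trans (cong (_== x) e) (==-refl x))) (step x x′ hx hx′₂) hy
    in not-elim (proj₂ (∧-split {Y y₀} (all y₀))) (==-refl y₀)
    where
    Yₓ : F → Sub
    Yₓ x z = Y z ∧ X (z +ᶠ (x -ᶠ y₀))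
    X₁ X₂ Y₁ Q : Sub
    X₁ x = X x ∧ not (does (∣ Yₓ x ∣ ≤? 1))
    X₂ x = X x ∧ does (∣ Yₓ x ∣ ≤? 1)
    Y₁ = remove Y y₀
    Q z = S (z +ᶠ y₀) ∧ not (X z)

    X-split : ∣ X₂ ∣ + ∣ X₁ ∣ ≡ ∣ X ∣
    X-split = trans (sym (∑-+ _ _)) (∑-cong λ x → lemma (X x) (does (∣ Yₓ x ∣ ≤? 1)))
      where
      lemma : ∀ a b → 𝟙 (a ∧ b) + 𝟙 (a ∧ not b) ≡ 𝟙 a
      lemma false _ = refl
      lemma true false = refl
      lemma true true = refl

    X⊆S : ∣ X ∣ ≤ ∣ S ∣
    X⊆S = translate-≤ X Y S sums hy₀

    Y₁-card : suc ∣ Y₁ ∣ ≡ ∣ Y ∣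
    Y₁-card = ∣remove∣ Y y₀ hy₀

    Y₁≥2 : 2 ≤ ∣ Y₁ ∣
    Y₁≥2 = ≤-pred (subst (3 ≤_) (sym Y₁-card) 3≤Y)

    X₁-sums : SumsIn X₁ Y (λ z → X (z +ᶠ -ᶠ y₀))
    X₁-sums x y hx hy with ∧-split {X x} hx
    ... | Xx , big with dichotomy x Xx
    ...   | inj₁ small = contradiction small (does-false (∣ Yₓ x ∣ ≤? 1) (¬-not′ big))
      where
      ¬-not′ : ∀ {b} → not b ≡ true → b ≡ false
      ¬-not′ {false} _ = refl
    ...   | inj₂ full = trans (cong X (solve 3 (λ x y z → x ⊕ y ⊕ ⊖ z := y ⊕ (x ⊕ ⊖ z)) refl x y y₀))
      (proj₂ (∧-split {Y y} (⊆∧≥⇒⊇ (Yₓ x) Y (λ z h → proj₁ (∧-split h)) full y hy)))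

    -- For x in X₁ the transform leaves Y whole, so X₁ + Y lies in X + y₀. Cauchy-Davenport then
    -- gives |X₁| ≤ |X| + 1 - |Y|, and |Y| ≥ 3 leaves two elements for X₂.
    X₂-card : 2 ≤ ∣ X₂ ∣
    X₂-card with search X₁
    ... | inj₂ none = subst (2 ≤_) (trans (sym X-split) (trans (cong (∣ X₂ ∣ +_)
            (∑-zero (λ x → cong 𝟙 (none x)))) (+-identityʳ _))) 2≤X
    ... | inj₁ (x , hx) = linarithⁿ 4 (λ a b x y → a :+ b :≡ x ⇒ b :+ y :≤ x :+ lit 1 ⇒ lit 3 :≤ y ⇒ ⊢ (lit 2 :≤ a)) refl _ _ _ _ X-split
        (subst (λ w → ∣ X₁ ∣ + ∣ Y ∣ ≤ w + 1) (∣∣-translate X (-ᶠ y₀))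
          (cauchy-davenport X₁ Y (λ z → X (z +ᶠ -ᶠ y₀)) hx hy₀ X₁-sums
            (subst (_< p) (sym (∣∣-translate X (-ᶠ y₀)))
              (linarithⁿ 3 (λ x s p → x :≤ s ⇒ s :+ lit 2 :≤ p ⇒ ⊢ (x :< p)) refl _ _ _ X⊆S S≤)))) 3≤Y

    Q-card : ∣ Q ∣ ≤ ∣ Y₁ ∣
    Q-card = linarithⁿ 5 (λ q y₁ y x s → x :+ q :≤ s ⇒ s :+ lit 1 :≤ x :+ y ⇒ lit 1 :+ y₁ :≡ y ⇒ ⊢ (q :≤ y₁)) refl _ _ _ _ _
      (subst (∣ X ∣ + ∣ Q ∣ ≤_) (∣∣-translate S y₀) (disjoint⇒≤ X Q (λ z → S (z +ᶠ y₀))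
        (λ z hz hq → not-elim (proj₂ (∧-split {S (z +ᶠ y₀)} hq)) hz) (λ z hz → sums z y₀ hz hy₀) (λ z hq → proj₁ (∧-split hq))))
      X+Y≥ Y₁-card

    R : F → Sub
    R x z = Y₁ (z +ᶠ (y₀ -ᶠ x))

    -- `R x` is the translate of Y without y₀ by x - y₀. A point of it in X would come from a second
    -- element of `Yₓ x`, besides y₀. Cardinalities then force `R x` to be Q for every such x, so Y₁
    -- is closed under differences of X₂.
    R⊆Q : ∀ x → X₂ x ≡ true → ∀ z → R x z ≡ true → Q z ≡ true
    R⊆Q x hx z hr with ∧-split {X x} hx | ∧-split {Y (z +ᶠ (y₀ -ᶠ x))} hr
    ... | Xx , small | Yw , w≢y₀ = ∧-intro
      (trans (cong S (solve 3 (λ x y z → z ⊕ y := x ⊕ (z ⊕ (y ⊕ ⊖ x))) refl x y₀ z)) (sums x _ Xx Yw))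
      (not-intro λ Xz → not-elim w≢y₀ (trans (cong (_== y₀) (∣∣≤1⇒unique (Yₓ x) (does-true (∣ Yₓ x ∣ ≤? 1) small)
        (∧-intro Yw (trans (cong X (solve 3 (λ x y z → z ⊕ (y ⊕ ⊖ x) ⊕ (x ⊕ ⊖ y) := z) refl x y₀ z)) Xz))
        (∧-intro hy₀ (trans (cong X (solve 2 (λ x y → y ⊕ (x ⊕ ⊖ y) := x) refl x y₀)) Xx)))) (==-refl y₀)))

    Q⊆R : ∀ x → X₂ x ≡ true → ∀ z → Q z ≡ true → R x z ≡ true
    Q⊆R x hx = ⊆∧≥⇒⊇ (R x) Q (R⊆Q x hx) (subst (∣ Q ∣ ≤_) (sym (∣∣-translate Y₁ (y₀ -ᶠ x))) Q-card)

    step : ∀ x x′ → X₂ x ≡ true → X₂ x′ ≡ true → ∀ w → Y₁ w ≡ true → Y₁ (w +ᶠ (x -ᶠ x′)) ≡ true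
    step x x′ hx hx′ w hw = trans (cong Y₁ (solve 4 (λ x x′ y w → w ⊕ (x ⊕ ⊖ x′) := w ⊕ (x ⊕ ⊖ y) ⊕ (y ⊕ ⊖ x′)) refl x x′ y₀ w))
      (Q⊆R x′ hx′ (w +ᶠ (x -ᶠ y₀)) (R⊆Q x hx (w +ᶠ (x -ᶠ y₀))
        (trans (cong Y₁ (solve 3 (λ x y w → w ⊕ (x ⊕ ⊖ y) ⊕ (y ⊕ ⊖ x) := w) refl x y₀ w)) hw)))

  -- Induction on |Y| by Dyson transforms. S is common to all the pairs: once the smaller pair
  -- consists of progressions with difference δ, so does S, and from S the property passes back to
  -- the original X and Y.
  vosper′ : ∀ n X Y S → ∣ Y ∣ ≤ n → 2 ≤ ∣ X ∣ → 2 ≤ ∣ Y ∣ → SumsIn X Y S →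
    ∣ S ∣ + 2 ≤ p → ∣ S ∣ + 1 ≤ ∣ X ∣ + ∣ Y ∣ →
    ∃ λ δ → δ ≢ 0ᶠ × Progression δ X × Progression δ Y
  vosper′ zero X Y S Y≤n 2≤X 2≤Y sums S≤ X+Y≥ = contradiction (≤-trans 2≤Y Y≤n) λ ()
  vosper′ (suc n) X Y S Y≤n 2≤X 2≤Y sums S≤ X+Y≥ with 1≤⇒member Y (≤-trans (s≤s z≤n) 2≤Y)
  ... | y₀ , hy₀ with ∣ Y ∣ ≤? 2
  ...   | yes Y≤2 = let y , hy = 1≤⇒member (remove Y y₀) (≤-pred (subst (2 ≤_) (sym (∣remove∣ Y y₀ hy₀)) 2≤Y))
                        Yy , y≢ = ∧-split {Y y} hy
                        y₀≢y = λ e → not-elim y≢ (trans (cong (_== y₀) (sym e)) (==-refl y₀)) in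
      (y -ᶠ y₀) , difference≢0 y₀≢y , vosper-pair X Y S hy₀ Yy y₀≢y Y≤2 sums X+Y≥
  ...   | no Y≰2 with search (λ x → X x ∧ (not (does (c x ≤? 1)) ∧ not (does (∣ Y ∣ ≤? c x))))
    where
    c : F → ℕ
    c x = ∣ (λ z → Y z ∧ X (z +ᶠ (x -ᶠ y₀))) ∣
  ...     | inj₂ none = ⊥-elim (vosper-stuck X Y S hy₀ 2≤X (≰⇒> Y≰2) sums S≤ X+Y≥ dichotomy)
    where
    dichotomy : ∀ x → X x ≡ true → _ ⊎ _
    dichotomy x hx with ∣ (λ z → Y z ∧ X (z +ᶠ (x -ᶠ y₀))) ∣ ≤? 1
    ... | yes a = inj₁ a
    ... | no a with ∣ Y ∣ ≤? ∣ (λ z → Y z ∧ X (z +ᶠ (x -ᶠ y₀))) ∣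
    ...   | yes b = inj₂ b
    ...   | no b = contradiction (trans (sym (none x)) (∧-intro hx (∧-intro (no-does (∣ (λ z → Y z ∧ X (z +ᶠ (x -ᶠ y₀))) ∣ ≤? 1) a) (no-does (∣ Y ∣ ≤? ∣ (λ z → Y z ∧ X (z +ᶠ (x -ᶠ y₀))) ∣) b)))) λ ()
      where
      no-does : ∀ {P : Set} (P? : Dec P) → ¬ P → not (does P?) ≡ true
      no-does P? ¬p = not-intro λ e → ¬p (does-true P? e)
  ...     | inj₁ (x , hx) = finish (vosper′ n X′ Y′ S Y′≤n (≤-trans 2≤X (∣∣-mono X X′ X⊆X′)) Y′≥2 sums′ S≤
              (subst (∣ S ∣ + 1 ≤_) (sym card-sum) X+Y≥))
    where
    open Transform X Y S sums (x -ᶠ y₀)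
    parts = ∧-split {X x} hx
    no-elim : ∀ {P : Set} (P? : Dec P) → not (does P?) ≡ true → ¬ P
    no-elim (no ¬p) _ = ¬p
    Y′≥2 : 2 ≤ ∣ Y′ ∣
    Y′≥2 = ≰⇒> (no-elim (∣ Y′ ∣ ≤? 1) (proj₁ (∧-split (proj₂ parts))))
    Y′≤n : ∣ Y′ ∣ ≤ n
    Y′≤n = ≤-pred (≤-trans (≰⇒> (no-elim (∣ Y ∣ ≤? ∣ Y′ ∣) (proj₂ (∧-split {not (does (∣ Y′ ∣ ≤? 1))} (proj₂ parts))))) Y≤n)
    -- Cauchy-Davenport for the transformed pair already yields |X| + |Y| - 1 ≥ |S| sums, so S has
    -- no other elements.
    generated : ∀ z → S z ≡ true → sumset X′ Y′ z ≡ true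
    generated = let x₁ , h₁ = 1≤⇒member X (≤-trans (s≤s z≤n) 2≤X)
                    y₁ , k₁ = 1≤⇒member Y′ (≤-trans (s≤s z≤n) Y′≥2)
                    T⊆S = ∣∣-mono (sumset X′ Y′) S (sumset-⊆ X′ Y′ S sums′) in
      ⊆∧≥⇒⊇ (sumset X′ Y′) S (sumset-⊆ X′ Y′ S sums′)
        (linarithⁿ 6 (λ t s x y x′ y′ → x′ :+ y′ :≤ t :+ lit 1 ⇒ s :+ lit 1 :≤ x :+ y ⇒ x′ :+ y′ :≡ x :+ y ⇒ ⊢ (s :≤ t)) refl
          _ _ (∣ X ∣) (∣ Y ∣) (∣ X′ ∣) (∣ Y′ ∣)
          (cauchy-davenport X′ Y′ (sumset X′ Y′) (X⊆X′ x₁ h₁) k₁ (sumset-intro X′ Y′)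
            (linarithⁿ 3 (λ t s p → t :≤ s ⇒ s :+ lit 2 :≤ p ⇒ ⊢ (t :< p)) refl _ _ _ T⊆S S≤))
          X+Y≥ card-sum)
    finish : (∃ λ δ → δ ≢ 0ᶠ × Progression δ X′ × Progression δ Y′) → ∃ λ δ → δ ≢ 0ᶠ × Progression δ X × Progression δ Y
    finish (δ , δ≢0 , pX′ , pY′) = δ , δ≢0 , progression-summand δ X Y S hy₀ sums pS S≤ X+Y≥ ,
        progression-summand δ Y X S (proj₁ parts) swapped pS S≤ (subst (∣ S ∣ + 1 ≤_) (+-comm ∣ X ∣ ∣ Y ∣) X+Y≥)
      where
      pS = progression-sum δ X′ Y′ S sums′ generated pX′ pY′
      swapped : SumsIn Y X S
      swapped y x hy hx = trans (cong S (+ᶠ-comm y x)) (sums x y hx hy)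

  vosper : ∀ X Y S → 2 ≤ ∣ X ∣ → 2 ≤ ∣ Y ∣ → SumsIn X Y S → ∣ S ∣ + 2 ≤ p → ∣ S ∣ + 1 ≤ ∣ X ∣ + ∣ Y ∣ →
    ∃ λ δ → δ ≢ 0ᶠ × Progression δ X
  vosper X Y S a b c d e = let δ , h , pX , _ = vosper′ ∣ Y ∣ X Y S ≤-refl a b c d e in δ , h , pX

-- A sum-free set of m residues lies in a progression of length m + 2.

module SumFreeLine (p : ℕ) .{{_ : NonZero p}} (prime : Prime p) where

  open LinearArithmetic
  open Sums
  open Residues p
  open PrimeField p prime
  open Vosper p prime
  open import Defs using (cardF; sumsetF; Covering; MBoundT; _-ₚ_; _*ₚ_)
  open import Data.Bool using (Bool; true; false; not; _∧_)
  open import Data.Bool.ListAction using (any)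
  open import Data.Fin using (toℕ)
  import Data.Fin.Properties as FinP
  open import Data.Integer as ℤ using (ℤ; 0ℤ; 1ℤ)
  open import Data.List using (_∷_; allFin)
  open import Data.List.Membership.Propositional using (_∈_)
  open import Data.List.Relation.Unary.Any using (here; there)
  open import Data.Nat using (zero; suc; _+_; _*_; _∸_; _≤_; _<_; z≤n; s≤s)
  open import Data.Nat.Properties
  open import Data.Product using (∃; _×_; _,_; proj₁; proj₂)
  open import Data.Sum using (inj₁; inj₂)
  open import Relation.Binary.PropositionalEquality hiding ([_])
  open import Relation.Nullary using (yes; no; contradiction)
  open FSolver using (solve; _:=_; con) renaming (_:+_ to _⊕_; _:-_ to _⊖_; _:*_ to _⊗_; :-_ to ⊖_)

  cardF≡∣∣ : ∀ X → cardF p X ≡ ∣ X ∣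
  cardF≡∣∣ X = trans (count≡sumOver X (allFin p)) (sym (∑≡sumOver (λ x → 𝟙 (X x))))

  any-intro : ∀ {A : Set} (Q : A → Bool) xs {x} → x ∈ xs → Q x ≡ true → any Q xs ≡ true
  any-intro Q (x ∷ xs) (here refl) h = ∨-introˡ h
  any-intro Q (x ∷ xs) (there i) h = ∨-introʳ (any-intro Q xs i h)

  any-elim : ∀ {A : Set} (Q : A → Bool) xs → any Q xs ≡ true → ∃ λ x → Q x ≡ true
  any-elim Q (x ∷ xs) h with ∨-elim {Q x} h
  ... | inj₁ e = x , e
  ... | inj₂ e = any-elim Q xs e

  -ₚ≡-ᶠ : ∀ a b → _-ₚ_ p a b ≡ a -ᶠ b
  -ₚ≡-ᶠ a b = sym (trans (cong (a +ᶠ_) (-ᶠ≡negₚ b)) (+ᶠ≡+ₚ a _))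

  opaque
    double : Sub → Sub
    double = sumsetF p

    double≡sumsetF : ∀ X → double X ≡ sumsetF p X
    double≡sumsetF X = refl

    double-elim : ∀ X z → double X z ≡ true → ∃ λ x → ∃ λ y → X x ≡ true × X y ≡ true × z ≡ x +ᶠ y
    double-elim X z h = let x , e = any-elim (λ u → X u ∧ X (_-ₚ_ p z u)) (allFin p) h
                            hx , hy = ∧-split {X x} e in
      x , _-ₚ_ p z x , hx , hy ,
      trans (solve 2 (λ x z → z := x ⊕ (z ⊕ ⊖ x)) refl x z) (cong (x +ᶠ_) (sym (-ₚ≡-ᶠ z x)))

  -- (3,2)-sum-freeness says x + (a + b) ≠ c + d, and (4,1)-sum-freeness says x − (a + b) ≠ c + d.
  data Sign : Set where
    plus minus : Sign

  sgn : Sign → F → F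
  sgn plus x = x
  sgn minus x = -ᶠ x

  sgn-sgn : ∀ σ x → sgn σ (sgn σ x) ≡ x
  sgn-sgn plus x = refl
  sgn-sgn minus x = solve 1 (λ x → ⊖ (⊖ x) := x) refl x

  SumFreeF : Sign → Sub → Set
  SumFreeF σ X = ∀ x a b c d → X x ≡ true → X a ≡ true → X b ≡ true → X c ≡ true → X d ≡ true →
    x +ᶠ sgn σ (a +ᶠ b) ≢ c +ᶠ d

  InProgression : Sub → F → F → ℕ → Set
  InProgression X a δ n = ∀ x → X x ≡ true → ∃ λ i → i < n × x ≡ a +ᶠ [ ℤ.+ i ] *ᶠ δ

  -- The listing runs backwards from the unique end t. Walking from x by steps δ cannot leave X
  -- before t, so the i + 1 points met on the way are distinct elements of X, and i < |X|. Without
  -- any end, X would be empty or everything.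
  progression-listing : ∀ δ X → δ ≢ 0ᶠ → Progression δ X → ∣ X ∣ < p → ∃ λ a → InProgression X a (-ᶠ δ) ∣ X ∣
  progression-listing δ X δ≢0 pX X<p with search (End δ X)
  ... | inj₂ none with search X
  ...   | inj₂ empty = 0ᶠ , λ x h → contradiction (trans (sym h) (empty x)) λ ()
  ...   | inj₁ (x₀ , h₀) = contradiction X<p (≤⇒≯ (subst (_≤ ∣ X ∣) (size-Fin p)
            (∑-mono {f = λ _ → 1} (λ z → ≤-reflexive (cong 𝟙 (sym (shift-closed X δ δ≢0 closed h₀ z)))))))
    where
    closed : ∀ x → X x ≡ true → X (x +ᶠ δ) ≡ true
    closed x h with X (x +ᶠ δ) in e
    ... | true = refl
    ... | false = contradiction (trans (sym (none x)) (∧-intro h (cong not e))) λ ()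
  progression-listing δ X δ≢0 pX X<p | inj₁ (t , ht) with inverse δ δ≢0
  ... | b , δb = t , listed
    where
    at-step : F → ℕ → F
    at-step x k = x +ᶠ [ ℤ.+ k ] *ᶠ δ
    listed : InProgression X t (-ᶠ δ) ∣ X ∣
    listed x hx = i , small , x-eq
      where
      i = toℕ (b *ᶠ (t -ᶠ x))
      reach : at-step x i ≡ t
      reach = trans (cong (λ w → x +ᶠ w *ᶠ δ) ([]-ι (b *ᶠ (t -ᶠ x))))
        (trans (solve 4 (λ x b w δ → x ⊕ b ⊗ w ⊗ δ := x ⊕ (δ ⊗ b) ⊗ w) refl x b (t -ᶠ x) δ)
          (trans (cong (λ w → x +ᶠ w *ᶠ (t -ᶠ x)) δb) (solve 2 (λ x z → x ⊕ con 1ℤ ⊗ (z ⊕ ⊖ x) := z) refl x t)))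
      x-eq : x ≡ t +ᶠ [ ℤ.+ i ] *ᶠ -ᶠ δ
      x-eq = trans (solve 3 (λ x k δ → x := x ⊕ k ⊗ δ ⊕ k ⊗ ⊖ δ) refl x [ ℤ.+ i ] δ) (cong (_+ᶠ [ ℤ.+ i ] *ᶠ -ᶠ δ) reach)
      i<p : i < p
      i<p = FinP.toℕ<n _
      step-injective : ∀ {k l} → k < p → l < p → at-step x k ≡ at-step x l → k ≡ l
      step-injective {k} {l} k<p l<p e = <p⇒≡ k<p l<p ([]-injective (*ᶠ-cancelˡ δ δ≢0
        (trans (solve 3 (λ x k δ → δ ⊗ k := x ⊕ k ⊗ δ ⊕ ⊖ x) refl x [ ℤ.+ k ] δ)
          (trans (cong (_-ᶠ x) e) (solve 3 (λ x k δ → x ⊕ k ⊗ δ ⊕ ⊖ x := δ ⊗ k) refl x [ ℤ.+ l ] δ)))))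
      inside : ∀ k → k ≤ i → X (at-step x k) ≡ true
      inside zero _ = trans (cong X (solve 2 (λ x δ → x ⊕ con 0ℤ ⊗ δ := x) refl x δ)) hx
      inside (suc k) k<i = trans (cong X (trans (cong (λ w → x +ᶠ w *ᶠ δ) (sym ([]-+ 1ℤ (ℤ.+ k))))
          (solve 3 (λ x k δ → x ⊕ (con 1ℤ ⊕ k) ⊗ δ := x ⊕ k ⊗ δ ⊕ δ) refl x [ ℤ.+ k ] δ))) successor
        where
        successor : X (at-step x k +ᶠ δ) ≡ true
        successor with X (at-step x k +ᶠ δ) in e
        ... | true = refl
        ... | false = contradiction
          (step-injective (<-trans k<i i<p) i<p (trans (∣∣≤1⇒unique (End δ X) pX (∧-intro (inside k (<⇒≤ k<i)) (cong not e)) ht) (sym reach)))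
          (<⇒≢ k<i)
      small : i < ∣ X ∣
      small = begin
        suc i                                              ≡⟨ trans (sym (*-identityʳ (suc i))) (sym (∑<-const (suc i) 1)) ⟩
        ∑< (suc i) (λ _ → 1)                               ≤⟨ ∑<-mono (suc i) (λ k k≤i → ≤-reflexive (cong 𝟙 (sym (inside k (≤-pred k≤i))))) ⟩
        ∑< (suc i) (λ k → 𝟙 (X (at-step x k)))             ≤⟨ m≤m+n _ _ ⟩
        ∑< (suc i) (λ k → 𝟙 (X (at-step x k))) + ∑< (p ∸ suc i) (λ k → 𝟙 (X (at-step x (suc i + k))))
                                                           ≡⟨ ∑<-split (suc i) (p ∸ suc i) (λ k → 𝟙 (X (at-step x k))) ⟨
        ∑< (suc i + (p ∸ suc i)) (λ k → 𝟙 (X (at-step x k))) ≡⟨ cong (λ n → ∑< n (λ k → 𝟙 (X (at-step x k)))) (m+[n∸m]≡n i<p) ⟩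
        ∑< p (λ k → 𝟙 (X (at-step x k)))                   ≡⟨ ∑-Fin p (λ k → 𝟙 (X (at-step x k))) ⟨
        ∑ {F} (λ k → 𝟙 (X (at-step x (toℕ k))))            ≡⟨ ∑-bijection (λ k → at-step x (toℕ k)) (λ y → b *ᶠ (y -ᶠ x)) left right (λ y → 𝟙 (X y)) ⟩
        ∣ X ∣                                              ∎
        where
        open ≤-Reasoning
        left : ∀ k → b *ᶠ (at-step x (toℕ k) -ᶠ x) ≡ k
        left k = trans (cong (λ w → b *ᶠ (x +ᶠ w *ᶠ δ -ᶠ x)) ([]-ι k))
          (trans (solve 4 (λ x b k δ → b ⊗ (x ⊕ k ⊗ δ ⊕ ⊖ x) := (δ ⊗ b) ⊗ k) refl x b k δ) (trans (cong (_*ᶠ k) δb) (*ᶠ-identityˡ k)))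
        right : ∀ y → at-step x (toℕ (b *ᶠ (y -ᶠ x))) ≡ y
        right y = trans (cong (λ w → x +ᶠ w *ᶠ δ) ([]-ι (b *ᶠ (y -ᶠ x))))
          (trans (solve 4 (λ x b y δ → x ⊕ b ⊗ (y ⊕ ⊖ x) ⊗ δ := x ⊕ (δ ⊗ b) ⊗ (y ⊕ ⊖ x)) refl x b y δ)
            (trans (cong (λ w → x +ᶠ w *ᶠ (y -ᶠ x)) δb) (solve 2 (λ x z → x ⊕ con 1ℤ ⊗ (z ⊕ ⊖ x) := z) refl x y)))

  module _ (m : ℕ) (p≡ : p ≡ 3 + 5 * m) (21≤m : 21 ≤ m) (bound : MBoundT m) (σ : Sign)
    (X : Sub) (X≡m : ∣ X ∣ ≡ m) (free : SumFreeF σ X) where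

    private
      T Y S : Sub
      T = double X
      Y z = T (sgn σ z)
      S = complement T

      Y-card : ∣ Y ∣ ≡ ∣ T ∣
      Y-card = ∣∣-bijection (sgn σ) (sgn σ) (sgn-sgn σ) (sgn-sgn σ) T

      -- Sum-freeness as a sumset inclusion: X + σ2X lies in the complement of 2X, and |σ2X| = |2X|.
      sums : SumsIn X Y S
      sums x y hx hy = not-intro λ hT →
        let a , b , ha , hb , e = double-elim X (sgn σ y) hy
            c , d , hc , hd , e′ = double-elim X (x +ᶠ y) hT
        in free x a b c d hx ha hb hc hd (trans (cong (x +ᶠ_) (trans (cong (sgn σ) (sym e)) (sgn-sgn σ y))) e′)

      S-card : ∣ T ∣ + ∣ S ∣ ≡ p
      S-card = trans (∣∣-complement T) (size-Fin p)

      nondegenerate : ∀ a n {δ} → InProgression X a δ n → δ ≢ 0ᶠ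
      nondegenerate a n h refl = contradiction (subst (_≤ 1) X≡m (unique⇒∣∣≤1 X λ x y hx hy → trans (at-a x hx) (sym (at-a y hy))))
        (<⇒≱ (≤-trans (s≤s (s≤s z≤n)) 21≤m))
        where
        at-a : ∀ x → X x ≡ true → x ≡ a
        at-a x hx = let i , _ , e = h x hx in trans e (solve 2 (λ a i → a ⊕ i ⊗ con 0ℤ := a) refl a [ ℤ.+ i ])

      Result : Set
      Result = ∃ λ a → ∃ λ δ → δ ≢ 0ᶠ × InProgression X a δ (m + 2)

      weaken : ∀ {a δ n} → n ≤ m + 2 → InProgression X a δ n → InProgression X a δ (m + 2)
      weaken le h x hx = let i , lt , e = h x hx in i , ≤-trans lt le , e

      neg≢0 : ∀ {δ} → δ ≢ 0ᶠ → -ᶠ δ ≢ 0ᶠ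
      neg≢0 {δ} δ≢0 e = δ≢0 (trans (solve 1 (λ δ → δ := con 0ℤ ⊕ ⊖ (⊖ δ)) refl δ) (trans (cong (λ w → 0ᶠ +ᶠ -ᶠ w) e)
        (solve 0 (con 0ℤ ⊕ ⊖ con 0ℤ := con 0ℤ) refl)))

      -- With |S| = 5m + 3 - |T| the assumption reads |S| + 1 ≤ |X| + |Y|, which is the hypothesis
      -- of Vosper's theorem; the progression even has length m.
      extremal : 2 * m + 2 ≤ ∣ T ∣ → Result
      extremal le =
        let δ , δ≢0 , pX = vosper X Y S (subst (2 ≤_) (sym X≡m) (≤-trans (s≤s (s≤s z≤n)) 21≤m))
              (subst (2 ≤_) (sym Y-card) (linarithⁿ 2 (λ m t → 2 :* m :+ lit 2 :≤ t ⇒ ⊢ (lit 2 :≤ t)) refl m _ le)) sums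
              (linarithⁿ 4 (λ m t s p → 2 :* m :+ lit 2 :≤ t ⇒ t :+ s :≡ p ⇒ ⊢ (s :+ lit 2 :≤ p)) refl m _ _ _ le S-card)
              (subst₂ (λ u v → ∣ S ∣ + 1 ≤ u + v) (sym X≡m) (sym Y-card)
                (linarithⁿ 4 (λ m t s p → p :≡ lit 3 :+ 5 :* m ⇒ 2 :* m :+ lit 2 :≤ t ⇒ t :+ s :≡ p ⇒ ⊢ (s :+ lit 1 :≤ m :+ t)) refl
                  m _ _ _ p≡ le S-card))
            a , h = progression-listing δ X δ≢0 pX
              (subst (_< p) (sym X≡m) (linarithⁿ 2 (λ m p → p :≡ lit 3 :+ 5 :* m ⇒ ⊢ (m :< p)) refl m p p≡))
        in a , -ᶠ δ , neg≢0 δ≢0 , weaken (subst (_≤ m + 2) (sym X≡m) (m≤m+n m 2)) h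

      -- Here τ = 4/m serves: (2 + 4/m)m - 3 is 2m + 1, and 4/m lies below the bound 5/m of
      -- `MBoundT`. The covering progression has length at most (2m + 1) - m + 1 = m + 2.
      generic : ∣ T ∣ ≤ 2 * m + 1 → Result
      generic le = a , δ , nondegenerate a (m + 2) listed , listed
        where
        double≡ : cardF p (sumsetF p X) ≡ ∣ T ∣
        double≡ = trans (cardF≡∣∣ (sumsetF p X)) (cong ∣_∣ (sym (double≡sumsetF X)))
        X≡ : cardF p X ≡ m
        X≡ = trans (cardF≡∣∣ X) X≡m
        covering : Covering p X
        covering = proj₂ (proj₂ (bound 4 m (s≤s z≤n) (≤-trans (s≤s (s≤s (s≤s (s≤s z≤n)))) 21≤m)
            (linarithⁿ 1 (λ m → lit 21 :≤ m ⇒ ⊢ (4 :* m :< 5 :* m)) refl m 21≤m)))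
          p prime X
          (subst₂ (λ u v → 5 * u ≤ v) (sym X≡) (sym (trans (*-identityˡ p) p≡)) (m≤n+m (5 * m) 3))
          (subst₂ (λ u v → m * u + 3 * m ≤ (2 * m + 4) * v) (sym double≡) (sym X≡)
            (≤-trans (≤-reflexive (trans (cong (_+ 3 * m) (*-comm m ∣ T ∣)) (sym (*-distribʳ-+ m ∣ T ∣ 3))))
              (*-monoˡ-≤ m (linarithⁿ 2 (λ m t → t :≤ 2 :* m :+ lit 1 ⇒ ⊢ (t :+ lit 3 :≤ 2 :* m :+ lit 4)) refl m _ le))))
        a = proj₁ covering
        δ = proj₁ (proj₂ covering)
        listed : InProgression X a δ (m + 2)
        listed x hx = let i , lt , e = proj₂ (proj₂ covering) x hx in i , ≤-trans lt length≤ ,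
          trans e (sym (trans (+ᶠ≡+ₚ a _) (cong (Defs._+ₚ_ p a) (trans (*ᶠ≡*ₚ _ δ) (cong (λ w → _*ₚ_ p w δ) (sym (⟦⟧≡[] i)))))))
          where
          length≤ : cardF p (sumsetF p X) ∸ cardF p X + 1 ≤ m + 2
          length≤ = subst₂ (λ u v → u ∸ v + 1 ≤ m + 2) (sym double≡) (sym X≡)
            (≤-trans (+-monoˡ-≤ 1 (∸-monoˡ-≤ m le)) (≤-reflexive (trans (cong (_+ 1) (trans (cong (_∸ m) (arrange m)) (m+n∸m≡n m (m + 1)))) (+-assoc m 1 1))))
            where
            arrange : ∀ m → 2 * m + 1 ≡ m + (m + 1)
            arrange = linarithⁿ 1 (λ m → ⊢ (2 :* m :+ lit 1 :≡ m :+ (m :+ lit 1))) refl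

    covered-by-progression : ∃ λ a → ∃ λ δ → δ ≢ 0ᶠ × InProgression X a δ (m + 2)
    covered-by-progression with 2 * m + 2 ≤? ∣ T ∣
    ... | yes le = extremal le
    ... | no ¬le = generic (≤-pred (subst (suc ∣ T ∣ ≤_) (+-suc (2 * m) 1) (≰⇒> ¬le)))

-- Long intervals in sums of dense sets of integers.

module Intervals where

  open LinearArithmetic
  open Sums
  open import Data.Bool using (Bool; true; false; _∧_)
  open import Data.Nat using (ℕ; zero; suc; _+_; _*_; _∸_; _≤_; _<_; z≤n; s≤s)
  open import Data.Nat.Properties
  open import Data.Product using (∃; _×_; _,_)
  open import Data.Sum using (_⊎_; inj₁; inj₂)
  open import Relation.Binary.PropositionalEquality
  open import Relation.Nullary using (yes; no; contradiction)

  least< : ∀ n (B : ℕ → Bool) →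
    (∃ λ k → k < n × B k ≡ true × (∀ i → i < k → B i ≡ false)) ⊎ (∀ i → i < n → B i ≡ false)
  least< zero B = inj₂ λ i ()
  least< (suc n) B with least< n B
  ... | inj₁ (k , lt , h) = inj₁ (k , m<n⇒m<1+n lt , h)
  ... | inj₂ none with B n in e
  ...   | true = inj₁ (n , ≤-refl , e , none)
  ...   | false = inj₂ below
    where
    below : ∀ i → i < suc n → B i ≡ false
    below i (s≤s i≤n) with m≤n⇒m<n∨m≡n i≤n
    ... | inj₁ lt = none i lt
    ... | inj₂ refl = e

  𝟙∘ : (ℕ → Bool) → ℕ → ℕ
  𝟙∘ P i = 𝟙 (P i)

  -- a - 1 is the largest number below L that is not a sum, with a = 0 if there is none. Since i and
  -- a - 1 - i are never both admissible, P and Q together have at most a elements below a.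
  left-end : ∀ (P Q : ℕ → Bool) L → ∃ λ a → a ≤ L × ∑< a (𝟙∘ P) + ∑< a (𝟙∘ Q) ≤ a ×
    (∀ z → a ≤ z → z < L → ∃ λ i → ∃ λ j → i + j ≡ z × P i ≡ true × Q j ≡ true)
  left-end P Q zero = zero , z≤n , z≤n , λ z _ ()
  left-end P Q (suc L) with least< (suc L) (λ i → P i ∧ Q (L ∸ i))
  ... | inj₁ (i , s≤s i≤L , h , _) = let a , a≤L , le , cov = left-end P Q L in
      a , m≤n⇒m≤1+n a≤L , le , λ z a≤z z<sL → extend cov z a≤z (m≤n⇒m<n∨m≡n (≤-pred z<sL))
    where
    extend : ∀ {a} → (∀ z → a ≤ z → z < L → ∃ λ i → ∃ λ j → i + j ≡ z × P i ≡ true × Q j ≡ true) →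
      ∀ z → a ≤ z → z < L ⊎ z ≡ L → ∃ λ i → ∃ λ j → i + j ≡ z × P i ≡ true × Q j ≡ true
    extend cov z a≤z (inj₁ z<L) = cov z a≤z z<L
    extend cov z a≤z (inj₂ refl) = i , L ∸ i , m+[n∸m]≡n i≤L , ∧-split h
  ... | inj₂ none = suc L , ≤-refl , bound , λ z a≤z z<L → contradiction a≤z (<⇒≱ z<L)
    where
    one : ∀ a b → a ∧ b ≡ false → 𝟙 a + 𝟙 b ≤ 1
    one false b _ = 𝟙≤1 b
    one true false _ = ≤-refl
    bound : ∑< (suc L) (𝟙∘ P) + ∑< (suc L) (𝟙∘ Q) ≤ suc L
    bound = begin
      ∑< (suc L) (𝟙∘ P) + ∑< (suc L) (𝟙∘ Q)                  ≡⟨ cong (∑< (suc L) (𝟙∘ P) +_) (∑<-reverse L (𝟙∘ Q)) ⟩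
      ∑< (suc L) (𝟙∘ P) + ∑< (suc L) (λ i → 𝟙 (Q (L ∸ i)))   ≡⟨ ∑<-+ (suc L) (𝟙∘ P) (λ i → 𝟙 (Q (L ∸ i))) ⟨
      ∑< (suc L) (λ i → 𝟙 (P i) + 𝟙 (Q (L ∸ i)))             ≤⟨ ∑<-mono (suc L) (λ i lt → one (P i) (Q (L ∸ i)) (none i lt)) ⟩
      ∑< (suc L) (λ _ → 1)                                   ≡⟨ trans (∑<-const (suc L) 1) (*-identityʳ (suc L)) ⟩
      suc L                                                  ∎
      where open ≤-Reasoning

  ∑<≤ : ∀ n (P : ℕ → Bool) → ∑< n (𝟙∘ P) ≤ n
  ∑<≤ n P = ≤-trans (∑<-mono n (λ i _ → 𝟙≤1 (P i))) (≤-reflexive (trans (∑<-const n 1) (*-identityʳ n)))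

  ∑<-prefix : ∀ a n (P : ℕ → Bool) → a ≤ n → ∑< n (𝟙∘ P) + a ≤ ∑< a (𝟙∘ P) + n
  ∑<-prefix a n P a≤n = subst (λ n → ∑< n (𝟙∘ P) + a ≤ ∑< a (𝟙∘ P) + n) (m+[n∸m]≡n a≤n)
    (linarithⁿ 5 (λ s u v a c → s :≡ u :+ v ⇒ v :≤ c ⇒ ⊢ (s :+ a :≤ u :+ (a :+ c))) refl
      _ (∑< a (𝟙∘ P)) _ a (n ∸ a) (∑<-split a (n ∸ a) (𝟙∘ P)) (∑<≤ (n ∸ a) (λ i → P (a + i))))

  ∑<-suffix : ∀ a n l (f : ℕ → ℕ) → a + n ≡ suc l → ∑< n (λ i → f (a + i)) ≡ ∑< n (λ i → f (l ∸ i))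
  ∑<-suffix a zero l f e = refl
  ∑<-suffix a (suc n) l f e = trans (∑<-reverse n (λ i → f (a + i)))
    (∑<-cong (suc n) λ i i≤n → cong f (trans (sym (+-∸-assoc a (≤-pred i≤n))) (cong (_∸ i) (suc-injective (trans (sym (+-suc a n)) e)))))

  ∑<-ends : ∀ a b l (P : ℕ → Bool) → a + b ≤ suc l →
    ∑< (suc l) (𝟙∘ P) + a + b ≤ ∑< a (𝟙∘ P) + ∑< b (λ i → 𝟙 (P (l ∸ i))) + suc l
  ∑<-ends a b l P a+b≤ = linear _ (∑< a (𝟙∘ P)) (∑< (b + c) (λ i → 𝟙 (P (l ∸ i)))) (∑< b (λ i → 𝟙 (P (l ∸ i)))) a b c (suc l)
      (trans (cong (λ n → ∑< n (𝟙∘ P)) (sym l≡)) (trans (∑<-split a (b + c) (𝟙∘ P)) (cong (∑< a (𝟙∘ P) +_) (∑<-suffix a (b + c) l (𝟙∘ P) l≡))))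
      (≤-trans (≤-reflexive (∑<-split b c (λ i → 𝟙 (P (l ∸ i))))) (+-monoʳ-≤ _ (∑<≤ c (λ i → P (l ∸ (b + i)))))) l≡
    where
    c = suc l ∸ (a + b)
    l≡ : a + (b + c) ≡ suc l
    l≡ = trans (sym (+-assoc a b c)) (m+[n∸m]≡n a+b≤)
    linear : ∀ s u r w a b c l → s ≡ u + r → r ≤ w + c → a + (b + c) ≡ l → s + a + b ≤ u + w + l
    linear = linarithⁿ 8 (λ s u r w a b c l → s :≡ u :+ r ⇒ r :≤ w :+ c ⇒ a :+ (b :+ c) :≡ l ⇒ ⊢ (s :+ a :+ b :≤ u :+ w :+ l)) refl

  -- `left-end` and its mirror image give a and b such that P and Q miss at least a elements at the
  -- bottom and b at the top, so n ≤ 2(l + 1) - a - b, and the sums from a to 2l - b include n - 1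
  -- consecutive ones. The bound 3l + 3 ≤ 2n keeps the two end segments disjoint.
  interval-in-sumset : ∀ l n (P Q : ℕ → Bool) → n ≤ ∑< (suc l) (𝟙∘ P) + ∑< (suc l) (𝟙∘ Q) →
    3 * l + 3 ≤ 2 * n →
    ∃ λ a → ∀ z → a ≤ z → z + 2 ≤ a + n → ∃ λ i → ∃ λ j → i + j ≡ z × P i ≡ true × Q j ≡ true
  interval-in-sumset l n P Q n≤ small with left-end P Q l | left-end (λ i → P (l ∸ i)) (λ i → Q (l ∸ i)) (suc l)
  ... | a , a≤l , sumₐ , covₐ | b , b≤l , sum_b , cov_b = a , cover
    where
    RP = λ i → P (l ∸ i)
    RQ = λ i → Q (l ∸ i)
    oneSide : ∀ p q sp sq a n l → p + a ≤ sp + (1 + l) → q + a ≤ sq + (1 + l) → sp + sq ≤ a → n ≤ p + q → a + n ≤ 2 * l + 2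
    oneSide = linarithⁿ 7 (λ p q sp sq a n l → p :+ a :≤ sp :+ (lit 1 :+ l) ⇒ q :+ a :≤ sq :+ (lit 1 :+ l) ⇒ sp :+ sq :≤ a ⇒
      n :≤ p :+ q ⇒ ⊢ (a :+ n :≤ 2 :* l :+ lit 2)) refl
    bothSides : ∀ p q sp sq rp rq a b n l → p + a + b ≤ sp + rp + (1 + l) → q + a + b ≤ sq + rq + (1 + l) → sp + sq ≤ a → rp + rq ≤ b →
      n ≤ p + q → a + b + n ≤ 2 * l + 2
    bothSides = linarithⁿ 10 (λ p q sp sq rp rq a b n l → p :+ a :+ b :≤ sp :+ rp :+ (lit 1 :+ l) ⇒
      q :+ a :+ b :≤ sq :+ rq :+ (lit 1 :+ l) ⇒ sp :+ sq :≤ a ⇒ rp :+ rq :≤ b ⇒ n :≤ p :+ q ⇒ ⊢ (a :+ b :+ n :≤ 2 :* l :+ lit 2)) refl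
    a-bound : a + n ≤ 2 * l + 2
    a-bound = oneSide (∑< (suc l) (𝟙∘ P)) (∑< (suc l) (𝟙∘ Q)) (∑< a (𝟙∘ P)) (∑< a (𝟙∘ Q)) a n l
      (∑<-prefix a (suc l) P (m≤n⇒m≤1+n a≤l)) (∑<-prefix a (suc l) Q (m≤n⇒m≤1+n a≤l)) sumₐ n≤
    b-bound : b + n ≤ 2 * l + 2
    b-bound = oneSide (∑< (suc l) (𝟙∘ RP)) (∑< (suc l) (𝟙∘ RQ)) (∑< b (𝟙∘ RP)) (∑< b (𝟙∘ RQ)) b n l
      (∑<-prefix b (suc l) RP b≤l) (∑<-prefix b (suc l) RQ b≤l) sum_b
      (subst₂ (λ u v → n ≤ u + v) (∑<-reverse l (𝟙∘ P)) (∑<-reverse l (𝟙∘ Q)) n≤)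
    a+b≤ : a + b ≤ suc l
    a+b≤ = linarithⁿ 4 (λ a b n l → a :+ n :≤ 2 :* l :+ lit 2 ⇒ b :+ n :≤ 2 :* l :+ lit 2 ⇒ 3 :* l :+ lit 3 :≤ 2 :* n ⇒ ⊢ (a :+ b :≤ lit 1 :+ l)) refl
      a b n l a-bound b-bound small
    total : a + b + n ≤ 2 * l + 2
    total = bothSides (∑< (suc l) (𝟙∘ P)) (∑< (suc l) (𝟙∘ Q)) (∑< a (𝟙∘ P)) (∑< a (𝟙∘ Q)) (∑< b (𝟙∘ RP)) (∑< b (𝟙∘ RQ)) a b n l
      (∑<-ends a b l P a+b≤) (∑<-ends a b l Q a+b≤) sumₐ sum_b n≤
    cover : ∀ z → a ≤ z → z + 2 ≤ a + n → ∃ λ i → ∃ λ j → i + j ≡ z × P i ≡ true × Q j ≡ true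
    cover z a≤z z≤ with z <? l
    ... | yes z<l = covₐ z a≤z z<l
    ... | no z≮l = let i , j , e , hi , hj = cov_b z′ b≤z′ (≤-trans (s≤s z′≤l) ≤-refl) in
        l ∸ i , l ∸ j , sum≡ i j e , hi , hj
      where
      l≤z : l ≤ z
      l≤z = ≮⇒≥ z≮l
      z≤2l : z ≤ l + l
      z≤2l = linarithⁿ 5 (λ z a b n l → z :+ lit 2 :≤ a :+ n ⇒ a :+ b :+ n :≤ 2 :* l :+ lit 2 ⇒ ⊢ (z :≤ l :+ l)) refl z a b n l z≤ total
      z′ = (l + l) ∸ z
      z′+z : z′ + z ≡ l + l
      z′+z = m∸n+n≡m z≤2l
      z′≤l : z′ ≤ l
      z′≤l = linarithⁿ 3 (λ z′ z l → z′ :+ z :≡ l :+ l ⇒ l :≤ z ⇒ ⊢ (z′ :≤ l)) refl z′ z l z′+z l≤z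
      b≤z′ : b ≤ z′
      b≤z′ = linarithⁿ 6 (λ z′ z a b n l → z′ :+ z :≡ l :+ l ⇒ z :+ lit 2 :≤ a :+ n ⇒ a :+ b :+ n :≤ 2 :* l :+ lit 2 ⇒ ⊢ (b :≤ z′)) refl
        z′ z a b n l z′+z z≤ total
      sum≡ : ∀ i j → i + j ≡ z′ → l ∸ i + (l ∸ j) ≡ z
      sum≡ i j e = linarithⁿ 7 (λ u v i j z′ z l → u :+ i :≡ l ⇒ v :+ j :≡ l ⇒ i :+ j :≡ z′ ⇒ z′ :+ z :≡ l :+ l ⇒ ⊢ (u :+ v :≡ z)) refl
        (l ∸ i) (l ∸ j) i j z′ z l (m∸n+n≡m (≤-trans (≤-trans (m≤m+n i j) (≤-reflexive e)) z′≤l))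
        (m∸n+n≡m (≤-trans (≤-trans (m≤n+m j i) (≤-reflexive e)) z′≤l)) e z′+z

  first-element : ∀ L (P : ℕ → Bool) → 1 ≤ ∑< L (𝟙∘ P) → ∃ λ i → i < L × P i ≡ true × ∑< L (𝟙∘ P) + i ≤ L
  first-element L P h with least< L P
  ... | inj₂ none = contradiction (subst (1 ≤_) (∑<-zero L (λ i lt → cong 𝟙 (none i lt))) h) λ ()
  ... | inj₁ (i , lt , hi , min) = i , lt , hi ,
      subst (λ w → ∑< L (𝟙∘ P) + i ≤ w + L) (∑<-zero i (λ j j<i → cong 𝟙 (min j j<i))) (∑<-prefix i L P (<⇒≤ lt))

  last-element : ∀ L (P : ℕ → Bool) → 1 ≤ ∑< L (𝟙∘ P) →
    ∃ λ i → i < L × P i ≡ true × ∑< L (𝟙∘ P) ≡ ∑< (suc i) (𝟙∘ P) × (∀ j → i < j → j < L → P j ≡ false)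
  last-element (suc L) P h with P L in e
  ... | true = L , ≤-refl , e , cong (λ b → ∑< L (𝟙∘ P) + 𝟙 b) (sym e) , λ j L<j j<sL → contradiction (≤-pred j<sL) (<⇒≱ L<j)
  ... | false = let i , lt , hi , eq , last = last-element L P (subst (1 ≤_) (+-identityʳ _) h) in
      i , m<n⇒m<1+n lt , hi , trans (+-identityʳ _) eq , beyond i last
    where
    beyond : ∀ i → (∀ j → i < j → j < L → P j ≡ false) → ∀ j → i < j → j < suc L → P j ≡ false
    beyond i last j i<j j<sL with m≤n⇒m<n∨m≡n (≤-pred j<sL)
    ... | inj₁ j<L = last j i<j j<L
    ... | inj₂ refl = e

  extreme-elements : ∀ L n (P : ℕ → Bool) → n ≤ ∑< L (𝟙∘ P) → 1 ≤ ∑< L (𝟙∘ P) →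
    ∃ λ i → ∃ λ k → i + k < L × P i ≡ true × P (i + k) ≡ true × n ≤ suc k
  extreme-elements L n P n≤ h with last-element L P h
  ... | j , j<L , hj , eq , _ with first-element (suc j) P (subst (1 ≤_) eq h)
  ...   | i , i<sj , hi , le = i , j ∸ i , subst (_< L) (sym j≡) j<L , hi , trans (cong P j≡) hj ,
      linarithⁿ 5 (λ n s i j k → n :≤ s ⇒ s :+ i :≤ lit 1 :+ j ⇒ i :+ k :≡ j ⇒ ⊢ (n :≤ lit 1 :+ k)) refl
        n _ i j (j ∸ i) (subst (n ≤_) eq n≤) le j≡
    where
    j≡ : i + (j ∸ i) ≡ j
    j≡ = m+[n∸m]≡n (≤-pred i<sj)

-- Maps that are additive up to a bounded error are close to homomorphisms.

module QuasiHomomorphisms (p : ℕ) .{{_ : NonZero p}} (prime : Prime p) where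

  open LinearArithmetic
  open Residues p
  open PrimeField p prime
  open import Algebra using (CommutativeRing)
  open import Data.Empty using (⊥; ⊥-elim)
  import Data.Fin as Fin
  open import Data.Integer hiding (NonZero; ∣_∣; suc)
  open import Data.Integer.Properties
  open import Data.Integer.Tactic.RingSolver using (solve-∀)
  open import Data.Nat using (zero; suc)
  import Data.Nat as ℕ
  import Data.Nat.Properties as ℕ
  open import Data.Product using (Σ; ∃; _×_; _,_; proj₁; proj₂)
  open import Relation.Binary.PropositionalEquality hiding ([_])
  open import Relation.Nullary using (yes; no)

  record Near (r x : ℤ) : Set where
    constructor near
    field
      rep : ℤ
      rep≈ : x ≈ rep
      lower : - r ≤ rep
      upper : rep ≤ r

  open Near public

  ≈-by : ∀ {x y} → x ≡ y → x ≈ y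
  ≈-by = ≡⇒≈

  -- 108 is 5m + 3 at m = 21. The error 12 enters at most fourfold into any comparison, which stays
  -- below this, so the lifts to ℤ are unique.
  module _ (108≤P : + 108 ≤ P) where

    -- The increments of f are constant up to a bounded error; lifting that error to ℤ and summing it
    -- along j, 2j, …, pj turns the bounded error into an exact slope.
    module Sequence (f : ℕ → ℤ) (periodic : ∀ k → f (k ℕ.+ p) ≡ f k)
      (quasi : ∀ j k k′ → Near (+ 12) (f (k ℕ.+ j) - f k - (f (k′ ℕ.+ j) - f k′))) where

      private
        w : ℤ
        w = f 1 - f 0

        err : ℕ → ℤ
        err k = rep (quasi 1 k 0)

        err≈ : ∀ k → f (suc k) - f k - w ≈ err k
        err≈ k = subst (λ n → f n - f k - w ≈ err k) (ℕ.+-comm k 1) (rep≈ (quasi 1 k 0))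

        E : ℕ → ℤ
        E zero = 0ℤ
        E (suc k) = E k + err k

        f≈ : ∀ k → f k ≈ f 0 + + k * w + E k
        f≈ zero = ≈-by (lemma (f 0) w)
          where
          lemma : ∀ x w → x ≡ x + 0ℤ * w + 0ℤ
          lemma = solve-∀
        f≈ (suc k) = ≈-trans (≈-by (lemma₁ (f (suc k)) (f k) w))
          (≈-trans (≈-+ (≈-+ (err≈ k) (≈-refl {w})) (f≈ k)) (≈-by (lemma₂ (err k) w (f 0) (+ k) (E k))))
          where
          lemma₁ : ∀ x y w → x ≡ x - y - w + w + y
          lemma₁ = solve-∀
          lemma₂ : ∀ e w x k E → e + w + (x + k * w + E) ≡ x + (1ℤ + k) * w + (E + e)
          lemma₂ = solve-∀

        small : ∀ {x y} → x ≈ y → x - y < + 108 → y - x < + 108 → x ≡ y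
        small {x} {y} h a b = ≈-small h
          (linarith 3 (λ x y P → x :- y :< lit (+ 108) ⇒ lit (+ 108) :≤ P ⇒ ⊢ (x :< y :+ P)) refl x y P a 108≤P)
          (linarith 3 (λ x y P → y :- x :< lit (+ 108) ⇒ lit (+ 108) :≤ P ⇒ ⊢ (y :< x :+ P)) refl x y P b 108≤P)

        err-periodic : ∀ k → err (k ℕ.+ p) ≡ err k
        err-periodic k = small
          (≈-trans (≈-sym (err≈ (k ℕ.+ p))) (≈-trans (≈-by (cong₂ (λ a b → a - b - w) (periodic (suc k)) (periodic k))) (err≈ k)))
          (bound (quasi 1 (k ℕ.+ p) 0) (quasi 1 k 0)) (bound (quasi 1 k 0) (quasi 1 (k ℕ.+ p) 0))
          where
          bound : ∀ {x y} (a : Near (+ 12) x) (b : Near (+ 12) y) → rep a - rep b < + 108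
          bound (near t _ l u) (near t′ _ l′ u′) =
            linarith 2 (λ t s → t :≤ lit (+ 12) ⇒ lit (- + 12) :≤ s ⇒ ⊢ (t :- s :< lit (+ 108))) refl t t′ u l′

        -- After p steps f returns and p·w vanishes modulo p, so the accumulated error is an exact
        -- multiple of p. Its quotient n is the average error per step and corrects the slope w.
        E-p≈0 : E p ≈ 0ℤ
        E-p≈0 = ≈-trans (≈-by (lemma₁ (E p) (f 0) (+ p * w)))
          (≈-trans (≈-+ (≈-trans (≈-sym (f≈ p)) (≈-by (periodic 0))) (≈-refl { - f 0 + - (+ p * w)})) (mod (- w) (lemma₂ (f 0) P w)))
          where
          lemma₁ : ∀ E x y → E ≡ x + y + E + (- x + - y)
          lemma₁ = solve-∀
          lemma₂ : ∀ x P w → x + (- x + - (P * w)) ≡ 0ℤ + - w * P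
          lemma₂ = solve-∀

        n : ℤ
        n = _≈_.quotient E-p≈0

        E-p : E p ≡ n * P
        E-p = trans (_≈_.equation E-p≈0) (+-identityˡ (n * P))

        E-shift : ∀ k → E (k ℕ.+ p) ≡ E k + n * P
        E-shift zero = trans E-p (sym (+-identityˡ (n * P)))
        E-shift (suc k) = trans (cong₂ _+_ (E-shift k) (err-periodic k)) (lemma (E k) (n * P) (err k))
          where
          lemma : ∀ a b c → a + b + c ≡ a + c + b
          lemma = solve-∀

        E-multiple : ∀ j → E (j ℕ.* p) ≡ j times (n * P)
        E-multiple zero = refl
        E-multiple (suc j) = trans (cong E (ℕ.+-comm p (j ℕ.* p))) (trans (E-shift (j ℕ.* p))
          (trans (+-comm _ (n * P)) (cong (λ z → n * P + z) (E-multiple j))))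

        gap : ℕ → ℕ → ℤ
        gap j k = E (k ℕ.+ j) - E k

        -- Modulo p this is the hypothesis on f. One step of k changes the lifted value by at most
        -- 24, so it cannot jump to another representative of a residue that is within 12 of 0.
        gap-near : ∀ j k → - + 12 ≤ gap j k - E j × gap j k - E j ≤ + 12
        gap-near j zero = linarith 1 (λ e → ⊢ (lit (- + 12) :≤ e :- lit 0ℤ :- e)) refl (E j) ,
          linarith 1 (λ e → ⊢ (e :- lit 0ℤ :- e :≤ lit (+ 12))) refl (E j)
        gap-near j (suc k) = subst (λ z → - + 12 ≤ z × z ≤ + 12) (sym exact) (lower q , upper q)
          where
          q = quasi j (suc k) 0
          ih = gap-near j k
          value : gap j (suc k) - E j ≈ rep q
          value = ≈-trans (≈-sym (≈-trans (≈-- (≈-- (f≈ (suc k ℕ.+ j)) (f≈ (suc k))) (≈-- (f≈ j) (f≈ 0)))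
              (≈-by (lemma (f 0) (+ suc k) (+ j) w (E (suc k ℕ.+ j)) (E (suc k)) (E j))))) (rep≈ q)
            where
            lemma : ∀ x k j w a b c → x + (k + j) * w + a - (x + k * w + b) - (x + j * w + c - (x + 0ℤ * w + 0ℤ)) ≡ a - b - c
            lemma = solve-∀
          step : ∀ a b e e′ c t → - + 12 ≤ a - b - c → a - b - c ≤ + 12 → - + 12 ≤ e → e ≤ + 12 → - + 12 ≤ e′ → e′ ≤ + 12 →
            - + 12 ≤ t → t ≤ + 12 → (a + e - (b + e′) - c) - t < + 108 × t - (a + e - (b + e′) - c) < + 108
          step a b e e′ c t l u l₁ u₁ l₂ u₂ l₃ u₃ =
            linarith 6 (λ a b e e′ c t → a :- b :- c :≤ lit (+ 12) ⇒ e :≤ lit (+ 12) ⇒ lit (- + 12) :≤ e′ ⇒ lit (- + 12) :≤ t ⇒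
              ⊢ ((a :+ e :- (b :+ e′) :- c) :- t :< lit (+ 108))) refl a b e e′ c t u u₁ l₂ l₃ ,
            linarith 6 (λ a b e e′ c t → lit (- + 12) :≤ a :- b :- c ⇒ lit (- + 12) :≤ e ⇒ e′ :≤ lit (+ 12) ⇒ t :≤ lit (+ 12) ⇒
              ⊢ (t :- (a :+ e :- (b :+ e′) :- c) :< lit (+ 108))) refl a b e e′ c t l l₁ u₂ u₃
          bounds = step (E (k ℕ.+ j)) (E k) (err (k ℕ.+ j)) (err k) (E j) (rep q) (proj₁ ih) (proj₂ ih)
            (lower (quasi 1 (k ℕ.+ j) 0)) (upper (quasi 1 (k ℕ.+ j) 0)) (lower (quasi 1 k 0)) (upper (quasi 1 k 0)) (lower q) (upper q)
          exact : gap j (suc k) - E j ≡ rep q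
          exact = small value (proj₁ bounds) (proj₂ bounds)

        E-progress : ∀ j i → - (i times + 12) ≤ E (i ℕ.* j) - i times E j × E (i ℕ.* j) - i times E j ≤ i times + 12
        E-progress j zero = ≤-refl , ≤-refl
        E-progress j (suc i) = subst (λ a → - (suc i times + 12) ≤ a - suc i times E j × a - suc i times E j ≤ suc i times + 12)
            (cong E (ℕ.+-comm (i ℕ.* j) j))
            (subst (_≤ a - (c + s)) (+-identityˡ (- (+ 12 + t)))
               (linarith 5 (λ a b c s t → lit 0ℤ :- t :≤ b :- s ⇒ lit (- + 12) :≤ a :- b :- c ⇒ ⊢ (lit 0ℤ :- (lit (+ 12) :+ t) :≤ a :- (c :+ s))) refl
                 a b c s t (subst (_≤ b - s) (sym (+-identityˡ (- t))) (proj₁ ih)) (proj₁ g)) ,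
             linarith 5 (λ a b c s t → b :- s :≤ t ⇒ a :- b :- c :≤ lit (+ 12) ⇒ ⊢ (a :- (c :+ s) :≤ lit (+ 12) :+ t)) refl
               a b c s t (proj₂ ih) (proj₂ g))
          where
          a = E (i ℕ.* j ℕ.+ j)
          b = E (i ℕ.* j)
          c = E j
          s = i times E j
          t = i times + 12
          ih = E-progress j i
          g = gap-near j (i ℕ.* j)

        -- E (p·j) is exactly j·n·p by periodicity, and within 12p of p·E j by adding up p gaps;
        -- division by p leaves the error 12.
        slope-near : ∀ j → - + 12 ≤ E j - + j * n × E j - + j * n ≤ + 12
        slope-near j = cancel (- + 12) (E j - + j * n) (subst₂ _≤_ left right (bound₁ B (P * E j) (P * + 12) upper′)) ,
            cancel (E j - + j * n) (+ 12) (subst₂ _≤_ right (*-comm P (+ 12)) (bound₂ B (P * E j) (P * + 12) lower′))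
          where
          B = + j * (n * P)
          E-pj : E (p ℕ.* j) ≡ B
          E-pj = trans (cong E (ℕ.*-comm p j)) (trans (E-multiple j) (sym (times-* j (n * P))))
          g = E-progress j p
          lower′ : - (P * + 12) ≤ B - P * E j
          lower′ = subst₂ _≤_ (cong -_ (sym (times-* p (+ 12)))) (cong₂ _-_ E-pj (sym (times-* p (E j)))) (proj₁ g)
          upper′ : B - P * E j ≤ P * + 12
          upper′ = subst₂ _≤_ (cong₂ _-_ E-pj (sym (times-* p (E j)))) (sym (times-* p (+ 12))) (proj₂ g)
          bound₁ : ∀ a b c → a - b ≤ c → 0ℤ - c ≤ b - a
          bound₁ = linarith 3 (λ a b c → a :- b :≤ c ⇒ ⊢ (lit 0ℤ :- c :≤ b :- a)) refl
          bound₂ : ∀ a b c → - c ≤ a - b → b - a ≤ c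
          bound₂ a b c h = linarith 3 (λ a b c → lit 0ℤ :- c :≤ a :- b ⇒ ⊢ (b :- a :≤ c)) refl a b c (subst (_≤ a - b) (sym (+-identityˡ (- c))) h)
          left : 0ℤ - P * + 12 ≡ - + 12 * P
          left = lemma P
            where
            lemma : ∀ P → 0ℤ - P * + 12 ≡ - + 12 * P
            lemma = solve-∀
          right : P * E j - B ≡ (E j - + j * n) * P
          right = lemma P (E j) (+ j) n
            where
            lemma : ∀ P e j n → P * e - j * (n * P) ≡ (e - j * n) * P
            lemma = solve-∀
          instance
            positiveP : Positive P
            positiveP = positive (<-≤-trans (+<+ (ℕ.s≤s ℕ.z≤n)) 108≤P)
          cancel : ∀ x y → x * P ≤ y * P → x ≤ y
          cancel x y = *-cancelʳ-≤-pos x y P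

      slope : ∃ λ a → ∀ k → Near (+ 12) (f k - f 0 - + k * a)
      slope = w + n , λ k → near (E k - + k * n)
        (≈-trans (≈-- (≈-- (f≈ k) (≈-refl {f 0})) (≈-refl {+ k * (w + n)})) (≈-by (lemma (f 0) (+ k) w n (E k))))
        (proj₁ (slope-near k)) (proj₂ (slope-near k))
        where
        lemma : ∀ x k w n E → x + k * w + E - x - k * (w + n) ≡ E - k * n
        lemma = solve-∀

    module Additive {d : ℕ} (u : V d → ℤ)
      (quasi : ∀ i i′ j → Near (+ 12) (u (i ⊞ j) - u i - (u (i′ ⊞ j) - u i′))) where

      private
        o : V d
        o = constᵛ 0ℤ

        _×ᵛ_ : ℕ → V d → V d
        k ×ᵛ v = scalar [ + k ] v

        module S (v : V d) = Sequence (λ k → u (k ×ᵛ v))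
          (λ k → cong (λ c → u (scalar c v)) ([]-cong (mod 1ℤ (cong (λ z → + k + z) (sym (*-identityˡ P))))))
          (λ j k k′ → subst₂ (λ a b → Near (+ 12) (u a - u (k ×ᵛ v) - (u b - u (k′ ×ᵛ v))))
            (sym ([]-·-+ (+ k) (+ j) v)) (sym ([]-·-+ (+ k′) (+ j) v)) (quasi (k ×ᵛ v) (k′ ×ᵛ v) (j ×ᵛ v)))

      opaque
        linear : V d → ℤ
        linear v = proj₁ (S.slope v)

        line : ∀ v k → Near (+ 12) (u (k ×ᵛ v) - u o - + k * linear v)
        line v k = subst (λ z → Near (+ 12) (u (k ×ᵛ v) - u z - + k * linear v)) (0·v v) (proj₂ (S.slope v) k)

      linear-near : ∀ v → Near (+ 12) (u v - u o - linear v)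
      linear-near v = subst₂ (λ x y → Near (+ 12) (u x - u o - y)) (1·v v) (*-identityˡ (linear v)) (line v 1)

      private
        defect : V d → V d → ℤ
        defect v w = linear (v ⊞ w) - (linear v + linear w)

        -- 48 is four times 12: the slopes along v + w, v and w, and one use of near-additivity of u
        -- at the k-th multiples. It is uniform in k.
        defect-multiple : ∀ v w k → Near (+ 48) (+ k * defect v w)
        defect-multiple v w k = near (rep n₄ - rep n₁ + rep n₂ + rep n₃)
            (≈-trans (≈-by (lemma (+ k) (linear (v ⊞ w)) (linear v) (linear w) (u (k ×ᵛ (v ⊞ w))) (u (k ×ᵛ v)) (u (k ×ᵛ w)) (u o)))
              (≈-+ (≈-+ (≈-- (rep≈ n₄) (rep≈ n₁)) (rep≈ n₂)) (rep≈ n₃)))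
            (linarith 4 (λ a b c d → lit (- + 12) :≤ a ⇒ b :≤ lit (+ 12) ⇒ lit (- + 12) :≤ c ⇒ lit (- + 12) :≤ d ⇒ ⊢ (lit (- + 48) :≤ a :- b :+ c :+ d)) refl
              (rep n₄) (rep n₁) (rep n₂) (rep n₃) (lower n₄) (upper n₁) (lower n₂) (lower n₃))
            (linarith 4 (λ a b c d → a :≤ lit (+ 12) ⇒ lit (- + 12) :≤ b ⇒ c :≤ lit (+ 12) ⇒ d :≤ lit (+ 12) ⇒ ⊢ (a :- b :+ c :+ d :≤ lit (+ 48))) refl
              (rep n₄) (rep n₁) (rep n₂) (rep n₃) (upper n₄) (lower n₁) (upper n₂) (upper n₃))
          where
          module R = CommutativeRing (Vring d)
          n₁ = line (v ⊞ w) k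
          n₂ = line v k
          n₃ = line w k
          n₄ : Near (+ 12) (u (k ×ᵛ (v ⊞ w)) - u (k ×ᵛ w) - (u (k ×ᵛ v) - u o))
          n₄ = subst₂ (λ a b → Near (+ 12) (u a - u (k ×ᵛ w) - (u b - u o)))
            (trans (R.+-comm (k ×ᵛ w) (k ×ᵛ v)) (sym (·-⊞ [ + k ] v w))) (R.+-identityˡ (k ×ᵛ v)) (quasi (k ×ᵛ w) o (k ×ᵛ v))
          lemma : ∀ k x y z a b c o → k * (x - (y + z)) ≡ (a - c - (b - o)) - (a - o - k * x) + (b - o - k * y) + (c - o - k * z)
          lemma = solve-∀

      -- A nonzero defect would have a multiple congruent to 50, but all its multiples are within 48
      -- of 0, and 50 < 108 - 48.
      linear-additive : ∀ v w → linear (v ⊞ w) ≈ linear v + linear w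
      linear-additive v w with [ defect v w ] Fin.≟ 0ᶠ
      ... | yes e = ≈-trans (≈-by (lemma (linear (v ⊞ w)) (linear v + linear w)))
          (≈-trans (≈-+ ([]-injective e) (≈-refl {linear v + linear w})) (≈-by (+-identityˡ _)))
        where
        lemma : ∀ x y → x ≡ x - y + y
        lemma = solve-∀
      ... | no z≢0 = ⊥-elim (absurd (multiples (defect v w) (+ 50) (λ h → z≢0 ([]-cong h))))
        where
        absurd : (∃ λ k → + k * defect v w ≈ + 50) → ⊥
        absurd (k , h) = clash (defect-multiple v w k)
          where
          clash : Near (+ 48) (+ k * defect v w) → ⊥
          clash (near t ht l u) = linarith 1 (λ t → t :≡ lit (+ 50) ⇒ t :≤ lit (+ 48) ⇒ ⊢⊥) refl t
            (≈-small (≈-trans (≈-sym ht) h)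
              (linarith 2 (λ t P → t :≤ lit (+ 48) ⇒ lit (+ 108) :≤ P ⇒ ⊢ (t :< lit (+ 50) :+ P)) refl t P u 108≤P)
              (linarith 2 (λ t P → lit (- + 48) :≤ t ⇒ lit (+ 108) :≤ P ⇒ ⊢ (lit (+ 50) :< t :+ P)) refl t P l 108≤P)) u

  approximate-homomorphism : + 108 ≤ P → ∀ {d} (u : V d → ℤ) →
    (∀ i i′ j → Near (+ 12) (u (i ⊞ j) - u i - (u (i′ ⊞ j) - u i′))) →
    Σ (V d → ℤ) λ a → (∀ v w → a (v ⊞ w) ≈ a v + a w) × (∀ v → Near (+ 12) (u v - u (constᵛ 0ℤ) - a v))
  approximate-homomorphism 108≤P u quasi = Additive.linear 108≤P u quasi ,
    Additive.linear-additive 108≤P u quasi , Additive.linear-near 108≤P u quasi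

-- Slices of A are short, and after a shear they are aligned.

module Concentration (p : ℕ) .{{_ : NonZero p}} (prime : Prime p) where

  open LinearArithmetic hiding (close)
  open Sums
  open Intervals
  open Residues p
  open Vosper p prime using (Sub)
  open SumFreeLine p prime using (Sign; plus; minus; sgn)
  open QuasiHomomorphisms p prime
  open import Data.Bool using (Bool; true; false)
  open import Data.Empty using (⊥; ⊥-elim)
  open import Data.Integer hiding (NonZero; ∣_∣; suc; sign)
  open import Data.Integer.Properties hiding (_≟_; _≤?_; _<?_)
  open import Data.Integer.Tactic.RingSolver using (solve-∀)
  open import Data.List using ([]; _∷_)
  open import Data.Nat using (suc)
  import Data.Nat as ℕ
  import Data.Nat.Properties as ℕ
  open import Data.Product using (Σ; ∃; _×_; _,_; proj₁; proj₂)
  open import Data.Sum using (_⊎_; inj₁; inj₂)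
  open import Data.Vec using ([]; _∷_)
  open import Relation.Binary.PropositionalEquality hiding ([_])
  open import Relation.Nullary using (¬_; Dec; yes; no; contradiction)
  open VSolver using (solve; _:=_; con) renaming (_:+_ to _⊕_; _:*_ to _⊗_; :-_ to ⊖_)

  opaque
    maximum : ∀ {A : Set} {{_ : Finite A}} → A → (f : A → ℤ) → ∃ λ a → ∀ b → f b ≤ f a
    maximum {A} {{F}} a₀ f = let a , all = go (Finite.elems F) in a , λ b → all b (ℕ.≤-reflexive (sym (Finite.once F b)))
      where
      go : ∀ xs → ∃ λ a → ∀ b → 1 ℕ.≤ sumOver xs (λ x → at x b) → f b ≤ f a
      go [] = a₀ , λ b ()
      go (x ∷ xs) with go xs
      ... | a , all with f a Data.Integer.≤? f x
      ...   | yes le = x , bound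
        where
        bound : ∀ b → 1 ℕ.≤ sumOver (x ∷ xs) (λ y → at y b) → f b ≤ f x
        bound b h with x ≟ᶠ b
        ... | yes refl = ≤-refl
        ... | no _ = ≤-trans (all b h) le
      ...   | no nle = a , bound
        where
        bound : ∀ b → 1 ℕ.≤ sumOver (x ∷ xs) (λ y → at y b) → f b ≤ f a
        bound b h with x ≟ᶠ b
        ... | yes refl = <⇒≤ (≰⇒> nle)
        ... | no _ = all b h

  toNat : ∀ {x} → 0ℤ ≤ x → ∃ λ n → x ≡ + n
  toNat (+≤+ {n = n} _) = n , refl

  sg : Sign → ℤ → ℤ
  sg plus z = z
  sg minus z = - z

  sgnᵛ : ∀ {n} → Sign → V n → V n
  sgnᵛ plus v = v
  sgnᵛ minus v = ⊝ v

  SumFreeV : ∀ {n} → Sign → (V n → Bool) → Set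
  SumFreeV σ A = ∀ x a b c d → A x ≡ true → A a ≡ true → A b ≡ true → A c ≡ true → A d ≡ true →
    x ⊞ sgnᵛ σ (a ⊞ b) ≢ c ⊞ d

  sgn-[] : ∀ σ z → sgn σ [ z ] ≡ [ sg σ z ]
  sgn-[] plus z = refl
  sgn-[] minus z = []-neg z

  sgnᵛ-∷ : ∀ {n} σ a (v : V n) → sgnᵛ σ (a ∷ v) ≡ sgn σ a ∷ sgnᵛ σ v
  sgnᵛ-∷ plus a v = refl
  sgnᵛ-∷ minus a v = refl

  sgnᵛ-sgnᵛ : ∀ {n} σ (v : V n) → sgnᵛ σ (sgnᵛ σ v) ≡ v
  sgnᵛ-sgnᵛ plus v = refl
  sgnᵛ-sgnᵛ minus v = solve 1 (λ v → ⊖ (⊖ v) := v) refl v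

  Window : Sub → ℤ → ℕ → Set
  Window X α l = ∀ z → X [ z ] ≡ true → ∃ λ i → i ℕ.≤ l × z ≈ α + + i

  window-count : ∀ X α l → l ℕ.< p → Window X α l → ∑< (suc l) (λ i → 𝟙 (X [ α + + i ])) ≡ ∣ X ∣
  window-count X α l l<p win = trans (sym (ℕ.+-identityʳ _)) (trans (cong (∑< (suc l) g ℕ.+_) (sym rest))
      (trans (sym (∑<-split (suc l) (p ℕ.∸ suc l) g)) (trans (cong (λ n → ∑< n g) (ℕ.m+[n∸m]≡n l<p)) (∑-shift α (λ x → 𝟙 (X x))))))
    where
    g : ℕ → ℕ
    g i = 𝟙 (X [ α + + i ])
    rest : ∑< (p ℕ.∸ suc l) (λ i → g (suc l ℕ.+ i)) ≡ 0
    rest = ∑<-zero (p ℕ.∸ suc l) λ i i< → outside (suc l ℕ.+ i) (ℕ.m≤m+n (suc l) i)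
        (subst (suc l ℕ.+ i ℕ.<_) (ℕ.m+[n∸m]≡n l<p) (ℕ.+-monoʳ-< (suc l) i<))
      where
      outside : ∀ k → l ℕ.< k → k ℕ.< p → g k ≡ 0
      outside k l<k k<p with X [ α + + k ] in e
      ... | false = refl
      ... | true = let i , i≤l , h = win (α + + k) e in
        contradiction (<p⇒≡ k<p (ℕ.≤-<-trans i≤l l<p) (≈-trans (≈-by (lemma α (+ k))) (≈-trans (≈-- h (≈-refl {α})) (≈-by (sym (lemma α (+ i)))))))
          (λ eq → ℕ.<-irrefl (sym eq) (ℕ.≤-<-trans i≤l l<k))
        where
        lemma : ∀ α k → k ≡ α + k - α
        lemma = solve-∀

  arc-in-sumset : ∀ X Y α β l n → l ℕ.< p → Window X α l → Window Y β l → n ℕ.≤ ∣ X ∣ ℕ.+ ∣ Y ∣ → 3 ℕ.* l ℕ.+ 3 ℕ.≤ 2 ℕ.* n →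
    ∃ λ u → ∀ i → i ℕ.+ 2 ℕ.≤ n → ∃ λ y → ∃ λ z → X [ y ] ≡ true × Y [ z ] ≡ true × y + z ≈ u + + i
  arc-in-sumset X Y α β l n l<p wX wY n≤ small =
    let a , cov = interval-in-sumset l n (λ i → X [ α + + i ]) (λ i → Y [ β + + i ])
          (subst (n ℕ.≤_) (sym (cong₂ ℕ._+_ (window-count X α l l<p wX) (window-count Y β l l<p wY))) n≤) small
    in α + β + + a , λ i i≤ → let j , k , e , hj , hk = cov (a ℕ.+ i) (ℕ.m≤m+n a i)
                                    (subst (ℕ._≤ a ℕ.+ n) (sym (ℕ.+-assoc a i 2)) (ℕ.+-monoʳ-≤ a i≤)) in
      α + + j , β + + k , hj , hk , ≈-by (trans (lemma α β (+ j) (+ k)) (trans (cong (λ z → α + β + + z) e) (sym (+-assoc (α + β) (+ a) (+ i)))))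
    where
    lemma : ∀ α β j k → α + j + (β + k) ≡ α + β + (j + k)
    lemma = solve-∀

  module AvoidArc (m : ℕ) (21≤m : 21 ℕ.≤ m) (u d : ℤ) (k : ℕ) (m≤k : m ℕ.≤ suc k) (k≤ : k ℕ.≤ m ℕ.+ 1) where

    Avoided : Sign → ℤ → Set
    Avoided τ D = ∀ i → i ℕ.+ 2 ℕ.≤ 2 ℕ.* m → ¬ (D ≈ sg τ (u + + i) - d) × ¬ (D ≈ sg τ (u + + i) - (d + + k))

    s : ℕ
    s = 2 ℕ.* m ℕ.∸ 2

    -- The first residue of the union of the two forbidden arcs. For `minus` the arc is reversed, so
    -- it begins at its last index s = 2m - 2.
    start : Sign → ℤ
    start plus = u - d - + k
    start minus = - u - d - + k - + s

    private
      s≡ : s ℕ.+ 2 ≡ 2 ℕ.* m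
      s≡ = ℕ.m∸n+n≡m (linarithⁿ 1 (λ m → lit 21 :≤ m ⇒ ⊢ (lit 2 :≤ 2 :* m)) refl m 21≤m)

      k≤θ : ∀ m k θ → 2 ℕ.* m ℕ.< θ ℕ.+ 2 → k ℕ.≤ m ℕ.+ 1 → 21 ℕ.≤ m → k ℕ.≤ θ
      k≤θ = linarithⁿ 3 (λ m k θ → 2 :* m :< θ :+ lit 2 ⇒ k :≤ m :+ lit 1 ⇒ lit 21 :≤ m ⇒ ⊢ (k :≤ θ)) refl

      θ≤k+s : ∀ m k θ s → θ ℕ.+ 3 ℕ.≤ 3 ℕ.* m → m ℕ.≤ suc k → s ℕ.+ 2 ≡ 2 ℕ.* m → θ ℕ.≤ k ℕ.+ s
      θ≤k+s = linarithⁿ 4 (λ m k θ s → θ :+ lit 3 :≤ 3 :* m ⇒ m :≤ lit 1 :+ k ⇒ s :+ lit 2 :≡ 2 :* m ⇒ ⊢ (θ :≤ k :+ s)) refl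

      index₁ : ∀ m k θ r → m ℕ.≤ suc k → θ ℕ.+ 3 ℕ.≤ 3 ℕ.* m → k ℕ.+ r ≡ θ → r ℕ.+ 2 ℕ.≤ 2 ℕ.* m
      index₁ = linarithⁿ 4 (λ m k θ r → m :≤ lit 1 :+ k ⇒ θ :+ lit 3 :≤ 3 :* m ⇒ k :+ r :≡ θ ⇒ ⊢ (r :+ lit 2 :≤ 2 :* m)) refl

      index₂ : ∀ m s r θ → s ℕ.+ 2 ≡ 2 ℕ.* m → r ℕ.+ θ ≡ s → r ℕ.+ 2 ℕ.≤ 2 ℕ.* m
      index₂ = linarithⁿ 4 (λ m s r θ → s :+ lit 2 :≡ 2 :* m ⇒ r :+ θ :≡ s ⇒ ⊢ (r :+ lit 2 :≤ 2 :* m)) refl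

      index₃ : ∀ m k θ s r → 2 ℕ.* m ℕ.< θ ℕ.+ 2 → k ℕ.≤ m ℕ.+ 1 → 21 ℕ.≤ m → s ℕ.+ 2 ≡ 2 ℕ.* m → r ℕ.+ θ ≡ k ℕ.+ s → r ℕ.+ 2 ℕ.≤ 2 ℕ.* m
      index₃ = linarithⁿ 5 (λ m k θ s r → 2 :* m :< θ :+ lit 2 ⇒ k :≤ m :+ lit 1 ⇒ lit 21 :≤ m ⇒ s :+ lit 2 :≡ 2 :* m ⇒ r :+ θ :≡ k :+ s ⇒
        ⊢ (r :+ lit 2 :≤ 2 :* m)) refl

      value₁ : ∀ u d k θ → u - d - k + θ ≡ u + θ - (d + k)
      value₁ = solve-∀

      value₂ : ∀ u d k r → u - d - k + (k + r) ≡ u + r - d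
      value₂ = solve-∀

      value₃ : ∀ u d k r θ → - u - d - k - (r + θ) + θ ≡ - (u + r) - (d + k)
      value₃ = solve-∀

      value₄ : ∀ u d k s θ r → r + θ ≡ k + s → - u - d - k - s + θ ≡ - (u + r) - d
      value₄ u d k s θ r e = trans (lemma₁ u d k s θ) (trans (cong (λ z → - u - d - z + θ) (sym e)) (lemma₂ u d r θ))
        where
        lemma₁ : ∀ u d k s θ → - u - d - k - s + θ ≡ - u - d - (k + s) + θ
        lemma₁ = solve-∀
        lemma₂ : ∀ u d r θ → - u - d - (r + θ) + θ ≡ - (u + r) - d
        lemma₂ = solve-∀

    -- Two arcs of 2m - 1 residues shifted by k ≤ m + 1 against each other leave no gap, and k ≥ m -
    -- 1 makes their union at least 3m - 2 long.
    avoid-arc : ∀ τ D → Avoided τ D → ∀ θ → θ ℕ.+ 3 ℕ.≤ 3 ℕ.* m → ¬ (D ≈ start τ + + θ)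
    avoid-arc plus D av θ θ≤ e = by (θ ℕ.+ 2 ℕ.≤? 2 ℕ.* m)
      where
      by : Dec (θ ℕ.+ 2 ℕ.≤ 2 ℕ.* m) → ⊥
      by (yes le) = proj₂ (av θ le) (≈-trans e (≈-by (value₁ u d (+ k) (+ θ))))
      by (no gt) = proj₁ (av (θ ℕ.∸ k) (index₁ m k θ (θ ℕ.∸ k) m≤k θ≤ k+r))
          (≈-trans e (≈-by (trans (cong (λ z → u - d - + k + + z) (sym k+r)) (value₂ u d (+ k) (+ (θ ℕ.∸ k))))))
        where
        k+r : k ℕ.+ (θ ℕ.∸ k) ≡ θ
        k+r = ℕ.m+[n∸m]≡n (k≤θ m k θ (ℕ.≰⇒> gt) k≤ 21≤m)
    avoid-arc minus D av θ θ≤ e = by (θ ℕ.+ 2 ℕ.≤? 2 ℕ.* m)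
      where
      by : Dec (θ ℕ.+ 2 ℕ.≤ 2 ℕ.* m) → ⊥
      by (yes le) = proj₂ (av (s ℕ.∸ θ) (index₂ m s (s ℕ.∸ θ) θ s≡ r+θ))
          (≈-trans e (≈-by (trans (cong (λ z → - u - d - + k - + z + + θ) (sym r+θ)) (value₃ u d (+ k) (+ (s ℕ.∸ θ)) (+ θ)))))
        where
        r+θ : s ℕ.∸ θ ℕ.+ θ ≡ s
        r+θ = ℕ.m∸n+n≡m (ℕ.+-cancelʳ-≤ 2 θ s (subst (θ ℕ.+ 2 ℕ.≤_) (sym s≡) le))
      by (no gt) = proj₁ (av (k ℕ.+ s ℕ.∸ θ) (index₃ m k θ s (k ℕ.+ s ℕ.∸ θ) (ℕ.≰⇒> gt) k≤ 21≤m s≡ r+θ))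
          (≈-trans e (≈-by (value₄ u d (+ k) (+ s) (+ θ) (+ (k ℕ.+ s ℕ.∸ θ)) (cong +_ r+θ))))
        where
        r+θ : k ℕ.+ s ℕ.∸ θ ℕ.+ θ ≡ k ℕ.+ s
        r+θ = ℕ.m∸n+n≡m (θ≤k+s m k θ s θ≤ m≤k s≡)

  module Close (m : ℕ) (p≡ : p ≡ 3 ℕ.+ 5 ℕ.* m) (21≤m : 21 ℕ.≤ m) (D : ℤ → Set) (D-cong : ∀ {x y} → x ≈ y → D x → D y)
    (D-neg : ∀ {x} → D x → D (- x)) (D-zero : D 0ℤ)
    (ρ : ℤ) (avoid : ∀ {x} → D x → ∀ θ → θ ℕ.+ 3 ℕ.≤ 3 ℕ.* m → ¬ (x ≈ ρ + + θ)) where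

    private
      ρ̂ : ℕ
      ρ̂ = rem ρ

      outside : ∀ n → D (+ n) → ρ̂ ℕ.≤ n → ρ̂ ℕ.+ 3 ℕ.* m ℕ.≤ n ℕ.+ 2
      outside n h ρ≤n = ℕ.≮⇒≥ λ lt → avoid h (n ℕ.∸ ρ̂)
        (linarithⁿ 4 (λ n ρ r m → n :+ lit 2 :< ρ :+ 3 :* m ⇒ ρ :+ r :≡ n ⇒ ⊢ (r :+ lit 3 :≤ 3 :* m)) refl n ρ̂ (n ℕ.∸ ρ̂) m lt eq)
        (≈-trans (≈-by (cong +_ (sym eq))) (≈-+ (rem≈ ρ) (≈-refl {+ (n ℕ.∸ ρ̂)})))
        where
        eq : ρ̂ ℕ.+ (n ℕ.∸ ρ̂) ≡ n
        eq = ℕ.m+[n∸m]≡n ρ≤n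

      D-p : D P
      D-p = D-cong (≈-sym (mod 1ℤ (sym (trans (+-identityˡ _) (*-identityˡ P))))) D-zero

      ρ-small : ρ̂ ℕ.+ 3 ℕ.* m ℕ.≤ p ℕ.+ 2
      ρ-small = outside p D-p (ℕ.<⇒≤ (rem<p ρ))

      -- Suppose both exceed m + 2. Two numbers beyond the forbidden arc sum to more than p, two
      -- before it to less, because ρ ≤ 2m + 5; one on each side differ by at least 3m - 1, and the
      -- sum is at least 5m + 5.
      pairs : ∀ a b → D (+ a) → D (+ b) → a ℕ.+ b ≡ p → a ℕ.≤ m ℕ.+ 2 ⊎ b ℕ.≤ m ℕ.+ 2
      pairs a b ha hb e with a ℕ.≤? m ℕ.+ 2 | b ℕ.≤? m ℕ.+ 2
      ... | yes r | _ = inj₁ r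
      ... | no _ | yes r = inj₂ r
      ... | no a> | no b> = ⊥-elim (cases (ρ̂ ℕ.≤? a) (ρ̂ ℕ.≤? b))
        where
        both : ∀ a b m p ρ → a ℕ.+ b ≡ p → p ≡ 3 ℕ.+ 5 ℕ.* m → 21 ℕ.≤ m → ρ ℕ.+ 3 ℕ.* m ℕ.≤ a ℕ.+ 2 → ρ ℕ.+ 3 ℕ.* m ℕ.≤ b ℕ.+ 2 → ⊥
        both = linarithⁿ 5 (λ a b m p ρ → a :+ b :≡ p ⇒ p :≡ lit 3 :+ 5 :* m ⇒ lit 21 :≤ m ⇒ ρ :+ 3 :* m :≤ a :+ lit 2 ⇒ ρ :+ 3 :* m :≤ b :+ lit 2 ⇒ ⊢⊥) refl
        one : ∀ a b m p ρ → a ℕ.+ b ≡ p → p ≡ 3 ℕ.+ 5 ℕ.* m → ρ ℕ.+ 3 ℕ.* m ℕ.≤ a ℕ.+ 2 → b ℕ.< ρ → m ℕ.+ 2 ℕ.< b → ⊥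
        one = linarithⁿ 5 (λ a b m p ρ → a :+ b :≡ p ⇒ p :≡ lit 3 :+ 5 :* m ⇒ ρ :+ 3 :* m :≤ a :+ lit 2 ⇒ b :< ρ ⇒ m :+ lit 2 :< b ⇒ ⊢⊥) refl
        none : ∀ a b m p ρ → a ℕ.+ b ≡ p → p ≡ 3 ℕ.+ 5 ℕ.* m → 21 ℕ.≤ m → ρ ℕ.+ 3 ℕ.* m ℕ.≤ p ℕ.+ 2 → a ℕ.< ρ → b ℕ.< ρ → ⊥
        none = linarithⁿ 5 (λ a b m p ρ → a :+ b :≡ p ⇒ p :≡ lit 3 :+ 5 :* m ⇒ lit 21 :≤ m ⇒ ρ :+ 3 :* m :≤ p :+ lit 2 ⇒ a :< ρ ⇒ b :< ρ ⇒ ⊢⊥) refl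
        cases : Dec (ρ̂ ℕ.≤ a) → Dec (ρ̂ ℕ.≤ b) → ⊥
        cases (yes ra) (yes rb) = both a b m p ρ̂ e p≡ 21≤m (outside a ha ra) (outside b hb rb)
        cases (yes ra) (no rb) = one a b m p ρ̂ e p≡ (outside a ha ra) (ℕ.≰⇒> rb) (ℕ.≰⇒> b>)
        cases (no ra) (yes rb) = one b a m p ρ̂ (trans (ℕ.+-comm b a) e) p≡ (outside b hb rb) (ℕ.≰⇒> ra) (ℕ.≰⇒> a>)
        cases (no ra) (no rb) = none a b m p ρ̂ e p≡ 21≤m ρ-small (ℕ.≰⇒> ra) (ℕ.≰⇒> rb)

    close : ∀ x → D x → Near (+ (m ℕ.+ 2)) x
    close x h = by (pairs a b ha hb a+b)
      where
      a = rem x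
      b = p ℕ.∸ rem x
      a+b : a ℕ.+ b ≡ p
      a+b = ℕ.m+[n∸m]≡n (ℕ.<⇒≤ (rem<p x))
      ha : D (+ a)
      ha = D-cong (≈-sym (rem≈ x)) h
      b≈ : - + b ≈ x
      b≈ = ≈-trans (mod (- 1ℤ) (trans (lemma (+ a) (+ b)) (cong (λ z → + a + - 1ℤ * z) (cong +_ a+b)))) (rem≈ x)
        where
        lemma : ∀ a b → - b ≡ a + - 1ℤ * (a + b)
        lemma = solve-∀
      hb : D (+ b)
      hb = subst D (neg-involutive (+ b)) (D-neg (D-cong (≈-sym b≈) h))
      by : a ℕ.≤ m ℕ.+ 2 ⊎ b ℕ.≤ m ℕ.+ 2 → Near (+ (m ℕ.+ 2)) x
      by (inj₁ r) = near (+ a) (≈-sym (rem≈ x)) (≤-trans (neg-≤-pos {m ℕ.+ 2} {0}) (+≤+ ℕ.z≤n)) (+≤+ r)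
      by (inj₂ r) = near (- + b) (≈-sym b≈) (neg-mono-≤ (+≤+ r)) (neg-≤-pos {b})

  -- Start from any element and go down as far as possible.
  windowed : ∀ (X : Sub) w → + 3 * + w < P → (∀ x x′ → X [ x ] ≡ true → X [ x′ ] ≡ true → Near (+ w) (x′ - x)) →
    ∃ λ α → Window X α w
  windowed X w 3w<P pairwise with search X
  ... | inj₂ none = 0ℤ , λ z h → contradiction (trans (sym h) (none [ z ])) λ ()
  ... | inj₁ (a , ha) = by (least< (suc w) B)
    where
    z₀ : ℤ
    z₀ = ι a
    hz₀ : X [ z₀ ] ≡ true
    hz₀ = trans (cong X ([]-ι a)) ha
    B : ℕ → Bool
    B k = X [ z₀ - + w + + k ]
    3w : 3 times + w < P
    3w = subst (_< P) (times-* 3 (+ w)) 3w<P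
    by : (∃ λ k → k ℕ.< suc w × B k ≡ true × (∀ i → i ℕ.< k → B i ≡ false)) ⊎ (∀ i → i ℕ.< suc w → B i ≡ false) → ∃ λ α → Window X α w
    by (inj₂ none) = contradiction (trans (sym hz₀) (trans (cong (λ z → X [ z ]) (lemma z₀ (+ w))) (none w ℕ.≤-refl))) λ ()
      where
      lemma : ∀ z w → z ≡ z - w + w
      lemma = solve-∀
    by (inj₁ (k , k≤w , hk , min)) = α , λ z hz → place z hz (pairwise z₀ z hz₀ hz) (pairwise α z hk hz)
      where
      α = z₀ - + w + + k
      place : ∀ z → X [ z ] ≡ true → Near (+ w) (z - z₀) → Near (+ w) (z - α) → ∃ λ i → i ℕ.≤ w × z ≈ α + + i
      place z hz (near D₁ e₁ l₁ u₁) (near D e l u) = cases (0ℤ Data.Integer.≤? D)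
        where
        exact : D ≡ D₁ + + w - + k
        exact = ≈-small (≈-trans (≈-sym e) (≈-trans (≈-by (lemma z z₀ (+ w) (+ k))) (≈-+ (≈-+ e₁ (≈-refl {+ w})) (≈-refl { - + k}))))
          (linarith 5 (λ D D₁ w k P → D :≤ w ⇒ lit 0ℤ :- w :≤ D₁ ⇒ k :≤ w ⇒ 3 :* w :< P ⇒ lit 0ℤ :≤ w ⇒ ⊢ (D :< D₁ :+ w :- k :+ P)) refl
            D D₁ (+ w) (+ k) P u (subst (_≤ D₁) (sym (+-identityˡ (- + w))) l₁) (+≤+ (ℕ.≤-pred k≤w)) 3w (+≤+ ℕ.z≤n))
          (linarith 5 (λ D D₁ w k P → lit 0ℤ :- w :≤ D ⇒ D₁ :≤ w ⇒ lit 0ℤ :≤ k ⇒ 3 :* w :< P ⇒ ⊢ (D₁ :+ w :- k :< D :+ P)) refl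
            D D₁ (+ w) (+ k) P (subst (_≤ D) (sym (+-identityˡ (- + w))) l) u₁ (+≤+ ℕ.z≤n) 3w)
          where
          lemma : ∀ z z₀ w k → z - (z₀ - w + k) ≡ z - z₀ + w + - k
          lemma = solve-∀
        cases : Dec (0ℤ ≤ D) → ∃ λ i → i ℕ.≤ w × z ≈ α + + i
        cases (yes 0≤D) with toNat 0≤D
        ... | i , refl = i , drop‿+≤+ u , ≈-trans (≈-by (lemma z α)) (≈-+ (≈-refl {α}) e)
          where
          lemma : ∀ z α → z ≡ α + (z - α)
          lemma = solve-∀
        cases (no D<0) = ⊥-elim (below (toNat 0≤j))
          where
          0≤j : 0ℤ ≤ D₁ + + w
          0≤j = linarith 2 (λ D₁ w → lit 0ℤ :- w :≤ D₁ ⇒ ⊢ (lit 0ℤ :≤ D₁ :+ w)) refl D₁ (+ w) (subst (_≤ D₁) (sym (+-identityˡ (- + w))) l₁)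
          below : (∃ λ j → D₁ + + w ≡ + j) → ⊥
          below (j , ej) = contradiction (trans (sym (trans (cong X ([]-cong z≈)) hz)) (min j (drop‿+<+ (subst (_< + k) ej
              (linarith 4 (λ D D₁ w k → D :≡ D₁ :+ w :- k ⇒ D :< lit 0ℤ ⇒ ⊢ (D₁ :+ w :< k)) refl D D₁ (+ w) (+ k) exact (≰⇒> D<0)))))) λ ()
            where
            lemma : ∀ z₀ w D₁ → z₀ - w + (D₁ + w) ≡ z₀ + D₁
            lemma = solve-∀
            lemma′ : ∀ z z₀ → z₀ + (z - z₀) ≡ z
            lemma′ = solve-∀
            z≈ : z₀ - + w + + j ≈ z
            z≈ = ≈-trans (≈-by (trans (cong (λ t → z₀ - + w + t) (sym ej)) (lemma z₀ (+ w) D₁)))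
              (≈-trans (≈-+ (≈-refl {z₀}) (≈-sym e₁)) (≈-by (lemma′ z z₀)))

  module Base (m : ℕ) (p≡ : p ≡ 3 ℕ.+ 5 ℕ.* m) (21≤m : 21 ℕ.≤ m) where
    M : ℤ
    M = + m

    P≡ : P ≡ + 3 + 5 times M
    P≡ = trans (cong +_ p≡) (cong (λ z → + 3 + z) (sym (times-+ 5 m)))

    21≤M : + 21 ≤ M
    21≤M = +≤+ 21≤m

    -- The possible differences of the starts of two disjoint arcs of 2m - 1 residues: from 2m - 1
    -- to p - (2m - 1) = 3m + 4.
    record Mid (y : ℤ) : Set where
      constructor mid
      field
        val : ℤ
        val≈ : y ≈ val
        low : 2 times M ≤ val + 1ℤ
        high : val ≤ 3 times M + + 4

    s : ℕ
    s = 2 ℕ.* m ℕ.∸ 2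

    s+2 : s ℕ.+ 2 ≡ 2 ℕ.* m
    s+2 = ℕ.m∸n+n≡m (linarithⁿ 1 (λ m → lit 21 :≤ m ⇒ ⊢ (lit 2 :≤ 2 :* m)) refl m 21≤m)

    -- If the reduced difference θ were at most s, the first arc would start inside the second; if p
    -- - θ were at most s, the second would start inside the first.
    disjoint⇒Mid : ∀ a b x → (∀ i j → i ℕ.≤ s → j ℕ.≤ s → ¬ (a + + i ≈ x + b + + j)) → Mid (a - b - x)
    disjoint⇒Mid a b x dis = from (rem (a - b - x)) (rem<p (a - b - x)) (rem≈ (a - b - x))
      where
      lemma : ∀ a b x → a ≡ x + b + (a - b - x)
      lemma = solve-∀
      lemma₁ : ∀ a P → a + P ≡ a + 0ℤ + 1ℤ * P
      lemma₁ = solve-∀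
      from : ∀ θ → θ ℕ.< p → + θ ≈ a - b - x → Mid (a - b - x)
      from θ θ<p θ≈ = mid (+ θ) (≈-sym θ≈) (low′ (θ ℕ.≤? s)) (high′ (p ℕ.∸ θ ℕ.≤? s))
        where
        r = p ℕ.∸ θ
        θ+r : θ ℕ.+ r ≡ p
        θ+r = ℕ.m+[n∸m]≡n (ℕ.<⇒≤ θ<p)
        low′ : Dec (θ ℕ.≤ s) → 2 times M ≤ + θ + 1ℤ
        low′ (yes le) = ⊥-elim (dis 0 θ ℕ.z≤n le
          (≈-trans (≈-by (trans (+-identityʳ a) (lemma a b x))) (≈-+ (≈-refl {x + b}) (≈-sym θ≈))))
        low′ (no gt) = linarith 3 (λ M s θ → s :+ lit (+ 2) :≡ 2 :* M ⇒ s :< θ ⇒ ⊢ (2 :* M :≤ θ :+ lit 1ℤ)) refl M (+ s) (+ θ)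
          (trans (cong +_ s+2) (sym (times-+ 2 m))) (+<+ (ℕ.≰⇒> gt))
        high′ : Dec (r ℕ.≤ s) → + θ ≤ 3 times M + + 4
        high′ (yes le) = ⊥-elim (dis r 0 le ℕ.z≤n
          (≈-trans (≈-+ (≈-by (lemma a b x)) (≈-refl {+ r}))
            (≈-trans (≈-+ (≈-+ (≈-refl {x + b}) (≈-sym θ≈)) (≈-refl {+ r}))
              (mod 1ℤ (trans (+-assoc (x + b) (+ θ) (+ r)) (trans (cong (λ z → x + b + + z) θ+r) (lemma₁ (x + b) P)))))))
        high′ (no gt) = linarith 5 (λ M s θ r P → P :≡ lit (+ 3) :+ 5 :* M ⇒ s :+ lit (+ 2) :≡ 2 :* M ⇒ s :< r ⇒ θ :+ r :≡ P ⇒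
            ⊢ (θ :≤ 3 :* M :+ lit (+ 4))) refl M (+ s) (+ θ) (+ r) P P≡ (trans (cong +_ s+2) (sym (times-+ 2 m)))
          (+<+ (ℕ.≰⇒> gt)) (cong +_ θ+r)

    open Mid

    -- Two points w apart raise the lower end of the range to 2m - 1 + w, leaving a range of length
    -- m + 5 - w ≤ m + 6 - N for y and for y′.
    two-points⇒Near : ∀ y y′ z w N → N ℕ.≤ suc w → w ℕ.≤ m ℕ.+ 2 → Mid (y - z) → Mid (y - (z + + w)) → Mid (y′ - z) → Mid (y′ - (z + + w)) →
      Near (M + + 6 - + N) (y - y′)
    two-points⇒Near y y′ z w N N≤ w≤ a b a′ b′ = near (val a - val a′)
        (≈-trans (≈-by (lemma y y′ z)) (≈-- (val≈ a) (val≈ a′)))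
        (subst (_≤ val a - val a′) (+-identityˡ (- (M + + 6 - + N))) (linarith 5 (λ M N w a a′ → N :≤ lit 1ℤ :+ w ⇒ 2 :* M :+ w :≤ a :+ lit 1ℤ ⇒ a′ :≤ 3 :* M :+ lit (+ 4) ⇒
          ⊢ (lit 0ℤ :- (M :+ lit (+ 6) :- N) :≤ a :- a′)) refl M (+ N) (+ w) (val a) (val a′) (+≤+ N≤) (sharp y a b) (high a′)))
        (linarith 5 (λ M N w a a′ → N :≤ lit 1ℤ :+ w ⇒ 2 :* M :+ w :≤ a′ :+ lit 1ℤ ⇒ a :≤ 3 :* M :+ lit (+ 4) ⇒
          ⊢ (a :- a′ :≤ M :+ lit (+ 6) :- N)) refl M (+ N) (+ w) (val a) (val a′) (+≤+ N≤) (sharp y′ a′ b′) (high a))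
      where
      lemma : ∀ x y z → x - y ≡ x - z - (y - z)
      lemma = solve-∀
      sharp : ∀ y (a : Mid (y - z)) (b : Mid (y - (z + + w))) → 2 times M + + w ≤ val a + 1ℤ
      sharp y a b = linarith 4 (λ M w a b → a :≡ b :+ w ⇒ 2 :* M :≤ b :+ lit 1ℤ ⇒ ⊢ (2 :* M :+ w :≤ a :+ lit 1ℤ)) refl M (+ w) (val a) (val b) exact (low b)
        where
        lemma′ : ∀ y z w → y - z ≡ y - (z + w) + w
        lemma′ = solve-∀
        exact : val a ≡ val b + + w
        exact = ≈-small (≈-trans (≈-sym (val≈ a)) (≈-trans (≈-by (lemma′ y z (+ w))) (≈-+ (val≈ b) (≈-refl {+ w}))))
          (linarith 5 (λ M w a b P → P :≡ lit (+ 3) :+ 5 :* M ⇒ lit (+ 21) :≤ M ⇒ a :≤ 3 :* M :+ lit (+ 4) ⇒ 2 :* M :≤ b :+ lit 1ℤ ⇒ lit 0ℤ :≤ w ⇒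
            ⊢ (a :< b :+ w :+ P)) refl M (+ w) (val a) (val b) P P≡ 21≤M (high a) (low b) (+≤+ ℕ.z≤n))
          (linarith 5 (λ M w a b P → P :≡ lit (+ 3) :+ 5 :* M ⇒ lit (+ 21) :≤ M ⇒ b :≤ 3 :* M :+ lit (+ 4) ⇒ 2 :* M :≤ a :+ lit 1ℤ ⇒ w :≤ M :+ lit (+ 2) ⇒
            ⊢ (b :+ w :< a :+ P)) refl M (+ w) (val a) (val b) P P≡ 21≤M (high b) (low a) (+≤+ w≤))

  module Localise (m : ℕ) (p≡ : p ≡ 3 ℕ.+ 5 ℕ.* m) (21≤m : 21 ℕ.≤ m) {d : ℕ} (u û : V d → ℤ) (Mem : V d → ℤ → Set)
    (position : ∀ {r x} k → Mem r x → Base.Mid m p≡ 21≤m (u (r ⊞ k) - û k - x))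
    (quasi : ∀ i i′ j → Near (+ 12) (u (i ⊞ j) - u i - (u (i′ ⊞ j) - u i′)))
    (x₀ : ℤ) (hx₀ : Mem (constᵛ 0ℤ) x₀) where

    open Base m p≡ 21≤m
    open Mid

    o : V d
    o = constᵛ 0ℤ

    108≤P : + 108 ≤ P
    108≤P = linarith 2 (λ M P → P :≡ lit (+ 3) :+ 5 :* M ⇒ lit (+ 21) :≤ M ⇒ ⊢ (lit (+ 108) :≤ P)) refl M P P≡ 21≤M

    opaque
      approximation : Σ (V d → ℤ) λ a → (∀ v w → a (v ⊞ w) ≈ a v + a w) × (∀ v → Near (+ 12) (u v - u o - a v))
      approximation = approximate-homomorphism 108≤P u quasi

    linear : V d → ℤ
    linear = proj₁ approximation

    linear-additive : ∀ v w → linear (v ⊞ w) ≈ linear v + linear w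
    linear-additive = proj₁ (proj₂ approximation)

    linear-near : ∀ v → Near (+ 12) (u v - u o - linear v)
    linear-near = proj₂ (proj₂ approximation)

    o⊞ : ∀ k → o ⊞ k ≡ k
    o⊞ k = solve 1 (λ k → con 0ℤ ⊕ k := k) refl k

    -- The bounded parts of u and û once their common homomorphism is removed. In these terms
    -- `position` says that ũ (r + k) - h k + (linear r + x₀ - x) is in the middle range for all k,
    -- so only the extreme values of ũ and h matter.
    ũ h : V d → ℤ
    ũ v = rep (linear-near v)
    h k = ũ k - val (position k hx₀)

    u≈ : ∀ v → u v ≈ u o + linear v + ũ v
    u≈ v = ≈-trans (≈-by (lemma (u v) (u o) (linear v))) (≈-+ (≈-refl {u o + linear v}) (rep≈ (linear-near v)))
      where
      lemma : ∀ x y z → x ≡ y + z + (x - y - z)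
      lemma = solve-∀

    û≈ : ∀ k → û k ≈ u o + linear k + h k - x₀
    û≈ k = ≈-trans (≈-by (lemma₁ (u (o ⊞ k)) (û k) x₀)) (≈-trans (≈-- (≈-- (≈-trans (≈-by (cong u (o⊞ k))) (u≈ k)) (≈-refl {x₀})) (val≈ (position k hx₀)))
        (≈-by (lemma₂ (u o) (linear k) (ũ k) x₀ (val (position k hx₀)))))
      where
      lemma₁ : ∀ u û x → û ≡ u - x - (u - û - x)
      lemma₁ = solve-∀
      lemma₂ : ∀ o l t x v → o + l + t - x - v ≡ o + l + (t - v) - x
      lemma₂ = solve-∀

    value : ∀ {r x} k (hx : Mem r x) → ũ (r ⊞ k) - h k + (linear r + x₀ - x) ≈ val (position k hx)
    value {r} {x} k hx = ≈-trans (≈-by (lemma (u o) (linear r) (linear k) (ũ (r ⊞ k)) (h k) x₀ x))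
        (≈-trans (≈-- (≈-- (≈-sym (≈-trans (u≈ (r ⊞ k)) (≈-+ (≈-+ (≈-refl {u o}) (linear-additive r k)) (≈-refl {ũ (r ⊞ k)})))) (≈-sym (û≈ k))) (≈-refl {x})) (val≈ (position k hx)))
      where
      lemma : ∀ o r k t h x₀ x → t - h + (r + x₀ - x) ≡ (o + (r + k) + t) - (o + k + h - x₀) - x
      lemma = solve-∀

    u-max h-max : ∃ λ a → ∀ b → _
    u-max = maximum o ũ
    h-max = maximum o h

    opaque
      top : ℤ
      top = ũ (proj₁ u-max) - h (proj₁ h-max)

      top-≤ : ∀ k i → i ≡ proj₁ u-max → top ≤ ũ i - h k
      top-≤ k i refl = linarith 3 (λ a b c → b :≤ c ⇒ ⊢ (a :- c :≤ a :- b)) refl (ũ (proj₁ u-max)) (h k) (h (proj₁ h-max)) (proj₂ h-max k)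

      top-≥ : ∀ i → ũ i - h (proj₁ h-max) ≤ top
      top-≥ i = linarith 3 (λ a b c → b :≤ a ⇒ ⊢ (b :- c :≤ a :- c)) refl (ũ (proj₁ u-max)) (ũ i) (h (proj₁ h-max)) (proj₂ u-max i)

    -- At the maxima of ũ and h the value ũ (r + k) − h k is on either side of top.
    localised : ∀ r x → Mem r x → ∃ λ i → i ℕ.≤ m ℕ.+ 5 × x ≈ linear r + (x₀ + top - 3 times M - + 4) + + i
    localised r x hx = from (toNat 0≤i)
      where
      k₁ k₂ : V d
      k₁ = proj₁ u-max ⊟ r
      k₂ = proj₁ h-max
      q₁ = position k₁ hx
      q₂ = position k₂ hx
      E₁ E₂ cᵣ : ℤ
      E₁ = ũ (r ⊞ k₁) - h k₁
      E₂ = ũ (r ⊞ k₂) - h k₂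
      cᵣ = linear r + x₀ - x
      E₁≥ : top ≤ E₁
      E₁≥ = top-≤ k₁ (r ⊞ k₁) (solve 2 (λ r a → r ⊕ (a ⊕ ⊖ r) := a) refl r (proj₁ u-max))
      E₂≤ : E₂ ≤ top
      E₂≤ = top-≥ (r ⊞ k₂)
      range : ∀ i k → 2 times M - + 25 ≤ ũ i - h k × ũ i - h k ≤ 3 times M + + 28
      range i k = linarith 4 (λ M a b v → lit (- + 12) :≤ a ⇒ b :≤ lit (+ 12) ⇒ 2 :* M :≤ v :+ lit 1ℤ ⇒ ⊢ (2 :* M :- lit (+ 25) :≤ a :- (b :- v))) refl
            M (ũ i) (ũ k) (val q) (lower (linear-near i)) (upper (linear-near k)) (low q) ,
          linarith 4 (λ M a b v → a :≤ lit (+ 12) ⇒ lit (- + 12) :≤ b ⇒ v :≤ 3 :* M :+ lit (+ 4) ⇒ ⊢ (a :- (b :- v) :≤ 3 :* M :+ lit (+ 28))) refl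
            M (ũ i) (ũ k) (val q) (upper (linear-near i)) (lower (linear-near k)) (high q)
        where q = position k hx₀
      difference : E₁ - val q₁ ≈ E₂ - val q₂
      difference = ≈-trans (≈-by (lemma E₁ cᵣ (val q₁))) (≈-trans (≈-- (≈-- (value k₁ hx) (≈-refl {val q₁})) (≈-refl {cᵣ}))
        (≈-trans (≈-by (lemma′ (val q₁) (val q₂) cᵣ)) (≈-trans (≈-- (≈-- (≈-sym (value k₂ hx)) (≈-refl {val q₂})) (≈-refl {cᵣ})) (≈-by (sym (lemma E₂ cᵣ (val q₂)))))))
        where
        lemma : ∀ E c v → E - v ≡ E + c - v - c
        lemma = solve-∀
        lemma′ : ∀ a b c → a - a - c ≡ b - b - c
        lemma′ = solve-∀
      gap : ∀ M E₁ E₂ v₁ v₂ P → P ≡ + 3 + 5 times M → + 21 ≤ M → E₁ ≤ 3 times M + + 28 → 2 times M - + 25 ≤ E₂ → 2 times M ≤ v₁ + 1ℤ → v₂ ≤ 3 times M + + 4 →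
        E₁ - v₁ < E₂ - v₂ + P
      gap = linarith 6 (λ M E₁ E₂ v₁ v₂ P → P :≡ lit (+ 3) :+ 5 :* M ⇒ lit (+ 21) :≤ M ⇒ E₁ :≤ 3 :* M :+ lit (+ 28) ⇒ 2 :* M :- lit (+ 25) :≤ E₂ ⇒
        2 :* M :≤ v₁ :+ lit 1ℤ ⇒ v₂ :≤ 3 :* M :+ lit (+ 4) ⇒ ⊢ (E₁ :- v₁ :< E₂ :- v₂ :+ P)) refl
      exact : E₁ - val q₁ ≡ E₂ - val q₂
      exact = ≈-small difference
        (gap M E₁ E₂ (val q₁) (val q₂) P P≡ 21≤M (proj₂ (range _ k₁)) (proj₁ (range _ k₂)) (low q₁) (high q₂))
        (gap M E₂ E₁ (val q₂) (val q₁) P P≡ 21≤M (proj₂ (range _ k₂)) (proj₁ (range _ k₁)) (low q₂) (high q₁))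
      -- A lift of `linear r + x₀ − x + top`. E₁ ≥ top gives Θ ≤ 3m + 4 and E₂ ≤ top gives Θ ≥ 2m -
      -- 1, hence the m + 6 possible values of i.
      Θ : ℤ
      Θ = val q₁ - (E₁ - top)
      0≤i : 0ℤ ≤ 3 times M + + 4 - Θ
      0≤i = linarith 4 (λ M v E t → v :≤ 3 :* M :+ lit (+ 4) ⇒ t :≤ E ⇒ ⊢ (lit 0ℤ :≤ 3 :* M :+ lit (+ 4) :- (v :- (E :- t)))) refl M (val q₁) E₁ top (high q₁) E₁≥
      i≤ : 3 times M + + 4 - Θ ≤ M + + 5
      i≤ = linarith 6 (λ M v₁ v₂ E₁ E₂ t → E₁ :- v₁ :≡ E₂ :- v₂ ⇒ 2 :* M :≤ v₂ :+ lit 1ℤ ⇒ E₂ :≤ t ⇒ ⊢ (3 :* M :+ lit (+ 4) :- (v₁ :- (E₁ :- t)) :≤ M :+ lit (+ 5))) refl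
        M (val q₁) (val q₂) E₁ E₂ top exact (low q₂) E₂≤
      x≈ : x ≈ linear r + (x₀ + top - 3 times M - + 4) + (3 times M + + 4 - Θ)
      x≈ = ≈-trans (≈-by (lemma (linear r) x₀ x E₁ (val q₁)))
          (≈-trans (≈-+ (≈-refl {linear r + x₀ + E₁ - val q₁}) (≈-trans (≈-- (≈-refl {val q₁}) (value k₁ hx)) (≈-by (+-inverseʳ (val q₁)))))
            (≈-by (lemma′ (linear r) x₀ E₁ (val q₁) top (3 times M))))
        where
        lemma : ∀ l x₀ x E v → x ≡ l + x₀ + E - v + (v - (E + (l + x₀ - x)))
        lemma = solve-∀
        lemma′ : ∀ l x₀ E v t T → l + x₀ + E - v + 0ℤ ≡ l + (x₀ + t - T - + 4) + (T + + 4 - (v - (E - t)))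
        lemma′ = solve-∀
      from : (∃ λ i → 3 times M + + 4 - Θ ≡ + i) → ∃ λ i → i ℕ.≤ m ℕ.+ 5 × x ≈ linear r + (x₀ + top - 3 times M - + 4) + + i
      from (i , e) = i , drop‿+≤+ (subst (_≤ M + + 5) e i≤) ,
        ≈-trans x≈ (≈-by (cong (λ z → linear r + (x₀ + top - 3 times M - + 4) + z) e))

  module _ (m : ℕ) (p≡ : p ≡ 3 ℕ.+ 5 ℕ.* m) (21≤m : 21 ℕ.≤ m) (σ : Sign) (d : ℕ) (A : V (suc d) → Bool)
    (free : SumFreeV σ A) (big : m ℕ.* p ℕ.^ d ℕ.≤ ∣ A ∣)
    (X* : Sub) (X*⊆ : ∀ x → X* x ≡ true → A (x ∷ constᵛ 0ℤ) ≡ true) (∣X*∣ : ∣ X* ∣ ≡ m)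
    (c : ℤ) (X*-window : Window X* c (m ℕ.+ 1)) where

    open Base m p≡ 21≤m
    open Mid

    o : V d
    o = constᵛ 0ℤ

    slice : V d → Sub
    slice v x = A (x ∷ v)

    n : V d → ℕ
    n v = ∣ slice v ∣

    Mem : V d → ℤ → Set
    Mem v z = A ([ z ] ∷ v) ≡ true

    record TwoA (j : V d) (z : ℤ) : Set where
      constructor twoA
      field
        {v₁ v₂} : V d
        {y₁ y₂} : ℤ
        v₁⊞v₂ : v₁ ⊞ v₂ ≡ j
        mem₁ : Mem v₁ y₁
        mem₂ : Mem v₂ y₂
        sum : y₁ + y₂ ≈ z

    slices-free : ∀ {r x k z z′} → Mem r x → TwoA (sgnᵛ σ k) z → TwoA (r ⊞ k) z′ → ¬ (x + sg σ z ≈ z′)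
    slices-free {r} {x} {k} {z} {z′} hx (twoA {s} {t} {y} {y′} st hs ht yz) (twoA {s′} {t′} {w} {w′} st′ hs′ ht′ wz) e =
      free ([ x ] ∷ r) ([ y ] ∷ s) ([ y′ ] ∷ t) ([ w ] ∷ s′) ([ w′ ] ∷ t′) hx hs ht hs′ ht′
        (trans (cong (([ x ] ∷ r) ⊞_) (sgnᵛ-∷ σ ([ y ] +ᶠ [ y′ ]) (s ⊞ t))) (cong₂ _∷_ heads tails))
      where
      sg-cong : ∀ σ {a b} → a ≈ b → sg σ a ≈ sg σ b
      sg-cong plus h = h
      sg-cong minus h = ≈-neg h
      heads : [ x ] +ᶠ sgn σ ([ y ] +ᶠ [ y′ ]) ≡ [ w ] +ᶠ [ w′ ]
      heads = trans (cong (λ a → [ x ] +ᶠ a) (trans (cong (sgn σ) ([]-+ y y′)) (sgn-[] σ (y + y′))))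
        (trans ([]-+ x (sg σ (y + y′))) (trans ([]-cong (≈-trans (≈-+ (≈-refl {x}) (sg-cong σ yz)) (≈-trans e (≈-sym wz)))) (sym ([]-+ w w′))))
      tails : r ⊞ sgnᵛ σ (s ⊞ t) ≡ s′ ⊞ t′
      tails = trans (cong (r ⊞_) (trans (cong (sgnᵛ σ) st) (sgnᵛ-sgnᵛ σ k))) (sym st′)

    total : m ℕ.* size (V d) ℕ.≤ ∑ n
    total = subst₂ ℕ._≤_ (cong (m ℕ.*_) (sym (trans (size-Vec {F} d) (cong (ℕ._^ d) (size-Fin p)))))
      (trans (∑-∷ d (λ w → 𝟙 (A w))) (∑-swap (λ x v → 𝟙 (A (x ∷ v))))) big

    opaque
      -- A slice has at least m points on average, and both s and g s run through all slices. The
      -- pairs wanted are s, j - s and s, s + j.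
      average : (g h : V d → V d) → (∀ v → h (g v) ≡ v) → (∀ v → g (h v) ≡ v) → ∃ λ s → 2 ℕ.* m ℕ.≤ n s ℕ.+ n (g s)
      average g h hg gh = ∑-≤⇒∃ o (λ s → n s ℕ.+ n (g s)) (λ _ → 2 ℕ.* m)
        (subst₂ ℕ._≤_ (sym (∑-const {V d} (2 ℕ.* m))) (sym (trans (∑-+ n (λ s → n (g s))) (cong (∑ n ℕ.+_) (∑-bijection g h hg gh n))))
          (ℕ.≤-trans (ℕ.≤-reflexive (lemma (size (V d)) m)) (ℕ.+-mono-≤ total total)))
        where
        lemma : ∀ s m → s ℕ.* (2 ℕ.* m) ≡ m ℕ.* s ℕ.+ m ℕ.* s
        lemma = ℕSolver.solve-∀
          where import Data.Nat.Tactic.RingSolver as ℕSolver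

    opaque
      -- m points among m + 2 consecutive ones: the extremes are between m - 1 and m + 1 apart, as
      -- required for the two forbidden arcs to merge.
      X*-extremes : ∃ λ i → ∃ λ k → i ℕ.+ k ℕ.< suc (m ℕ.+ 1) × X* [ c + + i ] ≡ true × X* [ c + + (i ℕ.+ k) ] ≡ true × m ℕ.≤ suc k
      X*-extremes = extreme-elements (suc (m ℕ.+ 1)) m (λ i → X* [ c + + i ])
        (ℕ.≤-reflexive (sym count)) (subst (1 ℕ.≤_) (sym count) (ℕ.≤-trans (ℕ.s≤s ℕ.z≤n) 21≤m))
        where
        count : ∑< (suc (m ℕ.+ 1)) (λ i → 𝟙 (X* [ c + + i ])) ≡ m
        count = trans (window-count X* c (m ℕ.+ 1)
          (linarithⁿ 2 (λ m p → p :≡ lit 3 :+ 5 :* m ⇒ ⊢ (m :+ lit 1 :< p)) refl m p p≡) X*-window) ∣X*∣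

    opaque
      X*-arc : ∃ λ u → ∀ i → i ℕ.+ 2 ℕ.≤ 2 ℕ.* m → TwoA o (u + + i)
      X*-arc = let u , arc = arc-in-sumset X* X* c c (m ℕ.+ 1) (2 ℕ.* m)
                     (linarithⁿ 2 (λ m p → p :≡ lit 3 :+ 5 :* m ⇒ ⊢ (m :+ lit 1 :< p)) refl m p p≡) X*-window X*-window
                     (ℕ.≤-reflexive (trans (cong (m ℕ.+_) (ℕ.+-identityʳ m)) (sym (cong₂ ℕ._+_ ∣X*∣ ∣X*∣))))
                     (linarithⁿ 1 (λ m → lit 21 :≤ m ⇒ ⊢ (3 :* (m :+ lit 1) :+ lit 3 :≤ 2 :* (2 :* m))) refl m 21≤m)
               in u , λ i i≤ → let y , z , hy , hz , e = arc i i≤ in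
                    twoA (solve 0 (con 0ℤ ⊕ con 0ℤ := con 0ℤ) refl) (X*⊆ _ hy) (X*⊆ _ hz) e

    -- In x + σ(a + b) ≠ c + d the pair a, b is taken from the zero slice, where 2A contains an arc,
    -- and c, d are x′ and a point δ of the zero slice; x and x′ share the slice v.
    avoids : ∀ {v x x′ δ} → Mem v x → Mem v x′ → Mem o δ → ∀ i → i ℕ.+ 2 ℕ.≤ 2 ℕ.* m →
      ¬ (x′ - x ≈ sg σ (proj₁ X*-arc + + i) - δ)
    avoids {v} {x} {x′} {δ} hx hx′ hδ i i≤ e =
      slices-free {r = v} {k = o} hx (subst (λ w → TwoA w (proj₁ X*-arc + + i)) (sym (sgn-o σ)) (proj₂ X*-arc i i≤)) (twoA refl hx′ hδ ≈-refl)
        (≈-trans (≈-by (lemma₁ x (sg σ (proj₁ X*-arc + + i)) δ)) (≈-trans (≈-+ (≈-sym e) (≈-refl {x + δ})) (≈-by (lemma₂ x x′ δ))))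
      where
      sgn-o : ∀ σ → sgnᵛ σ o ≡ o
      sgn-o plus = refl
      sgn-o minus = constᵛ-neg 0ℤ
      lemma₁ : ∀ x s δ → x + s ≡ s - δ + (x + δ)
      lemma₁ = solve-∀
      lemma₂ : ∀ x x′ δ → x′ - x + (x + δ) ≡ x′ + δ
      lemma₂ = solve-∀

    -- The differences of one slice form a symmetric set containing 0. With δ at the two extremes of
    -- X* they avoid an arc of 3m - 2 residues.
    pairwise-close : ∀ v x x′ → Mem v x → Mem v x′ → Near (+ (m ℕ.+ 2)) (x′ - x)
    pairwise-close v x x′ hx hx′ = close (x′ - x) (x , x′ , hx , hx′ , ≈-refl)
      where
      i = proj₁ X*-extremes
      k = proj₁ (proj₂ X*-extremes)
      ext = proj₂ (proj₂ X*-extremes)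
      k≤ : k ℕ.≤ m ℕ.+ 1
      k≤ = ℕ.≤-trans (ℕ.m≤n+m k i) (ℕ.≤-pred (proj₁ ext))
      open AvoidArc m 21≤m (proj₁ X*-arc) (c + + i) k (proj₂ (proj₂ (proj₂ ext))) k≤
      D : ℤ → Set
      D y = ∃ λ x → ∃ λ x′ → Mem v x × Mem v x′ × y ≈ x′ - x
      avoided : ∀ {y} → D y → Avoided σ y
      avoided (x , x′ , hx , hx′ , e) j j≤ =
        (λ h → avoids hx hx′ (X*⊆ _ (proj₁ (proj₂ ext))) j j≤ (≈-trans (≈-sym e) h)) ,
        (λ h → avoids hx hx′ (X*⊆ _ (proj₁ (proj₂ (proj₂ ext)))) j j≤ (≈-trans (≈-sym e) (≈-trans h (≈-by (cong (λ z → sg σ (proj₁ X*-arc + + j) - z) (+-assoc c (+ i) (+ k)))))))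
      D-cong : ∀ {y z} → y ≈ z → D y → D z
      D-cong e (x , x′ , hx , hx′ , h) = x , x′ , hx , hx′ , ≈-trans (≈-sym e) h
      D-neg : ∀ {y} → D y → D (- y)
      D-neg (x , x′ , hx , hx′ , h) = x′ , x , hx′ , hx , ≈-trans (≈-neg h) (≈-by (flip x x′))
        where
        flip : ∀ x x′ → - (x′ - x) ≡ x - x′
        flip = solve-∀
      D-zero : D 0ℤ
      D-zero = x , x , hx , hx , ≈-by (sym (+-inverseʳ x))
      D-avoid : ∀ {y} → D y → ∀ θ → θ ℕ.+ 3 ℕ.≤ 3 ℕ.* m → ¬ (y ≈ start σ + + θ)
      D-avoid h = avoid-arc σ _ (avoided h)
      open Close m p≡ 21≤m D D-cong D-neg D-zero (start σ) D-avoid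

    opaque
      window : ∀ v → ∃ λ α → Window (slice v) α (m ℕ.+ 2)
      window v = windowed (slice v) (m ℕ.+ 2)
        (subst₂ _<_ (sym (times-* 3 (+ (m ℕ.+ 2)))) (sym P≡)
          (linarith 1 (λ M → lit (+ 21) :≤ M ⇒ ⊢ (3 :* (M :+ lit (+ 2)) :< lit (+ 3) :+ 5 :* M)) refl M 21≤M))
        (pairwise-close v)

    m+2<p : m ℕ.+ 2 ℕ.< p
    m+2<p = linarithⁿ 2 (λ m p → p :≡ lit 3 :+ 5 :* m ⇒ ⊢ (m :+ lit 2 :< p)) refl m p p≡

    n≤ : ∀ v → n v ℕ.≤ m ℕ.+ 3
    n≤ v = subst₂ ℕ._≤_ (window-count (slice v) (proj₁ (window v)) (m ℕ.+ 2) m+2<p (proj₂ (window v))) (sym (ℕ.+-suc m 2))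
      (∑<≤ (suc (m ℕ.+ 2)) (λ i → slice v [ proj₁ (window v) + + i ]))

    opaque
      -- Some pair of slices s, j - s has 2m points in total, and each lies in m + 3 consecutive
      -- residues, dense enough for `interval-in-sumset`.
      arc : ∀ j → ∃ λ u → ∀ i → i ℕ.+ 2 ℕ.≤ 2 ℕ.* m → TwoA j (u + + i)
      arc j = let s , big′ = average (λ s → j ⊟ s) (λ s → j ⊟ s) (inv j) (inv j)
                  u , cov = arc-in-sumset (slice s) (slice (j ⊟ s)) (proj₁ (window s)) (proj₁ (window (j ⊟ s))) (m ℕ.+ 2) (2 ℕ.* m)
                    m+2<p (proj₂ (window s)) (proj₂ (window (j ⊟ s))) big′
                    (linarithⁿ 1 (λ m → lit 21 :≤ m ⇒ ⊢ (3 :* (m :+ lit 2) :+ lit 3 :≤ 2 :* (2 :* m))) refl m 21≤m)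
              in u , λ i i≤ → let y , z , hy , hz , e = cov i i≤ in twoA (solve 2 (λ s j → s ⊕ (j ⊕ ⊖ s) := j) refl s j) hy hz e
        where
        inv : ∀ (j s : V d) → j ⊟ (j ⊟ s) ≡ s
        inv j s = solve 2 (λ j s → j ⊕ ⊖ (j ⊕ ⊖ s) := s) refl j s

    u : V d → ℤ
    u j = proj₁ (arc j)

    -- The start of σ applied to the arc over σk, which is the arc that sum-freeness compares with
    -- the one over r + k. For `minus` reflection turns the last index into the first.
    û : V d → ℤ
    û k = û′ σ
      where
      û′ : Sign → ℤ
      û′ plus = u k
      û′ minus = - u (⊝ k) - + (2 ℕ.* m ℕ.∸ 2)

    disjoint-arcs : ∀ {r x} k → Mem r x → ∀ a b → a ℕ.≤ s → b ℕ.≤ s → ¬ (u (r ⊞ k) + + a ≈ x + û k + + b)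
    disjoint-arcs {r} {x} k hx a b a≤ b≤ e = by σ refl
      where
      bound : ∀ {i} → i ℕ.≤ s → i ℕ.+ 2 ℕ.≤ 2 ℕ.* m
      bound le = ℕ.≤-trans (ℕ.+-monoˡ-≤ 2 le) (ℕ.≤-reflexive s+2)
      by : ∀ τ → τ ≡ σ → ⊥
      by plus refl = slices-free {r = r} {k = k} hx (proj₂ (arc k) b (bound b≤)) (proj₂ (arc (r ⊞ k)) a (bound a≤))
        (≈-trans (≈-by (sym (+-assoc x (u k) (+ b)))) (≈-sym e))
      by minus refl = slices-free {r = r} {k = k} hx (proj₂ (arc (⊝ k)) (s ℕ.∸ b) (bound (ℕ.m∸n≤m s b))) (proj₂ (arc (r ⊞ k)) a (bound a≤))
        (≈-trans (≈-by (trans (lemma x (u (⊝ k)) (+ (s ℕ.∸ b)) (+ b)) (cong (λ z → x + (- u (⊝ k) - z) + + b) (cong +_ (ℕ.m∸n+n≡m b≤))))) (≈-sym e))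
        where
        lemma : ∀ x u r b → x + - (u + r) ≡ x + (- u - (r + b)) + b
        lemma = solve-∀

    position : ∀ {r x} k → Mem r x → Mid (u (r ⊞ k) - û k - x)
    position {r} {x} k hx = disjoint⇒Mid (u (r ⊞ k)) (û k) x (disjoint-arcs k hx)

    -- The extreme points of slice r are at least n r - 1 apart, and `position` holds at both, for k
    -- and for k′.
    spread : ∀ r k k′ → 1 ℕ.≤ n r → Near (M + + 6 - + n r) (u (r ⊞ k) - û k - (u (r ⊞ k′) - û k′))
    spread r k k′ 1≤n = from (extreme-elements (suc (m ℕ.+ 2)) (n r) (λ i → slice r [ α + + i ]) (ℕ.≤-reflexive (sym count)) (subst (1 ℕ.≤_) (sym count) 1≤n))
      where
      α = proj₁ (window r)
      count = window-count (slice r) α (m ℕ.+ 2) m+2<p (proj₂ (window r))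
      from : (∃ λ i → ∃ λ w → i ℕ.+ w ℕ.< suc (m ℕ.+ 2) × slice r [ α + + i ] ≡ true × slice r [ α + + (i ℕ.+ w) ] ≡ true × n r ℕ.≤ suc w) →
        Near (M + + 6 - + n r) (u (r ⊞ k) - û k - (u (r ⊞ k′) - û k′))
      from (i , w , i+w< , h₁ , h₂ , n≤w) = two-points⇒Near (u (r ⊞ k) - û k) (u (r ⊞ k′) - û k′) (α + + i) w (n r) n≤w
        (ℕ.≤-trans (ℕ.m≤n+m w i) (ℕ.≤-pred i+w<)) (position k h₁) (position k h₂′) (position k′ h₁) (position k′ h₂′)
        where
        h₂′ : Mem r (α + + i + + w)
        h₂′ = subst (Mem r) (sym (+-assoc α (+ i) (+ w))) h₂

    opaque
      -- Writing i + j = (ρ + j) + (i - ρ) and i = ρ + (i - ρ) makes û (i - ρ) cancel. The errors m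
      -- + 6 - n (ρ + j) and m + 6 - n ρ total at most 12 when the two slices have 2m points
      -- together.
      quasi : ∀ i i′ j → Near (+ 12) (u (i ⊞ j) - u i - (u (i′ ⊞ j) - u i′))
      quasi i i′ j = from (average (_⊞ j) (_⊟ j) (λ v → solve 2 (λ v j → v ⊕ j ⊕ ⊖ j := v) refl v j) (λ v → solve 2 (λ v j → v ⊕ ⊖ j ⊕ j := v) refl v j))
        where
        from : (∃ λ ρ → 2 ℕ.* m ℕ.≤ n ρ ℕ.+ n (ρ ⊞ j)) → Near (+ 12) (u (i ⊞ j) - u i - (u (i′ ⊞ j) - u i′))
        from (ρ , le) = near (rep a - rep b)
            (≈-trans (≈-by (lemma (u (i ⊞ j)) (u i) (u (i′ ⊞ j)) (u i′) (û (i ⊟ ρ)) (û (i′ ⊟ ρ)))) (≈-- (rep≈ a) (rep≈ b)))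
            (linarith 5 (λ M N N′ a b → 2 :* M :≤ N :+ N′ ⇒ lit 0ℤ :- (M :+ lit (+ 6) :- N′) :≤ a ⇒ b :≤ M :+ lit (+ 6) :- N ⇒ ⊢ (lit (- + 12) :≤ a :- b)) refl
              M (+ n ρ) (+ n (ρ ⊞ j)) (rep a) (rep b) le′ (subst (_≤ rep a) (sym (+-identityˡ _)) (lower a)) (upper b))
            (linarith 5 (λ M N N′ a b → 2 :* M :≤ N :+ N′ ⇒ lit 0ℤ :- (M :+ lit (+ 6) :- N) :≤ b ⇒ a :≤ M :+ lit (+ 6) :- N′ ⇒ ⊢ (a :- b :≤ lit (+ 12))) refl
              M (+ n ρ) (+ n (ρ ⊞ j)) (rep a) (rep b) le′ (subst (_≤ rep b) (sym (+-identityˡ _)) (lower b)) (upper a))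
          where
          le′ : 2 times M ≤ + n ρ + + n (ρ ⊞ j)
          le′ = subst (_≤ + n ρ + + n (ρ ⊞ j)) (sym (times-+ 2 m)) (+≤+ le)
          lemma : ∀ a b c d e f → a - b - (c - d) ≡ a - e - (c - f) - (b - e - (d - f))
          lemma = solve-∀
          positive′ : ∀ x y m → 2 ℕ.* m ℕ.≤ x ℕ.+ y → x ℕ.≤ m ℕ.+ 3 → 21 ℕ.≤ m → 1 ℕ.≤ y
          positive′ = linarithⁿ 3 (λ x y m → 2 :* m :≤ x :+ y ⇒ x :≤ m :+ lit 3 ⇒ lit 21 :≤ m ⇒ ⊢ (lit 1 :≤ y)) refl
          a : Near (M + + 6 - + n (ρ ⊞ j)) (u (i ⊞ j) - û (i ⊟ ρ) - (u (i′ ⊞ j) - û (i′ ⊟ ρ)))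
          a = subst₂ (λ x y → Near (M + + 6 - + n (ρ ⊞ j)) (u x - û (i ⊟ ρ) - (u y - û (i′ ⊟ ρ)))) (shift i) (shift i′)
                (spread (ρ ⊞ j) (i ⊟ ρ) (i′ ⊟ ρ) (positive′ (n ρ) (n (ρ ⊞ j)) m le (n≤ ρ) 21≤m))
            where
            shift : ∀ i → ρ ⊞ j ⊞ (i ⊟ ρ) ≡ i ⊞ j
            shift i = solve 3 (λ ρ j i → ρ ⊕ j ⊕ (i ⊕ ⊖ ρ) := i ⊕ j) refl ρ j i
          b : Near (M + + 6 - + n ρ) (u i - û (i ⊟ ρ) - (u i′ - û (i′ ⊟ ρ)))
          b = subst₂ (λ x y → Near (M + + 6 - + n ρ) (u x - û (i ⊟ ρ) - (u y - û (i′ ⊟ ρ)))) (shift i) (shift i′)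
                (spread ρ (i ⊟ ρ) (i′ ⊟ ρ) (positive′ (n (ρ ⊞ j)) (n ρ) m (subst (2 ℕ.* m ℕ.≤_) (ℕ.+-comm (n ρ) (n (ρ ⊞ j))) le) (n≤ (ρ ⊞ j)) 21≤m))
            where
            shift : ∀ i → ρ ⊞ (i ⊟ ρ) ≡ i
            shift i = solve 2 (λ ρ i → ρ ⊕ (i ⊕ ⊖ ρ) := i) refl ρ i

    x₀-exists : ∃ λ x₀ → Mem o x₀
    x₀-exists = let x , hx = 1≤⇒member X* (subst (1 ℕ.≤_) (sym ∣X*∣) (ℕ.≤-trans (ℕ.s≤s ℕ.z≤n) 21≤m)) in
      ι x , X*⊆ _ (trans (cong X* ([]-ι x)) hx)

    concentration : Σ (V d → ℤ) λ a → (∀ v w → a (v ⊞ w) ≈ a v + a w) ×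
      ∃ λ L → ∀ r x → Mem r x → ∃ λ i → i ℕ.≤ m ℕ.+ 5 × x ≈ a r + L + + i
    concentration = let x₀ , hx₀ = x₀-exists in
      Localise.linear m p≡ 21≤m u û Mem position quasi x₀ hx₀ ,
      Localise.linear-additive m p≡ 21≤m u û Mem position quasi x₀ hx₀ , _ ,
      Localise.localised m p≡ 21≤m u û Mem position quasi x₀ hx₀

-- Bounded sequences with large sum and competing terms.

module Sequences where

  open LinearArithmetic
  open Sums
  open import Data.Empty using (⊥)
  open import Data.Nat using (ℕ; zero; suc; _+_; _*_; _∸_; _≤_; _<_; s≤s; >-nonZero)
  open import Data.Nat.Properties
  open import Data.Nat.Tactic.RingSolver using (solve-∀)
  open import Data.Product using (_×_; _,_; proj₁; proj₂)
  open import Data.Sum using (_⊎_; inj₁; inj₂)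
  open import Relation.Binary.PropositionalEquality
  open import Relation.Nullary using (yes; no; contradiction)

  module _ (N : ℕ) (b : ℕ → ℕ) where

    ∑<-bounded : ∀ n → (∀ i → i < n → b i ≤ N) → ∑< n b ≤ n * N
    ∑<-bounded n h = ≤-trans (∑<-mono n h) (≤-reflexive (∑<-const n N))

    module _ (m M e : ℕ) (M+1 : suc M ≡ m + e) (e≤6 : e ≤ 6) (21≤m : 21 ≤ m) (1≤N : 1 ≤ N)
      (b≤N : ∀ i → i ≤ M → b i ≤ N) (big : m * N ≤ ∑< (suc M) b)
      (D : ℕ) (D+e≤M : D + e ≤ M) (pairs : ∀ i → i + D ≤ M → b i + b (i + D) ≤ N) where

      private
        block : ∀ n → (∀ i → i < n → i + D ≤ M) → ∑< n b + ∑< n (λ i → b (D + i)) ≤ n * N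
        block n h = ≤-trans (≤-reflexive (sym (∑<-+ n b (λ i → b (D + i)))))
          (≤-trans (∑<-mono n (λ i lt → subst (λ k → b i + b k ≤ N) (+-comm i D) (pairs i (h i lt)))) (≤-reflexive (∑<-const n N)))

        -- The e + 1 pairs (i, i + D) with i ≤ e are disjoint, and each has sum at most N. Each pair
        -- loses one N, so the total is at most (M + 1 - (e + 1))N = (m - 1)N.
        far : suc e ≤ D → ⊥
        far e<D = contradiction (≤-trans big total) (<⇒≱ (subst (_< m * N) (*-distribʳ-+ N a (suc e + r)) (*-monoˡ-< N {{>-nonZero 1≤N}} count)))
          where
          a = D ∸ suc e
          r = M ∸ (D + e)
          D≡ : suc e + a ≡ D
          D≡ = m+[n∸m]≡n e<D
          M≡ : D + e + r ≡ M
          M≡ = m+[n∸m]≡n D+e≤M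
          length : suc M ≡ suc e + (a + (suc e + r))
          length = linarithⁿ 5 (λ M e a r D → lit 1 :+ e :+ a :≡ D ⇒ D :+ e :+ r :≡ M ⇒ ⊢ (lit 1 :+ M :≡ lit 1 :+ e :+ (a :+ (lit 1 :+ e :+ r)))) refl M e a r D D≡ M≡
          count : a + (suc e + r) < m
          count = linarithⁿ 5 (λ M e a r m → lit 1 :+ M :≡ lit 1 :+ e :+ (a :+ (lit 1 :+ e :+ r)) ⇒ lit 1 :+ M :≡ m :+ e ⇒ ⊢ (a :+ (lit 1 :+ e :+ r) :< m)) refl M e a r m length M+1
          index₁ : ∀ M e a r i → suc M ≡ suc e + (a + (suc e + r)) → i < a → suc e + i ≤ M
          index₁ = linarithⁿ 5 (λ M e a r i → lit 1 :+ M :≡ lit 1 :+ e :+ (a :+ (lit 1 :+ e :+ r)) ⇒ i :< a ⇒ ⊢ (lit 1 :+ e :+ i :≤ M)) refl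
          index₂ : ∀ M e a r i → suc M ≡ suc e + (a + (suc e + r)) → i < r → suc e + (a + (suc e + i)) ≤ M
          index₂ = linarithⁿ 5 (λ M e a r i → lit 1 :+ M :≡ lit 1 :+ e :+ (a :+ (lit 1 :+ e :+ r)) ⇒ i :< r ⇒ ⊢ (lit 1 :+ e :+ (a :+ (lit 1 :+ e :+ i)) :≤ M)) refl
          f₁ : ℕ → ℕ
          f₁ i = b (suc e + i)
          f₂ : ℕ → ℕ
          f₂ i = b (suc e + (a + i))
          f₃ : ℕ → ℕ
          f₃ i = b (suc e + (a + (suc e + i)))
          parts : ∑< (suc M) b ≡ ∑< (suc e) b + (∑< a f₁ + (∑< (suc e) f₂ + ∑< r f₃))
          parts = trans (cong (λ n → ∑< n b) length) (trans (∑<-split (suc e) (a + (suc e + r)) b)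
            (cong (∑< (suc e) b +_) (trans (∑<-split a (suc e + r) f₁) (cong (∑< a f₁ +_) (∑<-split (suc e) r f₂)))))
          paired : ∑< (suc e) b + ∑< (suc e) f₂ ≤ suc e * N
          paired = subst (λ s → ∑< (suc e) b + s ≤ suc e * N)
            (∑<-cong (suc e) (λ i _ → cong b (trans (cong (_+ i) (sym D≡)) (+-assoc (suc e) a i))))
            (block (suc e) (λ i lt → linarithⁿ 5 (λ i e D M r → i :< lit 1 :+ e ⇒ D :+ e :+ r :≡ M ⇒ ⊢ (i :+ D :≤ M)) refl i e D M r lt M≡))
          mid : ∑< a f₁ ≤ a * N
          mid = ≤-trans (∑<-mono a (λ i lt → b≤N _ (index₁ M e a r i length lt))) (≤-reflexive (∑<-const a N))
          rest : ∑< r f₃ ≤ r * N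
          rest = ≤-trans (∑<-mono r (λ i lt → b≤N _ (index₂ M e a r i length lt))) (≤-reflexive (∑<-const r N))
          total : ∑< (suc M) b ≤ a * N + (suc e + r) * N
          total = linarithⁿ 9 (λ S s₀ s₁ s₂ s₃ A E R T → S :≡ s₀ :+ (s₁ :+ (s₂ :+ s₃)) ⇒ s₀ :+ s₂ :≤ E ⇒ s₁ :≤ A ⇒ s₃ :≤ R ⇒ T :≡ E :+ R ⇒ ⊢ (S :≤ A :+ T)) refl
            (∑< (suc M) b) (∑< (suc e) b) (∑< a f₁) (∑< (suc e) f₂) (∑< r f₃) (a * N) (suc e * N) (r * N) ((suc e + r) * N)
            parts paired mid rest (*-distribʳ-+ N (suc e) r)

        -- Pairs overlap now, so all pairs are used: twice the total is at most (M + 1 - D)N from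
        -- the pairs plus 2DN for the unpaired ends, that is (m + e + D)N < 2mN, since e and D are
        -- at most 6.
        near : D ≤ e → ⊥
        near D≤e = contradiction (≤-trans (*-monoʳ-≤ 2 big) total) (<⇒≱ (subst ((k + 2 * D) * N <_) (*-assoc 2 m N)
            (*-monoˡ-< N {{>-nonZero 1≤N}} count)))
          where
          k = suc M ∸ D
          k+D : k + D ≡ suc M
          k+D = m∸n+n≡m (≤-trans (m≤m+n D e) (m≤n⇒m≤1+n D+e≤M))
          count : k + 2 * D < 2 * m
          count = linarithⁿ 5 (λ k D M m e → k :+ D :≡ lit 1 :+ M ⇒ lit 1 :+ M :≡ m :+ e ⇒ D :≤ e ⇒ e :≤ lit 6 ⇒ lit 21 :≤ m ⇒ ⊢ (k :+ 2 :* D :< 2 :* m)) refl k D M m e k+D M+1 D≤e e≤6 21≤m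
          tail≤ : ∑< D (λ i → b (k + i)) ≤ D * N
          tail≤ = ≤-trans (∑<-mono D (λ i lt → b≤N _ (linarithⁿ 4 (λ k i D M → i :< D ⇒ k :+ D :≡ lit 1 :+ M ⇒ ⊢ (k :+ i :≤ M)) refl k i D M lt k+D))) (≤-reflexive (∑<-const D N))
          head≤ : ∑< D b ≤ D * N
          head≤ = ∑<-bounded D (λ i lt → b≤N i (linarithⁿ 4 (λ k i D M → i :< D ⇒ k :+ D :≡ lit 1 :+ M ⇒ ⊢ (i :≤ M)) refl k i D M lt k+D))
          split₁ : ∑< (suc M) b ≡ ∑< k b + ∑< D (λ i → b (k + i))
          split₁ = trans (cong (λ n → ∑< n b) (sym k+D)) (∑<-split k D b)
          split₂ : ∑< (suc M) b ≡ ∑< D b + ∑< k (λ i → b (D + i))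
          split₂ = trans (cong (λ n → ∑< n b) (trans (sym k+D) (+-comm k D))) (∑<-split D k b)
          paired : ∑< k b + ∑< k (λ i → b (D + i)) ≤ k * N
          paired = block k (λ i lt → linarithⁿ 4 (λ k i D M → i :< k ⇒ k :+ D :≡ lit 1 :+ M ⇒ ⊢ (i :+ D :≤ M)) refl k i D M lt k+D)
          total : 2 * ∑< (suc M) b ≤ (k + 2 * D) * N
          total = linarithⁿ 8 (λ S s t s′ t′ K Q T → S :≡ s :+ t ⇒ S :≡ t′ :+ s′ ⇒ s :+ s′ :≤ K ⇒ t :≤ Q ⇒ t′ :≤ Q ⇒ T :≡ K :+ 2 :* Q ⇒ ⊢ (2 :* S :≤ T)) refl
            (∑< (suc M) b) (∑< k b) (∑< D (λ i → b (k + i))) (∑< k (λ i → b (D + i))) (∑< D b) (k * N) (D * N) ((k + 2 * D) * N)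
            split₁ split₂ paired tail≤ head≤ (lemma k D N)
            where
            lemma : ∀ k D N → (k + 2 * D) * N ≡ k * N + 2 * (D * N)
            lemma = solve-∀

      no-distance : ⊥
      no-distance with suc e ≤? D
      ... | yes e<D = far e<D
      ... | no e≮D = near (≤-pred (≰⇒> e≮D))

    all-full : ∀ n → (∀ i → i < n → b i ≤ N) → n * N ≤ ∑< n b → ∀ i → i < n → N ≤ b i
    all-full (suc n) h le i i<sn = go (m≤n⇒m<n∨m≡n (≤-pred i<sn))
      where
      init : ∑< n b ≤ n * N
      init = ∑<-bounded n (λ j lt → h j (m<n⇒m<1+n lt))
      go : i < n ⊎ i ≡ n → N ≤ b i
      go (inj₁ i<n) = all-full n (λ j lt → h j (m<n⇒m<1+n lt)) (linarithⁿ 4 (λ N T s t → N :+ T :≤ s :+ t ⇒ t :≤ N ⇒ ⊢ (T :≤ s)) refl N (n * N) (∑< n b) (b n) le (h n ≤-refl)) i i<n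
      go (inj₂ refl) = linarithⁿ 4 (λ N T s t → N :+ T :≤ s :+ t ⇒ s :≤ T ⇒ ⊢ (N :≤ t)) refl N (n * N) (∑< n b) (b n) le init

    module _ (b≤N : ∀ i → b i ≤ N) where
      private
        window≤ : ∀ n k → ∑< n (λ i → b (k + i)) ≤ n * N
        window≤ n k = ≤-trans (∑<-mono n (λ i _ → b≤N (k + i))) (≤-reflexive (∑<-const n N))

      one-pair : ∀ n → suc n * N ≤ ∑< (2 + n) b → b 0 + b (suc n) ≤ N →
        (N ≤ b 0 + b (suc n)) × (n * N ≤ ∑< n (λ i → b (suc i)))
      one-pair n big pair =
        linarithⁿ 5 (λ N T s x y → N :+ T :≤ x :+ s :+ y ⇒ s :≤ T ⇒ ⊢ (N :≤ x :+ y)) refl N (n * N) S (b 0) (b (suc n)) big′ (window≤ n 1) ,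
        linarithⁿ 5 (λ N T s x y → N :+ T :≤ x :+ s :+ y ⇒ x :+ y :≤ N ⇒ ⊢ (T :≤ s)) refl N (n * N) S (b 0) (b (suc n)) big′ pair
        where
        S = ∑< n (λ i → b (suc i))
        big′ : N + n * N ≤ b 0 + S + b (suc n)
        big′ = subst (λ z → N + n * N ≤ z + b (suc n)) (∑<-cons n b) big

      two-pairs : ∀ n → (2 + n) * N ≤ ∑< (4 + n) b → b 0 + b (2 + n) ≤ N → b 1 + b (3 + n) ≤ N →
        (N ≤ b 0 + b (2 + n)) × (N ≤ b 1 + b (3 + n)) × (n * N ≤ ∑< n (λ i → b (2 + i)))
      two-pairs n big pair₁ pair₂ =
        linarithⁿ 7 (λ N T s x y z w → N :+ (N :+ T) :≤ x :+ y :+ s :+ z :+ w ⇒ s :≤ T ⇒ y :+ w :≤ N ⇒ ⊢ (N :≤ x :+ z)) refl N (n * N) S (b 0) (b 1) (b (2 + n)) (b (3 + n)) big′ (window≤ n 2) pair₂ ,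
        linarithⁿ 7 (λ N T s x y z w → N :+ (N :+ T) :≤ x :+ y :+ s :+ z :+ w ⇒ s :≤ T ⇒ x :+ z :≤ N ⇒ ⊢ (N :≤ y :+ w)) refl N (n * N) S (b 0) (b 1) (b (2 + n)) (b (3 + n)) big′ (window≤ n 2) pair₁ ,
        linarithⁿ 7 (λ N T s x y z w → N :+ (N :+ T) :≤ x :+ y :+ s :+ z :+ w ⇒ x :+ z :≤ N ⇒ y :+ w :≤ N ⇒ ⊢ (T :≤ s)) refl N (n * N) S (b 0) (b 1) (b (2 + n)) (b (3 + n)) big′ pair₁ pair₂
        where
        S = ∑< n (λ i → b (2 + i))
        big′ : N + (N + n * N) ≤ b 0 + b 1 + S + b (2 + n) + b (3 + n)
        big′ = subst (λ z → N + (N + n * N) ≤ z + b (2 + n) + b (3 + n)) (∑<-split 2 n b) big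

  module _ (N : ℕ) (b : ℕ → ℕ) (b≤N : ∀ i → b i ≤ N) where

    full-but-ends : ∀ m → 1 ≤ m → m * N ≤ ∑< (suc m) b → b 0 + b m ≤ N →
      (N ≤ b 0 + b m) × (∀ i → 0 < i → i < m → N ≤ b i)
    full-but-ends (suc n) _ big pair = proj₁ (one-pair N b b≤N n big pair) , inside
      where
      inside : ∀ i → 0 < i → i < suc n → N ≤ b i
      inside (suc i) _ i<n = all-full N (λ i → b (suc i)) n (λ i _ → b≤N (suc i)) (proj₂ (one-pair N b b≤N n big pair)) i (≤-pred i<n)

    full-but-two-ends : ∀ m → 2 ≤ m → m * N ≤ ∑< (2 + m) b → b 0 + b m ≤ N → b 1 + b (suc m) ≤ N →
      (N ≤ b 0 + b m) × (N ≤ b 1 + b (suc m)) × (∀ i → 1 < i → i < m → N ≤ b i)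
    full-but-two-ends (suc (suc n)) _ big pair₁ pair₂ = proj₁ all , proj₁ (proj₂ all) , inside
      where
      all = two-pairs N b b≤N n big pair₁ pair₂
      inside : ∀ i → 1 < i → i < 2 + n → N ≤ b i
      inside (suc (suc i)) _ i<n = all-full N (λ i → b (2 + i)) n (λ i _ → b≤N (2 + i)) (proj₂ (proj₂ all)) i (≤-pred (≤-pred i<n))
      inside (suc zero) (s≤s ()) _
    full-but-two-ends (suc zero) (s≤s ()) _ _ _

-- Sum-freeness for fibres over parallel hyperplanes, and their possible positions.

module Fibres (p : ℕ) .{{_ : NonZero p}} (prime : Prime p) where

  open LinearArithmetic hiding (close)
  open Sums
  open Sequences
  open Residues p
  open SumFreeLine p prime using (Sign; plus; minus; sgn)
  open QuasiHomomorphisms p prime using (≈-by)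
  open Concentration p prime using (sg; sgnᵛ; SumFreeV; sgnᵛ-∷; sgn-[])
  open import Data.Bool using (Bool; true; not)
  open import Data.Empty using (⊥; ⊥-elim)
  open import Data.Integer hiding (NonZero; ∣_∣; suc; sign)
  open import Data.Integer.Properties hiding (_≟_; _≤?_; _<?_)
  open import Data.Integer.Tactic.RingSolver using (solve-∀)
  open import Data.Nat using (suc)
  import Data.Nat as ℕ
  import Data.Nat.Properties as ℕ
  open import Data.Product using (∃; _×_; _,_)
  open import Data.Vec using (_∷_)
  open import Relation.Binary.PropositionalEquality hiding ([_])
  open import Relation.Nullary using (Dec; yes; no)
  open VSolver using (solve; _:=_; con) renaming (_:+_ to _⊕_; _:*_ to _⊗_; :-_ to ⊖_)

  ≈-both : ∀ {x y l r} k → x ≈ y → l ≡ x + k → r ≡ y + k → l ≈ r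
  ≈-both k h refl refl = ≈-+ h (≈-refl {k})

  -- j − 4m − 3 represents m + j modulo p = 5m + 3.
  choose-multiple : ∀ m M e j → suc M ≡ m ℕ.+ e → e ℕ.≤ 6 → 21 ℕ.≤ m → j ℕ.< 3 ℕ.+ 5 ℕ.* m → 7 ℕ.≤ j ℕ.+ 3 ℕ.* e →
    ∃ λ t → t ℕ.≤ 3 × ∃ λ D → D ≡ + j - 4 times (+ m) - + 3 + t times (+ M) × - + M + + e ≤ D × D ≤ + M - + e
  choose-multiple m M e j M+1 e≤6 21≤m j<p 7≤ = by₀ (- + M + + e Data.Integer.≤? Γ)
    where
    Γ : ℤ
    Γ = + j - 4 times (+ m) - + 3
    M+1′ : 1ℤ + + M ≡ + m + + e
    M+1′ = cong +_ M+1
    e≤6′ : + e ≤ + 6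
    e≤6′ = +≤+ e≤6
    21≤m′ : + 21 ≤ + m
    21≤m′ = +≤+ 21≤m
    j<p′ : + j < + 3 + 5 times (+ m)
    j<p′ = subst (λ z → + j < + 3 + z) (sym (times-+ 5 m)) (+<+ j<p)
    7≤′ : + 7 ≤ + j + 3 times (+ e)
    7≤′ = subst (λ z → + 7 ≤ + j + z) (sym (times-+ 3 e)) (+≤+ 7≤)
    Result = ∃ λ t → t ℕ.≤ 3 × ∃ λ D → D ≡ Γ + t times (+ M) × - + M + + e ≤ D × D ≤ + M - + e
    -- One addition of M cannot jump over the target range from -M + e to M - e, so the first sum
    -- reaching its lower end is inside it.
    step : ∀ M e m G → 1ℤ + M ≡ m + e → e ≤ + 6 → + 21 ≤ m → G < - M + e → G + M ≤ M - e
    step M e m G h₁ h₂ h₃ h₄ = linarith 4 (λ M e m G → lit 1ℤ :+ M :≡ m :+ e ⇒ e :≤ lit (+ 6) ⇒ lit (+ 21) :≤ m ⇒ G :< lit 0ℤ :- M :+ e ⇒ ⊢ (G :+ M :≤ M :- e)) refl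
      M e m G h₁ h₂ h₃ (subst (λ z → G < z + e) (sym (+-identityˡ (- M))) h₄)
    top : ∀ M e m j → 1ℤ + M ≡ m + e → j < + 3 + 5 times m → j - 4 times m - + 3 + 0ℤ ≤ M - e
    top = linarith 4 (λ M e m j → lit 1ℤ :+ M :≡ m :+ e ⇒ j :< lit (+ 3) :+ 5 :* m ⇒ ⊢ (j :- 4 :* m :- lit (+ 3) :+ lit 0ℤ :≤ M :- e)) refl
    -- That three additions suffice is equivalent to j + 3e ≥ 7, the source of the bound 6 in the
    -- classification.
    bottom : ∀ M e m j → 1ℤ + M ≡ m + e → + 7 ≤ j + 3 times e → 0ℤ - M + e ≤ j - 4 times m - + 3 + M + M + M
    bottom = linarith 4 (λ M e m j → lit 1ℤ :+ M :≡ m :+ e ⇒ lit (+ 7) :≤ j :+ 3 :* e ⇒ ⊢ (lit 0ℤ :- M :+ e :≤ j :- 4 :* m :- lit (+ 3) :+ M :+ M :+ M)) refl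
    eq₁ : ∀ G M → G + M ≡ G + (M + 0ℤ)
    eq₁ = solve-∀
    eq₂ : ∀ G M → G + M + M ≡ G + (M + (M + 0ℤ))
    eq₂ = solve-∀
    eq₃ : ∀ G M → G + M + M + M ≡ G + (M + (M + (M + 0ℤ)))
    eq₃ = solve-∀
    by₃ : Γ + + M + + M < - + M + + e → Result
    by₃ lt = 3 , ℕ.≤-refl , Γ + + M + + M + + M , eq₃ Γ (+ M) ,
      subst (λ z → z + + e ≤ Γ + + M + + M + + M) (+-identityˡ (- + M)) (bottom (+ M) (+ e) (+ m) (+ j) M+1′ 7≤′) ,
      step (+ M) (+ e) (+ m) (Γ + + M + + M) M+1′ e≤6′ 21≤m′ lt
    by₂ : Γ + + M < - + M + + e → Dec (- + M + + e ≤ Γ + + M + + M) → Result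
    by₂ lt (yes le) = 2 , ℕ.s≤s (ℕ.s≤s ℕ.z≤n) , Γ + + M + + M , eq₂ Γ (+ M) , le , step (+ M) (+ e) (+ m) (Γ + + M) M+1′ e≤6′ 21≤m′ lt
    by₂ lt (no nle) = by₃ (≰⇒> nle)
    by₁ : Γ < - + M + + e → Dec (- + M + + e ≤ Γ + + M) → Result
    by₁ lt (yes le) = 1 , ℕ.s≤s ℕ.z≤n , Γ + + M , eq₁ Γ (+ M) , le , step (+ M) (+ e) (+ m) Γ M+1′ e≤6′ 21≤m′ lt
    by₁ lt (no nle) = by₂ (≰⇒> nle) (- + M + + e Data.Integer.≤? Γ + + M + + M)
    by₀ : Dec (- + M + + e ≤ Γ) → Result
    by₀ (yes le) = 0 , ℕ.z≤n , Γ , sym (+-identityʳ Γ) , le , subst (_≤ + M - + e) (+-identityʳ Γ) (top (+ M) (+ e) (+ m) (+ j) M+1′ j<p′)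
    by₀ (no nle) = by₁ (≰⇒> nle) (- + M + + e Data.Integer.≤? Γ + + M)

  -- The displacement from x to e in x + σ(a + b) = e + f when a, b, f sit at those ends of the
  -- window that make it least; moving one of them to the other end adds M.
  Γ : Sign → ℤ → ℤ → ℤ
  Γ plus c M = c - M
  Γ minus c M = - (c + c + c) - (M + M + M)

  module _ (σ : Sign) {d : ℕ} (A : V (suc d) → Bool) where

    fibre : ℤ → V d → Bool
    fibre z v = A ([ z ] ∷ v)

    Inhabited : (V d → Bool) → Set
    Inhabited X = ∃ λ v → X v ≡ true

    ∣translate∣ : ∀ (X : V d → Bool) t → ∣ (λ y → X (y ⊟ t)) ∣ ≡ ∣ X ∣
    ∣translate∣ X t = ∣∣-bijection (_⊟ t) (_⊞ t) (λ x → solve 2 (λ x t → x ⊕ ⊖ t ⊕ t := x) refl x t)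
      (λ x → solve 2 (λ x t → x ⊕ t ⊕ ⊖ t := x) refl x t) X

    module _ (free : SumFreeV σ A) where
      -- Fixing one vector in each of the fibres over a, b and f leaves a relation between the
      -- fibres over x and e alone: a translate of the first misses the second.
      fibres-disjoint : ∀ x a b e f {ya yb yf} → x + sg σ (a + b) ≈ e + f →
        fibre a ya ≡ true → fibre b yb ≡ true → fibre f yf ≡ true →
        Disjoint (λ y → fibre x (y ⊟ (sgnᵛ σ (ya ⊞ yb) ⊟ yf))) (fibre e)
      fibres-disjoint x a b e f {ya} {yb} {yf} h ha hb hf y hx he =
        free ([ x ] ∷ (y ⊟ (s ⊟ yf))) ([ a ] ∷ ya) ([ b ] ∷ yb) ([ e ] ∷ y) ([ f ] ∷ yf) hx ha hb he hf
          (trans (cong (([ x ] ∷ (y ⊟ (s ⊟ yf))) ⊞_) (sgnᵛ-∷ σ ([ a ] +ᶠ [ b ]) (ya ⊞ yb))) (cong₂ _∷_ heads tails))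
        where
        s = sgnᵛ σ (ya ⊞ yb)
        heads : [ x ] +ᶠ sgn σ ([ a ] +ᶠ [ b ]) ≡ [ e ] +ᶠ [ f ]
        heads = trans (cong (λ z → [ x ] +ᶠ z) (trans (cong (sgn σ) ([]-+ a b)) (sgn-[] σ (a + b))))
          (trans ([]-+ x (sg σ (a + b))) (trans ([]-cong h) (sym ([]-+ e f))))
        tails : (y ⊟ (s ⊟ yf)) ⊞ s ≡ y ⊞ yf
        tails = solve 3 (λ y s f → y ⊕ ⊖ (s ⊕ ⊖ f) ⊕ s := y ⊕ f) refl y s yf

      fibres-≤ : ∀ x a b e f → x + sg σ (a + b) ≈ e + f → Inhabited (fibre a) → Inhabited (fibre b) → Inhabited (fibre f) →
        ∣ fibre x ∣ ℕ.+ ∣ fibre e ∣ ℕ.≤ size (V d)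
      fibres-≤ x a b e f h (ya , ha) (yb , hb) (yf , hf) = subst (λ z → z ℕ.+ ∣ fibre e ∣ ℕ.≤ size (V d))
        (∣translate∣ (fibre x) _) (disjoint⇒≤size _ (fibre e) (fibres-disjoint x a b e f h ha hb hf))

      -- When the bound is tight, the complement relation holds for every choice of ya, yb, yf.
      -- Comparing different choices is what produces periods of the fibres.
      fibres-complementary : ∀ x a b e f → x + sg σ (a + b) ≈ e + f → size (V d) ℕ.≤ ∣ fibre x ∣ ℕ.+ ∣ fibre e ∣ →
        ∀ {ya yb yf} → fibre a ya ≡ true → fibre b yb ≡ true → fibre f yf ≡ true →
        ∀ y → fibre e y ≡ not (fibre x (y ⊟ (sgnᵛ σ (ya ⊞ yb) ⊟ yf)))
      fibres-complementary x a b e f h le ha hb hf = complementary _ (fibre e) (fibres-disjoint x a b e f h ha hb hf)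
        (subst (λ z → size (V d) ℕ.≤ z ℕ.+ ∣ fibre e ∣) (sym (∣translate∣ (fibre x) _)) le)

      module _ (c : ℤ) (M : ℕ) (in₀ : Inhabited (fibre (c + 0ℤ))) (in-M : Inhabited (fibre (c + + M))) where

        γ : ℤ
        γ = Γ σ c (+ M)

        -- The remaining three summands are taken at the ends 0 and M.
        pair-≤ : ∀ t i y → t ℕ.≤ 3 → + i + t times + M + γ ≈ + y → ∣ fibre (c + + i) ∣ ℕ.+ ∣ fibre (c + + y) ∣ ℕ.≤ size (V d)
        pair-≤ t i y t≤3 h = by σ refl t t≤3 h
          where
          C = + M
          by : ∀ τ → τ ≡ σ → ∀ t → t ℕ.≤ 3 → + i + t times + M + γ ≈ + y → ∣ fibre (c + + i) ∣ ℕ.+ ∣ fibre (c + + y) ∣ ℕ.≤ size (V d)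
          by plus refl 0 _ h = fibres-≤ _ (c + 0ℤ) (c + 0ℤ) _ (c + + M) (≈-both (c + c + C) h (l c (+ i) C) (r c (+ y) C)) in₀ in₀ in-M
            where
            l : ∀ c i C → c + i + (c + 0ℤ + (c + 0ℤ)) ≡ i + 0ℤ + (c - C) + (c + c + C)
            l = solve-∀
            r : ∀ c y C → c + y + (c + C) ≡ y + (c + c + C)
            r = solve-∀
          by plus refl 1 _ h = fibres-≤ _ (c + 0ℤ) (c + 0ℤ) _ (c + 0ℤ) (≈-both (c + c) h (l c (+ i) C) (r c (+ y))) in₀ in₀ in₀
            where
            l : ∀ c i C → c + i + (c + 0ℤ + (c + 0ℤ)) ≡ i + (C + 0ℤ) + (c - C) + (c + c)
            l = solve-∀
            r : ∀ c y → c + y + (c + 0ℤ) ≡ y + (c + c)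
            r = solve-∀
          by plus refl 2 _ h = fibres-≤ _ (c + + M) (c + 0ℤ) _ (c + 0ℤ) (≈-both (c + c) h (l c (+ i) C) (r c (+ y))) in-M in₀ in₀
            where
            l : ∀ c i C → c + i + (c + C + (c + 0ℤ)) ≡ i + (C + (C + 0ℤ)) + (c - C) + (c + c)
            l = solve-∀
            r : ∀ c y → c + y + (c + 0ℤ) ≡ y + (c + c)
            r = solve-∀
          by plus refl 3 _ h = fibres-≤ _ (c + + M) (c + + M) _ (c + 0ℤ) (≈-both (c + c) h (l c (+ i) C) (r c (+ y))) in-M in-M in₀
            where
            l : ∀ c i C → c + i + (c + C + (c + C)) ≡ i + (C + (C + (C + 0ℤ))) + (c - C) + (c + c)
            l = solve-∀
            r : ∀ c y → c + y + (c + 0ℤ) ≡ y + (c + c)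
            r = solve-∀
          by minus refl 0 _ h = fibres-≤ _ (c + + M) (c + + M) _ (c + + M) (≈-both (c + c + C) h (l c (+ i) C) (r c (+ y) C)) in-M in-M in-M
            where
            l : ∀ c i C → c + i + - (c + C + (c + C)) ≡ i + 0ℤ + (- (c + c + c) - (C + C + C)) + (c + c + C)
            l = solve-∀
            r : ∀ c y C → c + y + (c + C) ≡ y + (c + c + C)
            r = solve-∀
          by minus refl 1 _ h = fibres-≤ _ (c + + M) (c + + M) _ (c + 0ℤ) (≈-both (c + c) h (l c (+ i) C) (r c (+ y))) in-M in-M in₀
            where
            l : ∀ c i C → c + i + - (c + C + (c + C)) ≡ i + (C + 0ℤ) + (- (c + c + c) - (C + C + C)) + (c + c)
            l = solve-∀
            r : ∀ c y → c + y + (c + 0ℤ) ≡ y + (c + c)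
            r = solve-∀
          by minus refl 2 _ h = fibres-≤ _ (c + + M) (c + 0ℤ) _ (c + 0ℤ) (≈-both (c + c) h (l c (+ i) C) (r c (+ y))) in-M in₀ in₀
            where
            l : ∀ c i C → c + i + - (c + C + (c + 0ℤ)) ≡ i + (C + (C + 0ℤ)) + (- (c + c + c) - (C + C + C)) + (c + c)
            l = solve-∀
            r : ∀ c y → c + y + (c + 0ℤ) ≡ y + (c + c)
            r = solve-∀
          by minus refl 3 _ h = fibres-≤ _ (c + 0ℤ) (c + 0ℤ) _ (c + 0ℤ) (≈-both (c + c) h (l c (+ i) C) (r c (+ y))) in₀ in₀ in₀
            where
            l : ∀ c i C → c + i + - (c + 0ℤ + (c + 0ℤ)) ≡ i + (C + (C + (C + 0ℤ))) + (- (c + c + c) - (C + C + C)) + (c + c)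
            l = solve-∀
            r : ∀ c y → c + y + (c + 0ℤ) ≡ y + (c + c)
            r = solve-∀
          by _ refl (suc (suc (suc (suc _)))) (ℕ.s≤s (ℕ.s≤s (ℕ.s≤s ()))) h

        module _ (m : ℕ) (p≡ : p ≡ 3 ℕ.+ 5 ℕ.* m) (21≤m : 21 ℕ.≤ m) (e : ℕ) (M+1 : suc M ≡ m ℕ.+ e) (e≤6 : e ℕ.≤ 6)
          (big : m ℕ.* size (V d) ℕ.≤ ∑< (suc M) (λ i → ∣ fibre (c + + i) ∣)) where

          -- No γ + tM with t ≤ 3 may have a representative between -(M - e) and M - e. The excluded
          -- values of γ fill the range from -4M + e to M - e, so p - (5M - 2e + 1) = 7 - 3e
          -- residues survive, beginning with M - e + 1 = m.
          exceptional : ∃ λ j → j ℕ.+ 3 ℕ.* e ℕ.≤ 6 × γ ≈ + (m ℕ.+ j)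
          exceptional = by (j ℕ.+ 3 ℕ.* e ℕ.≤? 6)
            where
            j = rem (γ - + m)
            γ≈ : γ ≈ + (m ℕ.+ j)
            γ≈ = ≈-trans (≈-by (lemma γ (+ m))) (≈-+ (≈-refl {+ m}) (≈-sym (rem≈ (γ - + m))))
              where
              lemma : ∀ g m → g ≡ m + (g - m)
              lemma = solve-∀
            γ≈Γ : γ ≈ + j - 4 times (+ m) - + 3
            γ≈Γ = ≈-trans γ≈ (mod 1ℤ (trans (lemma (+ m) (+ j)) (cong (λ z → + j - 4 times (+ m) - + 3 + 1ℤ * z)
                (sym (trans (cong +_ p≡) (cong (λ z → + 3 + z) (sym (times-+ 5 m))))))))
              where
              lemma : ∀ m j → m + j ≡ j - (m + (m + (m + (m + 0ℤ)))) - + 3 + 1ℤ * (+ 3 + (m + (m + (m + (m + (m + 0ℤ))))))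
              lemma = solve-∀
            N = size (V d)
            b = λ i → ∣ fibre (c + + i) ∣
            contradict : ∀ t → t ℕ.≤ 3 → ∀ D → D ≡ + j - 4 times (+ m) - + 3 + t times (+ M) → - + M + + e ≤ D → D ≤ + M - + e → ⊥
            contradict t t≤3 (+ D) eq lo hi = no-distance N b m M e M+1 e≤6 21≤m 1≤N (λ i _ → ∣∣≤size _) big D
                (drop‿+≤+ (linarith 3 (λ D M e → D :≤ M :- e ⇒ ⊢ (D :+ e :≤ M)) refl (+ D) (+ M) (+ e) hi))
                (λ i _ → pair-≤ t i (i ℕ.+ D) t≤3 (shifted i))
              where
              1≤N = term≤∑ {V d} (λ _ → 1) (constᵛ 0ℤ)
              shifted : ∀ i → + i + t times + M + γ ≈ + (i ℕ.+ D)
              shifted i = ≈-trans (≈-+ (≈-refl {+ i + t times + M}) γ≈Γ) (≈-by (trans (lemma (+ i) (t times + M) (+ j - 4 times (+ m) - + 3)) (cong (λ z → + i + z) (sym eq))))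
                where
                lemma : ∀ i T G → i + T + G ≡ i + (G + T)
                lemma = solve-∀
            contradict t t≤3 -[1+ D ] eq lo hi = no-distance N b m M e M+1 e≤6 21≤m 1≤N (λ i _ → ∣∣≤size _) big (suc D)
                (drop‿+≤+ (linarith 3 (λ D M e → lit 0ℤ :- M :+ e :≤ lit 0ℤ :- D ⇒ ⊢ (D :+ e :≤ M)) refl (+ suc D) (+ M) (+ e)
                  (subst₂ (λ x y → x + + e ≤ y) (sym (+-identityˡ (- + M))) (sym (+-identityˡ -[1+ D ])) lo)))
                (λ i _ → subst (ℕ._≤ N) (ℕ.+-comm (b (i ℕ.+ suc D)) (b i)) (pair-≤ t (i ℕ.+ suc D) i t≤3 (shifted i)))
              where
              1≤N = term≤∑ {V d} (λ _ → 1) (constᵛ 0ℤ)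
              shifted : ∀ i → + (i ℕ.+ suc D) + t times + M + γ ≈ + i
              shifted i = ≈-trans (≈-+ (≈-refl {+ (i ℕ.+ suc D) + t times + M}) γ≈Γ) (≈-by (trans (lemma (+ i) (+ suc D) (t times + M) (+ j - 4 times (+ m) - + 3))
                  (trans (cong (λ z → + i + (+ suc D + z)) (sym eq)) (trans (cong (λ z → + i + z) (+-inverseʳ (+ suc D))) (+-identityʳ (+ i))))))
                where
                lemma : ∀ i D T G → i + D + T + G ≡ i + (D + (G + T))
                lemma = solve-∀
            by : Dec (j ℕ.+ 3 ℕ.* e ℕ.≤ 6) → ∃ λ j → j ℕ.+ 3 ℕ.* e ℕ.≤ 6 × γ ≈ + (m ℕ.+ j)
            by (yes le) = j , le , γ≈
            by (no nle) = let t , t≤3 , D , eq , lo , hi = choose-multiple m M e j M+1 e≤6 21≤m (subst (j ℕ.<_) p≡ (rem<p (γ - + m))) (ℕ.≰⇒> nle) in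
              ⊥-elim (contradict t t≤3 D eq lo hi)

-- Automorphisms of the additive group, and positions in cyclic intervals.

module Automorphisms (p : ℕ) .{{_ : NonZero p}} (prime : Prime p) where

  open Sums
  open Residues p
  open PrimeField p prime
  open SumFreeLine p prime using (plus; minus; -ₚ≡-ᶠ)
  open QuasiHomomorphisms p prime using (≈-by)
  open Concentration p prime using (sgnᵛ; SumFreeV)
  open import Defs using (Aut; Iso; interval; _-ₚ_)
  open import Data.Bool using (Bool; true; false)
  open import Data.Bool.Properties using (T-≡)
  open import Data.Fin using (Fin; toℕ)
  import Data.Fin as Fin
  import Data.Fin.Properties as FinP
  open import Data.Integer hiding (NonZero; ∣_∣; suc; sign)
  open import Data.Integer.Tactic.RingSolver using (solve-∀)
  open import Data.Nat using (zero; suc)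
  import Data.Nat as ℕ
  import Data.Nat.Properties as ℕ
  open import Data.Product using (∃; _×_; _,_)
  open import Data.Vec using ([]; _∷_; lookup)
  open import Function using (_∘_; Equivalence)
  open import Relation.Binary.PropositionalEquality hiding ([_])
  open import Relation.Nullary using (does; yes; no; contradiction)
  open import Relation.Nullary.Decidable using (dec-true; dec-false)

  module FS = FSolver
  module VS = VSolver

  mkAut : ∀ {n} (f g : V n → V n) → (∀ x y → f (x ⊞ y) ≡ f x ⊞ f y) → (∀ x → g (f x) ≡ x) → (∀ y → f (g y) ≡ y) → Aut p n
  mkAut f g hom gf fg = record { f = f ; g = g
    ; f-hom = λ x y → trans (cong f (sym (⊞≡⊕ x y))) (trans (hom x y) (⊞≡⊕ (f x) (f y))) ; gf = gf ; fg = fg }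

  Aut-hom : ∀ {n} (φ : Aut p n) x y → Aut.f φ (x ⊞ y) ≡ Aut.f φ x ⊞ Aut.f φ y
  Aut-hom φ x y = trans (cong (Aut.f φ) (⊞≡⊕ x y)) (trans (Aut.f-hom φ x y) (sym (⊞≡⊕ _ _)))

  Aut-inverse-hom : ∀ {n} (φ : Aut p n) x y → Aut.g φ (x ⊞ y) ≡ Aut.g φ x ⊞ Aut.g φ y
  Aut-inverse-hom φ x y = trans (cong g (cong₂ _⊞_ (sym (fg x)) (sym (fg y)))) (trans (cong g (sym (Aut-hom φ (g x) (g y)))) (gf _))
    where open Aut φ

  compose : ∀ {n} → Aut p n → Aut p n → Aut p n
  compose φ ψ = mkAut (ψ.f ∘ φ.f) (φ.g ∘ ψ.g) (λ x y → trans (cong ψ.f (Aut-hom φ x y)) (Aut-hom ψ _ _))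
      (λ x → trans (cong φ.g (ψ.gf _)) (φ.gf x)) (λ x → trans (cong ψ.f (φ.fg _)) (ψ.fg x))
    where
    module φ = Aut φ
    module ψ = Aut ψ

  infixl 5 _∘⁻¹_
  _∘⁻¹_ : ∀ {n} → (V n → Bool) → Aut p n → V n → Bool
  (A ∘⁻¹ φ) x = A (Aut.g φ x)

  Iso-image : ∀ {n} (A : V n → Bool) φ → Iso p A (A ∘⁻¹ φ)
  Iso-image A φ = φ , λ x → cong A (sym (Aut.gf φ x))

  Iso-≗ : ∀ {n} {A B : V n → Bool} → (∀ x → A x ≡ B x) → Iso p A B
  Iso-≗ h = mkAut (λ x → x) (λ x → x) (λ _ _ → refl) (λ _ → refl) (λ _ → refl) , h

  card-image : ∀ {n} (A : V n → Bool) φ → ∣ A ∘⁻¹ φ ∣ ≡ ∣ A ∣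
  card-image A φ = ∣∣-bijection (Aut.g φ) (Aut.f φ) (Aut.fg φ) (Aut.gf φ) A

  hom-⊝ : ∀ {n} (g : V n → V n) → (∀ x y → g (x ⊞ y) ≡ g x ⊞ g y) → ∀ x → g (⊝ x) ≡ ⊝ g x
  hom-⊝ g hom x = trans (VS.solve 2 (λ a b → a VS.:= (a VS.:+ b) VS.:+ VS.:- b) refl (g (⊝ x)) (g x))
    (trans (cong (_⊟ g x) (trans (sym (hom (⊝ x) x)) (trans (cong g (VS.solve 1 (λ x → VS.:- x VS.:+ x VS.:= VS.con 0ℤ) refl x)) g0)))
      (VS.solve 1 (λ b → VS.con 0ℤ VS.:+ VS.:- b VS.:= VS.:- b) refl (g x)))
    where
    g0 : g (constᵛ 0ℤ) ≡ constᵛ 0ℤ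
    g0 = trans (VS.solve 1 (λ a → a VS.:= (a VS.:+ a) VS.:+ VS.:- a) refl (g (constᵛ 0ℤ)))
      (trans (cong (_⊟ g (constᵛ 0ℤ)) (trans (sym (hom _ _)) (cong g (VS.solve 0 (VS.con 0ℤ VS.:+ VS.con 0ℤ VS.:= VS.con 0ℤ) refl))))
        (VS.solve 1 (λ a → a VS.:+ VS.:- a VS.:= VS.con 0ℤ) refl (g (constᵛ 0ℤ))))

  free-image : ∀ {n} σ {A : V n → Bool} φ → SumFreeV σ A → SumFreeV σ (A ∘⁻¹ φ)
  free-image σ {A} φ free x a b c d hx ha hb hc hd e = free (g x) (g a) (g b) (g c) (g d) hx ha hb hc hd
      (trans (cong (g x ⊞_) (trans (cong (sgnᵛ σ) (sym (hom a b))) (sym (sgn-hom σ (a ⊞ b))))) (trans (sym (hom x _)) (trans (cong g e) (hom c d))))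
    where
    open Aut φ using (g)
    hom = Aut-inverse-hom φ
    sgn-hom : ∀ σ x → g (sgnᵛ σ x) ≡ sgnᵛ σ (g x)
    sgn-hom plus x = refl
    sgn-hom minus x = hom-⊝ g hom x

  negation : ∀ {n} → Aut p n
  negation = mkAut ⊝_ ⊝_ (λ x y → VS.solve 2 (λ x y → VS.:- (x VS.:+ y) VS.:= VS.:- x VS.:+ VS.:- y) refl x y) inv inv
    where
    inv : ∀ x → ⊝ (⊝ x) ≡ x
    inv x = VS.solve 1 (λ x → VS.:- (VS.:- x) VS.:= x) refl x

  scalar-+ : ∀ {n} a b (v : V n) → scalar (a +ᶠ b) v ≡ scalar a v ⊞ scalar b v
  scalar-+ a b [] = refl
  scalar-+ a b (x ∷ v) = cong₂ _∷_ (*ᶠ-distribʳ x a b) (scalar-+ a b v)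

  module _ {d : ℕ} where

    head-shear : (a : V d → F) → (∀ v w → a (v ⊞ w) ≡ a v +ᶠ a w) → Aut p (suc d)
    head-shear a add = mkAut (λ { (x ∷ v) → (x +ᶠ a v) ∷ v }) (λ { (x ∷ v) → (x +ᶠ -ᶠ a v) ∷ v })
      (λ { (x ∷ v) (y ∷ w) → cong (_∷ (v ⊞ w)) (trans (cong ((x +ᶠ y) +ᶠ_) (add v w))
        (FS.solve 4 (λ x y a b → x FS.:+ y FS.:+ (a FS.:+ b) FS.:= x FS.:+ a FS.:+ (y FS.:+ b)) refl x y (a v) (a w))) })
      (λ { (x ∷ v) → cong (_∷ v) (FS.solve 2 (λ x a → x FS.:+ a FS.:+ FS.:- a FS.:= x) refl x (a v)) })
      (λ { (x ∷ v) → cong (_∷ v) (FS.solve 2 (λ x a → x FS.:+ FS.:- a FS.:+ a FS.:= x) refl x (a v)) })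

    tail-shear : V d → Aut p (suc d)
    tail-shear w = mkAut (λ { (x ∷ v) → x ∷ (v ⊞ scalar x w) }) (λ { (x ∷ v) → x ∷ (v ⊟ scalar x w) })
      (λ { (x ∷ v) (y ∷ v′) → cong ((x +ᶠ y) ∷_) (trans (cong ((v ⊞ v′) ⊞_) (scalar-+ x y w))
        (VS.solve 4 (λ x y a b → x VS.:+ y VS.:+ (a VS.:+ b) VS.:= x VS.:+ a VS.:+ (y VS.:+ b)) refl v v′ (scalar x w) (scalar y w))) })
      (λ { (x ∷ v) → cong (x ∷_) (VS.solve 2 (λ x a → x VS.:+ a VS.:+ VS.:- a VS.:= x) refl v (scalar x w)) })
      (λ { (x ∷ v) → cong (x ∷_) (VS.solve 2 (λ x a → x VS.:+ VS.:- a VS.:+ a VS.:= x) refl v (scalar x w)) })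

    head-scale : ∀ s s⁻¹ → s *ᶠ s⁻¹ ≡ 1ᶠ → Aut p (suc d)
    head-scale s s⁻¹ e = mkAut (λ { (x ∷ v) → (s *ᶠ x) ∷ v }) (λ { (x ∷ v) → (s⁻¹ *ᶠ x) ∷ v })
      (λ { (x ∷ v) (y ∷ w) → cong (_∷ (v ⊞ w)) (*ᶠ-distribˡ s x y) })
      (λ { (x ∷ v) → cong (_∷ v) (trans (FS.solve 3 (λ s t x → t FS.:* (s FS.:* x) FS.:= (s FS.:* t) FS.:* x) refl s s⁻¹ x) (trans (cong (_*ᶠ x) e) (*ᶠ-identityˡ x))) })
      (λ { (x ∷ v) → cong (_∷ v) (trans (sym (*ᶠ-assoc s s⁻¹ x)) (trans (cong (_*ᶠ x) e) (*ᶠ-identityˡ x))) })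

    unit-vector : V (suc d)
    unit-vector = 1ᶠ ∷ constᵛ 0ℤ

    scalar-0 : ∀ {n} a → scalar a (constᵛ {n} 0ℤ) ≡ constᵛ 0ℤ
    scalar-0 {zero} a = refl
    scalar-0 {suc n} a = cong₂ _∷_ (*ᶠ-zeroʳ a) (scalar-0 a)

    straighten-head : ∀ x (v : V d) → x ≢ 0ᶠ → ∃ λ (φ : Aut p (suc d)) → Aut.f φ (x ∷ v) ≡ unit-vector
    straighten-head x v x≢0 = let x⁻¹ , e = inverse x x≢0
                                  e′ = trans (*ᶠ-comm x⁻¹ x) e in
      compose (head-scale x⁻¹ x e′) (tail-shear (⊝ v)) ,
      cong₂ _∷_ e′ (trans (cong (λ c → v ⊞ scalar c (⊝ v)) e′) (trans (cong (v ⊞_) (1·v (⊝ v))) (VS.solve 1 (λ v → v VS.:+ VS.:- v VS.:= VS.con 0ℤ) refl v)))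

  nonzero-coordinate : ∀ {n} (v : V n) → v ≢ constᵛ 0ℤ → ∃ λ i → lookup v i ≢ 0ᶠ
  nonzero-coordinate [] h = contradiction refl h
  nonzero-coordinate (x ∷ v) h with x Fin.≟ 0ᶠ
  ... | no x≢0 = Fin.zero , x≢0
  ... | yes refl = let i , k = nonzero-coordinate v (λ e → h (cong (0ᶠ ∷_) e)) in Fin.suc i , k

  lookup-⊞ : ∀ {n} i (v w : V n) → lookup (v ⊞ w) i ≡ lookup v i +ᶠ lookup w i
  lookup-⊞ Fin.zero (x ∷ v) (y ∷ w) = refl
  lookup-⊞ (Fin.suc i) (x ∷ v) (y ∷ w) = lookup-⊞ i v w

  -- If the first coordinate vanishes, a shear first adds a nonzero later coordinate to it; then
  -- scaling and a tail shear finish.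
  straighten : ∀ {d} (w : V (suc d)) → w ≢ constᵛ 0ℤ → ∃ λ (φ : Aut p (suc d)) → Aut.f φ w ≡ unit-vector
  straighten (x ∷ v) h with x Fin.≟ 0ᶠ
  ... | no x≢0 = straighten-head x v x≢0
  ... | yes refl = let i , k = nonzero-coordinate v (λ e → h (cong (0ᶠ ∷_) e))
                       ψ , e = straighten-head (0ᶠ +ᶠ lookup v i) v (λ e → k (trans (sym (+ᶠ-identityˡ _)) e)) in
    compose (head-shear (λ v → lookup v i) (lookup-⊞ i)) ψ , e

  rem-small : ∀ {n z} → n ℕ.< p → z ≈ + n → rem z ≡ n
  rem-small {n} {z} n<p h = <p⇒≡ (rem<p z) n<p (≈-trans (rem≈ z) h)

  toℕ-difference : ∀ x y {n} → n ℕ.< p → x - y ≈ + n → toℕ (_-ₚ_ p [ x ] [ y ]) ≡ n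
  toℕ-difference x y n<p h = trans (cong toℕ (trans (-ₚ≡-ᶠ [ x ] [ y ]) (trans (cong ([ x ] +ᶠ_) ([]-neg y)) ([]-+ x (- y)))))
    (trans (toℕ-[] (x - y)) (rem-small n<p h))

  module _ (c : ℤ) where
    private
      offset : ∀ {k i} → k ℕ.≤ i → c + + i - (c + + k) ≈ + (i ℕ.∸ k)
      offset {k} {i} k≤i = ≈-by (trans (cong (λ z → c + + z - (c + + k)) (sym (ℕ.m∸n+n≡m k≤i))) (lemma c (+ (i ℕ.∸ k)) (+ k)))
        where
        lemma : ∀ c r k → c + (r + k) - (c + k) ≡ r
        lemma = solve-∀

      wrapped : ∀ {k i} → i ℕ.< k → k ℕ.< p → c + + i - (c + + k) ≈ + (i ℕ.+ (p ℕ.∸ k))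
      wrapped {k} {i} i<k k<p = mod (- 1ℤ) (trans (lemma c (+ i) (+ k) (+ (p ℕ.∸ k))) (cong (λ z → + (i ℕ.+ (p ℕ.∸ k)) + - 1ℤ * z) (cong +_ (ℕ.m∸n+n≡m (ℕ.<⇒≤ k<p)))))
        where
        lemma : ∀ c i k r → c + i - (c + k) ≡ i + r + - 1ℤ * (r + k)
        lemma = solve-∀

      ≤ᵇ-true : ∀ {a b} → a ℕ.≤ b → (a ℕ.≤ᵇ b) ≡ true
      ≤ᵇ-true h = Equivalence.to T-≡ (ℕ.≤⇒≤ᵇ h)

      ≤ᵇ-false : ∀ {a b} → b ℕ.< a → (a ℕ.≤ᵇ b) ≡ false
      ≤ᵇ-false {a} {b} h with a ℕ.≤ᵇ b in e
      ... | false = refl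
      ... | true = contradiction (ℕ.≤ᵇ⇒≤ a b (Equivalence.from T-≡ e)) (ℕ.<⇒≱ h)

    interval-inside : ∀ k i l → k ℕ.≤ i → i ℕ.≤ l → l ℕ.< p → interval p [ c + + k ] [ c + + l ] [ c + + i ] ≡ true
    interval-inside k i l k≤i i≤l l<p = trans (cong₂ ℕ._≤ᵇ_
        (toℕ-difference _ _ (ℕ.≤-<-trans (ℕ.m∸n≤m i k) (ℕ.≤-<-trans i≤l l<p)) (offset k≤i))
        (toℕ-difference _ _ (ℕ.≤-<-trans (ℕ.m∸n≤m l k) l<p) (offset (ℕ.≤-trans k≤i i≤l))))
      (≤ᵇ-true (ℕ.∸-monoˡ-≤ k i≤l))

    interval-above : ∀ k i l → k ℕ.≤ l → l ℕ.< i → i ℕ.< p → interval p [ c + + k ] [ c + + l ] [ c + + i ] ≡ false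
    interval-above k i l k≤l l<i i<p = trans (cong₂ ℕ._≤ᵇ_
        (toℕ-difference _ _ (ℕ.≤-<-trans (ℕ.m∸n≤m i k) i<p) (offset (ℕ.≤-trans k≤l (ℕ.<⇒≤ l<i))))
        (toℕ-difference _ _ (ℕ.≤-<-trans (ℕ.m∸n≤m l k) (ℕ.<-trans l<i i<p)) (offset k≤l)))
      (≤ᵇ-false (ℕ.∸-monoˡ-< l<i k≤l))

    interval-below : ∀ k i l → i ℕ.< k → k ℕ.≤ l → l ℕ.< p → interval p [ c + + k ] [ c + + l ] [ c + + i ] ≡ false
    interval-below k i l i<k k≤l l<p = trans (cong₂ ℕ._≤ᵇ_
        (toℕ-difference _ _ (subst (i ℕ.+ (p ℕ.∸ k) ℕ.<_) (ℕ.m+[n∸m]≡n (ℕ.<⇒≤ k<p)) (ℕ.+-monoˡ-< (p ℕ.∸ k) i<k)) (wrapped i<k k<p))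
        (toℕ-difference _ _ (ℕ.≤-<-trans (ℕ.m∸n≤m l k) l<p) (offset k≤l)))
      (≤ᵇ-false (ℕ.<-≤-trans (ℕ.∸-monoˡ-< l<p k≤l) (ℕ.m≤n+m (p ℕ.∸ k) i)))
      where
      k<p = ℕ.≤-<-trans k≤l l<p

    position-injective : ∀ {i k} → i ℕ.< p → k ℕ.< p → [ c + + i ] ≡ [ c + + k ] → i ≡ k
    position-injective {i} {k} i<p k<p e = <p⇒≡ i<p k<p (≈-trans (≈-by (lemma c (+ i))) (≈-trans (≈-- ([]-injective e) (≈-refl {c})) (≈-by (sym (lemma c (+ k))))))
      where
      lemma : ∀ c i → i ≡ c + i - c
      lemma = solve-∀

    same : ∀ i → does ([ c + + i ] Fin.≟ [ c + + i ]) ≡ true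
    same i = dec-true ([ c + + i ] Fin.≟ [ c + + i ]) refl

    different : ∀ i k → i ℕ.< p → k ℕ.< p → i ≢ k → does ([ c + + i ] Fin.≟ [ c + + k ]) ≡ false
    different i k i<p k<p i≢k = dec-false ([ c + + i ] Fin.≟ [ c + + k ]) (λ e → i≢k (position-injective i<p k<p e))

    from-origin : ∀ x → ∃ λ i → i ℕ.< p × x ≡ [ c + + i ]
    from-origin x = toℕ y , FinP.toℕ<n y , sym (trans (sym ([]-+ c (ι y))) (trans (cong ([ c ] +ᶠ_) ([]-ι y))
        (FS.solve 2 (λ x c → c FS.:+ (x FS.:+ FS.:- c) FS.:= x) refl x [ c ])))
      where y = x +ᶠ -ᶠ [ c ]

-- Periods of fibres, and fibres that are cosets of a subspace.

module Cosets (p : ℕ) .{{_ : NonZero p}} (prime : Prime p) where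

  open Residues p
  open PrimeField p prime
  open import Defs using (_⊕_; _·_; 0v)
  open import Data.Bool using (Bool; true; false; not)
  open import Data.Bool.Properties using (not-injective; not-involutive)
  open import Data.Empty using (⊥)
  open import Data.Fin using (toℕ)
  open import Data.Integer using (+_; 0ℤ; 1ℤ)
  open import Data.Nat using (zero; suc)
  open import Data.Product using (_,_)
  open import Relation.Binary.PropositionalEquality hiding ([_])
  open import Relation.Nullary using (¬_)
  open VSolver using (solve; _:=_; con) renaming (_:+_ to _⊹_; _:*_ to _⊗_; :-_ to ⊖_)

  Bool-ext : ∀ {a b} → (a ≡ true → b ≡ true) → (b ≡ true → a ≡ true) → a ≡ b
  Bool-ext {true} f g = sym (f refl)
  Bool-ext {false} {true} f g = g refl
  Bool-ext {false} {false} f g = refl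

  true-false : ∀ {b} → b ≡ true → b ≡ false → ⊥
  true-false refl ()

  module _ {d : ℕ} where

    Period : (V d → Bool) → V d → Set
    Period X s = ∀ y → X (y ⊞ s) ≡ X y

    module _ {X : V d → Bool} where
      period-0 : Period X (constᵛ 0ℤ)
      period-0 y = cong X (solve 1 (λ y → y ⊹ con 0ℤ := y) refl y)

      period-+ : ∀ {s t} → Period X s → Period X t → Period X (s ⊞ t)
      period-+ {s} {t} h k y = trans (cong X (solve 3 (λ y s t → y ⊹ (s ⊹ t) := y ⊹ s ⊹ t) refl y s t)) (trans (k _) (h y))

      period-neg : ∀ {s} → Period X s → Period X (⊝ s)
      period-neg {s} h y = trans (sym (h _)) (cong X (solve 2 (λ y s → y ⊹ ⊖ s ⊹ s := y) refl y s))

      period-scalar : ∀ a {s} → Period X s → Period X (scalar a s)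
      period-scalar a {s} h = subst (λ a → Period X (scalar a s)) ([]-ι a) (multiple (toℕ a))
        where
        multiple : ∀ n → Period X (scalar [ + n ] s)
        multiple zero = subst (Period X) (sym (0·v s)) period-0
        multiple (suc n) = subst (Period X) (sym (trans ([]-·-+ 1ℤ (+ n) s) (cong (_⊞ scalar [ + n ] s) (1·v s)))) (period-+ h (multiple n))

      period-root : ∀ z {s} → ¬ (z ≈ 0ℤ) → Period X (scalar [ z ] s) → Period X s
      period-root z {s} z≉0 h with inverse [ z ] (λ e → z≉0 ([]-injective e))
      ... | b , e = subst (Period X) (trans (·-· b [ z ] s) (trans (cong (λ c → scalar c s) (trans (*ᶠ-comm b [ z ]) e)) (1·v s))) (period-scalar b h)

    double : ∀ (s : V d) → scalar [ + 2 ] s ≡ s ⊞ s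
    double s = trans (·≡⊠ [ + 2 ] s) (solve 1 (λ s → con (+ 2) ⊗ s := s ⊹ s) refl s)

    triple : ∀ (s : V d) → scalar [ + 3 ] s ≡ s ⊞ s ⊞ s
    triple s = trans (·≡⊠ [ + 3 ] s) (solve 1 (λ s → con (+ 3) ⊗ s := s ⊹ s ⊹ s) refl s)

    module _ {X Y : V d → Bool} {t t′ : V d} (h : ∀ y → Y y ≡ not (X (y ⊟ t))) (h′ : ∀ y → Y y ≡ not (X (y ⊟ t′))) where
      -- Y is the complement of X moved by t and also by t′, so moving Y by t - t′ changes nothing.
      complement-period : Period Y (t ⊟ t′)
      complement-period y = trans (h _) (trans (cong (λ z → not (X z)) (solve 3 (λ y t t′ → y ⊹ (t ⊹ ⊖ t′) ⊹ ⊖ t := y ⊹ ⊖ t′) refl y t t′)) (sym (h′ y)))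

      complemented-period : Period X (t ⊟ t′)
      complemented-period y = not-injective (trans (cong (λ z → not (X z)) (solve 3 (λ y t t′ → y ⊹ (t ⊹ ⊖ t′) := y ⊹ t ⊹ ⊖ t′) refl y t t′))
        (trans (sym (h′ (y ⊞ t))) (trans (h (y ⊞ t)) (cong (λ z → not (X z)) (solve 2 (λ y t → y ⊹ t ⊹ ⊖ t := y) refl y t)))))

    module _ (X : V d → Bool) (v : V d) (hv : X v ≡ true) (periods : ∀ x → X (v ⊞ x) ≡ true → Period X x) where
      -- X translated back by v. If all differences from v are periods this is a subspace: periods
      -- are closed under addition, and over a prime field also under scalars.
      coset : V d → Bool
      coset x = X (v ⊞ x)

      coset-0 : coset (0v p) ≡ true
      coset-0 = trans (cong coset 0v≡) (trans (cong X (solve 1 (λ v → v ⊹ con 0ℤ := v) refl v)) hv)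

      coset-⊕ : ∀ x y → coset x ≡ true → coset y ≡ true → coset (_⊕_ p x y) ≡ true
      coset-⊕ x y hx hy = trans (cong coset (sym (⊞≡⊕ x y))) (trans (cong X (solve 3 (λ v x y → v ⊹ (x ⊹ y) := v ⊹ x ⊹ y) refl v x y)) (trans (periods y hy (v ⊞ x)) hx))

      coset-· : ∀ c x → coset x ≡ true → coset (_·_ p c x) ≡ true
      coset-· c x hx = trans (cong coset (sym (scalar≡· c x))) (trans (period-scalar c (periods x hx) v) hv)

    -- The fibres at the two ends 0, 3 and next to them at 1, 2.
    module FourFibres (B₀ B₁ B₂ B₃ : V d → Bool) (v w : V d) (hv : B₀ v ≡ true) (hw : B₃ w ≡ true) where

      -- With W = B₀ - v this says B₃ = -v + W, while B₂ and B₁ are the complements of 4v + W and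
      -- -4v + W. The multiples 1, -1, 4, -4 match the positions of the four hyperplanes, so one
      -- shear will straighten all of them.
      record Structured : Set where
        field
          periods : ∀ x → B₀ (v ⊞ x) ≡ true → Period B₀ x
          at₃ : ∀ y → B₃ y ≡ B₀ (v ⊞ (y ⊞ v))
          at₂ : ∀ y → B₂ y ≡ not (B₀ (v ⊞ (y ⊟ (v ⊞ v ⊞ v ⊞ v))))
          at₁ : ∀ y → B₁ y ≡ not (B₀ (v ⊞ (y ⊞ (v ⊞ v ⊞ v ⊞ v))))

      -- The second and third hypotheses make B₃ the coset w + W of the same W. That v + w is a
      -- period then lets -v replace w throughout.
      structured : (∀ x → B₀ (v ⊞ x) ≡ true → Period B₀ x) → (∀ x → B₃ (w ⊞ x) ≡ true → Period B₀ x) →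
        (∀ x → B₀ (v ⊞ x) ≡ true → Period B₃ x) → Period B₀ (v ⊞ w) →
        (∀ y → B₂ y ≡ not (B₀ (y ⊟ (v ⊞ v ⊞ v)))) → (∀ y → B₁ y ≡ not (B₃ (y ⊟ (w ⊞ w ⊞ w)))) → Structured
      structured P₀ Q P₃ S N₂ N₁ = record
        { periods = P₀
        ; at₃ = λ y → trans (at-w y) (trans (sym (S _)) (cong B₀ (solve 3 (λ v w y → v ⊹ (y ⊹ ⊖ w) ⊹ (v ⊹ w) := v ⊹ (y ⊹ v)) refl v w y)))
        ; at₂ = λ y → trans (N₂ y) (cong (λ z → not (B₀ z)) (solve 2 (λ v y → y ⊹ ⊖ (v ⊹ v ⊹ v) := v ⊹ (y ⊹ ⊖ (v ⊹ v ⊹ v ⊹ v))) refl v y))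
        ; at₁ = λ y → trans (N₁ y) (cong not (trans (at-w _) (trans (sym (period-+ (period-+ (period-+ S S) S) S _))
            (cong B₀ (solve 3 (λ v w y → v ⊹ (y ⊹ ⊖ (w ⊹ w ⊹ w) ⊹ ⊖ w) ⊹ (v ⊹ w ⊹ (v ⊹ w) ⊹ (v ⊹ w) ⊹ (v ⊹ w)) := v ⊹ (y ⊹ (v ⊹ v ⊹ v ⊹ v))) refl v w y))))) }
        where
        at-w : ∀ y → B₃ y ≡ B₀ (v ⊞ (y ⊟ w))
        at-w y = Bool-ext (λ h → trans (Q (y ⊟ w) (trans (cong B₃ w+) h) v) hv) (λ h → trans (sym (cong B₃ w+)) (trans (P₃ (y ⊟ w) h w) hw))
          where
          w+ : w ⊞ (y ⊟ w) ≡ y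
          w+ = solve 2 (λ w y → w ⊹ (y ⊹ ⊖ w) := y) refl w y

      module _
        (R₁ : ∀ {a b f} → B₀ a ≡ true → B₀ b ≡ true → B₃ f ≡ true → ∀ y → B₂ y ≡ not (B₀ (y ⊟ (a ⊞ b ⊟ f))))
        (R₂ : ∀ {a b f} → B₃ a ≡ true → B₃ b ≡ true → B₀ f ≡ true → ∀ y → B₁ y ≡ not (B₃ (y ⊟ (a ⊞ b ⊟ f))))
        (R₃ : ∀ {a b f} → B₀ a ≡ true → B₀ b ≡ true → B₃ f ≡ true → ∀ y → B₃ y ≡ not (B₁ (y ⊟ (a ⊞ b ⊟ f)))) where
        private
          Q : ∀ x → B₃ (w ⊞ x) ≡ true → Period B₀ x
          Q x h = subst (Period B₀) (solve 3 (λ v w x → v ⊹ v ⊹ ⊖ w ⊹ ⊖ (v ⊹ v ⊹ ⊖ (w ⊹ x)) := x) refl v w x) (complemented-period (R₁ hv hv hw) (R₁ hv hv h))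
          -- R₃ followed by R₂ complements twice and so moves B₃ onto itself; this places w - (v +
          -- w) in B₃, and by Q its difference from w is a period.
          S : Period B₀ (v ⊞ w)
          S = subst (Period B₀) (solve 2 (λ v w → ⊖ (⊖ (v ⊹ w)) := v ⊹ w) refl v w) (period-neg (Q (⊝ (v ⊞ w)) (trans (sym step) hw)))
            where
            step : B₃ w ≡ B₃ (w ⊞ ⊝ (v ⊞ w))
            step = trans (R₃ hv hv hw w) (trans (cong not (R₂ hw hw hv _)) (trans (not-involutive _)
              (cong B₃ (solve 2 (λ v w → w ⊹ ⊖ (v ⊹ v ⊹ ⊖ w) ⊹ ⊖ (w ⊹ w ⊹ ⊖ v) := w ⊹ ⊖ (v ⊹ w)) refl v w))))
        structured-plus : Structured
        structured-plus = structured
          (λ x h → subst (Period B₀) (solve 3 (λ v w x → v ⊹ x ⊹ v ⊹ ⊖ w ⊹ ⊖ (v ⊹ v ⊹ ⊖ w) := x) refl v w x) (complemented-period (R₁ h hv hw) (R₁ hv hv hw)))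
          Q
          (λ x h → subst (Period B₃) (solve 3 (λ v w x → w ⊹ w ⊹ ⊖ v ⊹ ⊖ (w ⊹ w ⊹ ⊖ (v ⊹ x)) := x) refl v w x) (complemented-period (R₂ hw hw hv) (R₂ hw hw h)))
          S
          (λ y → trans (R₁ hv hv hw y) (cong not (trans (cong B₀ (solve 3 (λ v w y → y ⊹ ⊖ (v ⊹ v ⊹ ⊖ w) := y ⊹ ⊖ (v ⊹ v ⊹ v) ⊹ (v ⊹ w)) refl v w y)) (S _))))
          (λ y → trans (R₂ hw hw hv y) (cong not (trans (cong B₃ (solve 3 (λ v w y → y ⊹ ⊖ (w ⊹ w ⊹ ⊖ v) := y ⊹ ⊖ (w ⊹ w ⊹ w) ⊹ (v ⊹ w)) refl v w y))
            (S₃ _))))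
          where
          S₃ : Period B₃ (v ⊞ w)
          S₃ = subst (Period B₃) (solve 3 (λ v w x → w ⊹ w ⊹ ⊖ v ⊹ ⊖ (w ⊹ w ⊹ ⊖ (v ⊹ x)) := x) refl v w (v ⊞ w))
            (complemented-period (R₂ hw hw hv) (R₂ hw hw (trans (S v) hv)))

      module _ (3≉0 : ¬ (+ 3 ≈ 0ℤ))
        (R₁ : ∀ {a b f} → B₀ a ≡ true → B₀ b ≡ true → B₀ f ≡ true → ∀ y → B₀ y ≡ not (B₂ (y ⊟ (⊝ (a ⊞ b) ⊟ f))))
        (R₂ : ∀ {a b f} → B₃ a ≡ true → B₃ b ≡ true → B₃ f ≡ true → ∀ y → B₃ y ≡ not (B₁ (y ⊟ (⊝ (a ⊞ b) ⊟ f))))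
        (R₃ : ∀ {a b f} → B₀ a ≡ true → B₀ b ≡ true → B₀ f ≡ true → ∀ y → B₁ y ≡ not (B₃ (y ⊟ (⊝ (a ⊞ b) ⊟ f))))
        (R₄ : ∀ {a b f} → B₃ a ≡ true → B₃ b ≡ true → B₃ f ≡ true → ∀ y → B₂ y ≡ not (B₀ (y ⊟ (⊝ (a ⊞ b) ⊟ f)))) where
        private
          shifted : ∀ (a x : V d) → ⊝ (a ⊞ a) ⊟ a ⊟ (⊝ (a ⊞ a) ⊟ (a ⊞ x)) ≡ x
          shifted = solve 2 (λ a x → ⊖ (a ⊹ a) ⊹ ⊖ a ⊹ ⊖ (⊖ (a ⊹ a) ⊹ ⊖ (a ⊹ x)) := x) refl
          Q : ∀ x → B₃ (w ⊞ x) ≡ true → Period B₀ x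
          Q x h = subst (Period B₀) (shifted w x) (complemented-period (R₄ hw hw hw) (R₄ hw hw h))
          -- Here complementing twice moves B₃ by 3(v + w), which is therefore a period; 3 is
          -- invertible modulo p.
          S : Period B₀ (v ⊞ w)
          S = period-root (+ 3) 3≉0 (subst (Period B₀) (sym (triple (v ⊞ w))) (Q (v ⊞ w ⊞ (v ⊞ w) ⊞ (v ⊞ w)) (trans (sym step) hw)))
            where
            step : B₃ w ≡ B₃ (w ⊞ (v ⊞ w ⊞ (v ⊞ w) ⊞ (v ⊞ w)))
            step = trans (R₂ hw hw hw w) (trans (cong not (R₃ hv hv hv _)) (trans (not-involutive _)
              (cong B₃ (solve 2 (λ v w → w ⊹ ⊖ (⊖ (w ⊹ w) ⊹ ⊖ w) ⊹ ⊖ (⊖ (v ⊹ v) ⊹ ⊖ v) := w ⊹ (v ⊹ w ⊹ (v ⊹ w) ⊹ (v ⊹ w))) refl v w))))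
        structured-minus : Structured
        structured-minus = structured
          (λ x h → subst (Period B₀) (shifted v x) (complement-period {X = B₂} (R₁ hv hv hv) (R₁ hv hv h)))
          Q
          (λ x h → subst (Period B₃) (shifted v x) (complemented-period (R₃ hv hv hv) (R₃ hv hv h)))
          S
          (λ y → trans (sym (not-involutive _)) (cong not (sym (trans (R₁ hv hv hv _) (cong (λ z → not (B₂ z)) (back v y))))))
          (λ y → trans (sym (not-involutive _)) (cong not (sym (trans (R₂ hw hw hw _) (cong (λ z → not (B₁ z)) (back w y))))))
          where
          back : ∀ (v y : V d) → y ⊟ (v ⊞ v ⊞ v) ⊟ (⊝ (v ⊞ v) ⊟ v) ≡ y
          back = solve 2 (λ v y → y ⊹ ⊖ (v ⊹ v ⊹ v) ⊹ ⊖ (⊖ (v ⊹ v) ⊹ ⊖ v) := y) refl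

    -- For W = B₀ − v and x = 2w − 3v both x and 2x would lie outside W only if B₁ contained w + x, which it does not.
    no-complementary-cosets : ¬ (+ 2 ≈ 0ℤ) → (B₀ B₁ : V d → Bool) (v w : V d) → B₀ v ≡ true → B₁ w ≡ true →
      (∀ {a b f} → B₀ a ≡ true → B₀ b ≡ true → B₁ f ≡ true → ∀ y → B₁ y ≡ not (B₀ (y ⊟ (a ⊞ b ⊟ f)))) → ⊥
    no-complementary-cosets 2≉0 B₀ B₁ v w hv hw R = by (B₀ (v ⊞ (x ⊞ x))) refl
      where
      x = w ⊞ w ⊟ (v ⊞ v ⊞ v)
      periods : ∀ x → B₀ (v ⊞ x) ≡ true → Period B₀ x
      periods x h = subst (Period B₀) (solve 3 (λ v w x → v ⊹ x ⊹ v ⊹ ⊖ w ⊹ ⊖ (v ⊹ v ⊹ ⊖ w) := x) refl v w x) (complemented-period (R h hv hw) (R hv hv hw))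
      Q : ∀ x → B₁ (w ⊞ x) ≡ true → Period B₀ x
      Q x h = subst (Period B₀) (solve 3 (λ v w x → v ⊹ v ⊹ ⊖ w ⊹ ⊖ (v ⊹ v ⊹ ⊖ (w ⊹ x)) := x) refl v w x) (complemented-period (R hv hv hw) (R hv hv h))
      not-period : ¬ Period B₀ x
      not-period h = true-false hw (trans (R hv hv hw w) (cong not (trans
        (cong B₀ (solve 2 (λ v w → w ⊹ ⊖ (v ⊹ v ⊹ ⊖ w) := v ⊹ (w ⊹ w ⊹ ⊖ (v ⊹ v ⊹ v))) refl v w)) (trans (h v) hv))))
      by : ∀ b → B₀ (v ⊞ (x ⊞ x)) ≡ b → ⊥
      by true e = not-period (period-root (+ 2) 2≉0 (subst (Period B₀) (sym (double x)) (periods (x ⊞ x) e)))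
      by false e = not-period (Q x (trans (R hv hv hw (w ⊞ x)) (cong not (trans
        (cong B₀ (solve 2 (λ v w → w ⊹ (w ⊹ w ⊹ ⊖ (v ⊹ v ⊹ v)) ⊹ ⊖ (v ⊹ v ⊹ ⊖ w)
          := v ⊹ (w ⊹ w ⊹ ⊖ (v ⊹ v ⊹ v) ⊹ (w ⊹ w ⊹ ⊖ (v ⊹ v ⊹ v)))) refl v w)) e))))

-- Sets given fibre by fibre compared with the sets defining the types.

module Shapes (p : ℕ) .{{_ : NonZero p}} (prime : Prime p) where

  open Residues p
  open PrimeField p prime
  open SumFreeLine p prime using (-ₚ≡-ᶠ)
  open QuasiHomomorphisms p prime using (≈-by)
  open Automorphisms p prime
  open import Defs using (interval; full; type2Set; type3Set; type4Set; _+ₚ_; _-ₚ_; _*ₚ_; invₚ; ⟦_⟧) renaming (_⊠_ to _⊠ᵈ_)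
  open import Data.Bool using (Bool; true; false; not; _∧_; _∨_)
  open import Data.Bool.Properties using (∨-identityʳ)
  open import Data.Fin using (Fin)
  import Data.Fin as Fin
  open import Data.Integer hiding (NonZero; ∣_∣; suc; sign)
  open import Data.Integer.Properties using (+-identityʳ)
  open import Data.Integer.Tactic.RingSolver using (solve-∀)
  open import Data.Nat using (zero; suc; s≤s)
  import Data.Nat as ℕ
  import Data.Nat.Properties as ℕ
  open import Data.Product using (proj₁; proj₂)
  open import Data.Sum using (inj₁; inj₂)
  open import Data.Vec using (_∷_)
  open import Relation.Binary using (tri<; tri≈; tri>)
  open import Relation.Binary.PropositionalEquality hiding ([_])
  open import Relation.Nullary using (¬_; Dec; does; yes; no)

  +ₚ-⟦⟧ : ∀ {a} z n → a ≡ [ z ] → _+ₚ_ p a (⟦_⟧ p n) ≡ [ z + + n ]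
  +ₚ-⟦⟧ z n refl = trans (sym (+ᶠ≡+ₚ _ _)) (trans (cong ([ z ] +ᶠ_) (⟦⟧≡[] n)) ([]-+ z (+ n)))

  -ₚ-⟦⟧ : ∀ {a} z n → a ≡ [ z ] → _-ₚ_ p a (⟦_⟧ p n) ≡ [ z - + n ]
  -ₚ-⟦⟧ z n refl = trans (-ₚ≡-ᶠ _ _) (trans (cong (λ x → [ z ] +ᶠ -ᶠ x) (⟦⟧≡[] n)) (trans (cong ([ z ] +ᶠ_) ([]-neg (+ n))) ([]-+ z (- + n))))

  -- Evaluates the divisions by k - ℓ and ℓ - k in the definitions: the candidate z is verified by
  -- multiplication, without computing an inverse.
  quotient : ∀ {X U} r u z → X ≡ [ r ] → U ≡ [ u ] → ¬ (u ≈ 0ℤ) → u Data.Integer.* z ≈ r → _*ₚ_ p X (invₚ p U) ≡ [ z ]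
  quotient r u z refl refl u≉0 h = trans (sym (*ᶠ≡*ₚ _ _)) (*ᶠ-cancelˡ [ u ] u≢0 (begin
    [ u ] *ᶠ ([ r ] *ᶠ u⁻¹)    ≡⟨ FSolver.solve 3 (λ u r v → u FSolver.:* (r FSolver.:* v) FSolver.:= r FSolver.:* (u FSolver.:* v)) refl [ u ] [ r ] u⁻¹ ⟩
    [ r ] *ᶠ ([ u ] *ᶠ u⁻¹)    ≡⟨ cong ([ r ] *ᶠ_) (inv-inverse [ u ] u≢0) ⟩
    [ r ] *ᶠ 1ᶠ                ≡⟨ trans (*ᶠ-comm [ r ] 1ᶠ) (*ᶠ-identityˡ [ r ]) ⟩
    [ r ]                      ≡⟨ []-cong h ⟨
    [ u Data.Integer.* z ]     ≡⟨ []-* u z ⟨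
    [ u ] *ᶠ [ z ]             ∎))
    where
    open ≡-Reasoning
    u⁻¹ = invₚ p [ u ]
    u≢0 : [ u ] ≢ 0ᶠ
    u≢0 e = u≉0 ([]-injective e)

  by-positions : ∀ c (Q : F → Set) → (∀ i → i ℕ.< p → Q [ c + + i ]) → ∀ x → Q x
  by-positions c Q h x = subst Q (sym (proj₂ (proj₂ (from-origin c x)))) (h _ (proj₁ (proj₂ (from-origin c x))))

  data Position (l i : ℕ) : Set where
    first : i ≡ 0 → Position l i
    inner : 0 ℕ.< i → i ℕ.< l → Position l i
    last : i ≡ l → Position l i
    outer : l ℕ.< i → Position l i

  position : ∀ l i → Position l i
  position l zero = first refl
  position l (suc i) with ℕ.<-cmp (suc i) l
  ... | tri< lt _ _ = inner (s≤s ℕ.z≤n) lt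
  ... | tri≈ _ e _ = last e
  ... | tri> _ _ gt = outer gt

  module _ {d : ℕ} (c : ℤ) (A : V (suc d) → Bool) where

    interval-shape : ∀ m a → 1 ℕ.≤ m → m ℕ.≤ p → a ≡ [ c + 0ℤ ] → (∀ i u → i ℕ.< m → A ([ c + + i ] ∷ u) ≡ true) →
      (∀ i u → m ℕ.≤ i → i ℕ.< p → A ([ c + + i ] ∷ u) ≡ false) →
      ∀ x → A x ≡ _⊠ᵈ_ p (interval p a (_+ₚ_ p a (⟦_⟧ p (m ℕ.∸ 1)))) (full p) x
    interval-shape m a 1≤m m≤p a≡ inside outside (x ∷ u) = by-positions c (λ x → A (x ∷ u) ≡ (interval p a (_+ₚ_ p a (⟦_⟧ p (m ℕ.∸ 1))) x ∧ true)) (λ i i<p → by i i<p (m ℕ.≤? i)) x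
      where
      l = m ℕ.∸ 1
      1+l : suc l ≡ m
      1+l = ℕ.m+[n∸m]≡n 1≤m
      end : _+ₚ_ p a (⟦_⟧ p l) ≡ [ c + + l ]
      end = trans (+ₚ-⟦⟧ (c + 0ℤ) l a≡) ([]-cong (≈-by (cong (_+ + l) (+-identityʳ c))))
      value : ∀ i b → interval p [ c + 0ℤ ] [ c + + l ] [ c + + i ] ≡ b → (interval p a (_+ₚ_ p a (⟦_⟧ p l)) [ c + + i ] ∧ true) ≡ b
      value i true h = cong (_∧ true) (trans (cong₂ (λ a b → interval p a b [ c + + i ]) a≡ end) h)
      value i false h = cong (_∧ true) (trans (cong₂ (λ a b → interval p a b [ c + + i ]) a≡ end) h)
      by : ∀ i → i ℕ.< p → Dec (m ℕ.≤ i) → A ([ c + + i ] ∷ u) ≡ (interval p a (_+ₚ_ p a (⟦_⟧ p l)) [ c + + i ] ∧ true)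
      by i i<p (yes m≤i) = trans (outside i u m≤i i<p) (sym (value i false (interval-above c 0 i l ℕ.z≤n (subst (ℕ._≤ i) (sym 1+l) m≤i) i<p)))
      by i i<p (no m≰i) = trans (inside i u i<m) (sym (value i true (interval-inside c 0 i l ℕ.z≤n (ℕ.≤-pred (subst (suc i ℕ.≤_) (sym 1+l) i<m)) (ℕ.≤-trans (ℕ.≤-reflexive 1+l) m≤p))))
        where
        i<m = ℕ.≰⇒> m≰i

    -- `shift x` is the action of the final automorphism on the fibre over x: a tail shear for types
    -- 2 and 4, the identity for type 3.
    module _ (shift : F → V d → V d) (m : ℕ) (3≤m : 3 ℕ.≤ m) where
      private
        1+l : suc (m ℕ.∸ 1) ≡ m
        1+l = ℕ.m+[n∸m]≡n (ℕ.≤-trans (s≤s ℕ.z≤n) 3≤m)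
        below : ∀ {i} → i ℕ.< m → i ℕ.≤ m ℕ.∸ 1
        below lt = ℕ.≤-pred (subst (_ ℕ.≤_) (sym 1+l) lt)
        1≤l : 1 ℕ.≤ m ℕ.∸ 1
        1≤l = below (ℕ.≤-trans (s≤s (s≤s ℕ.z≤n)) 3≤m)
        l<m : m ℕ.∸ 1 ℕ.< m
        l<m = ℕ.≤-reflexive 1+l
        0<m : 0 ℕ.< m
        0<m = ℕ.<-trans (s≤s ℕ.z≤n) (ℕ.≤-<-trans 1≤l l<m)

        shape₂ : F → F → F → F → F → Bool → Bool
        shape₂ a b b′ z x v = (does (x Fin.≟ a) ∧ not v) ∨ interval p b b′ x ∨ (does (x Fin.≟ z) ∧ v)

        shape₂-cong : ∀ {a b b′ z a₁ b₁ b₁′ z₁} → a ≡ a₁ → b ≡ b₁ → b′ ≡ b₁′ → z ≡ z₁ → ∀ x v → shape₂ a b b′ z x v ≡ shape₂ a₁ b₁ b₁′ z₁ x v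
        shape₂-cong refl refl refl refl x v = refl

        shape₂-value : ∀ i v {α β ζ} → does ([ c + + i ] Fin.≟ [ c + 0ℤ ]) ≡ α → interval p [ c + 1ℤ ] [ c + + (m ℕ.∸ 1) ] [ c + + i ] ≡ β → does ([ c + + i ] Fin.≟ [ c + + m ]) ≡ ζ →
          shape₂ [ c + 0ℤ ] [ c + 1ℤ ] [ c + + (m ℕ.∸ 1) ] [ c + + m ] [ c + + i ] v ≡ (α ∧ not v) ∨ β ∨ (ζ ∧ v)
        shape₂-value i v refl refl refl = refl

      type2-shape : ∀ a V → m ℕ.< p → a ≡ [ c + 0ℤ ] → (∀ u → A ([ c + 0ℤ ] ∷ u) ≡ not (V (shift [ c + 0ℤ ] u))) →
        (∀ i u → 0 ℕ.< i → i ℕ.< m → A ([ c + + i ] ∷ u) ≡ true) → (∀ u → A ([ c + + m ] ∷ u) ≡ V (shift [ c + + m ] u)) →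
        (∀ i u → m ℕ.< i → i ℕ.< p → A ([ c + + i ] ∷ u) ≡ false) → ∀ x u → A (x ∷ u) ≡ type2Set p a m V (x ∷ shift x u)
      type2-shape a V m<p a≡ at₀ inside at-m outside x u = by-positions c _ (λ i i<p → trans (by i i<p (position m i)) (sym (shape₂-cong a≡ (place 1) (place (m ℕ.∸ 1)) (place m) [ c + + i ] (V (shift [ c + + i ] u))))) x
        where
        place : ∀ n → _+ₚ_ p a (⟦_⟧ p n) ≡ [ c + + n ]
        place n = trans (+ₚ-⟦⟧ (c + 0ℤ) n a≡) ([]-cong (≈-by (cong (_+ + n) (+-identityʳ c))))
        0<p = ℕ.<-trans 0<m m<p
        l<p = ℕ.<-trans l<m m<p
        by : ∀ i → i ℕ.< p → Position m i → A ([ c + + i ] ∷ u) ≡ shape₂ [ c + 0ℤ ] [ c + 1ℤ ] [ c + + (m ℕ.∸ 1) ] [ c + + m ] [ c + + i ] (V (shift [ c + + i ] u))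
        by i i<p (first refl) = trans (at₀ u) (sym (trans (shape₂-value i (V (shift [ c + + i ] u)) (same c 0) (interval-below c 1 0 (m ℕ.∸ 1) (s≤s ℕ.z≤n) 1≤l l<p) (different c 0 m 0<p m<p (ℕ.<⇒≢ 0<m))) (∨-identityʳ _)))
        by i i<p (inner 0<i i<m) = trans (inside i u 0<i i<m) (sym (shape₂-value i (V (shift [ c + + i ] u)) (different c i 0 i<p 0<p (λ e → ℕ.<⇒≢ 0<i (sym e))) (interval-inside c 1 i (m ℕ.∸ 1) 0<i (below i<m) l<p) (different c i m i<p m<p (ℕ.<⇒≢ i<m))))
        by i i<p (last refl) = trans (at-m u) (sym (shape₂-value i (V (shift [ c + + i ] u)) (different c m 0 i<p 0<p (λ e → ℕ.<⇒≢ 0<m (sym e))) (interval-above c 1 m (m ℕ.∸ 1) 1≤l l<m i<p) (same c m)))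
        by i i<p (outer m<i) = trans (outside i u m<i i<p) (sym (shape₂-value i (V (shift [ c + + i ] u)) (different c i 0 i<p 0<p (λ e → ℕ.<⇒≢ (ℕ.<-trans 0<m m<i) (sym e))) (interval-above c 1 i (m ℕ.∸ 1) 1≤l (ℕ.<-trans l<m m<i) i<p) (different c i m i<p m<p (λ e → ℕ.<⇒≢ m<i (sym e)))))

      private
        data Position₄ (i : ℕ) : Set where
          at-0 : i ≡ 0 → Position₄ i
          at-1 : i ≡ 1 → Position₄ i
          between : 1 ℕ.< i → i ℕ.< m → Position₄ i
          at-m : i ≡ m → Position₄ i
          at-1+m : i ≡ suc m → Position₄ i
          beyond : suc m ℕ.< i → Position₄ i

        position₄ : ∀ i → Position₄ i
        position₄ 0 = at-0 refl
        position₄ 1 = at-1 refl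
        position₄ (suc (suc i)) with position m (suc (suc i))
        ... | inner _ lt = between (s≤s (s≤s ℕ.z≤n)) lt
        ... | last e = at-m e
        ... | outer gt with ℕ.m≤n⇒m<n∨m≡n gt
        ...   | inj₁ lt = beyond lt
        ...   | inj₂ e = at-1+m (sym e)

        shape₄ : F → F → F → F → F → F → F → Bool → Bool
        shape₄ a b y z s t x v = ((does (x Fin.≟ a) ∨ does (x Fin.≟ z)) ∧ v) ∨ ((does (x Fin.≟ b) ∨ does (x Fin.≟ y)) ∧ not v) ∨ interval p s t x

        shape₄-cong : ∀ {a b y z s t a₁ b₁ y₁ z₁ s₁ t₁} → a ≡ a₁ → b ≡ b₁ → y ≡ y₁ → z ≡ z₁ → s ≡ s₁ → t ≡ t₁ → ∀ x v → shape₄ a b y z s t x v ≡ shape₄ a₁ b₁ y₁ z₁ s₁ t₁ x v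
        shape₄-cong refl refl refl refl refl refl x v = refl

        shape₄-value : ∀ i v {α β η ζ ι} → does ([ c + + i ] Fin.≟ [ c + 0ℤ ]) ≡ α → does ([ c + + i ] Fin.≟ [ c + 1ℤ ]) ≡ β →
          does ([ c + + i ] Fin.≟ [ c + + m ]) ≡ η → does ([ c + + i ] Fin.≟ [ c + + suc m ]) ≡ ζ → interval p [ c + + 2 ] [ c + + (m ℕ.∸ 1) ] [ c + + i ] ≡ ι →
          shape₄ [ c + 0ℤ ] [ c + 1ℤ ] [ c + + m ] [ c + + suc m ] [ c + + 2 ] [ c + + (m ℕ.∸ 1) ] [ c + + i ] v ≡ ((α ∨ ζ) ∧ v) ∨ ((β ∨ η) ∧ not v) ∨ ι
        shape₄-value i v refl refl refl refl refl = refl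

        shape₃ : F → F → F → F → F → Bool
        shape₃ s t a b x = (interval p s t x ∧ not (does (x Fin.≟ a)) ∧ not (does (x Fin.≟ b))) ∧ true

        shape₃-cong : ∀ {s t a b s₁ t₁ a₁ b₁} → s ≡ s₁ → t ≡ t₁ → a ≡ a₁ → b ≡ b₁ → ∀ x → shape₃ s t a b x ≡ shape₃ s₁ t₁ a₁ b₁ x
        shape₃-cong refl refl refl refl x = refl

        shape₃-value : ∀ i {ι α β} → interval p [ c + 0ℤ ] [ c + + suc m ] [ c + + i ] ≡ ι → does ([ c + + i ] Fin.≟ [ c + 1ℤ ]) ≡ α → does ([ c + + i ] Fin.≟ [ c + + m ]) ≡ β →
          shape₃ [ c + 0ℤ ] [ c + + suc m ] [ c + 1ℤ ] [ c + + m ] [ c + + i ] ≡ (ι ∧ not α ∧ not β) ∧ true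
        shape₃-value i refl refl refl = refl

        2≤l : 2 ℕ.≤ m ℕ.∸ 1
        2≤l = below 3≤m
        1<m = ℕ.≤-<-trans 1≤l l<m

      module _ (1+m<p : suc m ℕ.< p) (inside : ∀ i u → 1 ℕ.< i → i ℕ.< m → A ([ c + + i ] ∷ u) ≡ true)
        (outside : ∀ i u → suc m ℕ.< i → i ℕ.< p → A ([ c + + i ] ∷ u) ≡ false) where
        private
          m<p = ℕ.<-trans (ℕ.n<1+n m) 1+m<p
          l<p = ℕ.<-trans l<m m<p
          1<p = ℕ.<-trans 1<m m<p
          0<p = ℕ.<-trans (s≤s ℕ.z≤n) 1<p
          ne> : ∀ i k → i ℕ.< p → k ℕ.< i → does ([ c + + i ] Fin.≟ [ c + + k ]) ≡ false
          ne> i k i<p k<i = different c i k i<p (ℕ.<-trans k<i i<p) (λ e → ℕ.<⇒≢ k<i (sym e))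
          ne< : ∀ i k → k ℕ.< p → i ℕ.< k → does ([ c + + i ] Fin.≟ [ c + + k ]) ≡ false
          ne< i k k<p i<k = different c i k (ℕ.<-trans i<k k<p) k<p (ℕ.<⇒≢ i<k)
          0<1 : 0 ℕ.< 1
          0<1 = s≤s ℕ.z≤n
          m<1+m = ℕ.n<1+n m
          1<1+m = ℕ.<-trans 1<m m<1+m
          0<1+m = ℕ.<-trans 0<m m<1+m

        type4-shape : ∀ V → c ≈ + (2 ℕ.* m ℕ.+ 1) → (∀ u → A ([ c + 0ℤ ] ∷ u) ≡ V (shift [ c + 0ℤ ] u)) → (∀ u → A ([ c + + suc m ] ∷ u) ≡ V (shift [ c + + suc m ] u)) →
          (∀ u → A ([ c + 1ℤ ] ∷ u) ≡ not (V (shift [ c + 1ℤ ] u))) → (∀ u → A ([ c + + m ] ∷ u) ≡ not (V (shift [ c + + m ] u))) →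
          ∀ x u → A (x ∷ u) ≡ type4Set p m V (x ∷ shift x u)
        type4-shape V c≈ h₀ h₁₊ₘ h₁ hₘ x u = by-positions c _ (λ i i<p → trans (by i i<p (position₄ i)) (sym (shape₄-cong (place 0 (ℕ.+-identityʳ _)) (place 1 (eq₁ m)) (place m (eqₘ m)) (place (suc m) (eq₁₊ₘ m)) (place 2 (eq₂ m)) (place (m ℕ.∸ 1) eqₗ) [ c + + i ] (V (shift [ c + + i ] u))))) x
          where
          place : ∀ n {k} → 2 ℕ.* m ℕ.+ 1 ℕ.+ n ≡ k → ⟦_⟧ p k ≡ [ c + + n ]
          place n refl = trans (⟦⟧≡[] _) ([]-cong (≈-+ (≈-sym c≈) (≈-refl {+ n})))
          open import Data.Nat.Tactic.RingSolver using () renaming (solve-∀ to solve-ℕ)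
          eq₁ : ∀ m → 2 ℕ.* m ℕ.+ 1 ℕ.+ 1 ≡ 2 ℕ.* m ℕ.+ 2
          eq₁ = solve-ℕ
          eqₘ : ∀ m → 2 ℕ.* m ℕ.+ 1 ℕ.+ m ≡ 3 ℕ.* m ℕ.+ 1
          eqₘ = solve-ℕ
          eq₁₊ₘ : ∀ m → 2 ℕ.* m ℕ.+ 1 ℕ.+ (1 ℕ.+ m) ≡ 3 ℕ.* m ℕ.+ 2
          eq₁₊ₘ = solve-ℕ
          eq₂ : ∀ m → 2 ℕ.* m ℕ.+ 1 ℕ.+ 2 ≡ 2 ℕ.* m ℕ.+ 3
          eq₂ = solve-ℕ
          eqₗ : 2 ℕ.* m ℕ.+ 1 ℕ.+ (m ℕ.∸ 1) ≡ 3 ℕ.* m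
          eqₗ = trans (ℕ.+-assoc (2 ℕ.* m) 1 (m ℕ.∸ 1)) (trans (cong (2 ℕ.* m ℕ.+_) 1+l) (eq m))
            where
            eq : ∀ m → 2 ℕ.* m ℕ.+ m ≡ 3 ℕ.* m
            eq = solve-ℕ
          by : ∀ i → i ℕ.< p → Position₄ i → A ([ c + + i ] ∷ u) ≡ shape₄ [ c + 0ℤ ] [ c + 1ℤ ] [ c + + m ] [ c + + suc m ] [ c + + 2 ] [ c + + (m ℕ.∸ 1) ] [ c + + i ] (V (shift [ c + + i ] u))
          by i i<p (at-0 refl) = trans (h₀ u) (sym (trans (shape₄-value i (V (shift [ c + + i ] u)) (same c 0) (ne< 0 1 1<p 0<1) (ne< 0 m m<p 0<m) (ne< 0 (suc m) 1+m<p 0<1+m) (interval-below c 2 0 (m ℕ.∸ 1) (s≤s ℕ.z≤n) 2≤l l<p)) (∨-identityʳ _)))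
          by i i<p (at-1 refl) = trans (h₁ u) (sym (trans (shape₄-value i (V (shift [ c + + i ] u)) (ne> 1 0 i<p 0<1) (same c 1) (ne< 1 m m<p 1<m) (ne< 1 (suc m) 1+m<p 1<1+m) (interval-below c 2 1 (m ℕ.∸ 1) (s≤s (s≤s ℕ.z≤n)) 2≤l l<p)) (∨-identityʳ _)))
          by i i<p (between 1<i i<m) = trans (inside i u 1<i i<m) (sym (shape₄-value i (V (shift [ c + + i ] u)) (ne> i 0 i<p (ℕ.<-trans 0<1 1<i)) (ne> i 1 i<p 1<i) (ne< i m m<p i<m) (ne< i (suc m) 1+m<p (ℕ.<-trans i<m m<1+m)) (interval-inside c 2 i (m ℕ.∸ 1) 1<i (below i<m) l<p)))
          by i i<p (at-m refl) = trans (hₘ u) (sym (trans (shape₄-value i (V (shift [ c + + i ] u)) (ne> m 0 i<p 0<m) (ne> m 1 i<p 1<m) (same c m) (ne< m (suc m) 1+m<p m<1+m) (interval-above c 2 m (m ℕ.∸ 1) 2≤l l<m i<p)) (∨-identityʳ _)))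
          by i i<p (at-1+m refl) = trans (h₁₊ₘ u) (sym (trans (shape₄-value i (V (shift [ c + + i ] u)) (ne> (suc m) 0 i<p 0<1+m) (ne> (suc m) 1 i<p 1<1+m) (ne> (suc m) m i<p m<1+m) (same c (suc m)) (interval-above c 2 (suc m) (m ℕ.∸ 1) 2≤l (ℕ.<-trans l<m m<1+m) i<p)) (∨-identityʳ _)))
          by i i<p (beyond lt) = trans (outside i u lt i<p) (sym (shape₄-value i (V (shift [ c + + i ] u)) (ne> i 0 i<p (ℕ.<-trans 0<1+m lt)) (ne> i 1 i<p (ℕ.<-trans 1<1+m lt)) (ne> i m i<p (ℕ.<-trans m<1+m lt)) (ne> i (suc m) i<p lt) (interval-above c 2 i (m ℕ.∸ 1) 2≤l (ℕ.<-trans l<m (ℕ.<-trans m<1+m lt)) i<p)))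

        type3-shape : ∀ a → a ≡ [ c + 1ℤ ] → (∀ u → A ([ c + 0ℤ ] ∷ u) ≡ true) → (∀ u → A ([ c + + suc m ] ∷ u) ≡ true) →
          (∀ u → A ([ c + 1ℤ ] ∷ u) ≡ false) → (∀ u → A ([ c + + m ] ∷ u) ≡ false) → ∀ x → A x ≡ type3Set p a m x
        type3-shape a a≡ h₀ h₁₊ₘ h₁ hₘ (x ∷ u) = by-positions c _ (λ i i<p → trans (by i i<p (position₄ i)) (sym (shape₃-cong start (place m) a≡ end [ c + + i ]))) x
          where
          place : ∀ n → _+ₚ_ p a (⟦_⟧ p n) ≡ [ c + + suc n ]
          place n = trans (+ₚ-⟦⟧ (c + 1ℤ) n a≡) ([]-cong (≈-by (lemma c (+ n))))
            where
            lemma : ∀ c n → c + 1ℤ + n ≡ c + (1ℤ + n)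
            lemma = solve-∀
          start : _-ₚ_ p a (⟦_⟧ p 1) ≡ [ c + 0ℤ ]
          start = trans (-ₚ-⟦⟧ (c + 1ℤ) 1 a≡) ([]-cong (≈-by (lemma c)))
            where
            lemma : ∀ c → c + 1ℤ - 1ℤ ≡ c + 0ℤ
            lemma = solve-∀
          end : _+ₚ_ p a (⟦_⟧ p (m ℕ.∸ 1)) ≡ [ c + + m ]
          end = trans (place (m ℕ.∸ 1)) (cong (λ k → [ c + + k ]) 1+l)
          by : ∀ i → i ℕ.< p → Position₄ i → A ([ c + + i ] ∷ u) ≡ shape₃ [ c + 0ℤ ] [ c + + suc m ] [ c + 1ℤ ] [ c + + m ] [ c + + i ]
          by i i<p (at-0 refl) = trans (h₀ u) (sym (shape₃-value i (interval-inside c 0 0 (suc m) ℕ.z≤n ℕ.z≤n 1+m<p) (ne< 0 1 1<p 0<1) (ne< 0 m m<p 0<m)))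
          by i i<p (at-1 refl) = trans (h₁ u) (sym (shape₃-value i (interval-inside c 0 1 (suc m) ℕ.z≤n (ℕ.<⇒≤ 1<1+m) 1+m<p) (same c 1) (ne< 1 m m<p 1<m)))
          by i i<p (between 1<i i<m) = trans (inside i u 1<i i<m) (sym (shape₃-value i (interval-inside c 0 i (suc m) ℕ.z≤n (ℕ.<⇒≤ (ℕ.<-trans i<m m<1+m)) 1+m<p) (ne> i 1 i<p 1<i) (ne< i m m<p i<m)))
          by i i<p (at-m refl) = trans (hₘ u) (sym (shape₃-value i (interval-inside c 0 m (suc m) ℕ.z≤n (ℕ.<⇒≤ m<1+m) 1+m<p) (ne> m 1 i<p 1<m) (same c m)))
          by i i<p (at-1+m refl) = trans (h₁₊ₘ u) (sym (shape₃-value i (interval-inside c 0 (suc m) (suc m) ℕ.z≤n ℕ.≤-refl 1+m<p) (ne> (suc m) 1 i<p 1<1+m) (ne> (suc m) m i<p m<1+m)))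
          by i i<p (beyond lt) = trans (outside i u lt i<p) (sym (shape₃-value i (interval-above c 0 i (suc m) ℕ.z≤n lt i<p) (ne> i 1 i<p (ℕ.<-trans 1<1+m lt)) (ne> i m i<p (ℕ.<-trans m<1+m lt))))

-- The surviving positions one by one.

module Classification (p : ℕ) .{{_ : NonZero p}} (prime : Prime p) (m : ℕ) (p≡ : p ≡ 3 ℕ.+ 5 ℕ.* m) (21≤m : 21 ℕ.≤ m) where

  open LinearArithmetic hiding (close; classify)
  open Sums
  open Sequences using (all-full; full-but-ends; full-but-two-ends)
  open Residues p
  open PrimeField p prime
  open SumFreeLine p prime using (Sign; plus; minus; -ₚ≡-ᶠ)
  open QuasiHomomorphisms p prime using (≈-by)
  open Concentration p prime using (SumFreeV)
  open Fibres p prime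
  open Automorphisms p prime
  open Cosets p prime
  open Shapes p prime
  open import Defs using (type2Set; type4Set; Iso; Aut; Subset; Trivial; Normal; Type3; Type4; a₀; A₀; 0v; interval; _+ₚ_; _-ₚ_; _*ₚ_; invₚ; ⟦_⟧; full) renaming (_⊠_ to _⊠ᵈ_)
  open import Data.Bool using (Bool; true; false; not; _∧_)
  open import Data.Bool.Properties using (not-involutive)
  open import Data.Empty using (⊥; ⊥-elim)
  open import Data.Integer hiding (NonZero; ∣_∣; suc; sign)
  open import Data.Integer.Properties using (+-identityʳ; *-identityˡ; pos-*)
  open import Data.Integer.Tactic.RingSolver using (solve-∀)
  open import Data.Nat using (zero; suc; s≤s)
  import Data.Nat.Properties as ℕ
  open import Data.Product using (∃; _×_; _,_; proj₁; proj₂)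
  open import Data.Sum using (_⊎_; inj₁; inj₂)
  open import Data.Vec using ([]; _∷_)
  open import Relation.Binary.PropositionalEquality hiding ([_])
  open import Relation.Nullary using (¬_; Dec; yes; no; contradiction)
  open VSolver using (solve; _:=_; con) renaming (_:+_ to _⊹_; _:*_ to _⊗_; :-_ to ⊖_)

  kᵒ ℓᵒ : Sign → ℕ
  kᵒ plus = 3
  kᵒ minus = 4
  ℓᵒ plus = 2
  ℓᵒ minus = 1

  Outcome : ∀ {d} → Sign → Subset p (suc d) → Set
  Outcome σ A = Trivial p (kᵒ σ) (ℓᵒ σ) m A ⊎ Normal p (kᵒ σ) (ℓᵒ σ) m A ⊎ Type3 p (kᵒ σ) (ℓᵒ σ) m A ⊎ Type4 p m A

  Outcome-Iso : ∀ {d} σ {A B : Subset p (suc d)} → Iso p A B → Outcome σ B → Outcome σ A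
  Outcome-Iso σ (φ , k) (inj₁ (C , sub , (ψ , h))) = inj₁ (C , sub , compose φ ψ , λ x → trans (k x) (h (Aut.f φ x)))
  Outcome-Iso σ (φ , k) (inj₂ (inj₁ (inj₁ (a , r , (ψ , h))))) = inj₂ (inj₁ (inj₁ (a , r , compose φ ψ , λ x → trans (k x) (h (Aut.f φ x)))))
  Outcome-Iso σ (φ , k) (inj₂ (inj₁ (inj₂ (e , 1≤d , V , proper , (ψ , h))))) = inj₂ (inj₁ (inj₂ (e , 1≤d , V , proper , compose φ ψ , λ x → trans (k x) (h (Aut.f φ x)))))
  Outcome-Iso σ (φ , k) (inj₂ (inj₂ (inj₁ (ψ , h)))) = inj₂ (inj₂ (inj₁ (compose φ ψ , λ x → trans (k x) (h (Aut.f φ x)))))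
  Outcome-Iso σ (φ , k) (inj₂ (inj₂ (inj₂ (1≤d , V , proper , (ψ , h))))) = inj₂ (inj₂ (inj₂ (1≤d , V , proper , compose φ ψ , λ x → trans (k x) (h (Aut.f φ x)))))

  small≉0 : ∀ n → 0 ℕ.< n → n ℕ.≤ m → ¬ (+ n ≈ 0ℤ)
  small≉0 n 0<n n≤m h = ℕ.<⇒≢ 0<n (sym (<p⇒≡ n<p 0<p h))
    where
    n<p : n ℕ.< p
    n<p = subst (n ℕ.<_) (sym p≡) (linarithⁿ 2 (λ n m → n :≤ m ⇒ ⊢ (n :< lit 3 :+ 5 :* m)) refl n m n≤m)
    0<p = ℕ.<-trans 0<n n<p

  -3≉0 : ¬ (- + 3 ≈ 0ℤ)
  -3≉0 h = small≉0 3 (s≤s ℕ.z≤n) (ℕ.≤-trans (s≤s (s≤s (s≤s ℕ.z≤n))) 21≤m) (≈-neg h)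

  -- Linear consequences of x ≈ y, modulo p = 5m + 3 and M + 1 = m + e.
  ≈-linear : ∀ {M e x y T R} s r q → suc M ≡ m ℕ.+ e → x ≈ y →
    T - R ≡ s * (x - y) + r * (+ 3 + (+ m + (+ m + (+ m + (+ m + (+ m + 0ℤ)))))) + q * (1ℤ + + M - (+ m + + e)) → T ≈ R
  ≈-linear {M} {e} {y = y} {T} {R} s r q M+1 (mod t refl) eq = mod (s * t + r) (trans (lemma₁ T R) (trans (cong (λ z → R + z)
      (trans eq (trans (cong₂ (λ z w → s * (y + t * P - y) + r * z + q * (w - (+ m + + e))) (sym (cong +_ p≡)) (cong +_ M+1)) (lemma₂ s t r q y P (+ m + + e))))) refl))
    where
    lemma₁ : ∀ T R → T ≡ R + (T - R)
    lemma₁ = solve-∀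
    lemma₂ : ∀ s t r q y P w → s * (y + t * P - y) + r * P + q * (w - w) ≡ (s * t + r) * P
    lemma₂ = solve-∀

  -- e counts the hyperplanes in excess of m and j numbers the surviving value of γ. Together with
  -- the sign they fix c, since γ is c - M or -3(c + M).
  record Trimmed (σ : Sign) {d : ℕ} (A : V (suc d) → Bool) (c : ℤ) (M e j : ℕ) : Set where
    field
      free : SumFreeV σ A
      outside : ∀ i u → M ℕ.< i → i ℕ.< p → fibre σ A (c + + i) u ≡ false
      in₀ : Inhabited σ A (fibre σ A (c + 0ℤ))
      in-M : Inhabited σ A (fibre σ A (c + + M))
      big : m ℕ.* size (V d) ℕ.≤ ∑< (suc M) (λ i → ∣ fibre σ A (c + + i) ∣)
      M+1 : suc M ≡ m ℕ.+ e
      γ≈ : Γ σ c (+ M) ≈ + m + + j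

  everything : ∀ {d} (X : V d → Bool) → size (V d) ℕ.≤ ∣ X ∣ → ∀ v → X v ≡ true
  everything X h v = ⊆∧≥⇒⊇ X (λ _ → true) (λ _ _ → refl) h v refl

  1≤m : 1 ℕ.≤ m
  1≤m = ℕ.≤-trans (s≤s ℕ.z≤n) 21≤m
  3≤m : 3 ℕ.≤ m
  3≤m = ℕ.≤-trans (s≤s (s≤s (s≤s ℕ.z≤n))) 21≤m
  1+m<p : suc m ℕ.< p
  1+m<p = subst (suc m ℕ.<_) (sym p≡) (linarithⁿ 1 (λ m → ⊢ (lit 1 :+ m :< lit 3 :+ 5 :* m)) refl m)
  m<p : m ℕ.< p
  m<p = ℕ.<-trans (ℕ.n<1+n m) 1+m<p

  a₀-plus : ∀ z → 1ℤ * z ≈ - (+ m + (+ m + (+ m + 0ℤ)) + 1ℤ) → a₀ p 3 2 m ≡ [ z ]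
  a₀-plus z h = quotient (- + (3 ℕ.* m ℕ.+ 1)) 1ℤ z
    (trans (sym (-ᶠ≡negₚ _)) (trans (cong -ᶠ_ (⟦⟧≡[] (3 ℕ.* m ℕ.+ 1))) ([]-neg _))) (-ₚ-⟦⟧ (+ 3) 2 (⟦⟧≡[] 3)) (small≉0 1 (s≤s ℕ.z≤n) 1≤m) h

  a₀-minus : ∀ z → + 3 * z ≈ - (+ m + (+ m + (+ m + (+ m + 0ℤ))) + 1ℤ) → a₀ p 4 1 m ≡ [ z ]
  a₀-minus z h = quotient (- + (4 ℕ.* m ℕ.+ 1)) (+ 3) z
    (trans (sym (-ᶠ≡negₚ _)) (trans (cong -ᶠ_ (⟦⟧≡[] (4 ℕ.* m ℕ.+ 1))) ([]-neg _))) (-ₚ-⟦⟧ (+ 4) 1 (⟦⟧≡[] 4)) (small≉0 3 (s≤s ℕ.z≤n) 3≤m) h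

  -- s is the offset of the window of A inside the m + 1 hyperplanes of the extremal cuboid.
  trivial : ∀ {d} σ (A : V (suc d) → Bool) c M s → s ℕ.+ M ℕ.≤ m → (∀ i u → M ℕ.< i → i ℕ.< p → fibre σ A (c + + i) u ≡ false) →
    a₀ p (kᵒ σ) (ℓᵒ σ) m ≡ [ c - + s ] → Outcome σ A
  trivial σ A c M s s+M≤m outside a₀≡ = inj₁ (A , sub , Iso-≗ (λ _ → refl))
    where
    a = a₀ p (kᵒ σ) (ℓᵒ σ) m
    end : _+ₚ_ p a (⟦_⟧ p m) ≡ [ c - + s + + m ]
    end = +ₚ-⟦⟧ (c - + s) m a₀≡
    start : a ≡ [ c - + s + 0ℤ ]
    start = trans a₀≡ (cong [_] (sym (+-identityʳ _)))
    sub : ∀ x → A x ≡ true → A₀ p (kᵒ σ) (ℓᵒ σ) m x ≡ true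
    sub (x ∷ u) = by-positions c (λ x → A (x ∷ u) ≡ true → (interval p a (_+ₚ_ p a (⟦_⟧ p m)) x ∧ true) ≡ true) (λ i i<p → within i i<p (i ℕ.≤? M)) x
      where
      within : ∀ i → i ℕ.< p → Dec (i ℕ.≤ M) → A ([ c + + i ] ∷ u) ≡ true → (interval p a (_+ₚ_ p a (⟦_⟧ p m)) [ c + + i ] ∧ true) ≡ true
      within i i<p (no i≰M) h = ⊥-elim (true-false h (outside i u (ℕ.≰⇒> i≰M) i<p))
      within i i<p (yes i≤M) h = cong (_∧ true) (trans (cong₂ (λ a b → interval p a b [ c + + i ]) start end)
        (trans (cong (interval p [ c - + s + 0ℤ ] [ c - + s + + m ]) (cong [_] (lemma c (+ s) (+ i))))
          (interval-inside (c - + s) 0 (s ℕ.+ i) m ℕ.z≤n (ℕ.≤-trans (ℕ.+-monoʳ-≤ s i≤M) s+M≤m) m<p)))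
        where
        lemma : ∀ c s i → c + i ≡ c - s + (s + i)
        lemma = solve-∀

  module _ {d : ℕ} {A : V (suc d) → Bool} where

    -- The last hypothesis is a certificate: it writes the congruence for a₀ as a combination of γ ≡
    -- m + j, p = 5m + 3 and M + 1 = m + e. For numerals s, e, j it is a polynomial identity for the
    -- ring solver.
    trivial-plus : ∀ {c M e j} s → Trimmed plus A c M e j → s ℕ.+ M ℕ.≤ m →
      (∀ c M m → 1ℤ * (c - + s) - - (m + (m + (m + 0ℤ)) + 1ℤ) ≡ 1ℤ * (c - M - (m + + j)) + 1ℤ * (+ 3 + (m + (m + (m + (m + (m + 0ℤ)))))) + 1ℤ * (1ℤ + M - (m + + e))) →
      Outcome plus A
    trivial-plus {c} {M} s t s+M≤m eq = trivial plus A c M s s+M≤m outside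
      (a₀-plus (c - + s) (≈-linear 1ℤ 1ℤ 1ℤ M+1 γ≈ (eq c (+ M) (+ m))))
      where open Trimmed t

    trivial-minus : ∀ {c M e j} s → Trimmed minus A c M e j → s ℕ.+ M ℕ.≤ m →
      (∀ c M m → + 3 * (c - + s) - - (m + (m + (m + (m + 0ℤ))) + 1ℤ) ≡ - 1ℤ * (- (c + c + c) - (M + M + M) - (m + + j)) + 0ℤ * (+ 3 + (m + (m + (m + (m + (m + 0ℤ)))))) + - + 3 * (1ℤ + M - (m + + e))) →
      Outcome minus A
    trivial-minus {c} {M} s t s+M≤m eq = trivial minus A c M s s+M≤m outside
      (a₀-minus (c - + s) (≈-linear (- 1ℤ) 0ℤ (- + 3) M+1 γ≈ (eq c (+ M) (+ m))))
      where open Trimmed t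

    module _ {σ c M j} (t : Trimmed σ A c M 0 j) where
      open Trimmed t
      private
        m≡ : suc M ≡ m
        m≡ = trans M+1 (ℕ.+-identityʳ m)

      M≤m : M ℕ.≤ m
      M≤m = subst (M ℕ.≤_) m≡ (ℕ.n≤1+n M)

      1+M≤m : 1 ℕ.+ M ℕ.≤ m
      1+M≤m = ℕ.≤-reflexive m≡

      interval-type : ∀ x → A x ≡ _⊠ᵈ_ p (interval p [ c + 0ℤ ] (_+ₚ_ p [ c + 0ℤ ] (⟦_⟧ p (m ℕ.∸ 1)))) (full p) x
      interval-type = interval-shape c A m [ c + 0ℤ ] 1≤m (ℕ.<⇒≤ m<p) refl
        (λ i u i<m → everything (fibre σ A (c + + i)) (whole i i<m) u)
        (λ i u m≤i i<p → outside i u (subst (ℕ._≤ i) (sym m≡) m≤i) i<p)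
        where
        whole : ∀ i → i ℕ.< m → size (V d) ℕ.≤ ∣ fibre σ A (c + + i) ∣
        whole = all-full (size (V d)) (λ i → ∣ fibre σ A (c + + i) ∣) m (λ i _ → ∣∣≤size (fibre σ A (c + + i)))
          (subst (λ n → m ℕ.* size (V d) ℕ.≤ ∑< n (λ i → ∣ fibre σ A (c + + i) ∣)) m≡ big)

      type1-value : ∀ k ℓ → _-ₚ_ p (_*ₚ_ p (⟦_⟧ p ℓ) [ c + 0ℤ ]) (_*ₚ_ p (⟦_⟧ p k) (_+ₚ_ p [ c + 0ℤ ] (⟦_⟧ p (m ℕ.∸ 1)))) ≡ [ + ℓ * c - + k * (c + + M) ]
      type1-value k ℓ = begin
        _-ₚ_ p (_*ₚ_ p (⟦_⟧ p ℓ) [ c + 0ℤ ]) (_*ₚ_ p (⟦_⟧ p k) (_+ₚ_ p [ c + 0ℤ ] (⟦_⟧ p (m ℕ.∸ 1))))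
          ≡⟨ cong₂ (_-ₚ_ p) (times′ ℓ (cong [_] (+-identityʳ c))) (times′ k (trans (+ₚ-⟦⟧ c (m ℕ.∸ 1) (cong [_] (+-identityʳ c))) (cong (λ n → [ c + + n ]) (cong (ℕ._∸ 1) (sym m≡))))) ⟩
        _-ₚ_ p [ + ℓ * c ] [ + k * (c + + M) ]
          ≡⟨ trans (-ₚ≡-ᶠ _ _) (trans (cong ([ + ℓ * c ] +ᶠ_) ([]-neg _)) ([]-+ _ _)) ⟩
        [ + ℓ * c - + k * (c + + M) ] ∎
        where
        open ≡-Reasoning
        times′ : ∀ n {x z} → x ≡ [ z ] → _*ₚ_ p (⟦_⟧ p n) x ≡ [ + n * z ]
        times′ n {z = z} refl = trans (sym (*ᶠ≡*ₚ _ _)) (trans (cong (_*ᶠ [ z ]) (⟦⟧≡[] n)) ([]-* (+ n) z))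

    value-in : ∀ {x} a i b → a ℕ.≤ i → i ℕ.≤ b → b ℕ.≤ m → x ≡ [ + i ] → interval p (⟦_⟧ p a) (⟦_⟧ p b) x ≡ true
    value-in {x} a i b a≤i i≤b b≤m x≡ = trans (cong₂ (λ s t → interval p s t x) (shape a (⟦⟧≡[] a)) (shape b (⟦⟧≡[] b)))
      (trans (cong (interval p [ 0ℤ + + a ] [ 0ℤ + + b ]) (shape i x≡)) (interval-inside 0ℤ a i b a≤i i≤b (ℕ.≤-<-trans b≤m m<p)))
      where
      shape : ∀ n {y} → y ≡ [ + n ] → y ≡ [ 0ℤ + + n ]
      shape n h = h

    type1-plus : ∀ {c M j} i → 1 ℕ.≤ i → i ℕ.≤ 2 → Trimmed plus A c M 0 j →
      (∀ c M m → + 2 * c - + 3 * (c + M) - + i ≡ - 1ℤ * (c - M - (m + + j)) + - 1ℤ * (+ 3 + (m + (m + (m + (m + (m + 0ℤ)))))) + - + 4 * (1ℤ + M - (m + 0ℤ))) →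
      Outcome plus A
    type1-plus {c} {M} i 1≤i i≤2 t eq = inj₂ (inj₁ (inj₁ ([ c + 0ℤ ] , inj₁ (value-in 1 i 2 1≤i i≤2 (ℕ.≤-trans (s≤s (s≤s ℕ.z≤n)) 3≤m)
        (trans (type1-value t 3 2) ([]-cong (≈-linear (- 1ℤ) (- 1ℤ) (- + 4) M+1 γ≈ (eq c (+ M) (+ m)))))) , Iso-≗ (interval-type t))))
      where open Trimmed t

    type1-minus-value : ∀ {c M j} i → Trimmed minus A c M 0 j →
      (∀ c M m → + 1 * c - + 4 * (c + M) - + i ≡ 1ℤ * (- (c + c + c) - (M + M + M) - (m + + j)) + 0ℤ * (+ 3 + (m + (m + (m + (m + (m + 0ℤ)))))) + - 1ℤ * (1ℤ + M - (m + 0ℤ))) →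
      [ + 1 * c - + 4 * (c + + M) ] ≡ [ + i ]
    type1-minus-value {c} {M} i t eq = []-cong (≈-linear 1ℤ 0ℤ (- 1ℤ) M+1 γ≈ (eq c (+ M) (+ m)))
      where open Trimmed t

    type1-minus₁ : ∀ {c M} → Trimmed minus A c M 0 0 → Outcome minus A
    type1-minus₁ {c} {M} t = inj₂ (inj₁ (inj₁ ([ c + 0ℤ ] , inj₁ (value-in 1 1 1 ℕ.≤-refl ℕ.≤-refl 1≤m
        (trans (type1-value t 4 1) (type1-minus-value 1 t lemma))) , Iso-≗ (interval-type t))))
      where
      lemma : ∀ c M m → + 1 * c - + 4 * (c + M) - + 1 ≡ 1ℤ * (- (c + c + c) - (M + M + M) - (m + + 0)) + 0ℤ * (+ 3 + (m + (m + (m + (m + (m + 0ℤ)))))) + - 1ℤ * (1ℤ + M - (m + 0ℤ))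
      lemma = solve-∀

    type1-minus₄ : ∀ {c M} → Trimmed minus A c M 0 3 → Outcome minus A
    type1-minus₄ {c} {M} t = inj₂ (inj₁ (inj₁ ([ c + 0ℤ ] , inj₂ (ℕ.≤-refl , value-in 4 4 4 ℕ.≤-refl ℕ.≤-refl 4≤m
        (trans (type1-value t 4 1) (type1-minus-value 4 t lemma))) , Iso-≗ (interval-type t))))
      where
      4≤m : 4 ℕ.≤ m
      4≤m = ℕ.≤-trans (s≤s (s≤s (s≤s (s≤s ℕ.z≤n)))) 21≤m
      lemma : ∀ c M m → + 1 * c - + 4 * (c + M) - + 4 ≡ 1ℤ * (- (c + c + c) - (M + M + M) - (m + + 3)) + 0ℤ * (+ 3 + (m + (m + (m + (m + (m + 0ℤ)))))) + - 1ℤ * (1ℤ + M - (m + 0ℤ))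
      lemma = solve-∀

  -- A tail shear by v/y moves the fibre over the multiple t·y by tv, so a shear is prescribed by
  -- its effect over the single position y.
  scalar-ratio : ∀ {d} y b z t (v : V d) → [ y ] *ᶠ b ≡ 1ᶠ → z ≈ t * y → scalar [ z ] (scalar b v) ≡ scalar [ t ] v
  scalar-ratio y b z t v e h = trans (·-· [ z ] b v) (cong (λ a → scalar a v) (trans (cong (_*ᶠ b) (trans ([]-cong h) (sym ([]-* t y))))
    (trans (*ᶠ-assoc [ t ] [ y ] b) (trans (cong ([ t ] *ᶠ_) e) (trans (*ᶠ-comm [ t ] 1ᶠ) (*ᶠ-identityˡ [ t ]))))))

  proper⇒positive-dimension : ∀ {d} (W : V d → Bool) → W (0v p) ≡ true → (∃ λ x → W x ≡ false) → 1 ℕ.≤ d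
  proper⇒positive-dimension {zero} W h ([] , k) = ⊥-elim (true-false h k)
  proper⇒positive-dimension {suc d} W h k = s≤s ℕ.z≤n

  module _ {σ : Sign} {d : ℕ} {A : V (suc d) → Bool} {c : ℤ} {M e j : ℕ} (t : Trimmed σ A c M e j) where
    open Trimmed t

    pairs : ∀ i y → + i + 0ℤ + Γ σ c (+ M) ≈ + y → ∣ fibre σ A (c + + i) ∣ ℕ.+ ∣ fibre σ A (c + + y) ∣ ℕ.≤ size (V d)
    pairs i y h = pair-≤ σ A free c M in₀ in-M 0 i y ℕ.z≤n h

  module _ {σ : Sign} {d : ℕ} {A : V (suc d) → Bool} {c : ℤ} (t : Trimmed σ A c m 1 0) where
    open Trimmed t
    private
      B : ℕ → V d → Bool
      B i = fibre σ A (c + + i)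

    one-pair : (size (V d) ℕ.≤ ∣ B 0 ∣ ℕ.+ ∣ B m ∣) × (∀ i → 0 ℕ.< i → i ℕ.< m → size (V d) ℕ.≤ ∣ B i ∣)
    one-pair = full-but-ends (size (V d)) (λ i → ∣ B i ∣) (λ i → ∣∣≤size (B i)) m 1≤m big
      (pairs t 0 m (≈-trans (≈-+ (≈-refl {0ℤ + 0ℤ}) γ≈) (≈-by (lemma (+ m)))))
      where
      lemma : ∀ m → 0ℤ + 0ℤ + (m + 0ℤ) ≡ m
      lemma = solve-∀

  -- Here 3c ≡ 2(c + m), so three vectors over one end and two over the other are related by
  -- sum-freeness, and the two end fibres would be complementary cosets of the excluded kind.
  impossible : ∀ {d} {A : V (suc d) → Bool} {c} → Trimmed plus A c m 1 0 → ⊥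
  impossible {d} {A} {c} t = no-complementary-cosets (small≉0 2 (s≤s ℕ.z≤n) (ℕ.≤-trans (s≤s (s≤s ℕ.z≤n)) 21≤m))
      (fibre plus A (c + 0ℤ)) (fibre plus A (c + + m)) (proj₁ in₀) (proj₁ in-M) (proj₂ in₀) (proj₂ in-M)
      (λ {a} {b} {f} ha hb hf → fibres-complementary plus A free (c + 0ℤ) (c + 0ℤ) (c + 0ℤ) (c + + m) (c + + m) relation (proj₁ (one-pair t)) {a} {b} {f} ha hb hf)
    where
    open Trimmed t
    relation : c + 0ℤ + (c + 0ℤ + (c + 0ℤ)) ≈ c + + m + (c + + m)
    relation = ≈-linear {m} {1} 1ℤ 0ℤ (- 1ℤ) M+1 γ≈ (lemma c (+ m))
      where
      lemma : ∀ c m → c + 0ℤ + (c + 0ℤ + (c + 0ℤ)) - (c + m + (c + m)) ≡ 1ℤ * (c - m - (m + 0ℤ)) + 0ℤ * (+ 3 + (m + (m + (m + (m + (m + 0ℤ)))))) + - 1ℤ * (1ℤ + m - (m + 1ℤ))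
      lemma = solve-∀

  module _ {d : ℕ} {A : V (suc d) → Bool} {c : ℤ} (t : Trimmed minus A c m 1 0) where
    open Trimmed t
    private
      B₀ = fibre minus A (c + 0ℤ)
      Bₘ = fibre minus A (c + + m)
      v = proj₁ in-M
      hv = proj₂ in-M

      -- That is c ≡ 4(c + m): one vector over the first hyperplane against four over the last. It
      -- makes Bₘ a coset v + W and B₀ the complement of 4v + W.
      relation : c + 0ℤ + - (c + + m + (c + + m)) ≈ c + + m + (c + + m)
      relation = ≈-linear {m} {1} 1ℤ 0ℤ (- 1ℤ) M+1 γ≈ (lemma c (+ m))
        where
        lemma : ∀ c m → c + 0ℤ + - (c + m + (c + m)) - (c + m + (c + m)) ≡ 1ℤ * (- (c + c + c) - (m + m + m) - (m + 0ℤ)) + 0ℤ * (+ 3 + (m + (m + (m + (m + (m + 0ℤ)))))) + - 1ℤ * (1ℤ + m - (m + 1ℤ))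
        lemma = solve-∀

      R : ∀ {a b f} → Bₘ a ≡ true → Bₘ b ≡ true → Bₘ f ≡ true → ∀ y → Bₘ y ≡ not (B₀ (y ⊟ (⊝ (a ⊞ b) ⊟ f)))
      R = fibres-complementary minus A free (c + 0ℤ) (c + + m) (c + + m) (c + + m) (c + + m) relation (proj₁ (one-pair t))

      periods : ∀ x → Bₘ (v ⊞ x) ≡ true → Period Bₘ x
      periods x h = subst (Period Bₘ) (solve 2 (λ a x → ⊖ (a ⊹ a) ⊹ ⊖ a ⊹ ⊖ (⊖ (a ⊹ a) ⊹ ⊖ (a ⊹ x)) := x) refl v x)
        (complement-period {X = B₀} (R hv hv hv) (R hv hv h))

      W : V d → Bool
      W = coset Bₘ v hv periods

      four : V d
      four = v ⊞ v ⊞ v ⊞ v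

      at₀ : ∀ u → B₀ u ≡ not (W (u ⊟ four))
      at₀ u = trans (sym (not-involutive _)) (cong not (sym (trans (R hv hv hv _)
        (cong (λ z → not (B₀ z)) (solve 2 (λ u v → v ⊹ (u ⊹ ⊖ (v ⊹ v ⊹ v ⊹ v)) ⊹ ⊖ (⊖ (v ⊹ v) ⊹ ⊖ v) := u) refl u v)))))

      atₘ : ∀ u → Bₘ u ≡ W (u ⊟ v)
      atₘ u = cong Bₘ (solve 2 (λ u v → u := v ⊹ (u ⊹ ⊖ v)) refl u v)

      outsideW : ∃ λ x → W x ≡ false
      outsideW = proj₁ in₀ ⊟ four , trans (sym (not-involutive _)) (cong not (trans (sym (at₀ _)) (proj₂ in₀)))

      -- γ = -3(c + m) is congruent to m, which is not 0 modulo p.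
      end≉0 : ¬ (c + + m ≈ 0ℤ)
      end≉0 h = small≉0 m 1≤m ℕ.≤-refl (≈-trans (≈-by (sym (+-identityʳ (+ m)))) (≈-trans (≈-sym γ≈) (≈-trans (≈-by (lemma c (+ m))) (≈-trans (≈-* (≈-refl { - + 3}) h) (≈-by refl)))))
        where
        lemma : ∀ c m → - (c + c + c) - (m + m + m) ≡ - + 3 * (c + m)
        lemma = solve-∀

      b = proj₁ (inverse [ c + + m ] (λ e → end≉0 ([]-injective e)))
      hb = proj₂ (inverse [ c + + m ] (λ e → end≉0 ([]-injective e)))
      -- The shear subtracts v over c + m, hence 4v over c ≡ 4(c + m), which moves both end fibres
      -- to W and its complement.
      w₀ = scalar b (⊝ v)

      shear₀ : ∀ u → u ⊞ scalar [ c + 0ℤ ] w₀ ≡ u ⊟ four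
      shear₀ u = trans (cong (u ⊞_) (trans (scalar-ratio (c + + m) b (c + 0ℤ) (+ 4) (⊝ v) hb ratio) (·≡⊠ [ + 4 ] (⊝ v))))
          (solve 2 (λ u v → u ⊹ con (+ 4) ⊗ ⊖ v := u ⊹ ⊖ (v ⊹ v ⊹ v ⊹ v)) refl u v)
        where
        ratio : c + 0ℤ ≈ + 4 * (c + + m)
        ratio = ≈-linear {m} {1} 1ℤ 0ℤ (- 1ℤ) M+1 γ≈ (lemma c (+ m))
          where
          lemma : ∀ c m → c + 0ℤ - + 4 * (c + m) ≡ 1ℤ * (- (c + c + c) - (m + m + m) - (m + 0ℤ)) + 0ℤ * (+ 3 + (m + (m + (m + (m + (m + 0ℤ)))))) + - 1ℤ * (1ℤ + m - (m + 1ℤ))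
          lemma = solve-∀

      shearₘ : ∀ u → u ⊞ scalar [ c + + m ] w₀ ≡ u ⊟ v
      shearₘ u = cong (u ⊞_) (trans (scalar-ratio (c + + m) b (c + + m) 1ℤ (⊝ v) hb (≈-by (sym (*-identityˡ (c + + m))))) (1·v (⊝ v)))

      a : F
      a = _*ₚ_ p (⟦_⟧ p (m ℕ.* 4)) (invₚ p (_-ₚ_ p (⟦_⟧ p 1) (⟦_⟧ p 4)))

      a≡ : a ≡ [ c + 0ℤ ]
      a≡ = quotient (+ m * + 4) (- + 3) (c + 0ℤ) (trans (⟦⟧≡[] (m ℕ.* 4)) (cong [_] (pos-* m 4))) (-ₚ-⟦⟧ (+ 1) 4 (⟦⟧≡[] 1)) -3≉0
          (≈-linear {m} {1} 1ℤ 0ℤ (+ 3) M+1 γ≈ (lemma c (+ m)))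
        where
        lemma : ∀ c m → - + 3 * (c + 0ℤ) - m * + 4 ≡ 1ℤ * (- (c + c + c) - (m + m + m) - (m + 0ℤ)) + 0ℤ * (+ 3 + (m + (m + (m + (m + (m + 0ℤ)))))) + + 3 * (1ℤ + m - (m + 1ℤ))
        lemma = solve-∀

      iso : ∀ x → A x ≡ type2Set p a m W (Aut.f (tail-shear w₀) x)
      iso (x ∷ u) = type2-shape c A (λ x u → u ⊞ scalar x w₀) m 3≤m a W m<p a≡
        (λ u → trans (at₀ u) (cong (λ z → not (W z)) (sym (shear₀ u))))
        (λ i u 0<i i<m → everything (fibre minus A (c + + i)) (proj₂ (one-pair t) i 0<i i<m) u)
        (λ u → trans (atₘ u) (cong W (sym (shearₘ u))))
        (λ i u m<i i<p → outside i u m<i i<p) x u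

    type2-outcome : Outcome minus A
    type2-outcome = inj₂ (inj₁ (inj₂ (refl , proper⇒positive-dimension W (coset-0 Bₘ v hv periods) outsideW , W ,
      (coset-0 Bₘ v hv periods , coset-⊕ Bₘ v hv periods , coset-· Bₘ v hv periods , outsideW) , tail-shear w₀ , iso)))

  module _ {σ : Sign} {d : ℕ} {A : V (suc d) → Bool} {c : ℤ} (t : Trimmed σ A c (suc m) 2 0) where
    open Trimmed t
    private
      B : ℕ → V d → Bool
      B i = fibre σ A (c + + i)

    two-pairs : (size (V d) ℕ.≤ ∣ B 0 ∣ ℕ.+ ∣ B m ∣) × (size (V d) ℕ.≤ ∣ B 1 ∣ ℕ.+ ∣ B (suc m) ∣) × (∀ i → 1 ℕ.< i → i ℕ.< m → size (V d) ℕ.≤ ∣ B i ∣)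
    two-pairs = full-but-two-ends (size (V d)) (λ i → ∣ B i ∣) (λ i → ∣∣≤size (B i)) m (ℕ.≤-trans (s≤s (s≤s ℕ.z≤n)) 21≤m) big
      (pairs t 0 m (≈-trans (≈-+ (≈-refl {0ℤ + 0ℤ}) γ≈) (≈-by (lemma₀ (+ m)))))
      (pairs t 1 (suc m) (≈-trans (≈-+ (≈-refl {1ℤ + 0ℤ}) γ≈) (≈-by (lemma₁ (+ m)))))
      where
      lemma₀ : ∀ m → 0ℤ + 0ℤ + (m + 0ℤ) ≡ m
      lemma₀ = solve-∀
      lemma₁ : ∀ m → 1ℤ + 0ℤ + (m + 0ℤ) ≡ 1ℤ + m
      lemma₁ = solve-∀

  ≈-cancel : ∀ u {x y} → ¬ (u ≈ 0ℤ) → u * x ≈ u * y → x ≈ y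
  ≈-cancel u {x} {y} u≉0 h = []-injective (*ᶠ-cancelˡ [ u ] (λ e → u≉0 ([]-injective e)) (trans ([]-* u x) (trans ([]-cong h) (sym ([]-* u y)))))

  -- Both signs lead to c ≡ 2m + 1: directly for `plus`, and for `minus` from 3c ≡ -4m - 3 ≡ 3(2m +
  -- 1). This is why type 4 does not depend on k and ℓ.
  origin : ∀ σ c → Γ σ c (1ℤ + + m) ≈ + m + 0ℤ → c ≈ + m + (+ m + 0ℤ) + 1ℤ
  origin plus c h = ≈-linear {suc m} {2} 1ℤ 0ℤ 0ℤ (ℕ.+-comm 2 m) h (lemma c (+ m))
    where
    lemma : ∀ c m → c - (m + (m + 0ℤ) + 1ℤ) ≡ 1ℤ * (c - (1ℤ + m) - (m + 0ℤ)) + 0ℤ * (+ 3 + (m + (m + (m + (m + (m + 0ℤ)))))) + 0ℤ * (1ℤ + (1ℤ + m) - (m + + 2))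
    lemma = solve-∀
  origin minus c h = ≈-cancel (+ 3) (small≉0 3 (s≤s ℕ.z≤n) 3≤m) (≈-linear {suc m} {2} (- 1ℤ) (- + 2) 0ℤ (ℕ.+-comm 2 m) h (lemma c (+ m)))
    where
    lemma : ∀ c m → + 3 * c - + 3 * (m + (m + 0ℤ) + 1ℤ) ≡ - 1ℤ * (- (c + c + c) - (1ℤ + m + (1ℤ + m) + (1ℤ + m)) - (m + 0ℤ)) + - + 2 * (+ 3 + (m + (m + (m + (m + (m + 0ℤ)))))) + 0ℤ * (1ℤ + (1ℤ + m) - (m + + 2))
    lemma = solve-∀

  ≈-origin : ∀ {c T R} s r → c ≈ + m + (+ m + 0ℤ) + 1ℤ →
    T - R ≡ s * (c - (+ m + (+ m + 0ℤ) + 1ℤ)) + r * (+ 3 + (+ m + (+ m + (+ m + (+ m + (+ m + 0ℤ)))))) → T ≈ R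
  ≈-origin {c} s r h eq = ≈-linear {suc m} {2} s r 0ℤ (ℕ.+-comm 2 m) h (trans eq (sym (lemma _ (1ℤ + + suc m - (+ m + + 2)))))
    where
    lemma : ∀ x y → x + 0ℤ * y ≡ x
    lemma = solve-∀

  type3-centre : ∀ σ c → c ≈ + m + (+ m + 0ℤ) + 1ℤ →
    _*ₚ_ p (⟦_⟧ p (ℓᵒ σ ℕ.* m ℕ.+ kᵒ σ ℕ.∸ 1)) (invₚ p (_-ₚ_ p (⟦_⟧ p (kᵒ σ)) (⟦_⟧ p (ℓᵒ σ)))) ≡ [ c + 1ℤ ]
  type3-centre plus c h = quotient (+ (2 ℕ.* m ℕ.+ 2)) 1ℤ (c + 1ℤ)
    (trans (cong (⟦_⟧ p) (ℕ.+-∸-assoc (2 ℕ.* m) {3} {1} (s≤s ℕ.z≤n))) (⟦⟧≡[] _)) (-ₚ-⟦⟧ (+ 3) 2 (⟦⟧≡[] 3)) (small≉0 1 (s≤s ℕ.z≤n) 1≤m)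
    (≈-origin 1ℤ 0ℤ h (lemma c (+ m)))
    where
    lemma : ∀ c m → 1ℤ * (c + 1ℤ) - (m + (m + 0ℤ) + + 2) ≡ 1ℤ * (c - (m + (m + 0ℤ) + 1ℤ)) + 0ℤ * (+ 3 + (m + (m + (m + (m + (m + 0ℤ))))))
    lemma = solve-∀
  type3-centre minus c h = quotient (+ (1 ℕ.* m ℕ.+ 3)) (+ 3) (c + 1ℤ)
    (trans (cong (⟦_⟧ p) (ℕ.+-∸-assoc (1 ℕ.* m) {4} {1} (s≤s ℕ.z≤n))) (⟦⟧≡[] _)) (-ₚ-⟦⟧ (+ 4) 1 (⟦⟧≡[] 4)) (small≉0 3 (s≤s ℕ.z≤n) 3≤m)
    (≈-origin (+ 3) 1ℤ h (lemma c (+ m)))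
    where
    lemma : ∀ c m → + 3 * (c + 1ℤ) - (m + 0ℤ + + 3) ≡ + 3 * (c - (m + (m + 0ℤ) + 1ℤ)) + 1ℤ * (+ 3 + (m + (m + (m + (m + (m + 0ℤ))))))
    lemma = solve-∀

  module _ {d : ℕ} {A : V (suc d) → Bool} {c : ℤ} where

    -- For c ≡ 2m + 1 the relations are 3c ≡ (c + m) + (c + m + 1), 3(c + m + 1) ≡ (c + 1) + c and
    -- (c + 1) + 2c ≡ 2(c + m + 1); each links the two fibres of one tight pair, with the other
    -- summands at the ends.
    four-plus : (t : Trimmed plus A c (suc m) 2 0) → let open Trimmed t in
      FourFibres.Structured (fibre plus A (c + 0ℤ)) (fibre plus A (c + 1ℤ)) (fibre plus A (c + + m)) (fibre plus A (c + + suc m)) (proj₁ in₀) (proj₁ in-M) (proj₂ in₀) (proj₂ in-M)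
    four-plus t = FourFibres.structured-plus B₀ B₁ Bₘ B₁₊ₘ (proj₁ in₀) (proj₁ in-M) (proj₂ in₀) (proj₂ in-M) R₁ R₂ R₃
      where
      open Trimmed t
      B₀ = fibre plus A (c + 0ℤ)
      B₁ = fibre plus A (c + 1ℤ)
      Bₘ = fibre plus A (c + + m)
      B₁₊ₘ = fibre plus A (c + + suc m)
      c≈ = origin plus c γ≈
      ends = two-pairs t
      R₁ : ∀ {a b f} → B₀ a ≡ true → B₀ b ≡ true → B₁₊ₘ f ≡ true → ∀ y → Bₘ y ≡ not (B₀ (y ⊟ (a ⊞ b ⊟ f)))
      R₁ = fibres-complementary plus A free (c + 0ℤ) (c + 0ℤ) (c + 0ℤ) (c + + m) (c + + suc m) (≈-origin 1ℤ 0ℤ c≈ (lemma c (+ m))) (proj₁ ends)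
        where
        lemma : ∀ c m → c + 0ℤ + (c + 0ℤ + (c + 0ℤ)) - (c + m + (c + (1ℤ + m))) ≡ 1ℤ * (c - (m + (m + 0ℤ) + 1ℤ)) + 0ℤ * (+ 3 + (m + (m + (m + (m + (m + 0ℤ))))))
        lemma = solve-∀
      R₂ : ∀ {a b f} → B₁₊ₘ a ≡ true → B₁₊ₘ b ≡ true → B₀ f ≡ true → ∀ y → B₁ y ≡ not (B₁₊ₘ (y ⊟ (a ⊞ b ⊟ f)))
      R₂ = fibres-complementary plus A free (c + + suc m) (c + + suc m) (c + + suc m) (c + 1ℤ) (c + 0ℤ) (≈-origin 1ℤ 1ℤ c≈ (lemma c (+ m)))
          (subst (size (V d) ℕ.≤_) (ℕ.+-comm ∣ B₁ ∣ ∣ B₁₊ₘ ∣) (proj₁ (proj₂ ends)))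
        where
        lemma : ∀ c m → c + (1ℤ + m) + (c + (1ℤ + m) + (c + (1ℤ + m))) - (c + 1ℤ + (c + 0ℤ)) ≡ 1ℤ * (c - (m + (m + 0ℤ) + 1ℤ)) + 1ℤ * (+ 3 + (m + (m + (m + (m + (m + 0ℤ))))))
        lemma = solve-∀
      R₃ : ∀ {a b f} → B₀ a ≡ true → B₀ b ≡ true → B₁₊ₘ f ≡ true → ∀ y → B₁₊ₘ y ≡ not (B₁ (y ⊟ (a ⊞ b ⊟ f)))
      R₃ = fibres-complementary plus A free (c + 1ℤ) (c + 0ℤ) (c + 0ℤ) (c + + suc m) (c + + suc m) (≈-origin 1ℤ 0ℤ c≈ (lemma c (+ m))) (proj₁ (proj₂ ends))
        where
        lemma : ∀ c m → c + 1ℤ + (c + 0ℤ + (c + 0ℤ)) - (c + (1ℤ + m) + (c + (1ℤ + m))) ≡ 1ℤ * (c - (m + (m + 0ℤ) + 1ℤ)) + 0ℤ * (+ 3 + (m + (m + (m + (m + (m + 0ℤ))))))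
        lemma = solve-∀

    -- The underlying congruences are c + m ≡ 4c and c + 1 ≡ 4(c + m + 1). Each tight pair enters
    -- twice, once with the three auxiliary summands at c and once with them at c + m + 1.
    four-minus : (t : Trimmed minus A c (suc m) 2 0) → let open Trimmed t in
      FourFibres.Structured (fibre minus A (c + 0ℤ)) (fibre minus A (c + 1ℤ)) (fibre minus A (c + + m)) (fibre minus A (c + + suc m)) (proj₁ in₀) (proj₁ in-M) (proj₂ in₀) (proj₂ in-M)
    four-minus t = FourFibres.structured-minus B₀ B₁ Bₘ B₁₊ₘ (proj₁ in₀) (proj₁ in-M) (proj₂ in₀) (proj₂ in-M) (small≉0 3 (s≤s ℕ.z≤n) 3≤m) R₁ R₂ R₃ R₄
      where
      open Trimmed t
      B₀ = fibre minus A (c + 0ℤ)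
      B₁ = fibre minus A (c + 1ℤ)
      Bₘ = fibre minus A (c + + m)
      B₁₊ₘ = fibre minus A (c + + suc m)
      c≈ = origin minus c γ≈
      ends = two-pairs t
      R₁ : ∀ {a b f} → B₀ a ≡ true → B₀ b ≡ true → B₀ f ≡ true → ∀ y → B₀ y ≡ not (Bₘ (y ⊟ (⊝ (a ⊞ b) ⊟ f)))
      R₁ = fibres-complementary minus A free (c + + m) (c + 0ℤ) (c + 0ℤ) (c + 0ℤ) (c + 0ℤ) (≈-origin (- + 3) (- 1ℤ) c≈ (lemma c (+ m)))
          (subst (size (V d) ℕ.≤_) (ℕ.+-comm ∣ B₀ ∣ ∣ Bₘ ∣) (proj₁ ends))
        where
        lemma : ∀ c m → c + m + - (c + 0ℤ + (c + 0ℤ)) - (c + 0ℤ + (c + 0ℤ)) ≡ - + 3 * (c - (m + (m + 0ℤ) + 1ℤ)) + - 1ℤ * (+ 3 + (m + (m + (m + (m + (m + 0ℤ))))))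
        lemma = solve-∀
      R₂ : ∀ {a b f} → B₁₊ₘ a ≡ true → B₁₊ₘ b ≡ true → B₁₊ₘ f ≡ true → ∀ y → B₁₊ₘ y ≡ not (B₁ (y ⊟ (⊝ (a ⊞ b) ⊟ f)))
      R₂ = fibres-complementary minus A free (c + 1ℤ) (c + + suc m) (c + + suc m) (c + + suc m) (c + + suc m) (≈-origin (- + 3) (- + 2) c≈ (lemma c (+ m))) (proj₁ (proj₂ ends))
        where
        lemma : ∀ c m → c + 1ℤ + - (c + (1ℤ + m) + (c + (1ℤ + m))) - (c + (1ℤ + m) + (c + (1ℤ + m))) ≡ - + 3 * (c - (m + (m + 0ℤ) + 1ℤ)) + - + 2 * (+ 3 + (m + (m + (m + (m + (m + 0ℤ))))))
        lemma = solve-∀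
      R₃ : ∀ {a b f} → B₀ a ≡ true → B₀ b ≡ true → B₀ f ≡ true → ∀ y → B₁ y ≡ not (B₁₊ₘ (y ⊟ (⊝ (a ⊞ b) ⊟ f)))
      R₃ = fibres-complementary minus A free (c + + suc m) (c + 0ℤ) (c + 0ℤ) (c + 1ℤ) (c + 0ℤ) (≈-origin (- + 3) (- 1ℤ) c≈ (lemma c (+ m)))
          (subst (size (V d) ℕ.≤_) (ℕ.+-comm ∣ B₁ ∣ ∣ B₁₊ₘ ∣) (proj₁ (proj₂ ends)))
        where
        lemma : ∀ c m → c + (1ℤ + m) + - (c + 0ℤ + (c + 0ℤ)) - (c + 1ℤ + (c + 0ℤ)) ≡ - + 3 * (c - (m + (m + 0ℤ) + 1ℤ)) + - 1ℤ * (+ 3 + (m + (m + (m + (m + (m + 0ℤ))))))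
        lemma = solve-∀
      R₄ : ∀ {a b f} → B₁₊ₘ a ≡ true → B₁₊ₘ b ≡ true → B₁₊ₘ f ≡ true → ∀ y → Bₘ y ≡ not (B₀ (y ⊟ (⊝ (a ⊞ b) ⊟ f)))
      R₄ = fibres-complementary minus A free (c + 0ℤ) (c + + suc m) (c + + suc m) (c + + m) (c + + suc m) (≈-origin (- + 3) (- + 2) c≈ (lemma c (+ m))) (proj₁ ends)
        where
        lemma : ∀ c m → c + 0ℤ + - (c + (1ℤ + m) + (c + (1ℤ + m))) - (c + m + (c + (1ℤ + m))) ≡ - + 3 * (c - (m + (m + 0ℤ) + 1ℤ)) + - + 2 * (+ 3 + (m + (m + (m + (m + (m + 0ℤ))))))
        lemma = solve-∀

  four-fibres : ∀ σ {d} {A : V (suc d) → Bool} {c} (t : Trimmed σ A c (suc m) 2 0) → let open Trimmed t in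
    FourFibres.Structured (fibre σ A (c + 0ℤ)) (fibre σ A (c + 1ℤ)) (fibre σ A (c + + m)) (fibre σ A (c + + suc m)) (proj₁ in₀) (proj₁ in-M) (proj₂ in₀) (proj₂ in-M)
  four-fibres plus t = four-plus t
  four-fibres minus t = four-minus t

  module _ (σ : Sign) {d : ℕ} (A : V (suc d) → Bool) (c : ℤ) (c≈ : c ≈ + m + (+ m + 0ℤ) + 1ℤ)
    (inside : ∀ i u → 1 ℕ.< i → i ℕ.< m → A ([ c + + i ] ∷ u) ≡ true)
    (outside : ∀ i u → suc m ℕ.< i → i ℕ.< p → A ([ c + + i ] ∷ u) ≡ false)
    (v w : V d) (hv : A ([ c + 0ℤ ] ∷ v) ≡ true) (hw : A ([ c + + suc m ] ∷ w) ≡ true)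
    (S : FourFibres.Structured (fibre σ A (c + 0ℤ)) (fibre σ A (c + 1ℤ)) (fibre σ A (c + + m)) (fibre σ A (c + + suc m)) v w hv hw) where
    open FourFibres.Structured S
    private
      B₀ : V d → Bool
      B₀ = fibre σ A (c + 0ℤ)

      W : V d → Bool
      W = coset B₀ v hv periods

      four : V d
      four = v ⊞ v ⊞ v ⊞ v

      at₀ : ∀ u → B₀ u ≡ W (u ⊟ v)
      at₀ u = cong B₀ (solve 2 (λ u v → u := v ⊹ (u ⊹ ⊖ v)) refl u v)

      -- c ≡ 2m + 1, and 5(2m + 1) - 2p = -1, so c ≡ 0 would give 1 ≡ 0.
      c≉0 : ¬ (c ≈ 0ℤ)
      c≉0 h = small≉0 1 (s≤s ℕ.z≤n) 1≤m (≈-linear {suc m} {2} (+ 5) (+ 2) 0ℤ (ℕ.+-comm 2 m) (≈-trans (≈-sym h) c≈) (lemma (+ m)))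
        where
        lemma : ∀ m → 1ℤ - 0ℤ ≡ + 5 * (0ℤ - (m + (m + 0ℤ) + 1ℤ)) + + 2 * (+ 3 + (m + (m + (m + (m + (m + 0ℤ)))))) + 0ℤ * (1ℤ + (1ℤ + m) - (m + + 2))
        lemma = solve-∀

      b = proj₁ (inverse [ c ] (λ e → c≉0 ([]-injective e)))
      hb = proj₂ (inverse [ c ] (λ e → c≉0 ([]-injective e)))
      w₀ = scalar b (⊝ v)

      -- The positions c, c + m + 1, c + m, c + 1 are the multiples 1, -1, 4, -4 of c modulo p, in
      -- step with the translations in `Structured`.
      shear : ∀ z n → z ≈ n * c → ∀ u → u ⊞ scalar [ z ] w₀ ≡ u ⊞ constᵛ n ⊠ (⊝ v)
      shear z n h u = cong (u ⊞_) (trans (scalar-ratio c b z n (⊝ v) hb h) (·≡⊠ [ n ] (⊝ v)))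

      shear₀ : ∀ u → u ⊞ scalar [ c + 0ℤ ] w₀ ≡ u ⊟ v
      shear₀ u = trans (shear (c + 0ℤ) 1ℤ (≈-by (lemma c)) u) (solve 2 (λ u v → u ⊹ con 1ℤ ⊗ ⊖ v := u ⊹ ⊖ v) refl u v)
        where
        lemma : ∀ c → c + 0ℤ ≡ 1ℤ * c
        lemma = solve-∀
      shear₁₊ₘ : ∀ u → u ⊞ scalar [ c + + suc m ] w₀ ≡ u ⊞ v
      shear₁₊ₘ u = trans (shear (c + + suc m) (- 1ℤ) (≈-origin (+ 2) 1ℤ c≈ (lemma c (+ m))) u) (solve 2 (λ u v → u ⊹ con (- 1ℤ) ⊗ ⊖ v := u ⊹ v) refl u v)
        where
        lemma : ∀ c m → c + (1ℤ + m) - - 1ℤ * c ≡ + 2 * (c - (m + (m + 0ℤ) + 1ℤ)) + 1ℤ * (+ 3 + (m + (m + (m + (m + (m + 0ℤ))))))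
        lemma = solve-∀
      shearₘ : ∀ u → u ⊞ scalar [ c + + m ] w₀ ≡ u ⊟ four
      shearₘ u = trans (shear (c + + m) (+ 4) (≈-origin (- + 3) (- 1ℤ) c≈ (lemma c (+ m))) u) (solve 2 (λ u v → u ⊹ con (+ 4) ⊗ ⊖ v := u ⊹ ⊖ (v ⊹ v ⊹ v ⊹ v)) refl u v)
        where
        lemma : ∀ c m → c + m - + 4 * c ≡ - + 3 * (c - (m + (m + 0ℤ) + 1ℤ)) + - 1ℤ * (+ 3 + (m + (m + (m + (m + (m + 0ℤ))))))
        lemma = solve-∀
      shear₁ : ∀ u → u ⊞ scalar [ c + 1ℤ ] w₀ ≡ u ⊞ four
      shear₁ u = trans (shear (c + 1ℤ) (- + 4) (≈-origin (+ 5) (+ 2) c≈ (lemma c (+ m))) u) (solve 2 (λ u v → u ⊹ con (- + 4) ⊗ ⊖ v := u ⊹ (v ⊹ v ⊹ v ⊹ v)) refl u v)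
        where
        lemma : ∀ c m → c + 1ℤ - - + 4 * c ≡ + 5 * (c - (m + (m + 0ℤ) + 1ℤ)) + + 2 * (+ 3 + (m + (m + (m + (m + (m + 0ℤ))))))
        lemma = solve-∀

      iso : ∀ x → A x ≡ type4Set p m W (Aut.f (tail-shear w₀) x)
      iso (x ∷ u) = type4-shape c A (λ x u → u ⊞ scalar x w₀) m 3≤m 1+m<p inside outside W c≈
        (λ u → trans (at₀ u) (cong W (sym (shear₀ u)))) (λ u → trans (at₃ u) (cong W (sym (shear₁₊ₘ u))))
        (λ u → trans (at₁ u) (cong (λ z → not (W z)) (sym (shear₁ u)))) (λ u → trans (at₂ u) (cong (λ z → not (W z)) (sym (shearₘ u)))) x u

      -- Type 3 is the degenerate case of type 4 in which W is the whole space: the outer fibres are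
      -- full and the two next to them empty.
      by : (∃ λ x → not (W x) ≡ true) ⊎ (∀ x → not (W x) ≡ false) → Outcome σ A
      by (inj₁ (x , h)) = inj₂ (inj₂ (inj₂ (proper⇒positive-dimension W (coset-0 B₀ v hv periods) (x , h′) , W ,
          (coset-0 B₀ v hv periods , coset-⊕ B₀ v hv periods , coset-· B₀ v hv periods , x , h′) , tail-shear w₀ , iso)))
        where
        h′ : W x ≡ false
        h′ = trans (sym (not-involutive _)) (cong not h)
      by (inj₂ h) = inj₂ (inj₂ (inj₁ (Iso-≗ (type3-shape c A (λ _ u → u) m 3≤m 1+m<p inside outside _ (type3-centre σ c c≈)
          (λ u → trans (at₀ u) (whole _)) (λ u → trans (at₃ u) (whole _)) (λ u → trans (at₁ u) (h _)) (λ u → trans (at₂ u) (h _))))))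
        where
        whole : ∀ x → W x ≡ true
        whole x = trans (sym (not-involutive _)) (cong not (h x))

    four-fibres-outcome : Outcome σ A
    four-fibres-outcome = by (search (λ x → not (W x)))

  type34-outcome : ∀ σ {d} (A : V (suc d) → Bool) {c} → Trimmed σ A c (suc m) 2 0 → Outcome σ A
  type34-outcome σ A {c} t = four-fibres-outcome σ A c (origin σ c γ≈)
      (λ i u 1<i i<m → everything (fibre σ A (c + + i)) (proj₂ (proj₂ (two-pairs t)) i 1<i i<m) u) outside
      (proj₁ in₀) (proj₁ in-M) (proj₂ in₀) (proj₂ in-M) (four-fibres σ t)
    where open Trimmed t

  module _ (σ : Sign) {d : ℕ} (A : V (suc d) → Bool) {c : ℤ} {M e j : ℕ} (t : Trimmed σ A c M e j) (M<p : M ℕ.< p) where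
    private
      open Trimmed t
      c′ = - (c + + M)
      A′ = A ∘⁻¹ negation

      reflect : ∀ i k z → i ℕ.+ k ≡ M → z ≈ + k → ∀ u → fibre σ A′ (c′ + + i) u ≡ fibre σ A (c + z) (⊝ u)
      reflect i k z i+k h u = cong (λ x → A (x ∷ ⊝ u)) (trans ([]-neg (c′ + + i)) ([]-cong (≈-trans (≈-by (trans (cong (λ M → - (- (c + + M) + + i)) (sym i+k)) (lemma c (+ i) (+ k)))) (≈-+ (≈-refl {c}) (≈-sym h)))))
        where
        lemma : ∀ c i k → - (- (c + (i + k)) + i) ≡ c + k
        lemma = solve-∀

      ⊝⊝ : ∀ {n} (u : V n) → ⊝ (⊝ u) ≡ u
      ⊝⊝ u = solve 1 (λ u → ⊖ (⊖ u) := u) refl u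

      inhabited : ∀ i k → i ℕ.+ k ≡ M → Inhabited σ A (fibre σ A (c + + k)) → Inhabited σ A′ (fibre σ A′ (c′ + + i))
      inhabited i k i+k (u , h) = ⊝ u , trans (reflect i k (+ k) i+k ≈-refl (⊝ u)) (trans (cong (fibre σ A (c + + k)) (⊝⊝ u)) h)

      same-size : ∀ i → i ℕ.≤ M → ∣ fibre σ A (c + + (M ℕ.∸ i)) ∣ ≡ ∣ fibre σ A′ (c′ + + i) ∣
      same-size i i≤M = trans (sym (∣∣-bijection ⊝_ ⊝_ ⊝⊝ ⊝⊝ (fibre σ A (c + + (M ℕ.∸ i)))))
        (∑-cong (λ u → cong 𝟙 (sym (reflect i (M ℕ.∸ i) _ (ℕ.m+[n∸m]≡n i≤M) ≈-refl u))))

      outside′ : ∀ i u → M ℕ.< i → i ℕ.< p → fibre σ A′ (c′ + + i) u ≡ false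
      outside′ i u M<i i<p = trans (cong (λ x → A (x ∷ ⊝ u)) (trans ([]-neg (c′ + + i)) ([]-cong (mod (- 1ℤ) (trans (lemma c (+ M) (+ i) (+ (p ℕ.∸ i))) (cong (λ z → c + + (M ℕ.+ (p ℕ.∸ i)) + - 1ℤ * z) (cong +_ (ℕ.m∸n+n≡m (ℕ.<⇒≤ i<p)))))))))
        (outside (M ℕ.+ (p ℕ.∸ i)) (⊝ u) (ℕ.m<m+n M (ℕ.m<n⇒0<n∸m i<p))
          (subst (M ℕ.+ (p ℕ.∸ i) ℕ.<_) (ℕ.m+[n∸m]≡n (ℕ.<⇒≤ i<p)) (ℕ.+-monoˡ-< (p ℕ.∸ i) M<i)))
        where
        lemma : ∀ c M i r → - (- (c + M) + i) ≡ c + (M + r) + - 1ℤ * (r + i)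
        lemma = solve-∀

      γ′ : ∀ σ j′ → j′ ℕ.+ (j ℕ.+ 3 ℕ.* e) ≡ 6 → Γ σ c (+ M) ≈ + m + + j → Γ σ c′ (+ M) ≈ + m + + j′
      γ′ σ j′ sum h = ≈-trans (by σ h) (≈-by (cong (λ z → + m + z) (trans (cong (λ n → + n - (+ j + (+ e + (+ e + (+ e + 0ℤ))))) (sym sum)) (lemma (+ j′) (+ j + (+ e + (+ e + (+ e + 0ℤ))))))))
        where
        lemma : ∀ x y → x + y - y ≡ x
        lemma = solve-∀
        by : ∀ σ → Γ σ c (+ M) ≈ + m + + j → Γ σ c′ (+ M) ≈ + m + (+ 6 - (+ j + (+ e + (+ e + (+ e + 0ℤ)))))
        by plus h = ≈-linear {M} {e} (- 1ℤ) (- 1ℤ) (- + 3) M+1 h (eq c (+ M) (+ m) (+ j) (+ e))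
          where
          eq : ∀ c M m j e → - (c + M) - M - (m + (+ 6 - (j + (e + (e + (e + 0ℤ)))))) ≡ - 1ℤ * (c - M - (m + j)) + - 1ℤ * (+ 3 + (m + (m + (m + (m + (m + 0ℤ)))))) + - + 3 * (1ℤ + M - (m + e))
          eq = solve-∀
        by minus h = ≈-linear {M} {e} (- 1ℤ) (- 1ℤ) (- + 3) M+1 h (eq c (+ M) (+ m) (+ j) (+ e))
          where
          eq : ∀ c M m j e → - (- (c + M) + - (c + M) + - (c + M)) - (M + M + M) - (m + (+ 6 - (j + (e + (e + (e + 0ℤ)))))) ≡ - 1ℤ * (- (c + c + c) - (M + M + M) - (m + j)) + - 1ℤ * (+ 3 + (m + (m + (m + (m + (m + 0ℤ)))))) + - + 3 * (1ℤ + M - (m + e))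
          eq = solve-∀

    -- Negation reverses the window, exchanging i and M - i, and reverses the list of 7 - 3e
    -- survivors, j becoming 6 - 3e - j.
    mirror : ∀ j′ → j′ ℕ.+ (j ℕ.+ 3 ℕ.* e) ≡ 6 → Trimmed σ (A ∘⁻¹ negation) (- (c + + M)) M e j′
    mirror j′ sum = record
      { free = free-image σ negation free
      ; outside = outside′
      ; in₀ = inhabited 0 M refl in-M
      ; in-M = inhabited M 0 (ℕ.+-identityʳ M) in₀
      ; big = subst (m ℕ.* size (V d) ℕ.≤_) (trans (∑<-reverse M _) (∑<-cong (suc M) (λ i lt → same-size i (ℕ.≤-pred lt)))) big
      ; M+1 = M+1
      ; γ≈ = γ′ σ j′ sum γ≈ }

    by-mirror : ∀ j′ → j′ ℕ.+ (j ℕ.+ 3 ℕ.* e) ≡ 6 → (Trimmed σ (A ∘⁻¹ negation) (- (c + + M)) M e j′ → Outcome σ (A ∘⁻¹ negation)) → Outcome σ A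
    by-mirror j′ sum f = Outcome-Iso σ {B = A ∘⁻¹ negation} (Iso-image A negation) (f (mirror j′ sum))

  private
    plus₃ : ∀ c M m → 1ℤ * (c - + 0) - - (m + (m + (m + 0ℤ)) + 1ℤ) ≡ 1ℤ * (c - M - (m + + 3)) + 1ℤ * (+ 3 + (m + (m + (m + (m + (m + 0ℤ)))))) + 1ℤ * (1ℤ + M - (m + + 0))
    plus₃ = solve-∀
    plus₄ : ∀ c M m → 1ℤ * (c - + 1) - - (m + (m + (m + 0ℤ)) + 1ℤ) ≡ 1ℤ * (c - M - (m + + 4)) + 1ℤ * (+ 3 + (m + (m + (m + (m + (m + 0ℤ)))))) + 1ℤ * (1ℤ + M - (m + + 0))
    plus₄ = solve-∀
    plus₂ : ∀ c M m → 1ℤ * (c - + 0) - - (m + (m + (m + 0ℤ)) + 1ℤ) ≡ 1ℤ * (c - M - (m + + 2)) + 1ℤ * (+ 3 + (m + (m + (m + (m + (m + 0ℤ)))))) + 1ℤ * (1ℤ + M - (m + + 1))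
    plus₂ = solve-∀
    plus₅ : ∀ c M m → + 2 * c - + 3 * (c + M) - + 2 ≡ - 1ℤ * (c - M - (m + + 5)) + - 1ℤ * (+ 3 + (m + (m + (m + (m + (m + 0ℤ)))))) + - + 4 * (1ℤ + M - (m + 0ℤ))
    plus₅ = solve-∀
    plus₆ : ∀ c M m → + 2 * c - + 3 * (c + M) - + 1 ≡ - 1ℤ * (c - M - (m + + 6)) + - 1ℤ * (+ 3 + (m + (m + (m + (m + (m + 0ℤ)))))) + - + 4 * (1ℤ + M - (m + 0ℤ))
    plus₆ = solve-∀
    minus₄ : ∀ c M m → + 3 * (c - + 0) - - (m + (m + (m + (m + 0ℤ))) + 1ℤ) ≡ - 1ℤ * (- (c + c + c) - (M + M + M) - (m + + 4)) + 0ℤ * (+ 3 + (m + (m + (m + (m + (m + 0ℤ)))))) + - + 3 * (1ℤ + M - (m + + 0))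
    minus₄ = solve-∀
    minus₁ : ∀ c M m → + 3 * (c - + 1) - - (m + (m + (m + (m + 0ℤ))) + 1ℤ) ≡ - 1ℤ * (- (c + c + c) - (M + M + M) - (m + + 1)) + 0ℤ * (+ 3 + (m + (m + (m + (m + (m + 0ℤ)))))) + - + 3 * (1ℤ + M - (m + + 0))
    minus₁ = solve-∀
    minus₁′ : ∀ c M m → + 3 * (c - + 0) - - (m + (m + (m + (m + 0ℤ))) + 1ℤ) ≡ - 1ℤ * (- (c + c + c) - (M + M + M) - (m + + 1)) + 0ℤ * (+ 3 + (m + (m + (m + (m + (m + 0ℤ)))))) + - + 3 * (1ℤ + M - (m + + 1))
    minus₁′ = solve-∀

  module _ {d : ℕ} where

    full₃ : ∀ {A : V (suc d) → Bool} {c M} → Trimmed plus A c M 0 3 → Outcome plus A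
    full₃ t = trivial-plus 0 t (M≤m t) plus₃
    full₄ : ∀ {A : V (suc d) → Bool} {c M} → Trimmed plus A c M 0 4 → Outcome plus A
    full₄ t = trivial-plus 1 t (1+M≤m t) plus₄
    full₅ : ∀ {A : V (suc d) → Bool} {c M} → Trimmed plus A c M 0 5 → Outcome plus A
    full₅ t = type1-plus 2 (s≤s ℕ.z≤n) ℕ.≤-refl t plus₅
    full₆ : ∀ {A : V (suc d) → Bool} {c M} → Trimmed plus A c M 0 6 → Outcome plus A
    full₆ t = type1-plus 1 ℕ.≤-refl (s≤s ℕ.z≤n) t plus₆
    full₄′ : ∀ {A : V (suc d) → Bool} {c M} → Trimmed minus A c M 0 4 → Outcome minus A
    full₄′ t = trivial-minus 0 t (M≤m t) minus₄
    full₁′ : ∀ {A : V (suc d) → Bool} {c M} → Trimmed minus A c M 0 1 → Outcome minus A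
    full₁′ t = trivial-minus 1 t (1+M≤m t) minus₁

    -- m full hyperplanes in seven positions. For `plus` the middle three fit into the cuboid, up to
    -- negation, and the others are type 1; for `minus` 1, 2, 4, 5 fit, and 0, 3, 6 are type 1,
    -- where 3 needs the alternative value e = k = 4 in its definition.
    classify₀ : ∀ σ (A : V (suc d) → Bool) {c M} j → j ℕ.≤ 6 → Trimmed σ A c M 0 j → Outcome σ A
    classify₀ σ A {c} {M} j j≤6 t = by σ j j≤6 t
      where
      M<p : M ℕ.< p
      M<p = ℕ.≤-<-trans (M≤m t) m<p
      by : ∀ σ j → j ℕ.≤ 6 → Trimmed σ A c M 0 j → Outcome σ A
      by plus 0 _ t = by-mirror plus A t M<p 6 refl full₆
      by plus 1 _ t = by-mirror plus A t M<p 5 refl full₅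
      by plus 2 _ t = by-mirror plus A t M<p 4 refl full₄
      by plus 3 _ t = full₃ t
      by plus 4 _ t = full₄ t
      by plus 5 _ t = full₅ t
      by plus 6 _ t = full₆ t
      by minus 0 _ t = type1-minus₁ t
      by minus 1 _ t = full₁′ t
      by minus 2 _ t = by-mirror minus A t M<p 4 refl full₄′
      by minus 3 _ t = type1-minus₄ t
      by minus 4 _ t = full₄′ t
      by minus 5 _ t = by-mirror minus A t M<p 1 refl full₁′
      by minus 6 _ t = by-mirror minus A t M<p 0 refl type1-minus₁
      by _ (suc (suc (suc (suc (suc (suc (suc _))))))) (s≤s (s≤s (s≤s (s≤s (s≤s (s≤s ())))))) _

    -- m + 1 hyperplanes: the two middle positions are the cuboid and its negative. At the outer
    -- ones the end fibres are complementary, which is type 2 for `minus` and contradictory for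
    -- `plus`.
    classify₁ : ∀ σ (A : V (suc d) → Bool) {c} j → j ℕ.≤ 3 → Trimmed σ A c m 1 j → Outcome σ A
    classify₁ plus A 0 _ t = ⊥-elim (impossible t)
    classify₁ plus A 1 _ t = by-mirror plus A t m<p 2 refl (λ t → trivial-plus 0 t ℕ.≤-refl plus₂)
    classify₁ plus A 2 _ t = trivial-plus 0 t ℕ.≤-refl plus₂
    classify₁ plus A 3 _ t = by-mirror plus A t m<p 0 refl (λ t → ⊥-elim (impossible t))
    classify₁ minus A 0 _ t = type2-outcome t
    classify₁ minus A 1 _ t = trivial-minus 0 t ℕ.≤-refl minus₁′
    classify₁ minus A 2 _ t = by-mirror minus A t m<p 1 refl (λ t → trivial-minus 0 t ℕ.≤-refl minus₁′)
    classify₁ minus A 3 _ t = by-mirror minus A t m<p 0 refl type2-outcome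
    classify₁ _ A (suc (suc (suc (suc _)))) (s≤s (s≤s (s≤s ()))) _

    classify : ∀ σ (A : V (suc d) → Bool) {c M} e j → j ℕ.+ 3 ℕ.* e ℕ.≤ 6 → Trimmed σ A c M e j → Outcome σ A
    classify σ A 0 j h t = classify₀ σ A j (ℕ.≤-trans (ℕ.m≤m+n j 0) h) t
    classify σ A {c} {M} 1 j h t = classify₁ σ A j (ℕ.+-cancelʳ-≤ 3 j 3 h) (subst (λ M → Trimmed σ A c M 1 j) (ℕ.suc-injective (trans (Trimmed.M+1 t) (ℕ.+-comm m 1))) t)
    classify σ A {c} {M} 2 j h t = by j (ℕ.+-cancelʳ-≤ 6 j 0 h) t
      where
      by : ∀ j → j ℕ.≤ 0 → Trimmed σ A c M 2 j → Outcome σ A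
      by 0 _ t = type34-outcome σ A (subst (λ M → Trimmed σ A c M 2 0) (ℕ.suc-injective (trans (Trimmed.M+1 t) (ℕ.+-comm m 2))) t)
    classify σ A (suc (suc (suc e))) j h t = contradiction (ℕ.≤-trans (ℕ.*-monoʳ-≤ 3 (s≤s (s≤s (s≤s (ℕ.z≤n {e}))))) (ℕ.≤-trans (ℕ.m≤n+m _ j) h)) λ { (s≤s (s≤s (s≤s (s≤s (s≤s (s≤s ())))))) }

-- Rich lines, normalisation by automorphisms, and the combination of all steps.

module Assembly (p : ℕ) .{{_ : NonZero p}} (prime : Prime p) (m : ℕ) (p≡ : p ≡ 3 ℕ.+ 5 ℕ.* m) (21≤m : 21 ℕ.≤ m) where

  open LinearArithmetic hiding (close; classify)
  open Sums
  open Residues p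
  open PrimeField p prime
  open Vosper p prime using (Sub; remove; ∣remove∣)
  open SumFreeLine p prime using (Sign; plus; minus; sgn; SumFreeF; InProgression; covered-by-progression)
  open QuasiHomomorphisms p prime using (≈-by)
  open Concentration p prime using (sgnᵛ; SumFreeV; Window; concentration)
  open Fibres p prime
  open Automorphisms p prime
  open Cosets p prime using (true-false)
  open Classification p prime m p≡ 21≤m
  open import Defs using (count; Aut; MBoundT; SumFree; card; allVecs; vsum)
  open import Data.Bool using (Bool; true; false)
  open import Data.Empty using (⊥; ⊥-elim)
  open import Data.Fin using (toℕ)
  open import Data.Integer hiding (NonZero; ∣_∣; suc; sign)
  open import Data.Integer.Properties using (+-identityʳ; *-identityˡ)
  open import Data.Integer.Tactic.RingSolver using (solve-∀)
  open import Data.List using (allFin; concatMap) renaming (map to mapˡ)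
  open import Data.Nat using (zero; suc; s≤s)
  import Data.Nat.Properties as ℕ
  open import Data.Product using (∃; _×_; _,_; proj₁; proj₂)
  open import Data.Sum using (_⊎_; inj₁; inj₂)
  open import Data.Vec using (Vec; []; _∷_)
  open import Data.Vec.Relation.Unary.All using ([]; _∷_)
  open import Relation.Binary.PropositionalEquality hiding ([_])
  open import Relation.Nullary using (does; yes; no; contradiction)
  open VSolver using (solve; _:=_; con) renaming (_:+_ to _⊹_; _:*_ to _⊗_; :-_ to ⊖_)

  module _ (σ : Sign) {d : ℕ} (A : V (suc d) → Bool) where
    private
      B : ℤ → V d → Bool
      B = fibre σ A

      Outside : ℤ → ℕ → Set
      Outside c l = ∀ i u → l ℕ.< i → i ℕ.< p → B (c + + i) u ≡ false

    -- The fibre inequalities place summands on the end hyperplanes, so empty ones are cut off until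
    -- both ends are inhabited.
    trim : (∃ λ x → A x ≡ true) → ∀ l c → l ℕ.< p → Outside c l →
      ∃ λ c → ∃ λ M → M ℕ.≤ l × Outside c M × Inhabited σ A (B (c + 0ℤ)) × Inhabited σ A (B (c + + M))
    trim (x ∷ u , h) 0 c _ outside = c , 0 , ℕ.z≤n , outside , (u , h₀) , (u , h₀)
      where
      h₀ : B (c + 0ℤ) u ≡ true
      h₀ = by (from-origin c x)
        where
        by : (∃ λ i → i ℕ.< p × x ≡ [ c + + i ]) → B (c + 0ℤ) u ≡ true
        by (zero , _ , e) = trans (cong (λ x → A (x ∷ u)) (sym e)) h
        by (suc i , i<p , e) = ⊥-elim (true-false (trans (cong (λ x → A (x ∷ u)) (sym e)) h) (outside (suc i) u (s≤s ℕ.z≤n) i<p))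
    trim nonempty (suc l) c l<p outside = by (search (B (c + 0ℤ))) (search (B (c + + suc l)))
      where
      extend : (∃ λ c → ∃ λ M → M ℕ.≤ l × Outside c M × Inhabited σ A (B (c + 0ℤ)) × Inhabited σ A (B (c + + M))) →
        ∃ λ c → ∃ λ M → M ℕ.≤ suc l × Outside c M × Inhabited σ A (B (c + 0ℤ)) × Inhabited σ A (B (c + + M))
      extend (c , M , M≤l , rest) = c , M , ℕ.m≤n⇒m≤1+n M≤l , rest
      l<p′ = ℕ.<-trans (ℕ.n<1+n l) l<p
      by : (∃ λ v → B (c + 0ℤ) v ≡ true) ⊎ (∀ v → B (c + 0ℤ) v ≡ false) → (∃ λ v → B (c + + suc l) v ≡ true) ⊎ (∀ v → B (c + + suc l) v ≡ false) →
        ∃ λ c → ∃ λ M → M ℕ.≤ suc l × Outside c M × Inhabited σ A (B (c + 0ℤ)) × Inhabited σ A (B (c + + M))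
      by (inj₁ in₀) (inj₁ in-l) = c , suc l , ℕ.≤-refl , outside , in₀ , in-l
      by (inj₂ none) _ = extend (trim nonempty l (c + 1ℤ) l<p′ (λ i u l<i i<p → trans (cong (λ x → A (x ∷ u)) (cong [_] (lemma c (+ i)))) (next i u l<i (ℕ.m≤n⇒m<n∨m≡n i<p))))
        where
        lemma : ∀ c i → c + 1ℤ + i ≡ c + (1ℤ + i)
        lemma = solve-∀
        next : ∀ i u → l ℕ.< i → suc i ℕ.< p ⊎ suc i ≡ p → B (c + + suc i) u ≡ false
        next i u l<i (inj₁ lt) = outside (suc i) u (s≤s l<i) lt
        -- After the start moves by one, the last index wraps around to the old first hyperplane,
        -- which was just found empty.
        next i u l<i (inj₂ e) = trans (cong (λ x → A (x ∷ u)) ([]-cong (mod 1ℤ (trans (cong (λ n → c + + n) e) (wrap c P))))) (none u)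
          where
          wrap : ∀ c P → c + P ≡ c + 0ℤ + 1ℤ * P
          wrap = solve-∀
      by (inj₁ _) (inj₂ none) = extend (trim nonempty l c l<p′ (λ i u l<i i<p → last i u (ℕ.m≤n⇒m<n∨m≡n l<i) i<p))
        where
        last : ∀ i u → suc l ℕ.< i ⊎ suc l ≡ i → i ℕ.< p → B (c + + i) u ≡ false
        last i u (inj₁ lt) i<p = outside i u lt i<p
        last i u (inj₂ refl) _ = none u

    fibres-total : ∀ c M → M ℕ.< p → Outside c M → ∑< (suc M) (λ i → ∣ B (c + + i) ∣) ≡ ∣ A ∣
    fibres-total c M M<p outside = begin
      ∑< (suc M) b                                     ≡⟨ ℕ.+-identityʳ _ ⟨
      ∑< (suc M) b ℕ.+ 0                               ≡⟨ cong (∑< (suc M) b ℕ.+_) rest ⟨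
      ∑< (suc M) b ℕ.+ ∑< r (λ i → b (suc M ℕ.+ i))    ≡⟨ ∑<-split (suc M) r b ⟨
      ∑< (suc M ℕ.+ r) b                               ≡⟨ cong (λ n → ∑< n b) (ℕ.m+[n∸m]≡n M<p) ⟩
      ∑< p b                                           ≡⟨ ∑-shift c (λ x → ∣ (λ v → A (x ∷ v)) ∣) ⟩
      ∑ (λ x → ∣ (λ v → A (x ∷ v)) ∣)                  ≡⟨ ∑-∷ d (λ x → 𝟙 (A x)) ⟨
      ∣ A ∣                                            ∎
      where
      open ≡-Reasoning
      b : ℕ → ℕ
      b i = ∣ B (c + + i) ∣
      r = p ℕ.∸ suc M
      rest : ∑< r (λ i → b (suc M ℕ.+ i)) ≡ 0
      rest = ∑<-zero r (λ i i<r → ∑-zero (λ v → cong 𝟙 (outside (suc M ℕ.+ i) v (s≤s (ℕ.m≤m+n M i))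
        (subst (suc M ℕ.+ i ℕ.<_) (ℕ.m+[n∸m]≡n M<p) (ℕ.+-monoʳ-< (suc M) i<r)))))

    size≡ : size (V d) ≡ p ℕ.^ d
    size≡ = trans (size-Vec {F} d) (cong (ℕ._^ d) (size-Fin p))

    m+5<p : m ℕ.+ 5 ℕ.< p
    m+5<p = linarithⁿ 2 (λ m p → p :≡ lit 3 :+ 5 :* m ⇒ lit 21 :≤ m ⇒ ⊢ (m :+ lit 5 :< p)) refl m p p≡ 21≤m

    module _ (free : SumFreeV σ A) (big : m ℕ.* p ℕ.^ d ℕ.≤ ∣ A ∣) (nonempty : ∃ λ x → A x ≡ true) where

      trimmed-outcome : ∀ c M → M ℕ.≤ m ℕ.+ 5 → Outside c M → Inhabited σ A (B (c + 0ℤ)) → Inhabited σ A (B (c + + M)) → Outcome σ A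
      trimmed-outcome c M M≤ outside in₀ in-M =
        let j , j≤ , γ≈ = exceptional σ A free c M in₀ in-M m p≡ 21≤m e M+1 e≤6 big′ in
        classify σ A e j j≤ record { free = free ; outside = outside ; in₀ = in₀ ; in-M = in-M ; big = big′ ; M+1 = M+1 ; γ≈ = γ≈ }
        where
        N = size (V d)
        big′ : m ℕ.* N ℕ.≤ ∑< (suc M) (λ i → ∣ B (c + + i) ∣)
        big′ = subst₂ ℕ._≤_ (cong (m ℕ.*_) (sym size≡)) (sym (fibres-total c M (ℕ.≤-<-trans M≤ m+5<p) outside)) big
        1≤N : 1 ℕ.≤ N
        1≤N = term≤∑ {V d} (λ _ → 1) (constᵛ 0ℤ)
        m≤ : m ℕ.≤ suc M
        m≤ = ℕ.*-cancelʳ-≤ m (suc M) N {{ℕ.>-nonZero 1≤N}} (ℕ.≤-trans big′ (ℕ.≤-trans (∑<-mono (suc M) (λ i _ → ∣∣≤size (B (c + + i)))) (ℕ.≤-reflexive (∑<-const (suc M) N))))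
        e = suc M ℕ.∸ m
        M+1 : suc M ≡ m ℕ.+ e
        M+1 = sym (ℕ.m+[n∸m]≡n m≤)
        e≤6 : e ℕ.≤ 6
        e≤6 = ℕ.m≤n+o⇒m∸n≤o (suc M) m (ℕ.≤-trans (s≤s M≤) (ℕ.≤-reflexive (sym (ℕ.+-suc m 5))))

      window-outcome : ∀ L → (∀ u x → A ([ x ] ∷ u) ≡ true → ∃ λ i → i ℕ.≤ m ℕ.+ 5 × x ≈ L + + i) → Outcome σ A
      window-outcome L window = let c , M , M≤ , outside , in₀ , in-M = trim nonempty (m ℕ.+ 5) L m+5<p outside₀ in
        trimmed-outcome c M M≤ outside in₀ in-M
        where
        outside₀ : Outside L (m ℕ.+ 5)
        outside₀ i u lt i<p = by (B (L + + i) u) refl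
          where
          by : ∀ b → B (L + + i) u ≡ b → b ≡ false
          by false _ = refl
          by true h = let k , k≤ , e = window u (L + + i) h in
            contradiction (subst (m ℕ.+ 5 ℕ.<_) (position-injective L i<p (ℕ.≤-<-trans k≤ m+5<p) ([]-cong e)) lt) (ℕ.≤⇒≯ k≤)

  -- A rich line may contain more than m points; exactly m of them satisfy the density condition
  -- 5|X| ≤ p and the size conditions of the covering step.
  subset-of-size : ∀ {A : Set} {{_ : Finite A}} n (X : A → Bool) → n ℕ.≤ ∣ X ∣ → ∃ λ Y → (∀ x → Y x ≡ true → X x ≡ true) × ∣ Y ∣ ≡ n
  subset-of-size {A} n X n≤ = shrink (∣ X ∣ ℕ.∸ n) X (sym (ℕ.m∸n+n≡m n≤))
    where
    shrink : ∀ k X → ∣ X ∣ ≡ k ℕ.+ n → ∃ λ Y → (∀ x → Y x ≡ true → X x ≡ true) × ∣ Y ∣ ≡ n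
    shrink zero X e = X , (λ _ h → h) , e
    shrink (suc k) X e =
      let a , ha = 1≤⇒member X (subst (1 ℕ.≤_) (sym e) (s≤s ℕ.z≤n))
          Y , sub , size-Y = shrink k (remove X a) (ℕ.suc-injective (trans (∣remove∣ X a ha) e)) in
      Y , (λ x h → proj₁ (∧-split {X x} (sub x h))) , size-Y

  scalar-neg : ∀ {n} a (v : V n) → scalar (-ᶠ a) v ≡ ⊝ scalar a v
  scalar-neg a [] = refl
  scalar-neg a (x ∷ v) = cong₂ _∷_ (FS.solve 2 (λ a x → FS.:- a FS.:* x FS.:= FS.:- (a FS.:* x)) refl a x) (scalar-neg a v)

  hom-scalar : ∀ {n k} (g : V n → V k) → (∀ x y → g (x ⊞ y) ≡ g x ⊞ g y) → ∀ a v → g (scalar a v) ≡ scalar a (g v)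
  hom-scalar g hom a v = subst (λ a → g (scalar a v) ≡ scalar a (g v)) ([]-ι a) (multiple (toℕ a))
    where
    step : ∀ {n} k (v : V n) → scalar [ + suc k ] v ≡ v ⊞ scalar [ + k ] v
    step k v = trans ([]-·-+ 1ℤ (+ k) v) (cong (_⊞ scalar [ + k ] v) (1·v v))
    g-0 : g (constᵛ 0ℤ) ≡ constᵛ 0ℤ
    g-0 = trans (solve 1 (λ a → a := a ⊹ a ⊹ ⊖ a) refl (g (constᵛ 0ℤ)))
      (trans (cong (_⊟ g (constᵛ 0ℤ)) (trans (sym (hom _ _)) (cong g (solve 0 (con 0ℤ ⊹ con 0ℤ := con 0ℤ) refl))))
        (solve 1 (λ a → a ⊹ ⊖ a := con 0ℤ) refl (g (constᵛ 0ℤ))))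
    multiple : ∀ k → g (scalar [ + k ] v) ≡ scalar [ + k ] (g v)
    multiple zero = trans (cong g (0·v v)) (trans g-0 (sym (0·v (g v))))
    multiple (suc k) = trans (cong g (step k v)) (trans (hom _ _) (trans (cong (g v ⊞_) (multiple k)) (sym (step k (g v)))))

  line : ∀ {n} → (V n → Bool) → V n → Sub
  line A w x = A (scalar x w)

  line-free : ∀ {n} σ (A : V n → Bool) w → SumFreeV σ A → SumFreeF σ (line A w)
  line-free σ A w free x a b c d hx ha hb hc hd e = free (scalar x w) (scalar a w) (scalar b w) (scalar c w) (scalar d w) hx ha hb hc hd
    (trans (cong (scalar x w ⊞_) (trans (cong (sgnᵛ σ) (sym (scalar-+ a b w))) (sgn-scalar σ (a +ᶠ b))))
      (trans (sym (scalar-+ x (sgn σ (a +ᶠ b)) w)) (trans (cong (λ z → scalar z w) e) (scalar-+ c d w))))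
    where
    sgn-scalar : ∀ σ z → sgnᵛ σ (scalar z w) ≡ scalar (sgn σ z) w
    sgn-scalar plus z = refl
    sgn-scalar minus z = sym (scalar-neg z w)

  zero-excluded : ∀ {n} σ (A : V n → Bool) → SumFreeV σ A → A (constᵛ 0ℤ) ≡ false
  zero-excluded {n} σ A free = by (A o) refl
    where
    o : V n
    o = constᵛ 0ℤ
    zeros : ∀ σ → o ⊞ sgnᵛ σ (o ⊞ o) ≡ o ⊞ o
    zeros plus = solve 0 (con 0ℤ ⊹ (con 0ℤ ⊹ con 0ℤ) := con 0ℤ ⊹ con 0ℤ) refl
    zeros minus = solve 0 (con 0ℤ ⊹ ⊖ (con 0ℤ ⊹ con 0ℤ) := con 0ℤ ⊹ con 0ℤ) refl
    by : ∀ b → A o ≡ b → A o ≡ false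
    by false h = h
    by true h = ⊥-elim (free o o o o o h h h h h (zeros σ))

  module _ {d : ℕ} (A : V (suc d) → Bool) (no-zero : A (constᵛ 0ℤ) ≡ false) (big : m ℕ.* p ℕ.^ d ℕ.≤ ∣ A ∣) where

    -- Counting pairs (x, w) with xw in A: each nonzero x contributes |A|, since dilation is a
    -- bijection, and x = 0 contributes nothing, since 0 is not in A.
    lines-total : ∑ (λ w → ∣ line A w ∣) ℕ.+ ∣ A ∣ ≡ p ℕ.* ∣ A ∣
    lines-total = begin
      ∑ (λ w → ∣ line A w ∣) ℕ.+ ∣ A ∣                                        ≡⟨ cong₂ ℕ._+_ (∑-swap (λ w x → 𝟙 (A (scalar x w)))) (sym (∑-at (λ _ → ∣ A ∣) 0ᶠ)) ⟩
      ∑ (λ x → ∣ (λ w → A (scalar x w)) ∣) ℕ.+ ∑ (λ x → at x 0ᶠ ℕ.* ∣ A ∣)    ≡⟨ ∑-+ _ _ ⟨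
      ∑ (λ x → ∣ (λ w → A (scalar x w)) ∣ ℕ.+ at x 0ᶠ ℕ.* ∣ A ∣)              ≡⟨ ∑-cong dilate ⟩
      ∑ {F} (λ _ → ∣ A ∣)                                                     ≡⟨ ∑-const {F} ∣ A ∣ ⟩
      size F ℕ.* ∣ A ∣                                                        ≡⟨ cong (ℕ._* ∣ A ∣) (size-Fin p) ⟩
      p ℕ.* ∣ A ∣                                                             ∎
      where
      open ≡-Reasoning
      dilate : ∀ x → ∣ (λ w → A (scalar x w)) ∣ ℕ.+ at x 0ᶠ ℕ.* ∣ A ∣ ≡ ∣ A ∣
      dilate x with x ≟ᶠ 0ᶠ
      ... | yes refl = trans (cong (ℕ._+ (1 ℕ.* ∣ A ∣)) (∑-zero (λ w → cong 𝟙 (trans (cong A (0·v w)) no-zero)))) (ℕ.*-identityˡ _)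
      ... | no x≢0 = trans (ℕ.+-identityʳ _) (∣∣-bijection (scalar x) (scalar x⁻¹) (undo x⁻¹ x (trans (*ᶠ-comm x⁻¹ x) e)) (undo x x⁻¹ e) A)
        where
        x⁻¹ = proj₁ (inverse x x≢0)
        e = proj₂ (inverse x x≢0)
        undo : ∀ a b → a *ᶠ b ≡ 1ᶠ → ∀ (v : V (suc d)) → scalar a (scalar b v) ≡ v
        undo a b e v = trans (·-· a b v) (trans (cong (λ c → scalar c v) e) (1·v v))

    private
      -- For a = mN + r the assumption becomes pN + pr ≤ mN + r, which fails because p > m. The
      -- average line count thus exceeds m - 1 even though only p - 1 dilations contribute.
      impossible-average : ∀ p m N a → m ℕ.< p → 1 ℕ.≤ N → 1 ℕ.≤ m → m ℕ.* N ℕ.≤ a → p ℕ.* a ℕ.≤ (m ℕ.∸ 1) ℕ.* (p ℕ.* N) ℕ.+ a → ⊥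
      impossible-average p (suc n) N a m<p 1≤N _ le h = ℕ.<⇒≱ (ℕ.*-monoˡ-< N {{ℕ.>-nonZero 1≤N}} m<p)
        (linarithⁿ 7 (λ pa np a mN r pN pr → a :≡ mN :+ r ⇒ pa :≡ pN :+ np :+ pr ⇒ r :≤ pr ⇒ pa :≤ np :+ a ⇒ ⊢ (pN :≤ mN)) refl
          (p ℕ.* a) (n ℕ.* (p ℕ.* N)) a (suc n ℕ.* N) r (p ℕ.* N) (p ℕ.* r) a≡ (trans (cong (p ℕ.*_) a≡) (lemma p n N r))
          (ℕ.m≤n*m r p {{ℕ.>-nonZero (ℕ.≤-trans (s≤s ℕ.z≤n) m<p)}}) h)
        where
        r = a ℕ.∸ suc n ℕ.* N
        a≡ : a ≡ suc n ℕ.* N ℕ.+ r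
        a≡ = sym (ℕ.m+[n∸m]≡n le)
        open import Data.Nat.Tactic.RingSolver using () renaming (solve-∀ to solve-ℕ)
        lemma : ∀ p n N r → p ℕ.* ((1 ℕ.+ n) ℕ.* N ℕ.+ r) ≡ p ℕ.* N ℕ.+ n ℕ.* (p ℕ.* N) ℕ.+ p ℕ.* r
        lemma = solve-ℕ

    rich-line : ∃ λ w → m ℕ.≤ ∣ line A w ∣
    rich-line = by (search (λ w → does (m ℕ.≤? ∣ line A w ∣)))
      where
      by : (∃ λ w → does (m ℕ.≤? ∣ line A w ∣) ≡ true) ⊎ (∀ w → does (m ℕ.≤? ∣ line A w ∣) ≡ false) → ∃ λ w → m ℕ.≤ ∣ line A w ∣
      by (inj₁ (w , h)) = w , does-true (m ℕ.≤? ∣ line A w ∣) h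
      by (inj₂ none) = ⊥-elim (impossible-average p m (p ℕ.^ d) ∣ A ∣ m<p (ℕ.m^n>0 p d) 1≤m big
        (subst₂ ℕ._≤_ lines-total (cong (ℕ._+ ∣ A ∣) total) (ℕ.+-monoˡ-≤ ∣ A ∣ (∑-mono below))))
        where
        below : ∀ w → ∣ line A w ∣ ℕ.≤ m ℕ.∸ 1
        below w = ℕ.<⇒≤pred (ℕ.≰⇒> (does-false (m ℕ.≤? ∣ line A w ∣) (none w)))
        total : ∑ {V (suc d)} (λ _ → m ℕ.∸ 1) ≡ (m ℕ.∸ 1) ℕ.* (p ℕ.* p ℕ.^ d)
        total = trans (∑-const {V (suc d)} (m ℕ.∸ 1)) (trans (ℕ.*-comm _ (m ℕ.∸ 1)) (cong ((m ℕ.∸ 1) ℕ.*_) (trans (size-Vec {F} (suc d)) (cong (ℕ._^ suc d) (size-Fin p)))))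

    rich-line≢0 : ∀ w → m ℕ.≤ ∣ line A w ∣ → w ≢ constᵛ 0ℤ
    rich-line≢0 w h refl = contradiction (ℕ.≤-trans 1≤m h) (ℕ.<⇒≱ (s≤s (ℕ.≤-reflexive (∑-zero (λ x → cong 𝟙 (trans (cong A (scalar-0 {suc d} x)) no-zero))))))

  module _ (σ : Sign) {d : ℕ} (A : V (suc d) → Bool) (free : SumFreeV σ A) (big : m ℕ.* p ℕ.^ d ℕ.≤ ∣ A ∣) (nonempty : ∃ λ x → A x ≡ true) where

    -- Subtracting a from the head coordinate makes the slanted window over u independent of u, so
    -- the concentrated set lies over m + 6 consecutive values of the head coordinate.
    sheared-outcome : (a : V d → ℤ) → (∀ v w → a (v ⊞ w) ≈ a v + a w) →
      ∀ L → (∀ u x → A ([ x ] ∷ u) ≡ true → ∃ λ i → i ℕ.≤ m ℕ.+ 5 × x ≈ a u + L + + i) → Outcome σ A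
    sheared-outcome a add L window = Outcome-Iso σ {B = A ∘⁻¹ φ} (Iso-image A φ)
      (window-outcome σ (A ∘⁻¹ φ) (free-image σ φ free) (ℕ.≤-trans big (ℕ.≤-reflexive (sym (card-image A φ))))
        (Aut.f φ (proj₁ nonempty) , trans (cong A (Aut.gf φ (proj₁ nonempty))) (proj₂ nonempty)) L window′)
      where
      φ : Aut p (suc d)
      φ = head-shear (λ v → [ - a v ]) (λ v w → trans ([]-cong (≈-trans (≈-neg (add v w)) (≈-by (lemma (a v) (a w))))) (sym ([]-+ (- a v) (- a w))))
        where
        lemma : ∀ x y → - (x + y) ≡ - x + - y
        lemma = solve-∀
      window′ : ∀ u x → A (([ x ] +ᶠ -ᶠ [ - a u ]) ∷ u) ≡ true → ∃ λ i → i ℕ.≤ m ℕ.+ 5 × x ≈ L + + i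
      window′ u x h = let i , i≤ , e = window u (x - - a u) (trans (cong (λ y → A (y ∷ u)) (sym (trans (cong ([ x ] +ᶠ_) ([]-neg (- a u))) ([]-+ x (- - a u))))) h) in
        i , i≤ , ≈-trans (≈-by (lemma x (a u))) (≈-trans (≈-- e (≈-refl {a u})) (≈-by (lemma′ (a u) L (+ i))))
        where
        lemma : ∀ x a → x ≡ x - - a - a
        lemma = solve-∀
        lemma′ : ∀ a L i → a + L + i - a ≡ L + i
        lemma′ = solve-∀

    axis-outcome : (X : Sub) → (∀ x → X x ≡ true → A (x ∷ constᵛ 0ℤ) ≡ true) → ∣ X ∣ ≡ m → ∀ c → Window X c (m ℕ.+ 1) → Outcome σ A
    axis-outcome X X⊆ ∣X∣ c window = let a , add , L , near = concentration m p≡ 21≤m σ d A free big X X⊆ ∣X∣ c window in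
      sheared-outcome a add L near

  module _ (σ : Sign) {d : ℕ} (A : V (suc d) → Bool) (free : SumFreeV σ A) (big : m ℕ.* p ℕ.^ d ℕ.≤ ∣ A ∣) (nonempty : ∃ λ x → A x ≡ true) where

    line-outcome : ∀ w → w ≢ constᵛ 0ℤ → (X : Sub) → (∀ x → X x ≡ true → line A w x ≡ true) → ∣ X ∣ ≡ m → ∀ c → Window X c (m ℕ.+ 1) → Outcome σ A
    line-outcome w w≢0 X X⊆ ∣X∣ c window = Outcome-Iso σ {B = A ∘⁻¹ φ} (Iso-image A φ)
      (axis-outcome σ (A ∘⁻¹ φ) (free-image σ φ free) (ℕ.≤-trans big (ℕ.≤-reflexive (sym (card-image A φ))))
        (Aut.f φ (proj₁ nonempty) , trans (cong A (Aut.gf φ (proj₁ nonempty))) (proj₂ nonempty))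
        X (λ x h → trans (cong A (on-line x)) (X⊆ x h)) ∣X∣ c window)
      where
      φ = proj₁ (straighten w w≢0)
      on-line : ∀ x → Aut.g φ (x ∷ constᵛ 0ℤ) ≡ scalar x w
      on-line x = begin
        Aut.g φ (x ∷ constᵛ 0ℤ)           ≡⟨ cong (Aut.g φ) (cong₂ _∷_ (trans (sym (*ᶠ-identityˡ x)) (*ᶠ-comm 1ᶠ x)) (sym (scalar-0 {d} x))) ⟩
        Aut.g φ (scalar x unit-vector)    ≡⟨ hom-scalar (Aut.g φ) (Aut-inverse-hom φ) x unit-vector ⟩
        scalar x (Aut.g φ unit-vector)    ≡⟨ cong (λ v → scalar x (Aut.g φ v)) (proj₂ (straighten w w≢0)) ⟨
        scalar x (Aut.g φ (Aut.f φ w))    ≡⟨ cong (scalar x) (Aut.gf φ w) ⟩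
        scalar x w                        ∎
        where open ≡-Reasoning

    outcome : MBoundT m → Outcome σ A
    -- Replacing w by δw turns the progression with difference δ into consecutive multiples; its
    -- first term a becomes a/δ.
    outcome bound = line-outcome (scalar δ w) δw≢0 X* (λ x h → trans (cong A (·-· x δ w)) (X⊆ _ h)) ∣X*∣ (ι (a *ᶠ δ⁻¹)) window
      where
      no-zero : A (constᵛ 0ℤ) ≡ false
      no-zero = zero-excluded σ A free
      w = proj₁ (rich-line A no-zero big)
      w≢0 : w ≢ constᵛ 0ℤ
      w≢0 = rich-line≢0 A no-zero big w (proj₂ (rich-line A no-zero big))
      sub : ∃ λ Y → (∀ x → Y x ≡ true → line A w x ≡ true) × ∣ Y ∣ ≡ m
      sub = subset-of-size m (line A w) (proj₂ (rich-line A no-zero big))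
      X : Sub
      X = proj₁ sub
      X⊆ : ∀ x → X x ≡ true → line A w x ≡ true
      X⊆ = proj₁ (proj₂ sub)
      covered : ∃ λ a → ∃ λ δ → δ ≢ 0ᶠ × InProgression X a δ (m ℕ.+ 2)
      covered = covered-by-progression m p≡ 21≤m bound σ X (proj₂ (proj₂ sub))
        (λ x a b c d hx ha hb hc hd → line-free σ A w free x a b c d (X⊆ x hx) (X⊆ a ha) (X⊆ b hb) (X⊆ c hc) (X⊆ d hd))
      a = proj₁ covered
      δ = proj₁ (proj₂ covered)
      δ≢0 : δ ≢ 0ᶠ
      δ≢0 = proj₁ (proj₂ (proj₂ covered))
      δ⁻¹ = proj₁ (inverse δ δ≢0)
      δδ⁻¹ : δ *ᶠ δ⁻¹ ≡ 1ᶠ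
      δδ⁻¹ = proj₂ (inverse δ δ≢0)
      X* : Sub
      X* x = X (x *ᶠ δ)
      cancel : ∀ x → x *ᶠ δ *ᶠ δ⁻¹ ≡ x
      cancel x = trans (*ᶠ-assoc x δ δ⁻¹) (trans (cong (x *ᶠ_) δδ⁻¹) (trans (*ᶠ-comm x 1ᶠ) (*ᶠ-identityˡ x)))
      cancel′ : ∀ x → x *ᶠ δ⁻¹ *ᶠ δ ≡ x
      cancel′ x = trans (FS.solve 3 (λ x d e → x FS.:* e FS.:* d FS.:= x FS.:* d FS.:* e) refl x δ δ⁻¹) (cancel x)
      ∣X*∣ : ∣ X* ∣ ≡ m
      ∣X*∣ = trans (∣∣-bijection (_*ᶠ δ) (_*ᶠ δ⁻¹) cancel cancel′ X) (proj₂ (proj₂ sub))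
      δw≢0 : scalar δ w ≢ constᵛ 0ℤ
      δw≢0 e = w≢0 (trans (sym (1·v w)) (trans (cong (λ c → scalar c w) (trans (sym δδ⁻¹) (*ᶠ-comm δ δ⁻¹)))
        (trans (sym (·-· δ⁻¹ δ w)) (trans (cong (scalar δ⁻¹) e) (scalar-0 {suc d} δ⁻¹)))))
      window : Window X* (ι (a *ᶠ δ⁻¹)) (m ℕ.+ 1)
      window z h = let i , i< , e = proj₂ (proj₂ (proj₂ covered)) ([ z ] *ᶠ δ) h in
        i , ℕ.≤-pred (subst (suc i ℕ.≤_) (ℕ.+-suc m 1) i<) , []-injective (begin
          [ z ]                                     ≡⟨ cancel [ z ] ⟨
          [ z ] *ᶠ δ *ᶠ δ⁻¹                         ≡⟨ cong (_*ᶠ δ⁻¹) e ⟩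
          (a +ᶠ [ + i ] *ᶠ δ) *ᶠ δ⁻¹                ≡⟨ *ᶠ-distribʳ δ⁻¹ a ([ + i ] *ᶠ δ) ⟩
          a *ᶠ δ⁻¹ +ᶠ [ + i ] *ᶠ δ *ᶠ δ⁻¹           ≡⟨ cong₂ _+ᶠ_ (sym ([]-ι (a *ᶠ δ⁻¹))) (cancel [ + i ]) ⟩
          [ ι (a *ᶠ δ⁻¹) ] +ᶠ [ + i ]               ≡⟨ []-+ _ _ ⟩
          [ ι (a *ᶠ δ⁻¹) + + i ]                    ∎)
        where open ≡-Reasoning

  card≡∣∣ : ∀ {n} (A : V n → Bool) → card p A ≡ ∣ A ∣
  card≡∣∣ {n} A = trans (cong (count A) (allVecs≡ n)) (trans (count≡sumOver A (vectors (allFin p) n)) (sym (∑≡sumOver (λ x → 𝟙 (A x)))))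
    where
    allVecs≡ : ∀ n → allVecs p n ≡ vectors (allFin p) n
    allVecs≡ zero = refl
    allVecs≡ (suc n) = cong (λ vs → concatMap (λ x → mapˡ (x ∷_) vs) (allFin p)) (allVecs≡ n)

  vsum-∷ : ∀ {n h} (x : V n) (xs : Vec (V n) h) → vsum p (x ∷ xs) ≡ x ⊞ vsum p xs
  vsum-∷ x xs = sym (⊞≡⊕ x (vsum p xs))

  vsum₁ : ∀ {n} (a : V n) → vsum p (a ∷ []) ≡ a
  vsum₁ a = trans (vsum-∷ a []) (trans (cong (a ⊞_) 0v≡) (solve 1 (λ a → a ⊹ con 0ℤ := a) refl a))

  vsum₂ : ∀ {n} (a b : V n) → vsum p (a ∷ b ∷ []) ≡ a ⊞ b
  vsum₂ a b = trans (vsum-∷ a (b ∷ [])) (cong (a ⊞_) (vsum₁ b))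

  vsum₃ : ∀ {n} (a b c : V n) → vsum p (a ∷ b ∷ c ∷ []) ≡ a ⊞ (b ⊞ c)
  vsum₃ a b c = trans (vsum-∷ a (b ∷ c ∷ [])) (cong (a ⊞_) (vsum₂ b c))

  vsum₄ : ∀ {n} (a b c d : V n) → vsum p (a ∷ b ∷ c ∷ d ∷ []) ≡ a ⊞ (b ⊞ (c ⊞ d))
  vsum₄ a b c d = trans (vsum-∷ a (b ∷ c ∷ d ∷ [])) (cong (a ⊞_) (vsum₃ b c d))

  -- For (4,1) the forbidden equation a + b + c + d = x is rearranged to x - (a + b) = c + d, so
  -- that both cases have 2A on the right.
  sum-free : ∀ {n} σ (A : V n → Bool) → SumFree p (kᵒ σ) (ℓᵒ σ) A → SumFreeV σ A
  sum-free plus A (_ , free) x a b c d hx ha hb hc hd e = free (x ∷ a ∷ b ∷ [] , c ∷ d ∷ [] , hx ∷ ha ∷ hb ∷ [] , hc ∷ hd ∷ [] ,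
    trans (vsum₃ x a b) (trans e (sym (vsum₂ c d))))
  sum-free minus A (_ , free) x a b c d hx ha hb hc hd e = free (a ∷ b ∷ c ∷ d ∷ [] , x ∷ [] , ha ∷ hb ∷ hc ∷ hd ∷ [] , hx ∷ [] ,
    trans (vsum₄ a b c d) (trans (trans (solve 4 (λ a b c d → a ⊹ (b ⊹ (c ⊹ d)) := a ⊹ b ⊹ (c ⊹ d)) refl a b c d)
      (trans (cong (a ⊞ b ⊞_) (sym e)) (solve 3 (λ x a b → a ⊹ b ⊹ (x ⊹ ⊖ (a ⊹ b)) := x) refl x a b))) (sym (vsum₁ x))))

  sum-free-outcome : MBoundT m → ∀ σ {d} (A : V (suc d) → Bool) → SumFree p (kᵒ σ) (ℓᵒ σ) A → m ℕ.* p ℕ.^ d ℕ.≤ card p A → Outcome σ A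
  sum-free-outcome bound σ {d} A free big = outcome σ A (sum-free σ A free) (subst (m ℕ.* p ℕ.^ d ℕ.≤_) (card≡∣∣ A) big) (proj₁ free) bound

-- The theorem for both pairs (k, ℓ).

open import Defs
open import Data.Nat using (ℕ; suc; _+_; _*_; _^_; _≤_)
open import Data.Nat.Primality using (Prime)
open import Data.Product using (_×_; _,_)
open import Data.Sum using (_⊎_; inj₁; inj₂; [_,_]′)
open import Function using (id)
open import Relation.Nullary using (¬_; contradiction)
open import Relation.Binary.PropositionalEquality using (_≡_; refl)

theorem1p8 : (m : ℕ) → Prime (3 + 5 * m) → 21 ≤ m → MBoundT m →
    (k ℓ : ℕ) → ((k ≡ 4) × (ℓ ≡ 1)) ⊎ ((k ≡ 3) × (ℓ ≡ 2)) →
    (d : ℕ) (A : Subset (3 + 5 * m) (suc d)) →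
    SumFree (3 + 5 * m) k ℓ A →
    ¬ Trivial (3 + 5 * m) k ℓ m A →
    m * (3 + 5 * m) ^ d ≤ card (3 + 5 * m) A →
    Normal (3 + 5 * m) k ℓ m A ⊎ Type3 (3 + 5 * m) k ℓ m A ⊎ Type4 (3 + 5 * m) m A
theorem1p8 m p-prime 21≤m bound k ℓ cases d A free nontrivial big = by cases free nontrivial
  where
  open Assembly (3 + 5 * m) p-prime m refl 21≤m using (sum-free-outcome)
  open SumFreeLine (3 + 5 * m) p-prime using (plus; minus)
  Conclusion : ℕ → ℕ → Set
  Conclusion k ℓ = Normal (3 + 5 * m) k ℓ m A ⊎ Type3 (3 + 5 * m) k ℓ m A ⊎ Type4 (3 + 5 * m) m A
  by : ∀ {k ℓ} → ((k ≡ 4) × (ℓ ≡ 1)) ⊎ ((k ≡ 3) × (ℓ ≡ 2)) → SumFree (3 + 5 * m) k ℓ A → ¬ Trivial (3 + 5 * m) k ℓ m A → Conclusion k ℓ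
  by (inj₁ (refl , refl)) free nontrivial = [ (λ trivial → contradiction trivial nontrivial) , id ]′ (sum-free-outcome bound minus A free big)
  by (inj₂ (refl , refl)) free nontrivial = [ (λ trivial → contradiction trivial nontrivial) , id ]′ (sum-free-outcome bound plus A free big)
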